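{- Let $\overline{N}(s,m,n)$ denote the number of overpartitions of $n$ whose rank is congruent to $s$ modulo $m$ (with the convention that $\overline{N}(s,m,0)=0$ for all $s,m$), and for $\ell=3$ set $$R_{st}(d)=\sum_{n\ge 0}\left(\overline{N}(s,3,3n+d)-\overline{N}(t,3,3n+d)\right)q^n.$$ Then, as formal power series in $q$ (equivalently, as analytic functions for $|q|<1$), $$R_{01}(0)=-1+\frac{(q^3;q^3)_\infty^2(-q;q)_\infty}{(q;q)_\infty(-q^3;q^3)_\infty^2},$$ $$R_{01}(1)=\frac{2(q^3;q^3)_\infty(q^6;q^6)_\infty}{(q;q)_\infty},$$ $$R_{01}(2)=\frac{4(-q^3;q^3)_\infty^2(q^6;q^6)_\infty^2}{(q^2;q^2)_\infty}-\frac{6(-q^3;q^3)_\infty}{(q^3;q^3)_\infty}\sum_{n\in\mathbb{Z}}\frac{(-1)^nq^{3n^2+3n}}{1-q^{3n+1}}.$$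
   Context: An overpartition of $n$ is a partition of $n$ in which the first occurrence of each distinct part may be overlined. The rank of an overpartition is its largest part minus its number of parts. $\overline{N}(s,m,n)$ is the number of overpartitions of $n$ with rank congruent to $s$ modulo $m$; the empty overpartition of $0$ is not counted, i.e. $\overline{N}(s,m,0)=0$. Notation: $(a_1,\dots,a_j;q)_\infty=\prod_{k\ge0}(1-a_1q^k)\cdots(1-a_jq^k)$. -}

module Defs where

open import Data.Nat as ℕ using (ℕ; zero; suc; _≡ᵇ_; _≤ᵇ_; _⊔_)
open import Data.Nat.Divisibility using (_∣?_)
open import Data.Integer as ℤ using (ℤ; +_; -[1+_]; ∣_∣)
open import Data.Bool using (Bool; true; false; _∧_; _∨_; not; if_then_else_)
open import Data.Product using (_×_; _,_; proj₁)
open import Data.List using (List; []; _∷_; length; map; concatMap; upTo; filterᵇ; foldr)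
open import Data.Nat.ListAction using (sum)
open import Relation.Nullary using (does)

-- An overpartition is represented canonically as a list of
-- (part , overlined?) pairs, listed in non-increasing order of parts,
-- where among equal parts only the first one may be overlined.

OverPart : Set
OverPart = List (ℕ × Bool)

partsSum : OverPart → ℕ
partsSum λ' = sum (map proj₁ λ')

allPositive : OverPart → Bool
allPositive [] = true
allPositive ((p , _) ∷ xs) = (1 ≤ᵇ p) ∧ allPositive xs

canonical : OverPart → Bool
canonical [] = true
canonical (x ∷ []) = true
canonical ((p , b) ∷ (p' , b') ∷ xs) =
  (p' ≤ᵇ p) ∧ (not (p' ≡ᵇ p) ∨ not b') ∧ canonical ((p' , b') ∷ xs)

isOverpartitionOf : ℕ → OverPart → Bool
isOverpartitionOf n λ' = (partsSum λ' ≡ᵇ n) ∧ allPositive λ' ∧ canonical λ'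

allLists : {A : Set} → List A → ℕ → List (List A)
allLists A zero = [] ∷ []
allLists A (suc k) = [] ∷ concatMap (λ x → map (x ∷_) (allLists A k)) A

alphabet : ℕ → List (ℕ × Bool)
alphabet n = concatMap (λ p → (suc p , true) ∷ (suc p , false) ∷ []) (upTo n)

-- every overpartition of n has ≤ n parts, each in 1..n
candidates : ℕ → List OverPart
candidates n = allLists (alphabet n) n

largestPart : OverPart → ℕ
largestPart λ' = foldr _⊔_ 0 (map proj₁ λ')

numParts : OverPart → ℕ
numParts = length

rank : OverPart → ℤ
rank λ' = + largestPart λ' ℤ.- + numParts λ'

congMod : ℤ → ℤ → ℕ → Bool
congMod x s m = does (m ∣? ∣ x ℤ.- s ∣)

Nbar : ℤ → ℕ → ℕ → ℕ
Nbar s m zero = 0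
Nbar s m (suc n) =
  length (filterᵇ (λ λ' → isOverpartitionOf (suc n) λ' ∧ congMod (rank λ') s m)
                  (candidates (suc n)))

PS : Set
PS = ℕ → ℤ

Σ< : ℕ → (ℕ → ℤ) → ℤ
Σ< zero f = + 0
Σ< (suc n) f = Σ< n f ℤ.+ f n

constPS : ℤ → PS
constPS c zero = c
constPS c (suc n) = + 0

onePS : PS
onePS = constPS (+ 1)

mono : ℤ → ℕ → PS
mono c e n = if n ≡ᵇ e then c else + 0

_⊕_ : PS → PS → PS
(f ⊕ g) n = f n ℤ.+ g n

_⊖_ : PS → PS → PS
(f ⊖ g) n = f n ℤ.- g n

_·_ : ℤ → PS → PS
(c · f) n = c ℤ.* f n

infixl 6 _⊕_ _⊖_
infixl 7 _⊗_ _÷_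
infixr 8 _·_

_⊗_ : PS → PS → PS
(f ⊗ g) n = Σ< (suc n) (λ i → f i ℤ.* g (n ℕ.∸ i))

-- multiplicative inverse of a series with constant term 1:
-- c₀ = 1, c_{n+1} = - Σ_{i=1}^{n+1} f i · c_{n+1-i}.
-- revCoeffs f n = [c_n , c_{n-1} , … , c_0]
private
  dotFrom : PS → ℕ → List ℤ → ℤ
  dotFrom f i [] = + 0
  dotFrom f i (x ∷ xs) = f i ℤ.* x ℤ.+ dotFrom f (suc i) xs

  revCoeffs : PS → ℕ → List ℤ
  revCoeffs f zero = + 1 ∷ []
  revCoeffs f (suc n) = ℤ.- dotFrom f 1 (revCoeffs f n) ∷ revCoeffs f n

  headOr0 : List ℤ → ℤ
  headOr0 [] = + 0
  headOr0 (x ∷ _) = x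

invPS : PS → PS
invPS f n = headOr0 (revCoeffs f n)

-- f / g  (used only for g with constant term 1)
_÷_ : PS → PS → PS
f ÷ g = f ⊗ invPS g

prodUpTo : ℕ → (ℕ → PS) → PS
prodUpTo zero F = onePS
prodUpTo (suc k) F = prodUpTo k F ⊗ F k

-- infinite product Π_{k≥0} F k, valid when F k ≡ 1 mod q^{k+1}:
-- coefficient of q^n is that of the finite product of F 0 … F n.
infProd : (ℕ → PS) → PS
infProd F n = prodUpTo (suc n) F n

-- (c q^a ; q^b)_∞ = Π_{k≥0} (1 - c q^{a+bk}),   used with a , b ≥ 1
poch : ℤ → ℕ → ℕ → PS
poch c a b = infProd (λ k → onePS ⊖ mono c (a ℕ.+ b ℕ.* k))

-- The bilateral sum  Σ_{n∈ℤ} (-1)^n q^{3n²+3n} / (1 - q^{3n+1})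
-- Expansion for |q|<1 : for e = 3n+1 > 0, 1/(1-q^e) = Σ_{k≥0} q^{ek};
-- for e < 0, 1/(1-q^e) = -q^{-e}/(1-q^{-e}) = - Σ_{k≥1} q^{-ek}.
-- Coefficient of q^N in the n-th term:

signZ : ℤ → ℤ
signZ n = if does (2 ∣? ∣ n ∣) then + 1 else ℤ.- + 1

bilatTermCoeff : ℤ → ℕ → ℤ
bilatTermCoeff n N with (ℤ.+ 3 ℤ.* n ℤ.* n ℤ.+ ℤ.+ 3 ℤ.* n) | (ℤ.+ 3 ℤ.* n ℤ.+ ℤ.+ 1)
... | A | e with (+ N) ℤ.- A
...   | d with e
...     | + (suc e') with d
...       | + d' = if does (suc e' ∣? d') then signZ n else + 0
...       | -[1+ _ ] = + 0
bilatTermCoeff n N | A | e | d | -[1+ e' ] with d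
...       | + (suc d') = if does (suc e' ∣? suc d') then ℤ.- signZ n else + 0
...       | + zero = + 0
...       | -[1+ _ ] = + 0
bilatTermCoeff n N | A | e | d | + zero = + 0   -- never occurs (3n+1 ≠ 0)

-- Only n ∈ [-(N+1), N] contribute to the coefficient of q^N
-- (the n-th term has order 3n²+3n for n ≥ 0 and 3n²-1 for n < 0).
bilatSum : PS
bilatSum N = Σ< (suc N) (λ i → bilatTermCoeff (+ i) N)
           ℤ.+ Σ< (suc N) (λ j → bilatTermCoeff (-[1+ j ]) N)

R : ℤ → ℤ → ℕ → PS
R s t d n = + Nbar s 3 (3 ℕ.* n ℕ.+ d) ℤ.- + Nbar t 3 (3 ℕ.* n ℕ.+ d)

-- Let F(x) = 1 + Σ (N̄(0,3,n) − N̄(1,3,n)) xⁿ, the rank generating function of overpartitions at a primitive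
-- cube root of unity, and θ(x) = Σ (−1)^k x^{k²}.  A Rogers–Fine iteration, partial fractions and a Durfee
-- dissection give θ F = T with T = 1 + 6 Σ_{n≥1} (−1)ⁿ x^{n²+n} / (1 + xⁿ + x²ⁿ).
-- Put y = x³.  Then θ(x) = A(y) − 2x B(y) with A(y) = θ(y³) and B(y) = Σ (−1)^m y^{3m²+2m}, and comparing
-- exponents modulo 3 in θ F = T yields a linear system for the sections F₀, F₁, F₂ of F:
--   A F₀ − 2y B F₂ = T₀,   A F₁ − 2 B F₀ = 0,   A F₂ − 2 B F₁ = T₂.
-- It is solved by two identities: A (A³ − 8y B³) = θ(y)⁴, the product of θ over the cube roots of unity times x,
-- and A T₀ + 2y B T₂ = θ(y)³, so that θ F₀ = A², θ F₁ = 2AB and A F₂ = 2B F₁ + T₂.  Gauss' and Jacobi's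
-- product formulas for θ and B then give the theorem, T₂ being −6 times the bilateral sum.
-- The second identity counts representations 3M = k² + 2ab with characters modulo 3 in two ways (splitting the
-- sum over k at b − a, in the style of Liouville), and representations of M by three squares, arranged by
-- x + y + z, through the number of representations by the hexagonal form; that number and the divisor sum
-- which it equals satisfy the same recursion, because Σ (xy + yz + zx) = 0 over x² + y² + z² = M.
module Submission where

open import Defs hiding (R)
open import Level using (0ℓ)
open import Algebra using (CommutativeRing)
import Algebra.Solver.Ring
open import Algebra.Solver.Ring.AlmostCommutativeRing using (fromCommutativeRing; _-Raw-AlmostCommutative⟶_)
import Algebra.Properties.Semiring.Mult.TCOptimised
import Algebra.Properties.Semiring.Exp
import Algebra.Properties.CommutativeSemiring.Exp
import Algebra.Properties.Ring
import Algebra.Properties.AbelianGroup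
import Relation.Binary.Reasoning.Setoid
open import Data.Bool as Bool using (Bool; true; false; _∧_; _∨_; not; _xor_; if_then_else_)
import Data.Bool.Properties as Boolₚ
open import Data.Empty using (⊥-elim)
open import Data.Fin using (Fin)
open import Data.Fin.Patterns
import Data.Fin.Properties as Finₚ
open import Data.List using (List; []; _∷_; _++_; map; concatMap; upTo; applyUpTo; length; filterᵇ)
open import Data.Nat as ℕ using (ℕ; zero; suc; _∸_; z≤n; s≤s; _≡ᵇ_; _≤ᵇ_; _<ᵇ_; _⊔_)
import Data.Nat.Properties as ℕₚ
open import Data.Nat.Divisibility using (_∣?_; _∣_; divides; ∣m+n∣m⇒∣n; ∣m∣n⇒∣m+n; ∣-refl)
open import Data.Nat.Induction using (<-rec)
import Data.Nat.Solver
open import Data.Integer as ℤ using (ℤ; +_; -[1+_]; ∣_∣)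
import Data.Integer.Properties as ℤₚ
import Data.Integer.Divisibility.Signed as ℤ∣
import Data.Integer.Solver
open import Data.Maybe using (Maybe; just; nothing)
open import Data.Product using (_×_; _,_; proj₁; proj₂; ∃)
open import Data.Sum using (_⊎_; inj₁; inj₂)
open import Data.Unit using (⊤; tt)
open import Function using (_∘_; _∘′_)
open import Function.Bundles using (mk⇔)
open import Relation.Nullary using (Dec; yes; no; does; ¬?)
open import Relation.Nullary.Decidable using (from-yes; _→-dec_; does-⇔; dec-true; dec-false)
open import Relation.Binary.Definitions using (tri<; tri≈; tri>)
open import Relation.Binary.PropositionalEquality as ≡ using (_≡_; _≢_)
open Data.Nat.Solver.+-*-Solver using () renaming (solve to ℕsolve; _:+_ to _⊞_; _:*_ to _⊠_; _:=_ to _≔_; con to κ)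
open Data.Integer.Solver.+-*-Solver using () renaming (solve to ℤsolve; _:+_ to _⊞ᶻ_; _:*_ to _⊠ᶻ_; _:-_ to _⊟ᶻ_; :-_ to ⊟ᶻ_; _:=_ to _≔ᶻ_; con to κᶻ)

-- No limits are taken: the q-series identities are proved in an arbitrary commutative ring whose
-- element q is nilpotent, where all sums and products are finite and 1 - c q^(i+1) is invertible.
-- One lemma then serves q, ωq, ω²q, q³ and q⁹, with or without ω adjoined, and an identity of power
-- series follows from its truncations at every order. The identity A T₀ + 2yB T₂ = θ(y)³ is not a
-- matter of product formulas. Its left side is the section of exponents divisible by 3 of θ̃ T,
-- where θ̃ = A(y) + 2xB(y) is θ with the terms 3 ∤ k negated; this is the origin of the character
-- ε. Apart from k² = 3M, its coefficient at y^M is a sum over k² + nv = 3M with sign (-1)ⁿ and n <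
-- v. A symmetric combination of parities, summed against an antisymmetric function of n and v,
-- trades these constraints for sums over k² + 2ab = 3M carrying a single character ψ. The same
-- splitting of those sums is run with two weights: 1 relates the two kinds of sums, and (k - b)(k +
-- a) yields the recursion that identifies the divisor sum with the hexagonal count.

module RingKit (R : CommutativeRing 0ℓ 0ℓ) where
  open CommutativeRing R public
  open Algebra.Properties.Ring ring public
    using (-‿distribˡ-*; -‿distribʳ-*; -1*x≈-x; -0#≈0#)
  open Algebra.Properties.AbelianGroup +-abelianGroup public
    using () renaming (⁻¹-involutive to -‿involutive; ⁻¹-∙-comm to -‿+-comm)
  open Algebra.Properties.Semiring.Exp semiring public
    using (_^_; ^-congˡ; ^-homo-*; ^-assocʳ)
  open Algebra.Properties.CommutativeSemiring.Exp commutativeSemiring public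
    using (^-distrib-*)
  open Relation.Binary.Reasoning.Setoid setoid public
  private
    open module Mult = Algebra.Properties.Semiring.Mult.TCOptimised semiring
      using () renaming (_×_ to _ℕ×_)

  -- Integers as coefficients of the ring solver: its normal forms then cancel signs and constants
  -- in any commutative ring.
  fromℤ : ℤ → Carrier
  fromℤ (+ n) = n ℕ× 1#
  fromℤ -[1+ n ] = - (suc n ℕ× 1#)

  private
    cancel : ∀ x y z → (x + y) - (x + z) ≈ y - z
    cancel x y z = begin
      (x + y) - (x + z)       ≈⟨ +-congˡ (-‿+-comm x z) ⟨
      (x + y) + (- x + - z)   ≈⟨ +-assoc _ _ _ ⟩
      x + (y + (- x + - z))   ≈⟨ +-congˡ (trans (sym (+-assoc _ _ _)) (trans (+-congʳ (+-comm _ _)) (+-assoc _ _ _))) ⟩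
      x + (- x + (y + - z))   ≈⟨ +-assoc _ _ _ ⟨
      (x + - x) + (y + - z)   ≈⟨ +-congʳ (-‿inverseʳ x) ⟩
      0# + (y + - z)          ≈⟨ +-identityˡ _ ⟩
      y - z                   ∎

    ⊖-homo : ∀ m n → fromℤ (m ℤ.⊖ n) ≈ (m ℕ× 1#) - (n ℕ× 1#)
    ⊖-homo m zero = sym (trans (+-congˡ -0#≈0#) (+-identityʳ _))
    ⊖-homo zero (suc n) = sym (+-identityˡ _)
    ⊖-homo (suc m) (suc n) = begin
      fromℤ (suc m ℤ.⊖ suc n)               ≡⟨ ≡.cong fromℤ (ℤₚ.[1+m]⊖[1+n]≡m⊖n m n) ⟩
      fromℤ (m ℤ.⊖ n)                       ≈⟨ ⊖-homo m n ⟩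
      (m ℕ× 1#) - (n ℕ× 1#)                 ≈⟨ cancel 1# _ _ ⟨
      (1# + m ℕ× 1#) - (1# + n ℕ× 1#)       ≈⟨ +-cong (Mult.1+× m 1#) (-‿cong (Mult.1+× n 1#)) ⟨
      (suc m ℕ× 1#) - (suc n ℕ× 1#)         ∎

    +-hom : ∀ x y → fromℤ (x ℤ.+ y) ≈ fromℤ x + fromℤ y
    +-hom (+ m) (+ n) = Mult.×-homo-+ 1# m n
    +-hom (+ m) -[1+ n ] = ⊖-homo m (suc n)
    +-hom -[1+ m ] (+ n) = trans (⊖-homo n (suc m)) (+-comm _ _)
    +-hom -[1+ m ] -[1+ n ] = begin
      - (suc (suc (m ℕ.+ n)) ℕ× 1#)           ≡⟨ ≡.cong (λ k → - (k ℕ× 1#)) (≡.sym (ℕₚ.+-suc (suc m) n)) ⟩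
      - ((suc m ℕ.+ suc n) ℕ× 1#)             ≈⟨ -‿cong (Mult.×-homo-+ 1# (suc m) (suc n)) ⟩
      - (suc m ℕ× 1# + suc n ℕ× 1#)           ≈⟨ -‿+-comm _ _ ⟨
      - (suc m ℕ× 1#) + - (suc n ℕ× 1#)       ∎

    -hom : ∀ x → fromℤ (ℤ.- x) ≈ - fromℤ x
    -hom (+ zero) = sym -0#≈0#
    -hom (+ suc n) = refl
    -hom -[1+ n ] = sym (-‿involutive _)

    *-hom⁺ : ∀ m n → fromℤ (+ m ℤ.* + n) ≈ fromℤ (+ m) * fromℤ (+ n)
    *-hom⁺ m n = trans (reflexive (≡.cong fromℤ (≡.sym (ℤₚ.pos-* m n)))) (Mult.×1-homo-* m n)

    *-hom : ∀ x y → fromℤ (x ℤ.* y) ≈ fromℤ x * fromℤ y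
    *-hom (+ m) (+ n) = *-hom⁺ m n
    *-hom (+ m) -[1+ n ] = begin
      fromℤ (+ m ℤ.* -[1+ n ])            ≡⟨ ≡.cong fromℤ (≡.sym (ℤₚ.neg-distribʳ-* (+ m) (+ suc n))) ⟩
      fromℤ (ℤ.- (+ m ℤ.* + suc n))       ≈⟨ -hom (+ m ℤ.* + suc n) ⟩
      - fromℤ (+ m ℤ.* + suc n)           ≈⟨ -‿cong (*-hom⁺ m (suc n)) ⟩
      - (fromℤ (+ m) * fromℤ (+ suc n))   ≈⟨ -‿distribʳ-* _ _ ⟩
      fromℤ (+ m) * fromℤ -[1+ n ]        ∎
    *-hom -[1+ m ] (+ n) = begin
      fromℤ (-[1+ m ] ℤ.* + n)            ≡⟨ ≡.cong fromℤ (≡.sym (ℤₚ.neg-distribˡ-* (+ suc m) (+ n))) ⟩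
      fromℤ (ℤ.- (+ suc m ℤ.* + n))       ≈⟨ -hom (+ suc m ℤ.* + n) ⟩
      - fromℤ (+ suc m ℤ.* + n)           ≈⟨ -‿cong (*-hom⁺ (suc m) n) ⟩
      - (fromℤ (+ suc m) * fromℤ (+ n))   ≈⟨ -‿distribˡ-* _ _ ⟩
      fromℤ -[1+ m ] * fromℤ (+ n)        ∎
    *-hom -[1+ m ] -[1+ n ] = begin
      fromℤ (+ suc m ℤ.* + suc n)                ≈⟨ *-hom⁺ (suc m) (suc n) ⟩
      fromℤ (+ suc m) * fromℤ (+ suc n)          ≈⟨ -‿involutive _ ⟨
      - - (fromℤ (+ suc m) * fromℤ (+ suc n))    ≈⟨ -‿cong (-‿distribˡ-* _ _) ⟩
      - (- fromℤ (+ suc m) * fromℤ (+ suc n))    ≈⟨ -‿distribʳ-* _ _ ⟩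
      fromℤ -[1+ m ] * fromℤ -[1+ n ]            ∎

    morphism : CommutativeRing.rawRing ℤₚ.+-*-commutativeRing -Raw-AlmostCommutative⟶ fromCommutativeRing R
    morphism = record
      { ⟦_⟧ = fromℤ ; +-homo = +-hom ; *-homo = *-hom ; -‿homo = -hom
      ; 0-homo = refl ; 1-homo = refl }

    dec : ∀ x y → Maybe (fromℤ x ≈ fromℤ y)
    dec x y with x ℤₚ.≟ y
    ... | yes ≡.refl = just refl
    ... | no _ = nothing

  open Algebra.Solver.Ring (CommutativeRing.rawRing ℤₚ.+-*-commutativeRing) (fromCommutativeRing R) morphism dec public
    using (solve; _:=_; _:+_; _:*_; _:-_; :-_; con; Polynomial)

  :1 :2 : ∀ {n} → Polynomial n
  :1 = con (+ 1)
  :2 = con (+ 2)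

  -- Finite sums and products, and cancellation of units.

  ∑ : ℕ → (ℕ → Carrier) → Carrier
  ∑ zero f = 0#
  ∑ (suc n) f = ∑ n f + f n

  ∏ : ℕ → (ℕ → Carrier) → Carrier
  ∏ zero f = 1#
  ∏ (suc n) f = ∏ n f * f n

  ∑-cong< : ∀ n {f g} → (∀ i → i ℕ.< n → f i ≈ g i) → ∑ n f ≈ ∑ n g
  ∑-cong< zero h = refl
  ∑-cong< (suc n) h = +-cong (∑-cong< n (λ i p → h i (ℕₚ.m<n⇒m<1+n p))) (h n ℕₚ.≤-refl)

  ∑-cong : ∀ n {f g} → (∀ i → f i ≈ g i) → ∑ n f ≈ ∑ n g
  ∑-cong n h = ∑-cong< n (λ i _ → h i)

  ∑-zero< : ∀ n {f} → (∀ i → i ℕ.< n → f i ≈ 0#) → ∑ n f ≈ 0#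
  ∑-zero< zero h = refl
  ∑-zero< (suc n) h = trans (+-cong (∑-zero< n (λ i p → h i (ℕₚ.m<n⇒m<1+n p))) (h n ℕₚ.≤-refl)) (+-identityʳ 0#)

  ∑-+ : ∀ n f g → ∑ n (λ i → f i + g i) ≈ ∑ n f + ∑ n g
  ∑-+ zero f g = sym (+-identityʳ 0#)
  ∑-+ (suc n) f g = trans (+-congʳ (∑-+ n f g))
    (solve 4 (λ a b x y → ((a :+ b) :+ (x :+ y)) := ((a :+ x) :+ (b :+ y))) refl _ _ _ _)

  ∑-*ˡ : ∀ n c f → ∑ n (λ i → c * f i) ≈ c * ∑ n f
  ∑-*ˡ zero c f = sym (zeroʳ c)
  ∑-*ˡ (suc n) c f = trans (+-congʳ (∑-*ˡ n c f)) (sym (distribˡ c _ _))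

  ∑-*ʳ : ∀ n c f → ∑ n (λ i → f i * c) ≈ ∑ n f * c
  ∑-*ʳ n c f = trans (∑-cong n (λ i → *-comm _ _)) (trans (∑-*ˡ n c f) (*-comm _ _))

  ∑-neg : ∀ n f → ∑ n (λ i → - f i) ≈ - ∑ n f
  ∑-neg zero f = sym -0#≈0#
  ∑-neg (suc n) f = trans (+-congʳ (∑-neg n f)) (-‿+-comm _ _)

  ∑-head : ∀ n f → ∑ (suc n) f ≈ f 0 + ∑ n (f ∘ suc)
  ∑-head zero f = +-comm _ _
  ∑-head (suc n) f = trans (+-congʳ (∑-head n f)) (+-assoc _ _ _)

  ∑-split : ∀ m n f → ∑ (m ℕ.+ n) f ≈ ∑ m f + ∑ n (λ i → f (m ℕ.+ i))
  ∑-split zero n f = sym (+-identityˡ _)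
  ∑-split (suc m) n f = begin
    ∑ (suc (m ℕ.+ n)) f                                          ≈⟨ ∑-head (m ℕ.+ n) f ⟩
    f 0 + ∑ (m ℕ.+ n) (f ∘ suc)                                  ≈⟨ +-congˡ (∑-split m n (f ∘ suc)) ⟩
    f 0 + (∑ m (f ∘ suc) + ∑ n (λ i → f (suc (m ℕ.+ i))))        ≈⟨ +-assoc _ _ _ ⟨
    (f 0 + ∑ m (f ∘ suc)) + ∑ n (λ i → f (suc (m ℕ.+ i)))        ≈⟨ +-congʳ (∑-head m f) ⟨
    ∑ (suc m) f + ∑ n (λ i → f (suc (m ℕ.+ i)))                  ∎

  ∑-swap : ∀ m n (f : ℕ → ℕ → Carrier) → ∑ m (λ i → ∑ n (f i)) ≈ ∑ n (λ j → ∑ m (λ i → f i j))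
  ∑-swap zero n f = sym (∑-zero< n (λ _ _ → refl))
  ∑-swap (suc m) n f = trans (+-congʳ (∑-swap m n f)) (sym (∑-+ n _ _))

  ∑-rev : ∀ n f → ∑ (suc n) f ≈ ∑ (suc n) (λ i → f (n ∸ i))
  ∑-rev zero f = refl
  ∑-rev (suc n) f = begin
    ∑ (suc n) f + f (suc n)                        ≈⟨ +-comm _ _ ⟩
    f (suc n) + ∑ (suc n) f                        ≈⟨ +-congˡ (∑-rev n f) ⟩
    f (suc n) + ∑ (suc n) (λ i → f (n ∸ i))        ≈⟨ ∑-head (suc n) (λ i → f (suc n ∸ i)) ⟨
    ∑ (suc (suc n)) (λ i → f (suc n ∸ i))          ∎

  -- Σ_{n<K} Σ_{r≤n} f n r, summed along the diagonals n = r + b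
  ∑-triangle : ∀ K (f : ℕ → ℕ → Carrier) → ∑ K (λ n → ∑ (suc n) (f n)) ≈ ∑ K (λ r → ∑ (K ∸ r) (λ b → f (r ℕ.+ b) r))
  ∑-triangle zero f = refl
  ∑-triangle (suc K) f = begin
    ∑ K (λ n → ∑ (suc n) (f n)) + ∑ (suc K) (f K)
      ≈⟨ +-congʳ (∑-triangle K f) ⟩
    ∑ K (λ r → ∑ (K ∸ r) (λ b → f (r ℕ.+ b) r)) + (∑ K (f K) + f K K)
      ≈⟨ +-assoc _ _ _ ⟨
    (∑ K (λ r → ∑ (K ∸ r) (λ b → f (r ℕ.+ b) r)) + ∑ K (f K)) + f K K
      ≈⟨ +-cong (sym (∑-+ K _ _)) (last) ⟩
    ∑ K (λ r → ∑ (K ∸ r) (λ b → f (r ℕ.+ b) r) + f K r) + ∑ (suc K ∸ K) (λ b → f (K ℕ.+ b) K)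
      ≈⟨ +-congʳ (∑-cong< K step) ⟩
    ∑ (suc K) (λ r → ∑ (suc K ∸ r) (λ b → f (r ℕ.+ b) r)) ∎
    where
    last : f K K ≈ ∑ (suc K ∸ K) (λ b → f (K ℕ.+ b) K)
    last rewrite ℕₚ.m+n∸n≡m 1 K = sym (trans (+-identityˡ _) (reflexive (≡.cong (λ z → f z K) (ℕₚ.+-identityʳ K))))
    step : ∀ r → r ℕ.< K → ∑ (K ∸ r) (λ b → f (r ℕ.+ b) r) + f K r ≈ ∑ (suc K ∸ r) (λ b → f (r ℕ.+ b) r)
    step r p rewrite ℕₚ.+-∸-assoc 1 (ℕₚ.<⇒≤ p) =
      +-congˡ (reflexive (≡.cong (λ z → f z r) (≡.sym (ℕₚ.m+[n∸m]≡n (ℕₚ.<⇒≤ p)))))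

  ∏-cong< : ∀ n {f g} → (∀ i → i ℕ.< n → f i ≈ g i) → ∏ n f ≈ ∏ n g
  ∏-cong< zero h = refl
  ∏-cong< (suc n) h = *-cong (∏-cong< n (λ i p → h i (ℕₚ.m<n⇒m<1+n p))) (h n ℕₚ.≤-refl)

  ∏-cong : ∀ n {f g} → (∀ i → f i ≈ g i) → ∏ n f ≈ ∏ n g
  ∏-cong n h = ∏-cong< n (λ i _ → h i)

  ∏-* : ∀ n f g → ∏ n (λ i → f i * g i) ≈ ∏ n f * ∏ n g
  ∏-* zero f g = sym (*-identityʳ 1#)
  ∏-* (suc n) f g = trans (*-congʳ (∏-* n f g))
    (solve 4 (λ a b x y → ((a :* b) :* (x :* y)) := ((a :* x) :* (b :* y))) refl _ _ _ _)

  ∏-head : ∀ n f → ∏ (suc n) f ≈ f 0 * ∏ n (f ∘ suc)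
  ∏-head zero f = *-comm _ _
  ∏-head (suc n) f = trans (*-congʳ (∏-head n f)) (*-assoc _ _ _)

  ∏-split : ∀ m n f → ∏ (m ℕ.+ n) f ≈ ∏ m f * ∏ n (λ i → f (m ℕ.+ i))
  ∏-split zero n f = sym (*-identityˡ _)
  ∏-split (suc m) n f = begin
    ∏ (suc (m ℕ.+ n)) f                                          ≈⟨ ∏-head (m ℕ.+ n) f ⟩
    f 0 * ∏ (m ℕ.+ n) (f ∘ suc)                                  ≈⟨ *-congˡ (∏-split m n (f ∘ suc)) ⟩
    f 0 * (∏ m (f ∘ suc) * ∏ n (λ i → f (suc (m ℕ.+ i))))        ≈⟨ *-assoc _ _ _ ⟨
    (f 0 * ∏ m (f ∘ suc)) * ∏ n (λ i → f (suc (m ℕ.+ i)))        ≈⟨ *-congʳ (∏-head m f) ⟨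
    ∏ (suc m) f * ∏ n (λ i → f (suc (m ℕ.+ i)))                  ∎

  ∏-one< : ∀ n {f} → (∀ i → i ℕ.< n → f i ≈ 1#) → ∏ n f ≈ 1#
  ∏-one< zero h = refl
  ∏-one< (suc n) h = trans (*-cong (∏-one< n (λ i p → h i (ℕₚ.m<n⇒m<1+n p))) (h n ℕₚ.≤-refl)) (*-identityʳ 1#)

  -- ∏ over 0 … b n − 1 in n blocks of length b
  ∏-blocks : ∀ b n f → ∏ (n ℕ.* b) f ≈ ∏ n (λ i → ∏ b (λ r → f (i ℕ.* b ℕ.+ r)))
  ∏-blocks b zero f = refl
  ∏-blocks b (suc n) f = begin
    ∏ (b ℕ.+ n ℕ.* b) f                                          ≡⟨ ≡.cong (λ z → ∏ z f) (ℕₚ.+-comm b (n ℕ.* b)) ⟩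
    ∏ (n ℕ.* b ℕ.+ b) f                                          ≈⟨ ∏-split (n ℕ.* b) b f ⟩
    ∏ (n ℕ.* b) f * ∏ b (λ r → f (n ℕ.* b ℕ.+ r))                ≈⟨ *-congʳ (∏-blocks b n f) ⟩
    ∏ (suc n) (λ i → ∏ b (λ r → f (i ℕ.* b ℕ.+ r)))              ∎

  Unit : Carrier → Set
  Unit x = ∃ λ y → x * y ≈ 1#

  Unit-* : ∀ {x y} → Unit x → Unit y → Unit (x * y)
  Unit-* {x} {y} (a , p) (b , r) = a * b , (begin
    (x * y) * (a * b)   ≈⟨ solve 4 (λ x y a b → (x :* y) :* (a :* b) := (x :* a) :* (y :* b)) refl x y a b ⟩
    (x * a) * (y * b)   ≈⟨ *-cong p r ⟩
    1# * 1#             ≈⟨ *-identityʳ 1# ⟩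
    1#                  ∎)

  Unit-∏ : ∀ n {f} → (∀ i → Unit (f i)) → Unit (∏ n f)
  Unit-∏ zero h = 1# , *-identityʳ 1#
  Unit-∏ (suc n) h = Unit-* (Unit-∏ n h) (h n)

  -- The rings used below have nilpotents, so identities with denominators are proved by multiplying
  -- through by a unit and cancelling it.
  Unit-cancelˡ : ∀ {x y z} → Unit x → x * y ≈ x * z → y ≈ z
  Unit-cancelˡ {x} {y} {z} (a , p) e = begin
    y              ≈⟨ *-identityˡ y ⟨
    1# * y         ≈⟨ *-congʳ p ⟨
    (x * a) * y    ≈⟨ solve 3 (λ x a y → (x :* a) :* y := a :* (x :* y)) refl x a y ⟩
    a * (x * y)    ≈⟨ *-congˡ e ⟩
    a * (x * z)    ≈⟨ solve 3 (λ x a y → (x :* a) :* y := a :* (x :* y)) refl x a z ⟨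
    (x * a) * z    ≈⟨ *-congʳ p ⟩
    1# * z         ≈⟨ *-identityˡ z ⟩
    z              ∎

-- Overpartition q-series in a ring where q is nilpotent.

module Nilpotent (R : CommutativeRing 0ℓ 0ℓ) (q : CommutativeRing.Carrier R) (k : ℕ)
  (q-nil : CommutativeRing._≈_ R (RingKit._^_ R q (suc k)) (CommutativeRing.0# R)) where
  open RingKit R public

  K : ℕ
  K = suc k

  q^≥K : ∀ i → K ℕ.≤ i → q ^ i ≈ 0#
  q^≥K i K≤i = begin
    q ^ i                    ≡⟨ ≡.cong (q ^_) (ℕₚ.m+[n∸m]≡n K≤i) ⟨
    q ^ (K ℕ.+ (i ∸ K))      ≈⟨ ^-homo-* q K (i ∸ K) ⟩
    q ^ K * q ^ (i ∸ K)      ≈⟨ *-congʳ q-nil ⟩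
    0# * q ^ (i ∸ K)         ≈⟨ zeroˡ _ ⟩
    0#                       ∎

  nil : ∀ c i → (c * q ^ suc i) ^ K ≈ 0#
  nil c i = begin
    (c * q ^ suc i) ^ K          ≈⟨ ^-distrib-* c (q ^ suc i) K ⟩
    c ^ K * (q ^ suc i) ^ K      ≈⟨ *-congˡ (^-assocʳ q (suc i) K) ⟩
    c ^ K * q ^ (suc i ℕ.* K)    ≈⟨ *-congˡ (q^≥K _ (ℕₚ.m≤m+n K (i ℕ.* K))) ⟩
    c ^ K * 0#                   ≈⟨ zeroʳ _ ⟩
    0#                           ∎

  geometric : ∀ y n → (1# - y) * ∑ n (y ^_) ≈ 1# - y ^ n
  geometric y zero = solve 1 (λ y → (:1 :- y) :* con (+ 0) := :1 :- :1) refl y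
  geometric y (suc n) = begin
    (1# - y) * (∑ n (y ^_) + y ^ n)              ≈⟨ distribˡ _ _ _ ⟩
    (1# - y) * ∑ n (y ^_) + (1# - y) * y ^ n     ≈⟨ +-congʳ (geometric y n) ⟩
    (1# - y ^ n) + (1# - y) * y ^ n              ≈⟨ solve 2 (λ y p → (:1 :- p) :+ (:1 :- y) :* p := :1 :- y :* p) refl y (y ^ n) ⟩
    1# - y * y ^ n                               ∎

  -- the factors 1 ∓ c q^{i+1} and the inverse of the first one
  d e I : Carrier → ℕ → Carrier
  d c i = 1# - c * q ^ suc i
  e c i = 1# + c * q ^ suc i
  I c i = ∑ K ((c * q ^ suc i) ^_)

  d*I : ∀ c i → d c i * I c i ≈ 1#
  d*I c i = begin
    d c i * I c i                   ≈⟨ geometric (c * q ^ suc i) K ⟩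
    1# - (c * q ^ suc i) ^ K        ≈⟨ +-congˡ (-‿cong (nil c i)) ⟩
    1# - 0#                         ≈⟨ solve 0 (:1 :- con (+ 0) := :1) refl ⟩
    1#                              ∎

  d-unit : ∀ c i → Unit (d c i)
  d-unit c i = I c i , d*I c i

  e-unit : ∀ c i → Unit (e c i)
  e-unit c i = I (- c) i , trans (*-congʳ (solve 2 (λ c x → :1 :+ c :* x := :1 :- (:- c) :* x) refl c (q ^ suc i))) (d*I (- c) i)

  -- Reduction modulo a relation x = 1, applied with x = u ū: the solver proves an identity in which
  -- the multiple of x - 1 is written out, and this removes that multiple.
  kill : ∀ {x} → x ≈ 1# → ∀ y z → y + (x - 1#) * z ≈ y
  kill {x} x≈1 y z = begin
    y + (x - 1#) * z      ≈⟨ +-congˡ (*-congʳ (+-congʳ x≈1)) ⟩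
    y + (1# - 1#) * z     ≈⟨ solve 2 (λ y z → y :+ (:1 :- :1) :* z := y) refl y z ⟩
    y                     ∎

  sgn : ℕ → Carrier
  sgn i = (- 1#) ^ i

  sgn-sq : ∀ i → sgn i * sgn i ≈ 1#
  sgn-sq zero = *-identityʳ 1#
  sgn-sq (suc i) = begin
    sgn (suc i) * sgn (suc i)    ≈⟨ solve 1 (λ s → (:- :1 :* s) :* (:- :1 :* s) := s :* s) refl (sgn i) ⟩
    sgn i * sgn i                ≈⟨ sgn-sq i ⟩
    1#                           ∎

  -- (-1;q)_m / (q;q)_m. By the q-binomial theorem these are the coefficients of G(z) = (-z;q)_∞ /
  -- (z;q)_∞.
  g : ℕ → Carrier
  g m = ∏ m (λ i → (1# + q ^ i) * I 1# i)

  g-rec : ∀ m → (1# - q ^ suc m) * g (suc m) ≈ (1# + q ^ m) * g m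
  g-rec m = begin
    (1# - q ^ suc m) * (g m * ((1# + q ^ m) * I 1# m))
      ≈⟨ solve 4 (λ x g y i → (:1 :- x) :* (g :* (y :* i)) := y :* g :* ((:1 :- :1 :* x) :* i)) refl _ _ _ _ ⟩
    (1# + q ^ m) * g m * (d 1# m * I 1# m)
      ≈⟨ *-congˡ (d*I 1# m) ⟩
    (1# + q ^ m) * g m * 1#
      ≈⟨ *-identityʳ _ ⟩
    (1# + q ^ m) * g m ∎

  -- Σ_{i+j=N} F i j
  conv : ℕ → (ℕ → ℕ → Carrier) → Carrier
  conv N F = ∑ (suc N) (λ i → F i (N ∸ i))

  conv-first : ∀ N F → conv (suc N) F ≈ F 0 (suc N) + conv N (λ i j → F (suc i) j)
  conv-first N F = ∑-head (suc N) (λ i → F i (suc N ∸ i))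

  conv-last : ∀ N F → conv (suc N) F ≈ conv N (λ i j → F i (suc j)) + F (suc N) 0
  conv-last N F = +-cong
    (∑-cong< (suc N) (λ i p → reflexive (≡.cong (F i) (ℕₚ.+-∸-assoc 1 (ℕₚ.≤-pred p)))))
    (reflexive (≡.cong (F (suc N)) (ℕₚ.n∸n≡0 N)))

  conv-cong : ∀ N {F G : ℕ → ℕ → Carrier} → (∀ i j → i ℕ.+ j ≡ N → F i j ≈ G i j) → conv N F ≈ conv N G
  conv-cong N h = ∑-cong< (suc N) (λ i p → h i (N ∸ i) (ℕₚ.m+[n∸m]≡n (ℕₚ.≤-pred p)))

  -- Summed over i + j = N these give the coefficients of zᴺ in G(z)G(-z) and in G(qz)G(-z).
  cF dF : ℕ → ℕ → Carrier
  cF i j = sgn j * (g i * g j)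
  dF i j = sgn j * (q ^ i * g i * g j)

  cN dN : ℕ → Carrier
  cN N = conv N cF
  dN N = conv N dF

  -- (1 − q^{i+j}) = (1 − q^i) + q^i (1 − q^j) lets the recurrence of g act on either factor
  cN-rec : ∀ N → (1# - q ^ suc N) * cN (suc N) ≈ (1# - q ^ N) * cN N
  cN-rec N = begin
    (1# - q ^ suc N) * cN (suc N)
      ≈⟨ ∑-*ˡ (suc (suc N)) _ _ ⟨
    conv (suc N) (λ i j → (1# - q ^ suc N) * (sgn j * (g i * g j)))
      ≈⟨ conv-cong (suc N) (λ i j i+j≡ → trans (*-congʳ (+-congˡ (-‿cong (trans (reflexive (≡.cong (q ^_) (≡.sym i+j≡))) (^-homo-* q i j)))))
           (solve 5 (λ x y s a b → (:1 :- x :* y) :* (s :* (a :* b)) :=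
              s :* (((:1 :- x) :* a) :* b) :+ s :* (x :* a :* ((:1 :- y) :* b))) refl (q ^ i) (q ^ j) (sgn j) (g i) (g j))) ⟩
    conv (suc N) (λ i j → F i j + G i j)
      ≈⟨ ∑-+ (suc (suc N)) _ _ ⟩
    conv (suc N) F + conv (suc N) G
      ≈⟨ +-cong (conv-first N F) (conv-last N G) ⟩
    (F 0 (suc N) + conv N (λ i j → F (suc i) j)) + (conv N (λ i j → G i (suc j)) + G (suc N) 0)
      ≈⟨ +-cong (+-congʳ (solve 3 (λ s a b → s :* (((:1 :- :1) :* a) :* b) := con (+ 0)) refl (sgn (suc N)) (g 0) (g (suc N))))
                (+-congˡ (solve 4 (λ s x a b → s :* (x :* a :* ((:1 :- :1) :* b)) := con (+ 0)) refl (sgn 0) (q ^ suc N) (g (suc N)) (g 0))) ⟩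
    (0# + conv N (λ i j → F (suc i) j)) + (conv N (λ i j → G i (suc j)) + 0#)
      ≈⟨ +-cong (+-identityˡ _) (+-identityʳ _) ⟩
    conv N (λ i j → F (suc i) j) + conv N (λ i j → G i (suc j))
      ≈⟨ ∑-+ (suc N) _ _ ⟨
    conv N (λ i j → F (suc i) j + G i (suc j))
      ≈⟨ conv-cong N (λ i j i+j≡ → begin
           F (suc i) j + G i (suc j)
             ≈⟨ +-cong (*-congˡ (*-congʳ (g-rec i))) (*-congˡ (*-congˡ (g-rec j))) ⟩
           sgn j * (((1# + q ^ i) * g i) * g j) + sgn (suc j) * (q ^ i * g i * ((1# + q ^ j) * g j))
             ≈⟨ solve 5 (λ x y s a b → s :* (((:1 :+ x) :* a) :* b) :+ (:- :1 :* s) :* (x :* a :* ((:1 :+ y) :* b))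
                  := (:1 :- x :* y) :* (s :* (a :* b))) refl (q ^ i) (q ^ j) (sgn j) (g i) (g j) ⟩
           (1# - q ^ i * q ^ j) * (sgn j * (g i * g j))
             ≈⟨ *-congʳ (+-congˡ (-‿cong (trans (sym (^-homo-* q i j)) (reflexive (≡.cong (q ^_) i+j≡))))) ⟩
           (1# - q ^ N) * (sgn j * (g i * g j)) ∎) ⟩
    conv N (λ i j → (1# - q ^ N) * (sgn j * (g i * g j)))
      ≈⟨ ∑-*ˡ (suc N) _ _ ⟩
    (1# - q ^ N) * cN N ∎
    where
    F G : ℕ → ℕ → Carrier
    F i j = sgn j * (((1# - q ^ i) * g i) * g j)
    G i j = sgn j * (q ^ i * g i * ((1# - q ^ j) * g j))

  -- This is G(z)G(-z) = 1. The recurrence preserves (1 - qᴺ) cN N, which starts at 1 - q⁰ = 0.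
  cN-zero : ∀ N → cN (suc N) ≈ 0#
  cN-zero N = Unit-cancelˡ (d-unit 1# N) (begin
    d 1# N * cN (suc N)               ≈⟨ *-congʳ (+-congˡ (-‿cong (*-identityˡ _))) ⟩
    (1# - q ^ suc N) * cN (suc N)     ≈⟨ cN-rec N ⟩
    (1# - q ^ N) * cN N               ≈⟨ vanish N ⟩
    0#                                ≈⟨ zeroʳ _ ⟨
    d 1# N * 0#                       ∎)
    where
    vanish : ∀ N → (1# - q ^ N) * cN N ≈ 0#
    vanish zero = solve 1 (λ x → (:1 :- :1) :* x := con (+ 0)) refl (cN 0)
    vanish (suc N) = trans (cN-rec N) (vanish N)

  -- The functional equation (1 + z)G(qz) = (1 - z)G(z), multiplied by G(-z).
  dN-rec : ∀ N → dN (suc N) + dN N ≈ cN (suc N) - cN N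
  dN-rec N = begin
    dN (suc N) + dN N
      ≈⟨ +-congʳ (conv-first N dF) ⟩
    (sgn (suc N) * (1# * g 0 * g (suc N)) + conv N (λ i j → sgn j * (q ^ suc i * g (suc i) * g j))) + dN N
      ≈⟨ +-assoc _ _ _ ⟩
    sgn (suc N) * (1# * g 0 * g (suc N)) + (conv N (λ i j → sgn j * (q ^ suc i * g (suc i) * g j)) + dN N)
      ≈⟨ +-cong (*-congˡ (*-congʳ (*-identityˡ _))) (sym (∑-+ (suc N) _ _)) ⟩
    c₀ + conv N (λ i j → sgn j * (q ^ suc i * g (suc i) * g j) + sgn j * (q ^ i * g i * g j))
      ≈⟨ +-congˡ (conv-cong N (λ i j _ → begin
           sgn j * (q ^ suc i * g (suc i) * g j) + sgn j * (q ^ i * g i * g j)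
             ≈⟨ solve 6 (λ s x x′ a a′ b → s :* (x′ :* a′ :* b) :+ s :* (x :* a :* b) :=
                  s :* ((a′ :+ ((:1 :+ x) :* a) :- ((:1 :- x′) :* a′) :- a) :* b)) refl (sgn j) (q ^ i) (q ^ suc i) (g i) (g (suc i)) (g j) ⟩
           sgn j * ((g (suc i) + ((1# + q ^ i) * g i) - ((1# - q ^ suc i) * g (suc i)) - g i) * g j)
             ≈⟨ *-congˡ (*-congʳ (+-congʳ (+-congˡ (-‿cong (g-rec i))))) ⟩
           sgn j * ((g (suc i) + ((1# + q ^ i) * g i) - ((1# + q ^ i) * g i) - g i) * g j)
             ≈⟨ solve 5 (λ s x a a′ b → s :* ((a′ :+ x :- x :- a) :* b) := s :* (a′ :* b) :+ :- (s :* (a :* b))) refl (sgn j) ((1# + q ^ i) * g i) (g i) (g (suc i)) (g j) ⟩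
           sgn j * (g (suc i) * g j) - sgn j * (g i * g j) ∎)) ⟩
    c₀ + conv N (λ i j → sgn j * (g (suc i) * g j) - sgn j * (g i * g j))
      ≈⟨ +-congˡ (trans (∑-+ (suc N) _ _) (+-congˡ (∑-neg (suc N) _))) ⟩
    c₀ + (conv N (λ i j → sgn j * (g (suc i) * g j)) - cN N)
      ≈⟨ +-assoc _ _ _ ⟨
    (c₀ + conv N (λ i j → sgn j * (g (suc i) * g j))) - cN N
      ≈⟨ +-congʳ (conv-first N cF) ⟨
    cN (suc N) - cN N ∎
    where c₀ = sgn (suc N) * (g 0 * g (suc N))

  -- The expansion of G(qz)G(-z) = (1 - z)/(1 + z).
  dN-value : ∀ N → dN (suc N) ≈ (1# + 1#) * sgn (suc N)
  dN-value zero = begin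
    dN 1                      ≈⟨ solve 2 (λ x y → x := (x :+ y) :- y) refl (dN 1) (dN 0) ⟩
    (dN 1 + dN 0) - dN 0      ≈⟨ +-congʳ (trans (dN-rec 0) (+-congʳ (cN-zero 0))) ⟩
    (0# - cN 0) - dN 0        ≈⟨ solve 0 ((con (+ 0) :- (con (+ 0) :+ :1 :* (:1 :* :1))) :- (con (+ 0) :+ :1 :* (:1 :* :1 :* :1)) := :2 :* (:- :1 :* :1)) refl ⟩
    (1# + 1#) * sgn 1         ∎
  dN-value (suc N) = begin
    dN (2 ℕ.+ N)                              ≈⟨ solve 2 (λ x y → x := (x :+ y) :- y) refl _ (dN (suc N)) ⟩
    (dN (2 ℕ.+ N) + dN (suc N)) - dN (suc N)  ≈⟨ +-cong (trans (dN-rec (suc N)) (+-cong (cN-zero (suc N)) (-‿cong (cN-zero N)))) (-‿cong (dN-value N)) ⟩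
    (0# - 0#) - (1# + 1#) * sgn (suc N)       ≈⟨ solve 1 (λ s → (con (+ 0) :- con (+ 0)) :- :2 :* s := :2 :* (:- :1 :* s)) refl (sgn (suc N)) ⟩
    (1# + 1#) * sgn (2 ℕ.+ N)                 ∎

  -- the coefficients a n r of the partial fraction expansion (real indices n+1, r+1)
  a : ℕ → ℕ → Carrier
  a n r = sgn r * ((1# - q ^ suc r) * (1# - q ^ suc r)) * (g (n ℕ.+ suc (suc r)) * g (n ∸ r))

  sgn-+ : ∀ m n → sgn (m ℕ.+ n) ≈ sgn m * sgn n
  sgn-+ = ^-homo-* (- 1#)

  sgn-∸ : ∀ {n r} → r ℕ.≤ n → sgn (n ∸ r) ≈ sgn n * sgn r
  sgn-∸ {n} {r} r≤n = begin
    sgn (n ∸ r)                        ≈⟨ *-identityʳ _ ⟨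
    sgn (n ∸ r) * 1#                   ≈⟨ *-congˡ (sgn-sq r) ⟨
    sgn (n ∸ r) * (sgn r * sgn r)      ≈⟨ *-assoc _ _ _ ⟨
    sgn (n ∸ r) * sgn r * sgn r        ≈⟨ *-congʳ (sgn-+ (n ∸ r) r) ⟨
    sgn (n ∸ r ℕ.+ r) * sgn r          ≡⟨ ≡.cong (λ z → sgn z * sgn r) (ℕₚ.m∸n+n≡m r≤n) ⟩
    sgn n * sgn r                      ∎

  -- Pairs i with N - i about the middle of N = 2n + 2; the pair at distance r + 1 from the middle
  -- is n - r and n + r + 2.
  conv-fold : ∀ n F → conv (suc n ℕ.+ suc n) F ≈ F (suc n) (suc n) +
    ∑ (suc n) (λ r → F (n ∸ r) (n ℕ.+ suc (suc r)) + F (n ℕ.+ suc (suc r)) (n ∸ r))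
  conv-fold n F = begin
    ∑ (suc N) f
      ≡⟨ ≡.cong (λ z → ∑ z f) (≡.sym (ℕₚ.+-suc (suc n) (suc n))) ⟩
    ∑ (suc n ℕ.+ suc (suc n)) f
      ≈⟨ ∑-split (suc n) (suc (suc n)) f ⟩
    ∑ (suc n) f + ∑ (suc (suc n)) (λ i → f (suc n ℕ.+ i))
      ≈⟨ +-cong (∑-rev n f) (∑-head (suc n) _) ⟩
    ∑ (suc n) (λ r → f (n ∸ r)) + (f (suc n ℕ.+ 0) + ∑ (suc n) (λ r → f (suc n ℕ.+ suc r)))
      ≈⟨ solve 3 (λ x y z → x :+ (y :+ z) := y :+ (x :+ z)) refl _ _ _ ⟩
    f (suc n ℕ.+ 0) + (∑ (suc n) (λ r → f (n ∸ r)) + ∑ (suc n) (λ r → f (suc n ℕ.+ suc r)))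
      ≈⟨ +-cong (reflexive mid) (trans (sym (∑-+ (suc n) _ _)) (∑-cong< (suc n) (λ r p → reflexive (≡.cong₂ _+_ (lo r (ℕₚ.≤-pred p)) (hi r (ℕₚ.≤-pred p)))))) ⟩
    F (suc n) (suc n) + ∑ (suc n) (λ r → F (n ∸ r) (n ℕ.+ suc (suc r)) + F (n ℕ.+ suc (suc r)) (n ∸ r)) ∎
    where
    N = suc n ℕ.+ suc n
    f : ℕ → Carrier
    f i = F i (N ∸ i)
    mid : f (suc n ℕ.+ 0) ≡ F (suc n) (suc n)
    mid rewrite ℕₚ.+-identityʳ n = ≡.cong (F (suc n)) (ℕₚ.m+n∸m≡n (suc n) (suc n))
    total : ∀ r → r ℕ.≤ n → (n ∸ r) ℕ.+ (n ℕ.+ suc (suc r)) ≡ N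
    total r r≤n = ≡.trans
      (ℕsolve 3 (λ b n r → b ⊞ (n ⊞ (κ 2 ⊞ r)) ≔ κ 1 ⊞ (b ⊞ r) ⊞ (κ 1 ⊞ n)) ≡.refl (n ∸ r) n r)
      (≡.cong (λ z → suc z ℕ.+ suc n) (ℕₚ.m∸n+n≡m r≤n))
    lo : ∀ r → r ℕ.≤ n → f (n ∸ r) ≡ F (n ∸ r) (n ℕ.+ suc (suc r))
    lo r r≤n = ≡.cong (F (n ∸ r)) (≡.trans (≡.cong (_∸ (n ∸ r)) (≡.sym (total r r≤n))) (ℕₚ.m+n∸m≡n (n ∸ r) _))
    hi : ∀ r → r ℕ.≤ n → f (suc n ℕ.+ suc r) ≡ F (n ℕ.+ suc (suc r)) (n ∸ r)
    hi r r≤n = ≡.trans (≡.cong f (≡.sym (ℕₚ.+-suc n (suc r))))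
      (≡.cong (F (n ℕ.+ suc (suc r))) (≡.trans (≡.cong (_∸ (n ℕ.+ suc (suc r))) (≡.sym (total r r≤n))) (ℕₚ.m+n∸n≡m (n ∸ r) (n ℕ.+ suc (suc r)))))

  -- Fold dN - q^(n+1) cN at N = 2n + 2. A pair i, j contributes the factor q^i + q^j - 2q^((i+j)/2)
  -- = q^(n-r)(1 - q^(r+1))², which explains the square in `a`; the middle term cancels, and cN
  -- vanishes, so the value is that of dN.
  a-sum : ∀ n → ∑ (suc n) (λ r → q ^ (n ∸ r) * a n r) ≈ (1# + 1#) * sgn n
  a-sum n = begin
    S                                       ≈⟨ *-identityˡ S ⟨
    1# * S                                  ≈⟨ *-congʳ (sgn-sq n) ⟨
    (sgn n * sgn n) * S                     ≈⟨ *-assoc _ _ _ ⟩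
    sgn n * (sgn n * S)                     ≈⟨ *-congˡ main ⟨
    sgn n * (1# + 1#)                       ≈⟨ *-comm _ _ ⟩
    (1# + 1#) * sgn n                       ∎
    where
    S = ∑ (suc n) (λ r → q ^ (n ∸ r) * a n r)
    N = suc n ℕ.+ suc n
    F : ℕ → ℕ → Carrier
    F i j = dF i j - q ^ suc n * cF i j
    pair : ∀ r → r ℕ.≤ n → F (n ∸ r) (n ℕ.+ suc (suc r)) + F (n ℕ.+ suc (suc r)) (n ∸ r) ≈ sgn n * (q ^ (n ∸ r) * a n r)
    pair r r≤n = begin
      F (n ∸ r) h + F h (n ∸ r)
        ≈⟨ +-cong (+-cong (*-congʳ s₁) (-‿cong (*-cong x₁ (*-congʳ s₁)))) (+-cong (*-cong s₂ (*-congʳ (*-congʳ x₂))) (-‿cong (*-cong x₁ (*-congʳ s₂)))) ⟩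
      (s * (x * g (n ∸ r) * g h) - (x * y) * (s * (g (n ∸ r) * g h))) + (s * (x * y * y * g h * g (n ∸ r)) - (x * y) * (s * (g h * g (n ∸ r))))
        ≈⟨ solve 6 (λ sn sr x y l h → (sn :* sr :* (x :* l :* h) :- (x :* y) :* (sn :* sr :* (l :* h))) :+ (sn :* sr :* (x :* y :* y :* h :* l) :- (x :* y) :* (sn :* sr :* (h :* l)))
             := sn :* (x :* (sr :* ((:1 :- y) :* (:1 :- y)) :* (h :* l)))) refl (sgn n) (sgn r) x y (g (n ∸ r)) (g h) ⟩
      sgn n * (q ^ (n ∸ r) * a n r) ∎
      where
      h = n ℕ.+ suc (suc r)
      s = sgn n * sgn r
      x = q ^ (n ∸ r)
      y = q ^ suc r
      s₁ : sgn h ≈ s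
      s₁ = trans (sgn-+ n (suc (suc r))) (*-congˡ (solve 1 (λ s → :- :1 :* (:- :1 :* s) := s) refl (sgn r)))
      s₂ : sgn (n ∸ r) ≈ s
      s₂ = sgn-∸ r≤n
      x₁ : q ^ suc n ≈ x * y
      x₁ = trans (reflexive (≡.cong (q ^_) (≡.sym (≡.trans (ℕₚ.+-suc (n ∸ r) r) (≡.cong suc (ℕₚ.m∸n+n≡m r≤n)))))) (^-homo-* q (n ∸ r) (suc r))
      x₂ : q ^ h ≈ x * y * y
      x₂ = trans (reflexive (≡.cong (q ^_) (ℕₚ.+-suc n (suc r)))) (trans (^-homo-* q (suc n) (suc r)) (*-congʳ x₁))
    main : 1# + 1# ≈ sgn n * S
    main = begin
      1# + 1#
        ≈⟨ solve 1 (λ x → :2 := :2 :* :1 :- x :* con (+ 0)) refl (q ^ suc n) ⟩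
      (1# + 1#) * 1# - q ^ suc n * 0#
        ≈⟨ +-cong (*-congˡ (trans (sgn-+ (suc n) (suc n)) (sgn-sq (suc n)))) (-‿cong (*-congˡ (cN-zero (n ℕ.+ suc n)))) ⟨
      (1# + 1#) * sgn N - q ^ suc n * cN N
        ≈⟨ +-cong (dN-value (n ℕ.+ suc n)) (trans (∑-neg (suc N) _) (-‿cong (∑-*ˡ (suc N) _ _))) ⟨
      dN N + ∑ (suc N) (λ i → - (q ^ suc n * cF i (N ∸ i)))
        ≈⟨ ∑-+ (suc N) _ _ ⟨
      conv N F
        ≈⟨ conv-fold n F ⟩
      F (suc n) (suc n) + ∑ (suc n) (λ r → F (n ∸ r) (n ℕ.+ suc (suc r)) + F (n ℕ.+ suc (suc r)) (n ∸ r))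
        ≈⟨ +-cong (solve 3 (λ s x g → s :* (x :* g :* g) :- x :* (s :* (g :* g)) := con (+ 0)) refl (sgn (suc n)) (q ^ suc n) (g (suc n)))
                  (∑-cong< (suc n) (λ r p → pair r (ℕₚ.≤-pred p))) ⟩
      0# + ∑ (suc n) (λ r → sgn n * (q ^ (n ∸ r) * a n r))
        ≈⟨ trans (+-identityˡ _) (∑-*ˡ (suc n) _ _) ⟩
      sgn n * S ∎

  -- Summed over b this gives (-1;q)_∞ / (q;q)_∞ for every s: the overpartition analogue of the
  -- Durfee rectangle identity Σ q^(b(b+s)) / ((q)_b (q)_(b+s)) = 1/(q)_∞.
  durfeeTerm : ℕ → ℕ → Carrier
  durfeeTerm s b = q ^ (b ℕ.* (b ℕ.+ s)) * (1# + q ^ (b ℕ.+ (b ℕ.+ s))) * (g b * g (b ℕ.+ s))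

  -- The boundary term is the difference between the partial sums for s and s + 1. It carries
  -- q^(m(m+s)), so it disappears at m = K and the full sum does not depend on s.
  durfee-telescope : ∀ s m → ∑ m (durfeeTerm s) + q ^ (m ℕ.* (m ℕ.+ s)) * (g m * g (m ℕ.+ s)) * (1# - q ^ m)
    ≈ ∑ m (durfeeTerm (suc s))
  durfee-telescope s zero = solve 1 (λ x → con (+ 0) :+ x :* (:1 :- :1) := con (+ 0)) refl _
  durfee-telescope s (suc m) = begin
    (∑ m (durfeeTerm s) + durfeeTerm s m) + q ^ (suc m ℕ.* suc (m ℕ.+ s)) * (g′ * h′) * (1# - q * y)
      ≈⟨ +-cong (+-congˡ (*-congʳ (*-congˡ (+-congˡ (^-homo-* q m (m ℕ.+ s)))))) (*-congʳ (*-congʳ E′)) ⟩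
    (A + E * (1# + y * x) * (g m * h)) + (E * (q * x * y)) * (g′ * h′) * (1# - q * y)
      ≈⟨ solve 8 (λ A E q x y g h gh → (A :+ E :* (:1 :+ y :* x) :* (g :* h)) :+ gh
             := (A :+ E :* (g :* h) :* (:1 :- y)) :+ (E :* y :* g :* ((:1 :+ x) :* h) :+ gh)) refl A E q x y (g m) h _ ⟩
    (A + E * (g m * h) * (1# - y)) + (E * y * g m * ((1# + x) * h) + (E * (q * x * y)) * (g′ * h′) * (1# - q * y))
      ≈⟨ +-cong (durfee-telescope s m) (+-cong (*-congˡ (sym (g-rec (m ℕ.+ s))))
           (solve 6 (λ E q x y g′ h′ → (E :* (q :* x :* y)) :* (g′ :* h′) :* (:1 :- q :* y) := (E :* (q :* x :* y)) :* h′ :* ((:1 :- q :* y) :* g′)) refl E q x y g′ h′)) ⟩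
    B + (E * y * g m * ((1# - q * x) * h′) + (E * (q * x * y)) * h′ * ((1# - q * y) * g′))
      ≈⟨ +-congˡ (+-congˡ (*-congˡ (g-rec m))) ⟩
    B + (E * y * g m * ((1# - q * x) * h′) + (E * (q * x * y)) * h′ * ((1# + y) * g m))
      ≈⟨ solve 7 (λ B E q x y g h′ → B :+ (E :* y :* g :* ((:1 :- q :* x) :* h′) :+ (E :* (q :* x :* y)) :* h′ :* ((:1 :+ y) :* g))
            := B :+ E :* y :* (:1 :+ y :* (q :* x)) :* (g :* h′)) refl B E q x y (g m) h′ ⟩
    B + E * y * (1# + y * (q * x)) * (g m * h′)
      ≈⟨ +-congˡ (*-cong (*-cong E″ (+-congˡ (^-homo-* q m (suc (m ℕ.+ s))))) (*-congˡ refl)) ⟨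
    B + q ^ (m ℕ.* suc (m ℕ.+ s)) * (1# + q ^ (m ℕ.+ suc (m ℕ.+ s))) * (g m * g (suc (m ℕ.+ s)))
      ≡⟨ ≡.cong (λ z → B + q ^ (m ℕ.* z) * (1# + q ^ (m ℕ.+ z)) * (g m * g z)) (≡.sym (ℕₚ.+-suc m s)) ⟩
    B + durfeeTerm (suc s) m ∎
    where
    A = ∑ m (durfeeTerm s)
    B = ∑ m (durfeeTerm (suc s))
    E = q ^ (m ℕ.* (m ℕ.+ s))
    y = q ^ m
    x = q ^ (m ℕ.+ s)
    h = g (m ℕ.+ s)
    g′ = g (suc m)
    h′ = g (suc (m ℕ.+ s))
    E″ : q ^ (m ℕ.* suc (m ℕ.+ s)) ≈ E * y
    E″ = trans (reflexive (≡.cong (q ^_) (≡.trans (ℕₚ.*-suc m (m ℕ.+ s)) (ℕₚ.+-comm m _)))) (^-homo-* q (m ℕ.* (m ℕ.+ s)) m)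
    E′ : q ^ (suc m ℕ.* suc (m ℕ.+ s)) ≈ E * (q * x * y)
    E′ = begin
      q ^ (suc (m ℕ.+ s) ℕ.+ m ℕ.* suc (m ℕ.+ s))    ≈⟨ ^-homo-* q (suc (m ℕ.+ s)) _ ⟩
      q * x * q ^ (m ℕ.* suc (m ℕ.+ s))              ≈⟨ *-congˡ E″ ⟩
      q * x * (E * y)                                ≈⟨ solve 4 (λ q x E y → q :* x :* (E :* y) := E :* (q :* x :* y)) refl q x E y ⟩
      E * (q * x * y)                                ∎

  durfee : ℕ → Carrier
  durfee s = ∑ K (durfeeTerm s)

  durfee-suc : ∀ s → durfee s ≈ durfee (suc s)
  durfee-suc s = begin
    durfee s                                                  ≈⟨ solve 3 (λ x g w → x := x :+ con (+ 0) :* g :* w) refl _ (g K * g (K ℕ.+ s)) (1# - q ^ K) ⟩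
    durfee s + 0# * (g K * g (K ℕ.+ s)) * (1# - q ^ K)        ≈⟨ +-congˡ (*-congʳ (*-congʳ (q^≥K (K ℕ.* (K ℕ.+ s)) (ℕₚ.≤-trans (ℕₚ.≤-reflexive (≡.sym (ℕₚ.*-identityʳ K))) (ℕₚ.*-monoʳ-≤ K (s≤s z≤n)))))) ⟨
    durfee s + q ^ (K ℕ.* (K ℕ.+ s)) * (g K * g (K ℕ.+ s)) * (1# - q ^ K)  ≈⟨ durfee-telescope s K ⟩
    durfee (suc s)                                            ∎

  d≥K : ∀ c i → k ℕ.≤ i → d c i ≈ 1#
  d≥K c i p = begin
    1# - c * q ^ suc i   ≈⟨ +-congˡ (-‿cong (*-congˡ (q^≥K (suc i) (s≤s p)))) ⟩
    1# - c * 0#          ≈⟨ solve 1 (λ c → :1 :- c :* con (+ 0) := :1) refl c ⟩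
    1#                   ∎

  g-stable : ∀ j → g (K ℕ.+ j) ≈ g K
  g-stable zero = reflexive (≡.cong g (ℕₚ.+-identityʳ K))
  g-stable (suc j) = begin
    g (K ℕ.+ suc j)                              ≡⟨ ≡.cong g (ℕₚ.+-suc K j) ⟩
    g (suc (K ℕ.+ j))                            ≈⟨ *-identityˡ _ ⟨
    1# * g (suc (K ℕ.+ j))                       ≈⟨ *-congʳ (trans (sym (+-congˡ (-‿cong (*-identityˡ _)))) (d≥K 1# (K ℕ.+ j) (ℕₚ.≤-trans (ℕₚ.n≤1+n k) (ℕₚ.m≤m+n K j)))) ⟨
    (1# - q ^ suc (K ℕ.+ j)) * g (suc (K ℕ.+ j)) ≈⟨ g-rec (K ℕ.+ j) ⟩
    (1# + q ^ (K ℕ.+ j)) * g (K ℕ.+ j)           ≈⟨ *-cong (trans (+-congˡ (q^≥K _ (ℕₚ.m≤m+n K j))) (+-identityʳ 1#)) (g-stable j) ⟩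
    1# * g K                                     ≈⟨ *-identityˡ _ ⟩
    g K                                          ∎

  -- Raise s by K: every term with b > 0 is then divisible by q^K, and b = 0 leaves g (K + s), which
  -- is g K.
  durfee-value : ∀ s → durfee s ≈ g K
  durfee-value s = trans (climb K) (begin
    durfee (K ℕ.+ s)
      ≈⟨ ∑-head k _ ⟩
    1# * (1# + q ^ (K ℕ.+ s)) * (1# * g (K ℕ.+ s)) + ∑ k (durfeeTerm (K ℕ.+ s) ∘ suc)
      ≈⟨ +-cong (*-cong (*-congˡ (+-congˡ (q^≥K _ (ℕₚ.m≤m+n K s)))) (*-congˡ (g-stable s)))
                (∑-zero< k (λ b _ → trans (*-congʳ (*-congʳ (q^≥K _ (ℕₚ.≤-trans (ℕₚ.≤-trans (ℕₚ.m≤m+n K s) (ℕₚ.m≤n+m (K ℕ.+ s) (suc b))) (ℕₚ.m≤m+n _ (b ℕ.* _))))))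
                   (solve 2 (λ x y → con (+ 0) :* x :* y := con (+ 0)) refl _ _))) ⟩
    1# * (1# + 0#) * (1# * g K) + 0#
      ≈⟨ solve 1 (λ g → :1 :* (:1 :+ con (+ 0)) :* (:1 :* g) :+ con (+ 0) := g) refl (g K) ⟩
    g K ∎)
    where
    climb : ∀ j → durfee s ≈ durfee (j ℕ.+ s)
    climb zero = refl
    climb (suc j) = trans (climb j) (durfee-suc (j ℕ.+ s))

  theta : Carrier
  theta = 1# + (1# + 1#) * ∑ K (λ r → sgn (suc r) * q ^ (suc r ℕ.* suc r))

  -- The rank generating function: Rogers-Fine iteration, partial fractions, Lambert form.

  module RankSeries (u ū : Carrier) (uū : u * ū ≈ 1#) where

    -- u marks every part and ū = 1/u the largest one, so ū is the rank variable. `W l` generates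
    -- the overpartitions with parts at most l; `V l` generates what may follow a part l + 1, where
    -- l + 1 can recur only without overline.
    W V : ℕ → Carrier
    W l = ∏ l (λ i → e u i * I u i)
    V l = W l * I u l

    -- Sorted by the largest part l + 1, whose first occurrence is overlined or not; hence the
    -- factor 2.
    rankSeries : Carrier
    rankSeries = 1# + ∑ K (λ l → (1# + 1#) * (ū ^ suc l * (u * q ^ suc l * V l)))

    W-suc : ∀ l → W (suc l) ≈ W l + (1# + 1#) * (u * q ^ suc l * V l)
    W-suc l = begin
      W l * (e u l * I u l)
        ≈⟨ solve 3 (λ w x i → w :* ((:1 :+ x) :* i) := w :* ((:1 :- x) :* i) :+ :2 :* (x :* (w :* i))) refl (W l) (u * q ^ suc l) (I u l) ⟩
      W l * (d u l * I u l) + (1# + 1#) * (u * q ^ suc l * V l)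
        ≈⟨ +-congʳ (trans (*-congˡ (d*I u l)) (*-identityʳ _)) ⟩
      W l + (1# + 1#) * (u * q ^ suc l * V l) ∎

    -- The Rogers–Fine recurrence for Φ n = Σ_k (-uq^{n+1})_k/(uq^{n+2})_k (ūq^{n+1})^k.
    c : ℕ → ℕ → Carrier
    c n m = ∏ m (λ i → e u (n ℕ.+ i) * I u (suc (n ℕ.+ i)))

    Φ : ℕ → Carrier
    Φ n = ∑ K (λ m → c n m * (ū * q ^ suc n) ^ m)

    c-rec : ∀ n m → c n (suc m) * d u (suc (n ℕ.+ m)) ≈ c n m * e u (n ℕ.+ m)
    c-rec n m = begin
      c n m * (e u (n ℕ.+ m) * I u (suc (n ℕ.+ m))) * d u (suc (n ℕ.+ m))
        ≈⟨ solve 4 (λ c e i d → c :* (e :* i) :* d := c :* e :* (d :* i)) refl _ _ _ _ ⟩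
      c n m * e u (n ℕ.+ m) * (d u (suc (n ℕ.+ m)) * I u (suc (n ℕ.+ m)))
        ≈⟨ trans (*-congˡ (d*I u (suc (n ℕ.+ m)))) (*-identityʳ _) ⟩
      c n m * e u (n ℕ.+ m) ∎

    c-shift : ∀ n m → c n (suc m) ≈ e u n * I u (suc n) * c (suc n) m
    c-shift n m = begin
      c n (suc m)
        ≈⟨ ∏-head m _ ⟩
      e u (n ℕ.+ 0) * I u (suc (n ℕ.+ 0)) * ∏ m (λ i → e u (n ℕ.+ suc i) * I u (suc (n ℕ.+ suc i)))
        ≈⟨ *-cong (reflexive (≡.cong (λ z → e u z * I u (suc z)) (ℕₚ.+-identityʳ n)))
             (∏-cong m (λ i → reflexive (≡.cong (λ z → e u z * I u (suc z)) (ℕₚ.+-suc n i)))) ⟩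
      e u n * I u (suc n) * c (suc n) m ∎

    -- The Rogers-Fine recurrence for partial sums, with its remainder. The remainder contains
    -- τ^(m+1), so it vanishes at m = K.
    Φ-partial : ∀ n m → let Q = q ^ suc n in let τ = ū * Q in
      (1# - τ) * ∑ (suc m) (λ j → c n j * τ ^ j) ≈
      (1# + Q * Q) + q * (Q * Q) * e ū n * ∑ m (λ j → c n (suc j) * (τ * q) ^ j) - c n m * e u (n ℕ.+ m) * (τ * τ ^ m)
    Φ-partial n zero = sym (begin
      (1# + Q * Q) + q * (Q * Q) * e ū n * 0# - 1# * e u (n ℕ.+ 0) * (ū * Q * 1#)
        ≡⟨ ≡.cong (λ z → (1# + Q * Q) + q * (Q * Q) * e ū n * 0# - 1# * e u z * (ū * Q * 1#)) (ℕₚ.+-identityʳ n) ⟩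
      (1# + Q * Q) + q * (Q * Q) * e ū n * 0# - 1# * e u n * (ū * Q * 1#)
        ≈⟨ solve 4 (λ q Q u v → (:1 :+ Q :* Q) :+ q :* (Q :* Q) :* (:1 :+ v :* Q) :* con (+ 0) :- :1 :* (:1 :+ u :* Q) :* (v :* Q :* :1)
             := ((:1 :- v :* Q) :* (con (+ 0) :+ :1 :* :1)) :+ (u :* v :- :1) :* (:- (Q :* Q))) refl q Q u ū ⟩
      (1# - ū * Q) * (0# + 1# * 1#) + (u * ū - 1#) * (- (Q * Q))
        ≈⟨ kill uū _ _ ⟩
      (1# - ū * Q) * (0# + 1# * 1#) ∎)
      where Q = q ^ suc n
    Φ-partial n (suc m) = begin
      (1# - τ) * (S + C * (τ * T))
        ≈⟨ distribˡ _ _ _ ⟩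
      (1# - τ) * S + (1# - τ) * (C * (τ * T))
        ≈⟨ +-congʳ (Φ-partial n m) ⟩
      (h + G * S′ - c n m * e u (n ℕ.+ m) * (τ * T)) + (1# - τ) * (C * (τ * T))
        ≈⟨ +-congʳ (+-congˡ (-‿cong (*-congʳ (sym (c-rec n m))))) ⟩
      (h + G * S′ - C * d u (suc (n ℕ.+ m)) * (τ * T)) + (1# - τ) * (C * (τ * T))
        ≈⟨ +-congʳ (+-congˡ (-‿cong (*-congʳ (*-congˡ (+-congˡ (-‿cong (*-congˡ (*-congˡ X)))))))) ⟩
      (h + G * S′ - C * (1# - u * (q * (Q * Y))) * (τ * T)) + (1# - τ) * (C * (τ * T))
        ≈⟨ solve 9 (λ h S′ C u v q Q Y T → (h :+ q :* (Q :* Q) :* (:1 :+ v :* Q) :* S′ :- C :* (:1 :- u :* (q :* (Q :* Y))) :* (v :* Q :* T)) :+ (:1 :- v :* Q) :* (C :* (v :* Q :* T))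
              := (h :+ q :* (Q :* Q) :* (:1 :+ v :* Q) :* (S′ :+ C :* (T :* Y)) :- C :* (:1 :+ u :* (q :* (Q :* Y))) :* (v :* Q :* (v :* Q :* T)))
                 :+ (u :* v :- :1) :* (q :* Q :* Q :* Y :* C :* T :* (:1 :+ v :* Q))) refl h S′ C u ū q Q Y T ⟩
      (h + G * (S′ + C * (T * Y)) - C * (1# + u * (q * (Q * Y))) * (τ * (τ * T))) + (u * ū - 1#) * (q * Q * Q * Y * C * T * (1# + ū * Q))
        ≈⟨ kill uū _ _ ⟩
      h + G * (S′ + C * (T * Y)) - C * (1# + u * (q * (Q * Y))) * (τ * (τ * T))
        ≈⟨ +-cong (+-congˡ (*-congˡ (+-congˡ (*-congˡ (^-distrib-* τ q m))))) (-‿cong (*-congʳ (*-congˡ (+-congˡ (*-congˡ X′))))) ⟨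
      h + G * (S′ + C * (τ * q) ^ m) - C * e u (n ℕ.+ suc m) * (τ * (τ * T)) ∎
      where
      Q = q ^ suc n
      τ = ū * Q
      S = ∑ (suc m) (λ j → c n j * τ ^ j)
      S′ = ∑ m (λ j → c n (suc j) * (τ * q) ^ j)
      C = c n (suc m)
      T = τ ^ m
      Y = q ^ m
      h = 1# + Q * Q
      G = q * (Q * Q) * e ū n
      X : q ^ suc (n ℕ.+ m) ≈ Q * Y
      X = ^-homo-* q (suc n) m
      X′ : q ^ suc (n ℕ.+ suc m) ≈ q * (Q * Y)
      X′ = trans (reflexive (≡.cong (λ z → q ^ suc z) (ℕₚ.+-suc n m))) (*-congˡ X)

    Φ-rec : ∀ n → let Q = q ^ suc n in
      Φ n ≈ I ū n * ((1# + Q * Q) + q * (Q * Q) * (e u n * e ū n) * I u (suc n) * Φ (suc n))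
    Φ-rec n = Unit-cancelˡ (d-unit ū n) (begin
      d ū n * Φ n
        ≈⟨ *-congˡ (trans (+-congˡ (trans (*-congˡ (nil ū n)) (zeroʳ _))) (+-identityʳ _)) ⟨
      d ū n * ∑ (suc K) (λ j → c n j * τ ^ j)
        ≈⟨ Φ-partial n K ⟩
      h + q * (Q * Q) * e ū n * ∑ K (λ j → c n (suc j) * (τ * q) ^ j) - c n K * e u (n ℕ.+ K) * (τ * τ ^ K)
        ≈⟨ +-cong (+-congˡ (*-congˡ (∑-cong K (λ j → *-cong (c-shift n j) (^-congˡ j
             (solve 3 (λ v Q q → v :* Q :* q := v :* (q :* Q)) refl ū Q q))))))
             (-‿cong (*-congˡ (*-congˡ (nil ū n)))) ⟩
      h + q * (Q * Q) * e ū n * ∑ K (λ j → e u n * I u (suc n) * c (suc n) j * (ū * q ^ suc (suc n)) ^ j) - c n K * e u (n ℕ.+ K) * (τ * 0#)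
        ≈⟨ +-congʳ (+-congˡ (*-congˡ (trans (∑-cong K (λ j → *-assoc _ _ _)) (∑-*ˡ K _ _)))) ⟩
      h + q * (Q * Q) * e ū n * (e u n * I u (suc n) * Φ (suc n)) - c n K * e u (n ℕ.+ K) * (τ * 0#)
        ≈⟨ solve 8 (λ h g e e′ i p z t → h :+ g :* e′ :* (e :* i :* p) :- z :* (t :* con (+ 0)) := h :+ g :* (e :* e′) :* i :* p) refl h (q * (Q * Q)) (e u n) (e ū n) (I u (suc n)) (Φ (suc n)) (c n K * e u (n ℕ.+ K)) τ ⟩
      h + q * (Q * Q) * (e u n * e ū n) * I u (suc n) * Φ (suc n)
        ≈⟨ *-identityˡ _ ⟨
      1# * (h + q * (Q * Q) * (e u n * e ū n) * I u (suc n) * Φ (suc n))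
        ≈⟨ *-congʳ (d*I ū n) ⟨
      d ū n * I ū n * (h + q * (Q * Q) * (e u n * e ū n) * I u (suc n) * Φ (suc n))
        ≈⟨ *-assoc _ _ _ ⟩
      d ū n * (I ū n * (h + q * (Q * Q) * (e u n * e ū n) * I u (suc n) * Φ (suc n))) ∎)
      where
      Q = q ^ suc n
      τ = ū * Q
      h = 1# + Q * Q

    -- After n steps of the iteration, `s n` is the prefactor of the remaining `Φ n`, and `t n` that
    -- of the summand 1 + Q² split off at step n. Unlike the summands of `Φ`, `t n` is symmetric in
    -- u and ū.
    J t s : ℕ → Carrier
    J i = I u i * I ū i
    t n = ∏ n (λ i → e u i * e ū i) * ∏ (suc n) J
    s n = ∏ n (λ i → e u i * e ū i) * ∏ n J * I u n

    q^sq : ∀ n → q ^ (suc (suc n) ℕ.* suc (suc n)) ≈ q ^ (suc n ℕ.* suc n) * (q * (q ^ suc n * q ^ suc n))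
    q^sq n = begin
      q ^ (suc (suc n) ℕ.* suc (suc n))
        ≡⟨ ≡.cong (q ^_) (ℕsolve 1 (λ n → (κ 2 ⊞ n) ⊠ (κ 2 ⊞ n) ≔ (κ 1 ⊞ n) ⊠ (κ 1 ⊞ n) ⊞ (κ 1 ⊞ ((κ 1 ⊞ n) ⊞ (κ 1 ⊞ n)))) ≡.refl n) ⟩
      q ^ (suc n ℕ.* suc n ℕ.+ suc (suc n ℕ.+ suc n))
        ≈⟨ ^-homo-* q (suc n ℕ.* suc n) _ ⟩
      q ^ (suc n ℕ.* suc n) * (q * q ^ (suc n ℕ.+ suc n))
        ≈⟨ *-congˡ (*-congˡ (^-homo-* q (suc n) (suc n))) ⟩
      q ^ (suc n ℕ.* suc n) * (q * (q ^ suc n * q ^ suc n)) ∎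

    rogersFine : ∀ n → q * I u 0 * Φ 0 ≈
      ∑ n (λ m → q ^ (suc m ℕ.* suc m) * (1# + q ^ suc m * q ^ suc m) * t m) + q ^ (suc n ℕ.* suc n) * s n * Φ n
    rogersFine zero = solve 3 (λ q i p → q :* i :* p := con (+ 0) :+ q :* :1 :* (:1 :* :1 :* i) :* p) refl q (I u 0) (Φ 0)
    rogersFine (suc n) = begin
      q * I u 0 * Φ 0
        ≈⟨ rogersFine n ⟩
      A + E * s n * Φ n
        ≈⟨ +-congˡ (*-congˡ (Φ-rec n)) ⟩
      A + E * s n * (I ū n * ((1# + Q * Q) + q * (Q * Q) * (e u n * e ū n) * I u (suc n) * Φ (suc n)))
        ≈⟨ solve 11 (λ A E p j i i′ h G ee i″ f → A :+ E :* (p :* j :* i) :* (i′ :* (h :+ G :* ee :* i″ :* f))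
              := (A :+ E :* h :* (p :* (j :* (i :* i′)))) :+ (E :* G) :* ((p :* ee) :* (j :* (i :* i′)) :* i″) :* f) refl
              A E (∏ n (λ i → e u i * e ū i)) (∏ n J) (I u n) (I ū n) (1# + Q * Q) (q * (Q * Q)) (e u n * e ū n) (I u (suc n)) (Φ (suc n)) ⟩
      (A + E * (1# + Q * Q) * t n) + (E * (q * (Q * Q))) * s (suc n) * Φ (suc n)
        ≈⟨ +-congˡ (*-congʳ (*-congʳ (q^sq n))) ⟨
      (A + E * (1# + Q * Q) * t n) + q ^ (suc (suc n) ℕ.* suc (suc n)) * s (suc n) * Φ (suc n) ∎
      where
      Q = q ^ suc n
      E = q ^ (suc n ℕ.* suc n)
      A = ∑ n (λ m → q ^ (suc m ℕ.* suc m) * (1# + q ^ suc m * q ^ suc m) * t m)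

    D : ℕ → Carrier
    D r = d u r * d ū r

    D*J : ∀ r → D r * J r ≈ 1#
    D*J r = trans (solve 4 (λ a b x y → a :* b :* (x :* y) := (a :* x) :* (b :* y)) refl _ _ _ _)
      (trans (*-cong (d*I u r) (d*I ū r)) (*-identityʳ 1#))

    private
      Qxy : ∀ {n r} → r ℕ.≤ n → q ^ suc n ≈ q ^ (n ∸ r) * q ^ suc r
      Qxy {n} {r} r≤n = trans (reflexive (≡.cong (q ^_) (≡.sym (≡.trans (ℕₚ.+-suc (n ∸ r) r) (≡.cong suc (ℕₚ.m∸n+n≡m r≤n)))))) (^-homo-* q (n ∸ r) (suc r))

      Qxyy : ∀ {n r} → r ℕ.≤ n → q ^ (n ℕ.+ suc (suc r)) ≈ q ^ (n ∸ r) * q ^ suc r * q ^ suc r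
      Qxyy {n} {r} r≤n = trans (reflexive (≡.cong (q ^_) (ℕₚ.+-suc n (suc r)))) (trans (^-homo-* q (suc n) (suc r)) (*-congʳ (Qxy r≤n)))

    -- What the numerator of step n leaves of `a n r`, and the denominator of step n + 1 of
    -- `a (suc n) r`, once multiples of `D r` are split off. That the two agree drives the induction
    -- for the partial fractions.
    b : ℕ → ℕ → Carrier
    b n r = (1# + q ^ (n ∸ r)) * (1# + q ^ (n ∸ r) * q ^ suc r * q ^ suc r) * a n r

    -- Put y = q^(r+1) and x = q^(n-r), so Q = xy and D r = 1 + y² - y(u + ū). Then (1 + uQ)(1 + ūQ)
    -- = -x D r + (1 + x)(1 + xy²).
    ee-a : ∀ n r → r ℕ.≤ n → e u n * e ū n * (a n r * J r) ≈ - (q ^ (n ∸ r) * a n r) + b n r * J r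
    ee-a n r r≤n = begin
      e u n * e ū n * (a n r * J r)
        ≈⟨ *-congʳ (*-cong (+-congˡ (*-congˡ (Qxy r≤n))) (+-congˡ (*-congˡ (Qxy r≤n)))) ⟩
      (1# + u * (x * y)) * (1# + ū * (x * y)) * (a n r * J r)
        ≈⟨ solve 6 (λ u v x y a j → (:1 :+ u :* (x :* y)) :* (:1 :+ v :* (x :* y)) :* (a :* j) :=
              (:- (x :* a :* ((:1 :- u :* y) :* (:1 :- v :* y) :* j)) :+ (:1 :+ x) :* (:1 :+ x :* y :* y) :* a :* j)
              :+ (u :* v :- :1) :* ((x :* x :* y :* y :+ x :* y :* y) :* a :* j)) refl u ū x y (a n r) (J r) ⟩
      (- (x * a n r * (D r * J r)) + b n r * J r) + (u * ū - 1#) * ((x * x * y * y + x * y * y) * a n r * J r)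
        ≈⟨ kill uū _ _ ⟩
      - (x * a n r * (D r * J r)) + b n r * J r
        ≈⟨ +-congʳ (-‿cong (trans (*-congˡ (D*J r)) (*-identityʳ _))) ⟩
      - (x * a n r) + b n r * J r ∎
      where
      x = q ^ (n ∸ r)
      y = q ^ suc r

    -- In the same notation D (n+1) = qx D r + (1 - qx)(1 - qxy²), and the recurrence of `g`, used
    -- for both of its factors, turns the last product times `a (suc n) r` into `b n r`.
    D-a : ∀ n r → r ℕ.≤ n → D (suc n) * (a (suc n) r * J r) ≈ q ^ (suc n ∸ r) * a (suc n) r + b n r * J r
    D-a n r r≤n = begin
      D (suc n) * (a (suc n) r * J r)
        ≈⟨ *-congʳ (*-cong (+-congˡ (-‿cong (*-congˡ (*-congˡ (Qxy r≤n))))) (+-congˡ (-‿cong (*-congˡ (*-congˡ (Qxy r≤n)))))) ⟩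
      (1# - u * (q * (x * y))) * (1# - ū * (q * (x * y))) * (a (suc n) r * J r)
        ≈⟨ solve 7 (λ u v q x y a j → (:1 :- u :* (q :* (x :* y))) :* (:1 :- v :* (q :* (x :* y))) :* (a :* j) :=
              ((q :* x) :* a :* ((:1 :- u :* y) :* (:1 :- v :* y) :* j) :+ ((:1 :- q :* x) :* (:1 :- q :* (x :* y :* y)) :* a) :* j)
              :+ (u :* v :- :1) :* ((q :* q :* x :* x :* y :* y :- q :* x :* y :* y) :* a :* j)) refl u ū q x y (a (suc n) r) (J r) ⟩
      (q * x * a (suc n) r * (D r * J r) + ((1# - q * x) * (1# - q * (x * y * y)) * a (suc n) r) * J r) + (u * ū - 1#) * _
        ≈⟨ kill uū _ _ ⟩
      q * x * a (suc n) r * (D r * J r) + ((1# - q * x) * (1# - q * (x * y * y)) * a (suc n) r) * J r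
        ≈⟨ +-cong (trans (*-congˡ (D*J r)) (*-identityʳ _)) (*-congʳ coefficient) ⟩
      q * x * a (suc n) r + b n r * J r
        ≡⟨ ≡.cong (λ z → q ^ z * a (suc n) r + b n r * J r) (≡.sym (ℕₚ.+-∸-assoc 1 r≤n)) ⟩
      q ^ (suc n ∸ r) * a (suc n) r + b n r * J r ∎
      where
      x = q ^ (n ∸ r)
      y = q ^ suc r
      N = n ℕ.+ suc (suc r)
      coefficient : (1# - q * x) * (1# - q * (x * y * y)) * a (suc n) r ≈ b n r
      coefficient = begin
        (1# - q * x) * (1# - q * (x * y * y)) * (sgn r * ((1# - y) * (1# - y)) * (g (suc N) * g (suc n ∸ r)))
          ≡⟨ ≡.cong (λ z → (1# - q * x) * (1# - q * (x * y * y)) * (sgn r * ((1# - y) * (1# - y)) * (g (suc N) * g z))) (ℕₚ.+-∸-assoc 1 r≤n) ⟩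
        (1# - q * x) * (1# - q * (x * y * y)) * (sgn r * ((1# - y) * (1# - y)) * (g (suc N) * g (suc (n ∸ r))))
          ≈⟨ solve 5 (λ A B S G H → A :* B :* (S :* (G :* H)) := S :* ((B :* G) :* (A :* H))) refl _ _ _ _ _ ⟩
        sgn r * ((1# - y) * (1# - y)) * (((1# - q * (x * y * y)) * g (suc N)) * ((1# - q * x) * g (suc (n ∸ r))))
          ≈⟨ *-congˡ (*-cong (trans (*-congʳ (+-congˡ (-‿cong (*-congˡ (sym (Qxyy r≤n)))))) (trans (g-rec N) (*-congʳ (+-congˡ (Qxyy r≤n))))) (g-rec (n ∸ r))) ⟩
        sgn r * ((1# - y) * (1# - y)) * (((1# + x * y * y) * g N) * ((1# + x) * g (n ∸ r)))
          ≈⟨ solve 5 (λ A B S G H → S :* ((B :* G) :* (A :* H)) := A :* B :* (S :* (G :* H))) refl _ _ _ _ _ ⟩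
        b n r ∎

    -- After multiplication by D (n+1), both sides are Σ b n r J r plus a term free of u. These
    -- terms agree by `a-sum` at n and at n + 1, because -2(-1)ⁿ = 2(-1)^(n+1).
    partialFractions : ∀ n → (1# + 1#) * t n ≈ ∑ (suc n) (λ r → a n r * J r)
    partialFractions zero = begin
      (1# + 1#) * t 0           ≈⟨ solve 1 (λ j → :2 :* (:1 :* (:1 :* j)) := con (+ 0) :+ (:2 :* :1) :* j) refl (J 0) ⟩
      0# + (1# + 1#) * 1# * J 0 ≈⟨ +-congˡ (*-congʳ (trans (sym (a-sum 0)) (solve 1 (λ x → con (+ 0) :+ :1 :* x := x) refl (a 0 0)))) ⟩
      0# + a 0 0 * J 0          ∎
    partialFractions (suc n) = Unit-cancelˡ (J (suc n) , D*J (suc n)) (begin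
      D (suc n) * ((1# + 1#) * t (suc n))
        ≈⟨ solve 6 (λ D J p ee j two → D :* (two :* ((p :* ee) :* (j :* J))) := ee :* (two :* (p :* j)) :* (D :* J)) refl
             (D (suc n)) (J (suc n)) (∏ n (λ i → e u i * e ū i)) (e u n * e ū n) (∏ (suc n) J) (1# + 1#) ⟩
      e u n * e ū n * ((1# + 1#) * t n) * (D (suc n) * J (suc n))
        ≈⟨ trans (*-congˡ (D*J (suc n))) (*-identityʳ _) ⟩
      e u n * e ū n * ((1# + 1#) * t n)
        ≈⟨ *-congˡ (partialFractions n) ⟩
      e u n * e ū n * ∑ (suc n) (λ r → a n r * J r)
        ≈⟨ ∑-*ˡ (suc n) _ _ ⟨
      ∑ (suc n) (λ r → e u n * e ū n * (a n r * J r))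
        ≈⟨ ∑-cong< (suc n) (λ r p → ee-a n r (ℕₚ.≤-pred p)) ⟩
      ∑ (suc n) (λ r → - (q ^ (n ∸ r) * a n r) + b n r * J r)
        ≈⟨ trans (∑-+ (suc n) _ _) (+-congʳ (trans (∑-neg (suc n) _) (-‿cong (a-sum n)))) ⟩
      - ((1# + 1#) * sgn n) + B
        ≈⟨ +-congʳ (solve 1 (λ s → :- (:2 :* s) := :2 :* (:- :1 :* s)) refl (sgn n)) ⟩
      (1# + 1#) * sgn (suc n) + B
        ≈⟨ +-congʳ (a-sum (suc n)) ⟨
      (∑ (suc n) (λ r → q ^ (suc n ∸ r) * a (suc n) r) + q ^ (n ∸ n) * a (suc n) (suc n)) + B
        ≈⟨ solve 3 (λ x y z → (x :+ y) :+ z := (x :+ z) :+ y) refl _ _ _ ⟩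
      (∑ (suc n) (λ r → q ^ (suc n ∸ r) * a (suc n) r) + B) + q ^ (n ∸ n) * a (suc n) (suc n)
        ≈⟨ +-cong (trans (sym (∑-+ (suc n) _ _)) (∑-cong< (suc n) (λ r p → sym (D-a n r (ℕₚ.≤-pred p))))) lastTerm ⟩
      ∑ (suc (suc n)) (λ r → D (suc n) * (a (suc n) r * J r))
        ≈⟨ ∑-*ˡ (suc (suc n)) _ _ ⟩
      D (suc n) * ∑ (suc (suc n)) (λ r → a (suc n) r * J r) ∎)
      where
      B = ∑ (suc n) (λ r → b n r * J r)
      lastTerm : q ^ (n ∸ n) * a (suc n) (suc n) ≈ D (suc n) * (a (suc n) (suc n) * J (suc n))
      lastTerm = begin
        q ^ (n ∸ n) * a (suc n) (suc n)               ≡⟨ ≡.cong (λ z → q ^ z * a (suc n) (suc n)) (ℕₚ.n∸n≡0 n) ⟩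
        1# * a (suc n) (suc n)                        ≈⟨ *-congʳ (D*J (suc n)) ⟨
        D (suc n) * J (suc n) * a (suc n) (suc n)     ≈⟨ solve 3 (λ D J a → D :* J :* a := D :* (a :* J)) refl _ _ _ ⟩
        D (suc n) * (a (suc n) (suc n) * J (suc n))   ∎

    V-c : ∀ l → V l ≈ I u 0 * c 0 l
    V-c zero = *-comm _ _
    V-c (suc l) = begin
      W l * (e u l * I u l) * I u (suc l)         ≈⟨ solve 4 (λ w e i j → w :* (e :* i) :* j := (w :* i) :* (e :* j)) refl _ _ _ _ ⟩
      V l * (e u l * I u (suc l))                 ≈⟨ *-congʳ (V-c l) ⟩
      I u 0 * c 0 l * (e u l * I u (suc l))       ≈⟨ *-assoc _ _ _ ⟩
      I u 0 * c 0 (suc l)                         ∎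

    rankSeries-Φ : rankSeries ≈ 1# + (1# + 1#) * (q * I u 0 * Φ 0)
    rankSeries-Φ = +-congˡ (begin
      ∑ K (λ l → (1# + 1#) * (ū ^ suc l * (u * q ^ suc l * V l)))
        ≈⟨ ∑-cong K term ⟩
      ∑ K (λ l → (1# + 1#) * (q * I u 0) * (c 0 l * (ū * q ^ 1) ^ l))
        ≈⟨ trans (∑-*ˡ K _ _) (*-assoc _ _ _) ⟩
      (1# + 1#) * (q * I u 0 * Φ 0) ∎)
      where
      term : ∀ l → (1# + 1#) * (ū ^ suc l * (u * q ^ suc l * V l)) ≈ (1# + 1#) * (q * I u 0) * (c 0 l * (ū * q ^ 1) ^ l)
      term l = begin
        (1# + 1#) * (ū * ū ^ l * (u * (q * q ^ l) * V l))
          ≈⟨ *-congˡ (*-congˡ (*-congˡ (V-c l))) ⟩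
        (1# + 1#) * (ū * ū ^ l * (u * (q * q ^ l) * (I u 0 * c 0 l)))
          ≈⟨ solve 7 (λ v vl u q ql i c → :2 :* (v :* vl :* (u :* (q :* ql) :* (i :* c))) :=
                :2 :* (q :* i) :* (c :* (vl :* ql)) :+ (u :* v :- :1) :* (:2 :* (q :* i) :* (c :* (vl :* ql)))) refl ū (ū ^ l) u q (q ^ l) (I u 0) (c 0 l) ⟩
        (1# + 1#) * (q * I u 0) * (c 0 l * (ū ^ l * q ^ l)) + (u * ū - 1#) * _
          ≈⟨ kill uū _ _ ⟩
        (1# + 1#) * (q * I u 0) * (c 0 l * (ū ^ l * q ^ l))
          ≈⟨ *-congˡ (*-congˡ (trans (^-distrib-* ū (q ^ 1) l) (*-congˡ (^-congˡ l (*-identityʳ q))))) ⟨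
        (1# + 1#) * (q * I u 0) * (c 0 l * (ū * q ^ 1) ^ l) ∎

    -- Insert the partial fractions and sum along m = r + b for fixed r. Since (r + b + 1)² = (r +
    -- 1)² + b(b + 2r + 2), the inner sum is a Durfee sum with s = 2r + 2, whose value is the same
    -- for all r.
    rankSeries-Lambert : rankSeries ≈ 1# + g K * ∑ K (λ r → sgn r * q ^ (suc r ℕ.* suc r) * ((1# - q ^ suc r) * (1# - q ^ suc r)) * J r)
    rankSeries-Lambert = begin
      rankSeries
        ≈⟨ rankSeries-Φ ⟩
      1# + (1# + 1#) * (q * I u 0 * Φ 0)
        ≈⟨ +-congˡ (*-congˡ (rogersFine K)) ⟩
      1# + (1# + 1#) * (∑ K (λ m → E m * H m * t m) + q ^ (suc K ℕ.* suc K) * s K * Φ K)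
        ≈⟨ +-congˡ (*-congˡ (trans (+-congˡ (trans (*-congʳ (trans (*-congʳ (q^≥K _ (ℕₚ.≤-trans (ℕₚ.n≤1+n K) (ℕₚ.m≤m+n (suc K) (K ℕ.* suc K))))) (zeroˡ _))) (zeroˡ _))) (+-identityʳ _))) ⟩
      1# + (1# + 1#) * ∑ K (λ m → E m * H m * t m)
        ≈⟨ +-congˡ (trans (sym (∑-*ˡ K _ _)) (∑-cong K expand)) ⟩
      1# + ∑ K (λ m → ∑ (suc m) (λ r → E m * H m * (a m r * J r)))
        ≈⟨ +-congˡ (∑-triangle K _) ⟩
      1# + ∑ K (λ r → ∑ (K ∸ r) (λ b → E (r ℕ.+ b) * H (r ℕ.+ b) * (a (r ℕ.+ b) r * J r)))
        ≈⟨ +-congˡ (∑-cong< K inner) ⟩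
      1# + ∑ K (λ r → g K * (sgn r * E r * S r * J r))
        ≈⟨ +-congˡ (∑-*ˡ K _ _) ⟩
      1# + g K * ∑ K (λ r → sgn r * E r * S r * J r) ∎
      where
      E H S : ℕ → Carrier
      E m = q ^ (suc m ℕ.* suc m)
      H m = 1# + q ^ suc m * q ^ suc m
      S r = (1# - q ^ suc r) * (1# - q ^ suc r)
      expand : ∀ m → (1# + 1#) * (E m * H m * t m) ≈ ∑ (suc m) (λ r → E m * H m * (a m r * J r))
      expand m = begin
        (1# + 1#) * (E m * H m * t m)                 ≈⟨ solve 3 (λ w x y → w :* (x :* y) := x :* (w :* y)) refl _ _ _ ⟩
        E m * H m * ((1# + 1#) * t m)                 ≈⟨ *-congˡ (partialFractions m) ⟩
        E m * H m * ∑ (suc m) (λ r → a m r * J r)     ≈⟨ ∑-*ˡ (suc m) _ _ ⟨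
        ∑ (suc m) (λ r → E m * H m * (a m r * J r))   ∎
      inner : ∀ r → r ℕ.< K → ∑ (K ∸ r) (λ b → E (r ℕ.+ b) * H (r ℕ.+ b) * (a (r ℕ.+ b) r * J r)) ≈ g K * (sgn r * E r * S r * J r)
      inner r r<K = begin
        ∑ (K ∸ r) (λ b → E (r ℕ.+ b) * H (r ℕ.+ b) * (a (r ℕ.+ b) r * J r))
          ≈⟨ ∑-cong (K ∸ r) (λ b → term b) ⟩
        ∑ (K ∸ r) f
          ≈⟨ +-identityʳ _ ⟨
        ∑ (K ∸ r) f + 0#
          -- The triangle provides only K - r values of b. The r others have r + b ≥ K, so their
          -- combined power of q is zero, and adding them completes the Durfee sum.
          ≈⟨ +-congˡ (∑-zero< r (λ i _ → tail i)) ⟨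
        ∑ (K ∸ r) f + ∑ r (λ i → f (K ∸ r ℕ.+ i))
          ≈⟨ ∑-split (K ∸ r) r f ⟨
        ∑ (K ∸ r ℕ.+ r) f
          ≡⟨ ≡.cong (λ z → ∑ z f) (ℕₚ.m∸n+n≡m (ℕₚ.<⇒≤ r<K)) ⟩
        ∑ K f
          ≈⟨ ∑-*ˡ K _ _ ⟩
        sgn r * E r * S r * J r * durfee (suc r ℕ.+ suc r)
          ≈⟨ *-congˡ (durfee-value (suc r ℕ.+ suc r)) ⟩
        sgn r * E r * S r * J r * g K
          ≈⟨ *-comm _ _ ⟩
        g K * (sgn r * E r * S r * J r) ∎
        where
        f : ℕ → Carrier
        f b = sgn r * E r * S r * J r * durfeeTerm (suc r ℕ.+ suc r) b
        square : ∀ b → suc (r ℕ.+ b) ℕ.* suc (r ℕ.+ b) ≡ suc r ℕ.* suc r ℕ.+ b ℕ.* (b ℕ.+ (suc r ℕ.+ suc r))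
        square b = ℕsolve 2 (λ r b → (κ 1 ⊞ (r ⊞ b)) ⊠ (κ 1 ⊞ (r ⊞ b)) ≔ (κ 1 ⊞ r) ⊠ (κ 1 ⊞ r) ⊞ b ⊠ (b ⊞ ((κ 1 ⊞ r) ⊞ (κ 1 ⊞ r)))) ≡.refl r b
        E-split : ∀ b → E (r ℕ.+ b) ≈ E r * q ^ (b ℕ.* (b ℕ.+ (suc r ℕ.+ suc r)))
        E-split b = trans (reflexive (≡.cong (q ^_) (square b))) (^-homo-* q (suc r ℕ.* suc r) _)
        term : ∀ b → E (r ℕ.+ b) * H (r ℕ.+ b) * (a (r ℕ.+ b) r * J r) ≈ f b
        term b = begin
          E (r ℕ.+ b) * H (r ℕ.+ b) * (sgn r * S r * (g (r ℕ.+ b ℕ.+ suc (suc r)) * g (r ℕ.+ b ∸ r)) * J r)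
            ≈⟨ *-cong (*-cong (E-split b) (+-congˡ (trans (sym (^-homo-* q (suc (r ℕ.+ b)) (suc (r ℕ.+ b)))) (reflexive (≡.cong (q ^_) e₁)))))
                 (*-congʳ (*-congˡ (reflexive (≡.cong₂ (λ y z → g y * g z) e₂ (ℕₚ.m+n∸m≡n r b))))) ⟩
          E r * X * Y * (sgn r * S r * (g (b ℕ.+ (suc r ℕ.+ suc r)) * g b) * J r)
            ≈⟨ solve 8 (λ E X Y s S G h J → E :* X :* Y :* (s :* S :* (G :* h) :* J) := s :* E :* S :* J :* (X :* Y :* (h :* G))) refl
                 (E r) X Y (sgn r) (S r) (g (b ℕ.+ (suc r ℕ.+ suc r))) (g b) (J r) ⟩
          f b ∎
          where
          X = q ^ (b ℕ.* (b ℕ.+ (suc r ℕ.+ suc r)))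
          Y = 1# + q ^ (b ℕ.+ (b ℕ.+ (suc r ℕ.+ suc r)))
          e₁ : suc (r ℕ.+ b) ℕ.+ suc (r ℕ.+ b) ≡ b ℕ.+ (b ℕ.+ (suc r ℕ.+ suc r))
          e₁ = ℕsolve 2 (λ r b → (κ 1 ⊞ (r ⊞ b)) ⊞ (κ 1 ⊞ (r ⊞ b)) ≔ b ⊞ (b ⊞ ((κ 1 ⊞ r) ⊞ (κ 1 ⊞ r)))) ≡.refl r b
          e₂ : r ℕ.+ b ℕ.+ suc (suc r) ≡ b ℕ.+ (suc r ℕ.+ suc r)
          e₂ = ℕsolve 2 (λ r b → r ⊞ b ⊞ (κ 2 ⊞ r) ≔ b ⊞ ((κ 1 ⊞ r) ⊞ (κ 1 ⊞ r))) ≡.refl r b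
        tail : ∀ i → f (K ∸ r ℕ.+ i) ≈ 0#
        tail i = begin
          sgn r * E r * S r * J r * (X * Y * Z)
            ≈⟨ solve 7 (λ s E S J X Y Z → s :* E :* S :* J :* (X :* Y :* Z) := s :* S :* J :* Y :* Z :* (E :* X)) refl (sgn r) (E r) (S r) (J r) X Y Z ⟩
          sgn r * S r * J r * Y * Z * (E r * X)
            ≈⟨ *-congˡ (trans (sym (E-split β)) (q^≥K _ (ℕₚ.≤-trans K≤ (ℕₚ.m≤m+n (suc (r ℕ.+ β)) _)))) ⟩
          sgn r * S r * J r * Y * Z * 0#
            ≈⟨ zeroʳ _ ⟩
          0# ∎
          where
          β = K ∸ r ℕ.+ i
          X = q ^ (β ℕ.* (β ℕ.+ (suc r ℕ.+ suc r)))
          Y = 1# + q ^ (β ℕ.+ (β ℕ.+ (suc r ℕ.+ suc r)))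
          Z = g β * g (β ℕ.+ (suc r ℕ.+ suc r))
          K≤ : K ℕ.≤ suc (r ℕ.+ β)
          K≤ = ℕₚ.≤-trans (ℕₚ.≤-reflexive (≡.sym (ℕₚ.m+[n∸m]≡n (ℕₚ.<⇒≤ r<K)))) (ℕₚ.≤-trans (ℕₚ.+-monoʳ-≤ r (ℕₚ.m≤m+n (K ∸ r) i)) (ℕₚ.n≤1+n _))

    W-sum : ∀ n → W n ≈ 1# + ∑ n (λ l → (1# + 1#) * (u * q ^ suc l * V l))
    W-sum zero = sym (+-identityʳ 1#)
    W-sum (suc n) = trans (W-suc n) (trans (+-congʳ (W-sum n)) (+-assoc _ _ _))

  module AtOne = RankSeries 1# 1# (*-identityʳ 1#)

  1^ : ∀ n → 1# ^ n ≈ 1#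
  1^ zero = refl
  1^ (suc n) = trans (*-identityˡ _) (1^ n)

  -- (-1;q)_∞ = 2(-q;q)_∞, the factor with exponent 0 being 2.
  g-W : g K ≈ (1# + 1#) * AtOne.W K
  g-W = begin
    g K
      ≈⟨ ∏-* K (λ i → 1# + q ^ i) (I 1#) ⟩
    ∏ K (λ i → 1# + q ^ i) * ∏ K (I 1#)
      ≈⟨ *-congʳ (trans (*-congˡ (trans (+-congˡ q-nil) (+-identityʳ 1#))) (*-identityʳ _)) ⟨
    ∏ (suc K) (λ i → 1# + q ^ i) * ∏ K (I 1#)
      ≈⟨ *-congʳ (∏-head K _) ⟩
    (1# + 1#) * ∏ K (λ i → 1# + q ^ suc i) * ∏ K (I 1#)
      ≈⟨ *-congʳ (*-congˡ (∏-cong K (λ i → +-congˡ (sym (*-identityˡ _))))) ⟩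
    (1# + 1#) * ∏ K (e 1#) * ∏ K (I 1#)
      ≈⟨ *-assoc _ _ _ ⟩
    (1# + 1#) * (∏ K (e 1#) * ∏ K (I 1#))
      ≈⟨ *-congˡ (∏-* K (e 1#) (I 1#)) ⟨
    (1# + 1#) * AtOne.W K ∎

  -- Gauss's identity is the case u = 1, where every overpartition has weight 1.
  theta*W : theta * AtOne.W K ≈ 1#
  theta*W = begin
    theta * w
      ≈⟨ *-congʳ (+-congˡ (*-congˡ theta-neg)) ⟩
    (1# + (1# + 1#) * (- S)) * w
      ≈⟨ solve 2 (λ S w → (:1 :+ :2 :* (:- S)) :* w := w :- (:2 :* w) :* S) refl S w ⟩
    w - ((1# + 1#) * w) * S
      ≈⟨ +-cong w-eq (-‿cong (*-congʳ (sym g-W))) ⟩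
    (1# + g K * S) - g K * S
      ≈⟨ solve 1 (λ x → :1 :+ x :- x := :1) refl (g K * S) ⟩
    1# ∎
    where
    w = AtOne.W K
    S = ∑ K (λ r → sgn r * q ^ (suc r ℕ.* suc r))
    theta-neg : ∑ K (λ r → sgn (suc r) * q ^ (suc r ℕ.* suc r)) ≈ - S
    theta-neg = trans (∑-cong K (λ r → solve 2 (λ s x → (:- :1 :* s) :* x := :- (s :* x)) refl (sgn r) (q ^ (suc r ℕ.* suc r)))) (∑-neg K _)
    -- At u = 1 the factor J r cancels (1 - q^(r+1))². Since g K = 2w, this is the linear equation w
    -- = 1 + 2wS, that is θw = 1 with θ = 1 - 2S.
    w-eq : w ≈ 1# + g K * S
    w-eq = begin
      w
        ≈⟨ AtOne.W-sum K ⟩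
      1# + ∑ K (λ l → (1# + 1#) * (1# * q ^ suc l * AtOne.V l))
        ≈⟨ +-congˡ (∑-cong K (λ l → *-congˡ (trans (sym (*-identityˡ _)) (*-congʳ (sym (1^ (suc l))))))) ⟩
      AtOne.rankSeries
        ≈⟨ AtOne.rankSeries-Lambert ⟩
      1# + g K * ∑ K (λ r → sgn r * q ^ (suc r ℕ.* suc r) * ((1# - q ^ suc r) * (1# - q ^ suc r)) * AtOne.J r)
        ≈⟨ +-congˡ (*-congˡ (∑-cong K (λ r → trans (*-assoc _ _ _) (trans (*-congˡ (trans (*-congʳ (*-cong (unfold r) (unfold r))) (AtOne.D*J r))) (*-identityʳ _))))) ⟩
      1# + g K * S ∎
      where
      unfold : ∀ r → 1# - q ^ suc r ≈ d 1# r
      unfold r = +-congˡ (-‿cong (sym (*-identityˡ _)))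

  gauss : theta * ∏ K (e 1#) ≈ ∏ K (d 1#)
  gauss = begin
    theta * ∏ K (e 1#)
      ≈⟨ *-identityʳ _ ⟨
    theta * ∏ K (e 1#) * 1#
      ≈⟨ *-congˡ (∏-one< K (λ i _ → d*I 1# i)) ⟨
    theta * ∏ K (e 1#) * ∏ K (λ i → d 1# i * I 1# i)
      ≈⟨ *-congˡ (∏-* K _ _) ⟩
    theta * ∏ K (e 1#) * (∏ K (d 1#) * ∏ K (I 1#))
      ≈⟨ solve 4 (λ t e d i → t :* e :* (d :* i) := t :* (e :* i) :* d) refl _ _ _ _ ⟩
    theta * (∏ K (e 1#) * ∏ K (I 1#)) * ∏ K (d 1#)
      ≈⟨ *-congʳ (trans (*-congˡ (sym (∏-* K _ _))) theta*W) ⟩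
    1# * ∏ K (d 1#)
      ≈⟨ *-identityˡ _ ⟩
    ∏ K (d 1#) ∎

  module RankTheta (u ū : Carrier) (uū : u * ū ≈ 1#) where
    open RankSeries u ū uū

    -- (1 - y)² = D r - y(2 - u - ū) for y = q^(r+1). The part with D r cancels the sum in `theta`;
    -- the other part raises the exponent from n² to n² + n, where n = r + 1.
    theta*rankSeries : theta * rankSeries ≈
      1# + ((1# + 1#) * (1# + 1# - (u + ū))) * ∑ K (λ r → sgn (suc r) * q ^ (suc r ℕ.* suc (suc r)) * J r)
    theta*rankSeries = begin
      theta * rankSeries
        ≈⟨ *-congˡ rankSeries-Lambert ⟩
      theta * (1# + g K * ∑ K (λ r → sgn r * E r * ((1# - q ^ suc r) * (1# - q ^ suc r)) * J r))
        ≈⟨ *-congˡ (+-congˡ (*-cong g-W (∑-cong K split))) ⟩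
      theta * (1# + (1# + 1#) * w * ∑ K (λ r → - (sgn (suc r) * E r) + z * (sgn (suc r) * E′ r * J r)))
        ≈⟨ *-congˡ (+-congˡ (*-congˡ (trans (∑-+ K _ _) (+-cong (∑-neg K _) (∑-*ˡ K _ _))))) ⟩
      theta * (1# + (1# + 1#) * w * (- S + z * L))
        ≈⟨ solve 5 (λ t w S z L → t :* (:1 :+ :2 :* w :* (:- S :+ z :* L)) := t :+ (t :* w) :* (:2 :* (:- S :+ z :* L))) refl theta w S z L ⟩
      theta + (theta * w) * ((1# + 1#) * (- S + z * L))
        ≈⟨ +-congˡ (*-congʳ theta*W) ⟩
      theta + 1# * ((1# + 1#) * (- S + z * L))
        ≈⟨ solve 3 (λ S z L → (:1 :+ :2 :* S) :+ :1 :* (:2 :* (:- S :+ z :* L)) := :1 :+ (:2 :* z) :* L) refl S z L ⟩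
      1# + ((1# + 1#) * z) * L ∎
      where
      w = AtOne.W K
      z = 1# + 1# - (u + ū)
      E E′ : ℕ → Carrier
      E r = q ^ (suc r ℕ.* suc r)
      E′ r = q ^ (suc r ℕ.* suc (suc r))
      S = ∑ K (λ r → sgn (suc r) * E r)
      L = ∑ K (λ r → sgn (suc r) * E′ r * J r)
      E-shift : ∀ r → E′ r ≈ E r * q ^ suc r
      E-shift r = trans (reflexive (≡.cong (q ^_) (≡.trans (ℕₚ.*-suc (suc r) (suc r)) (ℕₚ.+-comm (suc r) _)))) (^-homo-* q (suc r ℕ.* suc r) (suc r))
      split : ∀ r → sgn r * E r * ((1# - q ^ suc r) * (1# - q ^ suc r)) * J r ≈ - (sgn (suc r) * E r) + z * (sgn (suc r) * E′ r * J r)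
      split r = begin
        sgn r * E r * ((1# - y) * (1# - y)) * J r
          ≈⟨ solve 6 (λ s E y u v J → s :* E :* ((:1 :- y) :* (:1 :- y)) :* J
               := (s :* E :* ((:1 :- u :* y) :* (:1 :- v :* y) :* J) :+ (:2 :- (u :+ v)) :* ((:- :1 :* s) :* (E :* y) :* J))
                  :+ (u :* v :- :1) :* (:- (s :* E :* y :* y :* J))) refl (sgn r) (E r) y u ū (J r) ⟩
        (sgn r * E r * (D r * J r) + z * (sgn (suc r) * (E r * y) * J r)) + (u * ū - 1#) * _
          ≈⟨ kill uū _ _ ⟩
        sgn r * E r * (D r * J r) + z * (sgn (suc r) * (E r * y) * J r)
          ≈⟨ +-cong (trans (*-congˡ (D*J r)) (solve 2 (λ s E → s :* E :* :1 := :- ((:- :1 :* s) :* E)) refl (sgn r) (E r))) (*-congˡ (*-congʳ (*-congˡ (sym (E-shift r))))) ⟩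
        - (sgn (suc r) * E r) + z * (sgn (suc r) * E′ r * J r) ∎
        where y = q ^ suc r

-- The finite Jacobi triple product and its form for nilpotent arguments.

module FiniteTripleProduct (R : CommutativeRing 0ℓ 0ℓ) (x y Q : CommutativeRing.Carrier R)
  (xy : CommutativeRing._≈_ R (CommutativeRing._*_ R x y) Q) where
  open RingKit R

  -- Gaussian binomial coefficients in Q. This Pascal rule matches multiplication by a factor in x;
  -- the other one, `bin-pascal`, matches a factor in y.
  bin : ℕ → ℕ → Carrier
  bin N zero = 1#
  bin zero (suc i) = 0#
  bin (suc N) (suc i) = bin N (suc i) + Q ^ (N ∸ i) * bin N i

  bin-< : ∀ {N i} → N ℕ.< i → bin N i ≈ 0#
  bin-< {zero} {suc i} _ = refl
  bin-< {suc N} {suc i} (s≤s p) = begin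
    bin N (suc i) + Q ^ (N ∸ i) * bin N i   ≈⟨ +-cong (bin-< (ℕₚ.m<n⇒m<1+n p)) (*-congˡ (bin-< p)) ⟩
    0# + Q ^ (N ∸ i) * 0#                   ≈⟨ solve 1 (λ x → con (+ 0) :+ x :* con (+ 0) := con (+ 0)) refl _ ⟩
    0#                                      ∎

  bin-pascal : ∀ N i → bin (suc N) (suc i) ≈ bin N i + Q ^ suc i * bin N (suc i)
  bin-pascal zero zero = solve 1 (λ Q → con (+ 0) :+ :1 :* :1 := :1 :+ (Q :* :1) :* con (+ 0)) refl Q
  bin-pascal zero (suc i) = solve 1 (λ Q → con (+ 0) :+ :1 :* con (+ 0) := con (+ 0) :+ Q :* con (+ 0)) refl (Q ^ suc (suc i))
  bin-pascal (suc N) zero = begin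
    (bin N 1 + Q ^ N * 1#) + (Q * Q ^ N) * 1#      ≈⟨ +-congʳ (bin-pascal N 0) ⟩
    (1# + (Q * 1#) * bin N 1) + (Q * Q ^ N) * 1#   ≈⟨ solve 3 (λ Q p b → (:1 :+ (Q :* :1) :* b) :+ (Q :* p) :* :1 := :1 :+ (Q :* :1) :* (b :+ p :* :1)) refl Q (Q ^ N) (bin N 1) ⟩
    1# + (Q * 1#) * (bin N 1 + Q ^ N * 1#)         ∎
  bin-pascal (suc N) (suc i) = begin
    bin (suc N) (suc (suc i)) + P * bin (suc N) (suc i)
      ≈⟨ +-cong (bin-pascal N (suc i)) (*-congˡ (bin-pascal N i)) ⟩
    (b₁ + q₂ * b₂) + P * (b₀ + q₁ * b₁)
      ≈⟨ solve 6 (λ b₀ b₁ b₂ P q₁ q₂ → (b₁ :+ q₂ :* b₂) :+ P :* (b₀ :+ q₁ :* b₁) := (b₁ :+ P :* b₀ :+ q₂ :* b₂) :+ P :* q₁ :* b₁) refl b₀ b₁ b₂ P q₁ q₂ ⟩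
    (b₁ + P * b₀ + q₂ * b₂) + P * q₁ * b₁
      ≈⟨ +-congˡ exponents ⟩
    (b₁ + P * b₀ + q₂ * b₂) + q₂ * Q ^ (N ∸ suc i) * b₁
      ≈⟨ solve 6 (λ b₀ b₁ b₂ P q₂ r → (b₁ :+ P :* b₀ :+ q₂ :* b₂) :+ q₂ :* r :* b₁ := (b₁ :+ P :* b₀) :+ q₂ :* (b₂ :+ r :* b₁)) refl b₀ b₁ b₂ P q₂ (Q ^ (N ∸ suc i)) ⟩
    (b₁ + P * b₀) + q₂ * (b₂ + Q ^ (N ∸ suc i) * b₁) ∎
    where
    P = Q ^ (N ∸ i)
    q₁ = Q ^ suc i
    q₂ = Q ^ suc (suc i)
    b₀ = bin N i
    b₁ = bin N (suc i)
    b₂ = bin N (suc (suc i))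
    exponents : P * q₁ * b₁ ≈ q₂ * Q ^ (N ∸ suc i) * b₁
    exponents with ℕₚ.≤-<-connex (suc i) N
    ... | inj₂ N<i = trans (trans (*-congˡ (bin-< N<i)) (zeroʳ _)) (sym (trans (*-congˡ (bin-< N<i)) (zeroʳ _)))
    ... | inj₁ i<N = *-congʳ (begin
      Q ^ (N ∸ i) * Q ^ suc i                   ≈⟨ ^-homo-* Q (N ∸ i) (suc i) ⟨
      Q ^ (N ∸ i ℕ.+ suc i)                     ≡⟨ ≡.cong (Q ^_) same ⟩
      Q ^ (suc (suc i) ℕ.+ (N ∸ suc i))         ≈⟨ ^-homo-* Q (suc (suc i)) (N ∸ suc i) ⟩
      Q ^ suc (suc i) * Q ^ (N ∸ suc i)         ∎)
      where
      same : N ∸ i ℕ.+ suc i ≡ suc (suc i) ℕ.+ (N ∸ suc i)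
      same = ≡.trans (ℕₚ.+-suc (N ∸ i) i) (≡.trans (≡.cong suc (ℕₚ.m∸n+n≡m (ℕₚ.<⇒≤ i<N))) (≡.cong suc (≡.sym (ℕₚ.m+[n∸m]≡n i<N))))

  fact : ℕ → Carrier
  fact n = ∏ n (λ i → 1# - Q ^ suc i)

  bin-fact : ∀ i j → bin (i ℕ.+ j) i * (fact i * fact j) ≈ fact (i ℕ.+ j)
  bin-fact zero j = solve 1 (λ x → :1 :* (:1 :* x) := x) refl (fact j)
  bin-fact (suc i) j = begin
    (bin N (suc i) + Q ^ (N ∸ i) * bin N i) * (fact i * (1# - q₁) * fact j)
      ≈⟨ *-congʳ (+-congˡ (*-congʳ (reflexive (≡.cong (Q ^_) (ℕₚ.m+n∸m≡n i j))))) ⟩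
    (bin N (suc i) + Q ^ j * bin N i) * (fact i * (1# - q₁) * fact j)
      ≈⟨ solve 6 (λ b′ p b f q₁ h → (b′ :+ p :* b) :* (f :* (:1 :- q₁) :* h) := b′ :* (f :* (:1 :- q₁) :* h) :+ (p :* (:1 :- q₁)) :* (b :* (f :* h))) refl
           (bin N (suc i)) (Q ^ j) (bin N i) (fact i) q₁ (fact j) ⟩
    bin N (suc i) * (fact (suc i) * fact j) + (Q ^ j * (1# - q₁)) * (bin N i * (fact i * fact j))
      ≈⟨ +-cong (first j) (*-congˡ (bin-fact i j)) ⟩
    (1# - Q ^ j) * fact N + (Q ^ j * (1# - q₁)) * fact N
      ≈⟨ solve 3 (λ p q₁ f → (:1 :- p) :* f :+ (p :* (:1 :- q₁)) :* f := f :* (:1 :- q₁ :* p)) refl (Q ^ j) q₁ (fact N) ⟩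
    fact N * (1# - q₁ * Q ^ j)
      ≈⟨ *-congˡ (+-congˡ (-‿cong (^-homo-* Q (suc i) j))) ⟨
    fact N * (1# - Q ^ suc N) ∎
    where
    N = i ℕ.+ j
    q₁ = Q ^ suc i
    first : ∀ j → bin (i ℕ.+ j) (suc i) * (fact (suc i) * fact j) ≈ (1# - Q ^ j) * fact (i ℕ.+ j)
    first zero = trans (*-congʳ (bin-< (s≤s (ℕₚ.≤-reflexive (ℕₚ.+-identityʳ i)))))
      (solve 2 (λ x y → con (+ 0) :* x := (:1 :- :1) :* y) refl _ _)
    first (suc j) = begin
      bin (i ℕ.+ suc j) (suc i) * (fact (suc i) * (fact j * (1# - Q ^ suc j)))
        ≡⟨ ≡.cong (λ z → bin z (suc i) * (fact (suc i) * (fact j * (1# - Q ^ suc j)))) (ℕₚ.+-suc i j) ⟩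
      bin (suc i ℕ.+ j) (suc i) * (fact (suc i) * (fact j * (1# - Q ^ suc j)))
        ≈⟨ solve 4 (λ b f h w → b :* (f :* (h :* w)) := w :* (b :* (f :* h))) refl _ _ _ _ ⟩
      (1# - Q ^ suc j) * (bin (suc i ℕ.+ j) (suc i) * (fact (suc i) * fact j))
        ≈⟨ *-congˡ (bin-fact (suc i) j) ⟩
      (1# - Q ^ suc j) * fact (suc i ℕ.+ j)
        ≡⟨ ≡.cong (λ z → (1# - Q ^ suc j) * fact z) (≡.sym (ℕₚ.+-suc i j)) ⟩
      (1# - Q ^ suc j) * fact (i ℕ.+ suc j) ∎

  tri : ℕ → ℕ
  tri zero = 0
  tri (suc j) = tri j ℕ.+ j

  X Y : ℕ → Carrier
  X j = (- x) ^ j * Q ^ tri j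
  Y j = (- y) ^ j * Q ^ tri j

  -- T n i is the theta term with index i − n ∈ ℤ
  T : ℕ → ℕ → Carrier
  T zero i = X i
  T (suc n) zero = Y (suc n)
  T (suc n) (suc i) = T n i

  T-zero : ∀ n → T n 0 ≈ Y n
  T-zero zero = refl
  T-zero (suc n) = refl

  step : ∀ z j → (- z) ^ suc j * Q ^ tri (suc j) ≈ (- z) * Q ^ j * ((- z) ^ j * Q ^ tri j)
  step z j = begin
    (- z) * (- z) ^ j * Q ^ (tri j ℕ.+ j)       ≈⟨ *-congˡ (^-homo-* Q (tri j) j) ⟩
    (- z) * (- z) ^ j * (Q ^ tri j * Q ^ j)     ≈⟨ solve 4 (λ z a b c → z :* a :* (b :* c) := z :* c :* (a :* b)) refl _ _ _ _ ⟩
    (- z) * Q ^ j * ((- z) ^ j * Q ^ tri j)     ∎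

  -- Multiplication by -x and a power of Q raises the index of a theta term by one. At negative
  -- indices a power of y is lost instead of a power of x gained, and this is where xy = Q is used.
  T-x : ∀ m n i → i ℕ.≤ m ℕ.+ n → (- x) * Q ^ m * T n i ≈ Q ^ (m ℕ.+ n ∸ i) * T n (suc i)
  T-x m zero i i≤m = begin
    (- x) * Q ^ m * X i
      ≡⟨ ≡.cong (λ z → (- x) * Q ^ z * X i) (≡.sym (ℕₚ.m∸n+n≡m (≡.subst (i ℕ.≤_) (ℕₚ.+-identityʳ m) i≤m))) ⟩
    (- x) * Q ^ (m ∸ i ℕ.+ i) * X i
      ≈⟨ *-congʳ (*-congˡ (^-homo-* Q (m ∸ i) i)) ⟩
    (- x) * (Q ^ (m ∸ i) * Q ^ i) * X i
      ≈⟨ solve 4 (λ x a b c → x :* (a :* b) :* c := a :* (x :* b :* c)) refl _ _ _ _ ⟩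
    Q ^ (m ∸ i) * ((- x) * Q ^ i * X i)
      ≈⟨ *-congˡ (sym (step x i)) ⟩
    Q ^ (m ∸ i) * X (suc i)
      ≡⟨ ≡.cong (λ z → Q ^ (z ∸ i) * X (suc i)) (≡.sym (ℕₚ.+-identityʳ m)) ⟩
    Q ^ (m ℕ.+ 0 ∸ i) * X (suc i) ∎
  T-x m (suc n) zero _ = begin
    (- x) * Q ^ m * Y (suc n)
      ≈⟨ *-congˡ (step y n) ⟩
    (- x) * Q ^ m * ((- y) * Q ^ n * Y n)
      ≈⟨ solve 5 (λ x y a b c → (:- x) :* a :* ((:- y) :* b :* c) := (x :* y) :* (a :* b) :* c) refl x y _ _ _ ⟩
    (x * y) * (Q ^ m * Q ^ n) * Y n
      ≈⟨ *-congʳ (*-cong xy (sym (^-homo-* Q m n))) ⟩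
    Q ^ suc (m ℕ.+ n) * Y n
      ≈⟨ *-cong (reflexive (≡.cong (Q ^_) (≡.sym (ℕₚ.+-suc m n)))) (sym (T-zero n)) ⟩
    Q ^ (m ℕ.+ suc n) * T n 0 ∎
  T-x m (suc n) (suc i) i<m = begin
    (- x) * Q ^ m * T n i              ≈⟨ T-x m n i (ℕₚ.≤-pred (≡.subst (suc i ℕ.≤_) (ℕₚ.+-suc m n) i<m)) ⟩
    Q ^ (m ℕ.+ n ∸ i) * T n (suc i)    ≡⟨ ≡.cong (λ z → Q ^ (z ∸ suc i) * T n (suc i)) (≡.sym (ℕₚ.+-suc m n)) ⟩
    Q ^ (m ℕ.+ suc n ∸ suc i) * T n (suc i) ∎

  T-y : ∀ n i → i ℕ.≤ n → (- y) * Q ^ n * T n i ≈ Q ^ i * T (suc n) i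
  T-y n zero _ = trans (*-congˡ (T-zero n)) (trans (sym (step y n)) (sym (*-identityˡ _)))
  T-y (suc n) (suc i) (s≤s i≤n) = begin
    (- y) * (Q * Q ^ n) * T n i      ≈⟨ solve 4 (λ y Q p t → y :* (Q :* p) :* t := Q :* (y :* p :* t)) refl _ _ _ _ ⟩
    Q * ((- y) * Q ^ n * T n i)      ≈⟨ *-congˡ (T-y n i i≤n) ⟩
    Q * (Q ^ i * T (suc n) i)        ≈⟨ *-assoc _ _ _ ⟨
    Q ^ suc i * T (suc n) i          ∎

  product-y : ∀ n → ∏ n (λ i → 1# - y * Q ^ i) ≈ ∑ (suc n) (λ i → bin n i * T n i)
  product-y zero = solve 0 (:1 := con (+ 0) :+ :1 :* (:1 :* :1)) refl
  product-y (suc n) = begin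
    ∏ n (λ i → 1# - y * Q ^ i) * (1# - y * Q ^ n)
      ≈⟨ *-congʳ (product-y n) ⟩
    ∑ (suc n) (λ i → bin n i * T n i) * (1# - y * Q ^ n)
      ≈⟨ ∑-*ʳ (suc n) _ _ ⟨
    ∑ (suc n) (λ i → bin n i * T n i * (1# - y * Q ^ n))
      ≈⟨ ∑-cong< (suc n) (λ i p → trans
           (solve 4 (λ b t y w → b :* t :* (:1 :- y :* w) := b :* ((:- y) :* w :* t) :+ b :* t) refl (bin n i) (T n i) y (Q ^ n))
           (+-congʳ (*-congˡ (T-y n i (ℕₚ.≤-pred p))))) ⟩
    ∑ (suc n) (λ i → bin n i * (Q ^ i * T (suc n) i) + bin n i * T (suc n) (suc i))
      ≈⟨ ∑-+ (suc n) _ _ ⟩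
    ∑ (suc n) (λ i → bin n i * (Q ^ i * T (suc n) i)) + B
      ≈⟨ +-congʳ (trans (sym (+-identityʳ _)) (+-congˡ (sym (trans (*-congʳ (bin-< {n} ℕₚ.≤-refl)) (zeroˡ _))))) ⟩
    ∑ (suc (suc n)) (λ i → bin n i * (Q ^ i * T (suc n) i)) + B
      ≈⟨ +-congʳ (∑-head (suc n) _) ⟩
    (1# * (1# * T (suc n) 0) + ∑ (suc n) (λ i → bin n (suc i) * (Q ^ suc i * T (suc n) (suc i)))) + B
      ≈⟨ trans (+-assoc _ _ _) (+-cong (*-congˡ (*-identityˡ _)) (sym (∑-+ (suc n) _ _))) ⟩
    1# * T (suc n) 0 + ∑ (suc n) (λ i → bin n (suc i) * (Q ^ suc i * T n i) + bin n i * T n i)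
      ≈⟨ +-congˡ (∑-cong (suc n) (λ i → trans
           (solve 4 (λ b′ q t b → b′ :* (q :* t) :+ b :* t := (b :+ q :* b′) :* t) refl (bin n (suc i)) (Q ^ suc i) (T n i) (bin n i))
           (*-congʳ (sym (bin-pascal n i))))) ⟩
    1# * T (suc n) 0 + ∑ (suc n) (λ i → bin (suc n) (suc i) * T (suc n) (suc i))
      ≈⟨ ∑-head (suc n) _ ⟨
    ∑ (suc (suc n)) (λ i → bin (suc n) i * T (suc n) i) ∎
    where B = ∑ (suc n) (λ i → bin n i * T (suc n) (suc i))

  product-xy : ∀ m n → ∏ m (λ i → 1# - x * Q ^ i) * ∏ n (λ i → 1# - y * Q ^ i)
    ≈ ∑ (suc (m ℕ.+ n)) (λ i → bin (m ℕ.+ n) i * T n i)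
  product-xy zero n = trans (*-identityˡ _) (product-y n)
  product-xy (suc m) n = begin
    ∏ m (λ i → 1# - x * Q ^ i) * (1# - x * Q ^ m) * ∏ n (λ i → 1# - y * Q ^ i)
      ≈⟨ solve 3 (λ a b c → a :* b :* c := (a :* c) :* b) refl _ _ _ ⟩
    (∏ m (λ i → 1# - x * Q ^ i) * ∏ n (λ i → 1# - y * Q ^ i)) * (1# - x * Q ^ m)
      ≈⟨ *-congʳ (product-xy m n) ⟩
    ∑ (suc N) (λ i → bin N i * T n i) * (1# - x * Q ^ m)
      ≈⟨ ∑-*ʳ (suc N) _ _ ⟨
    ∑ (suc N) (λ i → bin N i * T n i * (1# - x * Q ^ m))
      ≈⟨ ∑-cong< (suc N) (λ i p → trans
           (solve 4 (λ b t x w → b :* t :* (:1 :- x :* w) := b :* t :+ b :* ((:- x) :* w :* t)) refl (bin N i) (T n i) x (Q ^ m))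
           (+-congˡ (*-congˡ (T-x m n i (ℕₚ.≤-pred p))))) ⟩
    ∑ (suc N) (λ i → bin N i * T n i + bin N i * (Q ^ (N ∸ i) * T n (suc i)))
      ≈⟨ ∑-+ (suc N) _ _ ⟩
    ∑ (suc N) (λ i → bin N i * T n i) + B
      ≈⟨ +-congʳ (trans (sym (+-identityʳ _)) (+-congˡ (sym (trans (*-congʳ (bin-< {N} ℕₚ.≤-refl)) (zeroˡ _))))) ⟩
    ∑ (suc (suc N)) (λ i → bin N i * T n i) + B
      ≈⟨ +-congʳ (∑-head (suc N) _) ⟩
    (1# * T n 0 + ∑ (suc N) (λ i → bin N (suc i) * T n (suc i))) + B
      ≈⟨ trans (+-assoc _ _ _) (+-congˡ (sym (∑-+ (suc N) _ _))) ⟩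
    1# * T n 0 + ∑ (suc N) (λ i → bin N (suc i) * T n (suc i) + bin N i * (Q ^ (N ∸ i) * T n (suc i)))
      ≈⟨ +-congˡ (∑-cong (suc N) (λ i →
           solve 4 (λ b′ t b w → b′ :* t :+ b :* (w :* t) := (b′ :+ w :* b) :* t) refl (bin N (suc i)) (T n (suc i)) (bin N i) (Q ^ (N ∸ i)))) ⟩
    1# * T n 0 + ∑ (suc N) (λ i → bin (suc N) (suc i) * T n (suc i))
      ≈⟨ ∑-head (suc N) _ ⟨
    ∑ (suc (suc N)) (λ i → bin (suc N) i * T n i) ∎
    where
    N = m ℕ.+ n
    B = ∑ (suc N) (λ i → bin N i * (Q ^ (N ∸ i) * T n (suc i)))

  T-sum : ∀ n m → ∑ (suc (m ℕ.+ n)) (T n) ≈ ∑ n (λ j → Y (suc j)) + ∑ (suc m) X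
  T-sum zero m rewrite ℕₚ.+-identityʳ m = sym (+-identityˡ _)
  T-sum (suc n) m rewrite ℕₚ.+-suc m n = begin
    ∑ (suc (suc (m ℕ.+ n))) (T (suc n))                            ≈⟨ ∑-head (suc (m ℕ.+ n)) _ ⟩
    Y (suc n) + ∑ (suc (m ℕ.+ n)) (T n)                            ≈⟨ +-congˡ (T-sum n m) ⟩
    Y (suc n) + (∑ n (λ j → Y (suc j)) + ∑ (suc m) X)              ≈⟨ solve 3 (λ y a b → y :+ (a :+ b) := (a :+ y) :+ b) refl _ _ _ ⟩
    (∑ n (λ j → Y (suc j)) + Y (suc n)) + ∑ (suc m) X              ∎

  T-lo : ∀ n i → i ℕ.≤ n → T n i ≈ Y (n ∸ i)
  T-lo n zero _ = T-zero n
  T-lo (suc n) (suc i) (s≤s p) = T-lo n i p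

  T-hi : ∀ n i → T n (n ℕ.+ i) ≡ X i
  T-hi zero i = ≡.refl
  T-hi (suc n) i = T-hi n i

  module _ (K : ℕ) (x-nil : x ^ K ≈ 0#) (y-nil : y ^ K ≈ 0#) (Q-nil : Q ^ K ≈ 0#) where

    pow-nil : ∀ {z} → z ^ K ≈ 0# → ∀ i → K ℕ.≤ i → z ^ i ≈ 0#
    pow-nil {z} z-nil i K≤i = begin
      z ^ i                    ≡⟨ ≡.cong (z ^_) (ℕₚ.m+[n∸m]≡n K≤i) ⟨
      z ^ (K ℕ.+ (i ∸ K))      ≈⟨ ^-homo-* z K (i ∸ K) ⟩
      z ^ K * z ^ (i ∸ K)      ≈⟨ trans (*-congʳ z-nil) (zeroˡ _) ⟩
      0#                       ∎

    neg-nil : ∀ {z} → z ^ K ≈ 0# → ∀ i → K ℕ.≤ i → (- z) ^ i ≈ 0#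
    neg-nil {z} z-nil i K≤i = begin
      (- z) ^ i               ≈⟨ ^-congˡ i (-1*x≈-x z) ⟨
      (- 1# * z) ^ i          ≈⟨ ^-distrib-* (- 1#) z i ⟩
      (- 1#) ^ i * z ^ i      ≈⟨ trans (*-congˡ (pow-nil z-nil i K≤i)) (zeroʳ _) ⟩
      0#                      ∎

    X-nil : ∀ i → K ℕ.≤ i → X i ≈ 0#
    X-nil i p = trans (*-congʳ (neg-nil x-nil i p)) (zeroˡ _)

    Y-nil : ∀ i → K ℕ.≤ i → Y i ≈ 0#
    Y-nil i p = trans (*-congʳ (neg-nil y-nil i p)) (zeroˡ _)

    fact-stable : ∀ j → fact (K ℕ.+ j) ≈ fact K
    fact-stable j = trans (∏-split K j _) (trans (*-congˡ (∏-one< j (λ i _ →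
      trans (+-congˡ (-‿cong (pow-nil Q-nil _ (ℕₚ.≤-trans (ℕₚ.m≤m+n K i) (ℕₚ.n≤1+n _)))))
            (solve 0 (:1 :- con (+ 0) := :1) refl)))) (*-identityʳ _))

    -- With 2K factors on each side, a nonzero theta term has index less than K in absolute value.
    -- Its Gaussian binomial then has both i and the complementary index at least K, so that
    -- multiplied by `fact K` it is 1.
    tripleProduct : Unit (fact K) →
      fact K * (∏ (K ℕ.+ K) (λ i → 1# - x * Q ^ i) * ∏ (K ℕ.+ K) (λ i → 1# - y * Q ^ i))
      ≈ 1# + ∑ K (λ j → X (suc j) + Y (suc j))
    tripleProduct unit = begin
      fact K * (∏ M (λ i → 1# - x * Q ^ i) * ∏ M (λ i → 1# - y * Q ^ i))
        ≈⟨ *-congˡ (product-xy M M) ⟩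
      fact K * ∑ (suc (M ℕ.+ M)) (λ i → bin (M ℕ.+ M) i * T M i)
        ≈⟨ ∑-*ˡ (suc (M ℕ.+ M)) _ _ ⟨
      ∑ (suc (M ℕ.+ M)) (λ i → fact K * (bin (M ℕ.+ M) i * T M i))
        ≈⟨ ∑-cong< (suc (M ℕ.+ M)) (λ i p → drop i (ℕₚ.≤-pred p)) ⟩
      ∑ (suc (M ℕ.+ M)) (T M)
        ≈⟨ T-sum M M ⟩
      ∑ M (λ j → Y (suc j)) + ∑ (suc M) X
        ≈⟨ +-cong (cut Y Y-nil) (∑-head M X) ⟩
      ∑ K (λ j → Y (suc j)) + (1# * 1# + ∑ M (λ j → X (suc j)))
        ≈⟨ +-congˡ (+-cong (*-identityʳ 1#) (cut X X-nil)) ⟩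
      ∑ K (λ j → Y (suc j)) + (1# + ∑ K (λ j → X (suc j)))
        ≈⟨ solve 2 (λ a b → a :+ (:1 :+ b) := :1 :+ (b :+ a)) refl _ _ ⟩
      1# + (∑ K (λ j → X (suc j)) + ∑ K (λ j → Y (suc j)))
        ≈⟨ +-congˡ (∑-+ K _ _) ⟨
      1# + ∑ K (λ j → X (suc j) + Y (suc j)) ∎
      where
      M = K ℕ.+ K
      cut : ∀ Z → (∀ i → K ℕ.≤ i → Z i ≈ 0#) → ∑ M (λ j → Z (suc j)) ≈ ∑ K (λ j → Z (suc j))
      cut Z h = trans (∑-split K K _) (trans (+-congˡ (∑-zero< K (λ i _ → h _ (ℕₚ.≤-trans (ℕₚ.m≤m+n K i) (ℕₚ.n≤1+n _))))) (+-identityʳ _))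
      bin-one : ∀ i j → fact K * bin ((K ℕ.+ i) ℕ.+ (K ℕ.+ j)) (K ℕ.+ i) ≈ 1#
      bin-one i j = Unit-cancelˡ unit (begin
        fact K * (fact K * bin N (K ℕ.+ i))                    ≈⟨ solve 2 (λ f b → f :* (f :* b) := b :* (f :* f)) refl _ _ ⟩
        bin N (K ℕ.+ i) * (fact K * fact K)                    ≈⟨ *-congˡ (*-cong (fact-stable i) (fact-stable j)) ⟨
        bin N (K ℕ.+ i) * (fact (K ℕ.+ i) * fact (K ℕ.+ j))    ≈⟨ bin-fact (K ℕ.+ i) (K ℕ.+ j) ⟩
        fact N                                                 ≡⟨ ≡.cong fact (ℕₚ.+-assoc K i (K ℕ.+ j)) ⟩
        fact (K ℕ.+ (i ℕ.+ (K ℕ.+ j)))                         ≈⟨ fact-stable _ ⟩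
        fact K                                                 ≈⟨ *-identityʳ _ ⟨
        fact K * 1#                                            ∎)
        where N = (K ℕ.+ i) ℕ.+ (K ℕ.+ j)
      vanish : ∀ i → T M i ≈ 0# → fact K * (bin (M ℕ.+ M) i * T M i) ≈ T M i
      vanish i h = trans (*-congˡ (trans (*-congˡ h) (zeroʳ _))) (trans (zeroʳ _) (sym h))
      drop : ∀ i → i ℕ.≤ M ℕ.+ M → fact K * (bin (M ℕ.+ M) i * T M i) ≈ T M i
      drop i i≤2M with ℕₚ.≤-<-connex K i | ℕₚ.≤-<-connex K (M ℕ.+ M ∸ i)
      ... | inj₂ i<K | _ = vanish i (trans (T-lo M i i≤M) (Y-nil (M ∸ i) (ℕₚ.m+n≤o⇒m≤o∸n K (ℕₚ.+-monoʳ-≤ K (ℕₚ.<⇒≤ i<K)))))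
        where i≤M = ℕₚ.≤-trans (ℕₚ.<⇒≤ i<K) (ℕₚ.m≤m+n K K)
      ... | inj₁ _ | inj₂ j<K = vanish i (trans (reflexive (≡.trans (≡.cong (T M) (≡.sym (ℕₚ.m+[n∸m]≡n M≤i))) (T-hi M (i ∸ M)))) (X-nil (i ∸ M) K≤i-M))
        where
        M+K≤i : M ℕ.+ K ℕ.≤ i
        M+K≤i = ℕₚ.+-cancelʳ-≤ K (M ℕ.+ K) i (ℕₚ.≤-trans (ℕₚ.≤-reflexive (ℕₚ.+-assoc M K K))
          (ℕₚ.≤-trans (ℕₚ.≤-reflexive (≡.sym (ℕₚ.m+[n∸m]≡n i≤2M))) (ℕₚ.+-monoʳ-≤ i (ℕₚ.<⇒≤ j<K))))
        M≤i = ℕₚ.≤-trans (ℕₚ.m≤m+n M K) M+K≤i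
        K≤i-M = ℕₚ.m+n≤o⇒m≤o∸n K (ℕₚ.≤-trans (ℕₚ.≤-reflexive (ℕₚ.+-comm K M)) M+K≤i)
      ... | inj₁ K≤i | inj₁ K≤j = begin
        fact K * (bin (M ℕ.+ M) i * T M i)     ≈⟨ *-assoc _ _ _ ⟨
        fact K * bin (M ℕ.+ M) i * T M i       ≈⟨ *-congʳ (trans (reflexive (≡.cong₂ (λ a b → fact K * bin a b) total (≡.sym (ℕₚ.m+[n∸m]≡n K≤i)))) (bin-one (i ∸ K) (M ℕ.+ M ∸ i ∸ K))) ⟩
        1# * T M i                             ≈⟨ *-identityˡ _ ⟩
        T M i                                  ∎
        where
        total : M ℕ.+ M ≡ (K ℕ.+ (i ∸ K)) ℕ.+ (K ℕ.+ (M ℕ.+ M ∸ i ∸ K))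
        total = ≡.trans (≡.sym (ℕₚ.m+[n∸m]≡n i≤2M)) (≡.cong₂ ℕ._+_ (≡.sym (ℕₚ.m+[n∸m]≡n K≤i)) (≡.sym (ℕₚ.m+[n∸m]≡n K≤j)))

-- Products split modulo 6, and the product formula for B.

module Products (R : CommutativeRing 0ℓ 0ℓ) (q : CommutativeRing.Carrier R) (k : ℕ)
  (q-nil : CommutativeRing._≈_ R (RingKit._^_ R q (suc k)) (CommutativeRing.0# R)) where
  open Nilpotent R q k q-nil

  ∏-stable : ∀ n {f} → (∀ i → k ℕ.≤ i → f i ≈ 1#) → ∏ (K ℕ.+ n) f ≈ ∏ K f
  ∏-stable n h = trans (∏-split K n _) (trans (*-congˡ (∏-one< n (λ i _ → h _ (ℕₚ.≤-trans (ℕₚ.n≤1+n k) (ℕₚ.m≤m+n K i))))) (*-identityʳ _))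

  factor : Carrier → ℕ → Carrier
  factor c n = 1# - c * q ^ n

  factor-unit : ∀ c n → Unit (factor c (suc n))
  factor-unit c n = d-unit c n

  -- (c q^b; q^b)_∞ for b ≥ 1: the omitted factors equal 1.
  P : Carrier → ℕ → Carrier
  P c b = ∏ K (λ i → factor c (b ℕ.* suc i))

  P-extend : ∀ c b n → ∏ (K ℕ.+ n) (λ i → factor c (suc b ℕ.* suc i)) ≈ P c (suc b)
  P-extend c b n = ∏-stable n (λ i k≤i → d≥K c _ (ℕₚ.≤-trans k≤i (ℕₚ.m≤m+n i _)))

  P-unit : ∀ c b → Unit (P c (suc b))
  P-unit c b = Unit-∏ K (λ i → factor-unit c (i ℕ.+ b ℕ.* suc i))

  P-double : ∀ b → P 1# b * P (- 1#) b ≈ P 1# (b ℕ.+ b)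
  P-double b = begin
    P 1# b * P (- 1#) b
      ≈⟨ ∏-* K _ _ ⟨
    ∏ K (λ i → factor 1# (b ℕ.* suc i) * factor (- 1#) (b ℕ.* suc i))
      ≈⟨ ∏-cong K (λ i → begin
           factor 1# (b ℕ.* suc i) * factor (- 1#) (b ℕ.* suc i)
             ≈⟨ solve 1 (λ x → (:1 :- :1 :* x) :* (:1 :- (:- :1) :* x) := :1 :- :1 :* (x :* x)) refl (q ^ (b ℕ.* suc i)) ⟩
           1# - 1# * (q ^ (b ℕ.* suc i) * q ^ (b ℕ.* suc i))
             ≈⟨ +-congˡ (-‿cong (*-congˡ (trans (sym (^-homo-* q (b ℕ.* suc i) (b ℕ.* suc i))) (reflexive (≡.cong (q ^_) (≡.sym (ℕₚ.*-distribʳ-+ (suc i) b b))))))) ⟩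
           factor 1# ((b ℕ.+ b) ℕ.* suc i) ∎) ⟩
    P 1# (b ℕ.+ b) ∎

  private
    M : ℕ
    M = K ℕ.+ K

    F : ℕ → Carrier
    F = factor 1#

    -- (q^(r+1); q⁶)_∞, with the 2K factors that the triple product delivers.
    col : ℕ → Carrier
    col r = ∏ M (λ i → F (suc (i ℕ.* 6 ℕ.+ r)))

    col-unit : ∀ r → Unit (col r)
    col-unit r = Unit-∏ M (λ i → factor-unit 1# (i ℕ.* 6 ℕ.+ r))

    extend : ∀ b m → ∏ (M ℕ.* suc m) (λ i → F (suc b ℕ.* suc i)) ≈ P 1# (suc b)
    extend b m = trans (reflexive (≡.cong (λ z → ∏ z (λ i → F (suc b ℕ.* suc i)))
      (≡.trans (ℕₚ.*-suc M m) (ℕₚ.+-assoc K K (M ℕ.* m))))) (P-extend 1# b (K ℕ.+ M ℕ.* m))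

    P₁ : P 1# 1 ≈ col 0 * col 1 * col 2 * col 3 * col 4 * col 5
    P₁ = begin
      P 1# 1
        ≈⟨ extend 0 5 ⟨
      ∏ (M ℕ.* 6) (λ i → F (1 ℕ.* suc i))
        ≈⟨ ∏-blocks 6 M _ ⟩
      ∏ M (λ i → ∏ 6 (λ r → F (1 ℕ.* suc (i ℕ.* 6 ℕ.+ r))))
        ≈⟨ ∏-cong M (λ i → trans (∏-cong 6 (λ r → reflexive (≡.cong F (ℕₚ.*-identityˡ (suc (i ℕ.* 6 ℕ.+ r))))))
             (solve 6 (λ a b c d e f → :1 :* a :* b :* c :* d :* e :* f := a :* b :* c :* d :* e :* f) refl _ _ _ _ _ _)) ⟩
      ∏ M (λ i → G i 0 * G i 1 * G i 2 * G i 3 * G i 4 * G i 5)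
        ≈⟨ trans (∏-* M _ _) (*-congʳ (trans (∏-* M _ _) (*-congʳ (trans (∏-* M _ _) (*-congʳ (trans (∏-* M _ _) (*-congʳ (∏-* M _ _)))))))) ⟩
      col 0 * col 1 * col 2 * col 3 * col 4 * col 5 ∎
      where
      G : ℕ → ℕ → Carrier
      G i r = F (suc (i ℕ.* 6 ℕ.+ r))

    P₂ : P 1# 2 ≈ col 1 * col 3 * col 5
    P₂ = begin
      P 1# 2
        ≈⟨ extend 1 2 ⟨
      ∏ (M ℕ.* 3) (λ i → F (2 ℕ.* suc i))
        ≈⟨ ∏-blocks 3 M _ ⟩
      ∏ M (λ i → ∏ 3 (λ r → F (2 ℕ.* suc (i ℕ.* 3 ℕ.+ r))))
        ≈⟨ ∏-cong M (λ i → trans (∏-cong 3 (λ r → reflexive (≡.cong F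
             (ℕsolve 2 (λ i r → κ 2 ⊠ (κ 1 ⊞ (i ⊠ κ 3 ⊞ r)) ≔ κ 1 ⊞ (i ⊠ κ 6 ⊞ (κ 1 ⊞ κ 2 ⊠ r))) ≡.refl i r))))
             (solve 3 (λ a b c → :1 :* a :* b :* c := a :* b :* c) refl _ _ _)) ⟩
      ∏ M (λ i → G i 1 * G i 3 * G i 5)
        ≈⟨ trans (∏-* M _ _) (*-congʳ (∏-* M _ _)) ⟩
      col 1 * col 3 * col 5 ∎
      where
      G : ℕ → ℕ → Carrier
      G i r = F (suc (i ℕ.* 6 ℕ.+ r))

    P₃ : P 1# 3 ≈ col 2 * col 5
    P₃ = begin
      P 1# 3
        ≈⟨ extend 2 1 ⟨
      ∏ (M ℕ.* 2) (λ i → F (3 ℕ.* suc i))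
        ≈⟨ ∏-blocks 2 M _ ⟩
      ∏ M (λ i → ∏ 2 (λ r → F (3 ℕ.* suc (i ℕ.* 2 ℕ.+ r))))
        ≈⟨ ∏-cong M (λ i → trans (∏-cong 2 (λ r → reflexive (≡.cong F
             (ℕsolve 2 (λ i r → κ 3 ⊠ (κ 1 ⊞ (i ⊠ κ 2 ⊞ r)) ≔ κ 1 ⊞ (i ⊠ κ 6 ⊞ (κ 2 ⊞ κ 3 ⊠ r))) ≡.refl i r))))
             (solve 2 (λ a b → :1 :* a :* b := a :* b) refl _ _)) ⟩
      ∏ M (λ i → F (suc (i ℕ.* 6 ℕ.+ 2)) * F (suc (i ℕ.* 6 ℕ.+ 5)))
        ≈⟨ ∏-* M _ _ ⟩
      col 2 * col 5 ∎

    P₆ : P 1# 6 ≈ col 5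
    P₆ = trans (sym (P-extend 1# 5 K)) (∏-cong M (λ i → reflexive (≡.cong F
      (ℕsolve 1 (λ i → κ 6 ⊠ (κ 1 ⊞ i) ≔ κ 1 ⊞ (i ⊠ κ 6 ⊞ κ 5)) ≡.refl i))))

    -- Euler's identity (q; q²)_∞ (-q; q)_∞ = 1, with the odd exponents split modulo 6.
    odd₁ : (col 0 * col 4) * col 2 * P (- 1#) 1 ≈ 1#
    odd₁ = Unit-cancelˡ (Unit-* (Unit-* (col-unit 1) (col-unit 3)) (col-unit 5)) (begin
      col 1 * col 3 * col 5 * ((col 0 * col 4) * col 2 * P (- 1#) 1)
        ≈⟨ solve 7 (λ a b c d e f p → b :* d :* f :* ((a :* e) :* c :* p) := a :* b :* c :* d :* e :* f :* p) refl
             (col 0) (col 1) (col 2) (col 3) (col 4) (col 5) (P (- 1#) 1) ⟩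
      col 0 * col 1 * col 2 * col 3 * col 4 * col 5 * P (- 1#) 1
        ≈⟨ *-congʳ P₁ ⟨
      P 1# 1 * P (- 1#) 1
        ≈⟨ trans (P-double 1) P₂ ⟩
      col 1 * col 3 * col 5
        ≈⟨ *-identityʳ _ ⟨
      col 1 * col 3 * col 5 * 1# ∎)

    odd₃ : col 2 * P (- 1#) 3 ≈ 1#
    odd₃ = Unit-cancelˡ (col-unit 5) (begin
      col 5 * (col 2 * P (- 1#) 3)     ≈⟨ solve 3 (λ a b p → a :* (b :* p) := b :* a :* p) refl _ _ _ ⟩
      col 2 * col 5 * P (- 1#) 3       ≈⟨ *-congʳ P₃ ⟨
      P 1# 3 * P (- 1#) 3              ≈⟨ trans (P-double 3) P₆ ⟩
      col 5                            ≈⟨ *-identityʳ _ ⟨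
      col 5 * 1#                       ∎)

    -- (q, q⁵; q⁶)_∞ (-q; q)_∞ = (-q³; q³)_∞: Euler's identity for q divided by the one for q³.
    sixth : (col 0 * col 4) * P (- 1#) 1 ≈ P (- 1#) 3
    sixth = begin
      c * p                            ≈⟨ *-identityʳ _ ⟨
      c * p * 1#                       ≈⟨ *-congˡ odd₃ ⟨
      c * p * (col 2 * p₃)             ≈⟨ solve 4 (λ c p z p₃ → c :* p :* (z :* p₃) := c :* z :* p :* p₃) refl c p (col 2) p₃ ⟩
      c * col 2 * p * p₃               ≈⟨ *-congʳ odd₁ ⟩
      1# * p₃                          ≈⟨ *-identityˡ _ ⟩
      p₃                               ∎
      where
      c = col 0 * col 4
      p = P (- 1#) 1
      p₃ = P (- 1#) 3

  -- Σ_{m∈ℤ} (-1)^m q^{3m²+2m}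
  bSeries : Carrier
  bSeries = 1# + ∑ K (λ j → sgn (suc j) * q ^ (suc j ℕ.* (3 ℕ.* suc j ℕ.+ 2)) + sgn (suc j) * q ^ (suc j ℕ.* (3 ℕ.* j ℕ.+ 1)))

  private
    -- The base point x = q⁵, y = q, Q = q⁶ is forced by the exponents: 5n + 3n(n - 1) = 3n² + 2n
    -- for m = n, and n + 3n(n - 1) = 3n² - 2n for m = -n.
    module TP = FiniteTripleProduct R (q ^ 5) (q ^ 1) (q ^ 6) (sym (^-homo-* q 5 1))

    power-nil : ∀ b → (q ^ suc b) ^ K ≈ 0#
    power-nil b = trans (^-assocʳ q (suc b) K) (q^≥K _ (ℕₚ.m≤m+n K (b ℕ.* K)))

    fact≈ : TP.fact K ≈ P 1# 6
    fact≈ = ∏-cong K (λ i → +-congˡ (-‿cong (trans (^-assocʳ q 6 (suc i)) (sym (*-identityˡ _)))))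

    column : ∀ r → ∏ M (λ i → 1# - q ^ suc r * (q ^ 6) ^ i) ≈ col r
    column r = ∏-cong M (λ i → +-congˡ (-‿cong (begin
      q ^ suc r * (q ^ 6) ^ i          ≈⟨ *-congˡ (^-assocʳ q 6 i) ⟩
      q ^ suc r * q ^ (6 ℕ.* i)        ≈⟨ ^-homo-* q (suc r) (6 ℕ.* i) ⟨
      q ^ suc (r ℕ.+ 6 ℕ.* i)          ≡⟨ ≡.cong (q ^_) (ℕsolve 2 (λ r i → κ 1 ⊞ (r ⊞ κ 6 ⊠ i) ≔ κ 1 ⊞ (i ⊠ κ 6 ⊞ r)) ≡.refl r i) ⟩
      q ^ suc (i ℕ.* 6 ℕ.+ r)          ≈⟨ *-identityˡ _ ⟨
      1# * q ^ suc (i ℕ.* 6 ℕ.+ r)     ∎)))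

    tri-sq : ∀ j → TP.tri j ℕ.+ TP.tri j ℕ.+ j ≡ j ℕ.* j
    tri-sq zero = ≡.refl
    tri-sq (suc j) = ≡.trans (ℕsolve 2 (λ t j → (t ⊞ j) ⊞ (t ⊞ j) ⊞ (κ 1 ⊞ j) ≔ (t ⊞ t ⊞ j) ⊞ (κ 1 ⊞ (j ⊞ j))) ≡.refl (TP.tri j) j)
      (≡.trans (≡.cong (ℕ._+ (1 ℕ.+ (j ℕ.+ j))) (tri-sq j)) (ℕsolve 1 (λ j → j ⊠ j ⊞ (κ 1 ⊞ (j ⊞ j)) ≔ (κ 1 ⊞ j) ⊠ (κ 1 ⊞ j)) ≡.refl j))

    term : ∀ b n e → b ℕ.* n ℕ.+ 6 ℕ.* TP.tri n ≡ e → (- (q ^ b)) ^ n * (q ^ 6) ^ TP.tri n ≈ sgn n * q ^ e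
    term b n e eq = begin
      (- (q ^ b)) ^ n * (q ^ 6) ^ TP.tri n              ≈⟨ *-cong (trans (^-congˡ n (sym (-1*x≈-x _))) (^-distrib-* (- 1#) (q ^ b) n)) (^-assocʳ q 6 (TP.tri n)) ⟩
      sgn n * (q ^ b) ^ n * q ^ (6 ℕ.* TP.tri n)        ≈⟨ trans (*-assoc _ _ _) (*-congˡ (*-congʳ (^-assocʳ q b n))) ⟩
      sgn n * (q ^ (b ℕ.* n) * q ^ (6 ℕ.* TP.tri n))    ≈⟨ *-congˡ (trans (sym (^-homo-* q (b ℕ.* n) (6 ℕ.* TP.tri n))) (reflexive (≡.cong (q ^_) eq))) ⟩
      sgn n * q ^ e                                     ∎

    e₅ : ∀ n → 5 ℕ.* n ℕ.+ 6 ℕ.* TP.tri n ≡ n ℕ.* (3 ℕ.* n ℕ.+ 2)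
    e₅ n = ≡.trans (ℕsolve 2 (λ n t → κ 5 ⊠ n ⊞ κ 6 ⊠ t ≔ κ 3 ⊠ (t ⊞ t ⊞ n) ⊞ κ 2 ⊠ n) ≡.refl n (TP.tri n))
      (≡.trans (≡.cong (λ z → 3 ℕ.* z ℕ.+ 2 ℕ.* n) (tri-sq n)) (ℕsolve 1 (λ n → κ 3 ⊠ (n ⊠ n) ⊞ κ 2 ⊠ n ≔ n ⊠ (κ 3 ⊠ n ⊞ κ 2)) ≡.refl n))

    e₁ : ∀ j → 1 ℕ.* suc j ℕ.+ 6 ℕ.* TP.tri (suc j) ≡ suc j ℕ.* (3 ℕ.* j ℕ.+ 1)
    e₁ j = ≡.trans (ℕsolve 2 (λ j t → κ 1 ⊠ (κ 1 ⊞ j) ⊞ κ 6 ⊠ (t ⊞ j) ≔ κ 3 ⊠ (t ⊞ t ⊞ j) ⊞ (κ 1 ⊞ κ 4 ⊠ j)) ≡.refl j (TP.tri j))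
      (≡.trans (≡.cong (λ z → 3 ℕ.* z ℕ.+ (1 ℕ.+ 4 ℕ.* j)) (tri-sq j)) (ℕsolve 1 (λ j → κ 3 ⊠ (j ⊠ j) ⊞ (κ 1 ⊞ κ 4 ⊠ j) ≔ (κ 1 ⊞ j) ⊠ (κ 3 ⊠ j ⊞ κ 1)) ≡.refl j))

  bSeries-product : bSeries * P (- 1#) 1 ≈ P 1# 6 * P (- 1#) 3
  bSeries-product = begin
    bSeries * P (- 1#) 1
      ≈⟨ *-congʳ (+-congˡ (∑-cong K (λ j → +-cong (term 5 (suc j) _ (e₅ (suc j))) (term 1 (suc j) _ (e₁ j))))) ⟨
    (1# + ∑ K (λ j → TP.X (suc j) + TP.Y (suc j))) * P (- 1#) 1
      ≈⟨ *-congʳ (TP.tripleProduct K (power-nil 4) (power-nil 0) (power-nil 5) (let (a , p) = P-unit 1# 5 in a , trans (*-congʳ fact≈) p)) ⟨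
    TP.fact K * (∏ M (λ i → 1# - q ^ 5 * (q ^ 6) ^ i) * ∏ M (λ i → 1# - q ^ 1 * (q ^ 6) ^ i)) * P (- 1#) 1
      ≈⟨ *-congʳ (*-cong fact≈ (*-cong (column 4) (column 0))) ⟩
    P 1# 6 * (col 4 * col 0) * P (- 1#) 1
      ≈⟨ solve 4 (λ f a b p → f :* (a :* b) :* p := f :* ((b :* a) :* p)) refl _ _ _ _ ⟩
    P 1# 6 * ((col 0 * col 4) * P (- 1#) 1)
      ≈⟨ *-congˡ sixth ⟩
    P 1# 6 * P (- 1#) 3 ∎

-- The product of θ over q, ωq and ω²q.

module ThetaNorm (R : CommutativeRing 0ℓ 0ℓ) (q ω : CommutativeRing.Carrier R) (k : ℕ)
  (q-nil : CommutativeRing._≈_ R (RingKit._^_ R q (suc k)) (CommutativeRing.0# R))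
  (ω²+ω+1 : CommutativeRing._≈_ R (RingKit._+_ R (RingKit._+_ R (RingKit._*_ R ω ω) ω) (CommutativeRing.1# R)) (CommutativeRing.0# R)) where
  open RingKit R
  private
    K = suc k
    module N₀ = Nilpotent R q k q-nil

  scaled-nil : ∀ c → (c * q) ^ K ≈ 0#
  scaled-nil c = trans (^-distrib-* c q K) (trans (*-congˡ q-nil) (zeroʳ _))

  power-nil : ∀ b → (q ^ suc b) ^ K ≈ 0#
  power-nil b = trans (^-assocʳ q (suc b) K) (N₀.q^≥K _ (ℕₚ.m≤m+n K (b ℕ.* K)))

  module N₁ = Nilpotent R (ω * q) k (scaled-nil ω)
  module N₂ = Nilpotent R ((ω * ω) * q) k (scaled-nil (ω * ω))
  module N₃ = Nilpotent R (q ^ 3) k (power-nil 2)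
  module N₉ = Nilpotent R (q ^ 9) k (power-nil 8)
  open Products R q k q-nil using (∏-stable)

  private
    ω³ : ω ^ 3 ≈ 1#
    ω³ = begin
      ω ^ 3                                        ≈⟨ solve 1 (λ w → w :* (w :* (w :* :1)) := :1 :+ (w :* w :+ w :+ :1) :* (w :- :1)) refl ω ⟩
      1# + (ω * ω + ω + 1#) * (ω - 1#)             ≈⟨ +-congˡ (trans (*-congʳ ω²+ω+1) (zeroˡ _)) ⟩
      1# + 0#                                      ≈⟨ +-identityʳ 1# ⟩
      1#                                           ∎

    ω^3i : ∀ i → ω ^ (i ℕ.* 3) ≈ 1#
    ω^3i i = trans (reflexive (≡.cong (ω ^_) (ℕₚ.*-comm i 3))) (trans (sym (^-assocʳ ω 3 i)) (trans (^-congˡ i ω³) (N₀.1^ i)))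

    ω-power : ∀ i r → ω ^ (i ℕ.* 3 ℕ.+ r) ≈ ω ^ r
    ω-power i r = trans (^-homo-* ω (i ℕ.* 3) r) (trans (*-congʳ (ω^3i i)) (*-identityˡ _))

    f : Carrier → ℕ → Carrier
    f c i = N₀.d c i * N₁.d c i * N₂.d c i

    f-expand : ∀ c i r → let z = q ^ suc (i ℕ.* 3 ℕ.+ r) in let o = ω ^ suc r in
      f c (i ℕ.* 3 ℕ.+ r) ≈ (1# - c * z) * (1# - c * (o * z)) * (1# - c * (o * o * z))
    f-expand c i r = *-cong (*-congˡ (+-congˡ (-‿cong (*-congˡ (trans (^-distrib-* ω q n) (*-congʳ o≈))))))
      (+-congˡ (-‿cong (*-congˡ (trans (^-distrib-* (ω * ω) q n) (*-congʳ (trans (^-distrib-* ω ω n) (*-cong o≈ o≈)))))))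
      where
      n = suc (i ℕ.* 3 ℕ.+ r)
      o≈ : ω ^ n ≈ ω ^ suc r
      o≈ = trans (reflexive (≡.cong (ω ^_) (≡.sym (ℕₚ.+-suc (i ℕ.* 3) r)))) (ω-power i (suc r))

    cube : ∀ n → q ^ n * q ^ n * q ^ n ≈ (q ^ 3) ^ n
    cube n = begin
      q ^ n * q ^ n * q ^ n     ≈⟨ solve 1 (λ x → x :* x :* x := x :* (x :* (x :* :1))) refl (q ^ n) ⟩
      (q ^ n) ^ 3               ≈⟨ ^-assocʳ q n 3 ⟩
      q ^ (n ℕ.* 3)             ≡⟨ ≡.cong (q ^_) (ℕₚ.*-comm n 3) ⟩
      q ^ (3 ℕ.* n)             ≈⟨ ^-assocʳ q 3 n ⟨
      (q ^ 3) ^ n               ∎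

  module _ (c : Carrier) (c³ : c * c * c ≈ c) where
    private
      -- Reduction modulo ω² + ω + 1, with the cofactor supplied explicitly.
      vanish : ∀ y z → y + (ω * ω + ω + 1#) * z ≈ y
      vanish y z = trans (+-congˡ (trans (*-congʳ ω²+ω+1) (zeroˡ _))) (+-identityʳ _)

      D₃ : ∀ n → 1# - c * c * c * (q ^ n * q ^ n * q ^ n) ≈ 1# - c * (q ^ 3) ^ n
      D₃ n = +-congˡ (-‿cong (*-cong c³ (cube n)))

      f₀ : ∀ i → f c (i ℕ.* 3 ℕ.+ 0) ≈ N₃.d c (i ℕ.* 3 ℕ.+ 0)
      f₀ i = begin
        f c (i ℕ.* 3 ℕ.+ 0)
          ≈⟨ f-expand c i 0 ⟩
        (1# - c * z) * (1# - c * (ω * 1# * z)) * (1# - c * (ω * 1# * (ω * 1#) * z))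
          ≈⟨ solve 3 (λ c z w → (:1 :- c :* z) :* (:1 :- c :* (w :* :1 :* z)) :* (:1 :- c :* (w :* :1 :* (w :* :1) :* z))
               := (:1 :- c :* c :* c :* (z :* z :* z)) :+ (w :* w :+ w :+ :1) :* (:- (c :* z) :+ c :* c :* z :* z :* w :- c :* c :* c :* z :* z :* z :* (w :- :1))) refl c z ω ⟩
        (1# - c * c * c * (z * z * z)) + (ω * ω + ω + 1#) * _
          ≈⟨ trans (vanish _ _) (D₃ (suc (i ℕ.* 3 ℕ.+ 0))) ⟩
        N₃.d c (i ℕ.* 3 ℕ.+ 0) ∎
        where z = q ^ suc (i ℕ.* 3 ℕ.+ 0)

      f₁ : ∀ i → f c (i ℕ.* 3 ℕ.+ 1) ≈ N₃.d c (i ℕ.* 3 ℕ.+ 1)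
      f₁ i = begin
        f c (i ℕ.* 3 ℕ.+ 1)
          ≈⟨ f-expand c i 1 ⟩
        (1# - c * z) * (1# - c * (o * z)) * (1# - c * (o * o * z))
          ≈⟨ *-congˡ (+-congˡ (-‿cong (*-congˡ (*-congʳ (trans (sym (^-homo-* ω 2 2)) (ω-power 1 1)))))) ⟩
        (1# - c * z) * (1# - c * (o * z)) * (1# - c * (ω * 1# * z))
          ≈⟨ solve 3 (λ c z w → (:1 :- c :* z) :* (:1 :- c :* (w :* (w :* :1) :* z)) :* (:1 :- c :* (w :* :1 :* z))
               := (:1 :- c :* c :* c :* (z :* z :* z)) :+ (w :* w :+ w :+ :1) :* (:- (c :* z) :+ c :* c :* z :* z :* w :- c :* c :* c :* z :* z :* z :* (w :- :1))) refl c z ω ⟩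
        (1# - c * c * c * (z * z * z)) + (ω * ω + ω + 1#) * _
          ≈⟨ trans (vanish _ _) (D₃ (suc (i ℕ.* 3 ℕ.+ 1))) ⟩
        N₃.d c (i ℕ.* 3 ℕ.+ 1) ∎
        where
        z = q ^ suc (i ℕ.* 3 ℕ.+ 1)
        o = ω ^ 2

      f₂ : ∀ i → f c (i ℕ.* 3 ℕ.+ 2) ≈ N₃.d c i * N₃.d c i * N₃.d c i
      f₂ i = begin
        f c (i ℕ.* 3 ℕ.+ 2)
          ≈⟨ f-expand c i 2 ⟩
        (1# - c * z) * (1# - c * (o * z)) * (1# - c * (o * o * z))
          ≈⟨ *-cong (*-congˡ (+-congˡ (-‿cong (*-congˡ (*-congʳ ω³))))) (+-congˡ (-‿cong (*-congˡ (*-congʳ (*-cong ω³ ω³))))) ⟩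
        (1# - c * z) * (1# - c * (1# * z)) * (1# - c * (1# * 1# * z))
          ≈⟨ solve 2 (λ c z → (:1 :- c :* z) :* (:1 :- c :* (:1 :* z)) :* (:1 :- c :* (:1 :* :1 :* z)) := (:1 :- c :* z) :* (:1 :- c :* z) :* (:1 :- c :* z)) refl c z ⟩
        (1# - c * z) * (1# - c * z) * (1# - c * z)
          ≈⟨ *-cong (*-cong same same) same ⟩
        N₃.d c i * N₃.d c i * N₃.d c i ∎
        where
        z = q ^ suc (i ℕ.* 3 ℕ.+ 2)
        o = ω ^ 3
        same : 1# - c * z ≈ N₃.d c i
        same = +-congˡ (-‿cong (*-congˡ (trans (reflexive (≡.cong (q ^_) (ℕsolve 1 (λ i → κ 1 ⊞ (i ⊠ κ 3 ⊞ κ 2) ≔ κ 3 ⊠ (κ 1 ⊞ i)) ≡.refl i))) (sym (^-assocʳ q 3 (suc i))))))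

      ninth : ∀ i → N₉.d c i ≈ N₃.d c (i ℕ.* 3 ℕ.+ 2)
      ninth i = +-congˡ (-‿cong (*-congˡ (begin
        (q ^ 9) ^ suc i                       ≈⟨ ^-assocʳ q 9 (suc i) ⟩
        q ^ (9 ℕ.* suc i)                     ≡⟨ ≡.cong (q ^_) (ℕsolve 1 (λ i → κ 9 ⊠ (κ 1 ⊞ i) ≔ κ 3 ⊠ (κ 1 ⊞ (i ⊠ κ 3 ⊞ κ 2))) ≡.refl i) ⟩
        q ^ (3 ℕ.* suc (i ℕ.* 3 ℕ.+ 2))       ≈⟨ ^-assocʳ q 3 (suc (i ℕ.* 3 ℕ.+ 2)) ⟨
        (q ^ 3) ^ suc (i ℕ.* 3 ℕ.+ 2)         ∎)))

      K*3 : K ℕ.* 3 ≡ K ℕ.+ (K ℕ.+ K)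
      K*3 = ℕsolve 1 (λ k → k ⊠ κ 3 ≔ k ⊞ (k ⊞ k)) ≡.refl K

    -- The three conjugate factors of exponent n multiply to 1 - c³q^(3n) if 3 ∤ n, and to (1 -
    -- cqⁿ)³ if 3 | n. The product in q⁹ supplies the factors of (cq³; q³)_∞ that the first kind
    -- omits. Both c = 1 and c = -1 satisfy c³ = c.
    normProduct : (∏ K (N₀.d c) * ∏ K (N₁.d c) * ∏ K (N₂.d c)) * ∏ K (N₉.d c)
      ≈ ∏ K (N₃.d c) * (∏ K (N₃.d c) * ∏ K (N₃.d c) * ∏ K (N₃.d c))
    normProduct = begin
      (∏ K (N₀.d c) * ∏ K (N₁.d c) * ∏ K (N₂.d c)) * ∏ K (N₉.d c)
        ≈⟨ *-congʳ (trans (∏-* K _ _) (*-congʳ (∏-* K _ _))) ⟨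
      ∏ K (f c) * ∏ K (N₉.d c)
        ≈⟨ *-congʳ (trans (reflexive (≡.cong (λ z → ∏ z (f c)) K*3)) (∏-stable (K ℕ.+ K) (λ i p →
             trans (*-cong (*-cong (N₀.d≥K c i p) (N₁.d≥K c i p)) (N₂.d≥K c i p)) (solve 0 (:1 :* :1 :* :1 := :1) refl)))) ⟨
      ∏ (K ℕ.* 3) (f c) * ∏ K (N₉.d c)
        ≈⟨ *-cong (∏-blocks 3 K (f c)) (∏-cong K ninth) ⟩
      ∏ K (λ i → ∏ 3 (λ r → f c (i ℕ.* 3 ℕ.+ r))) * ∏ K (λ i → N₃.d c (i ℕ.* 3 ℕ.+ 2))
        ≈⟨ ∏-* K _ _ ⟨
      ∏ K (λ i → ∏ 3 (λ r → f c (i ℕ.* 3 ℕ.+ r)) * N₃.d c (i ℕ.* 3 ℕ.+ 2))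
        ≈⟨ ∏-cong K (λ i → trans (*-congʳ (*-cong (*-cong (*-congˡ (f₀ i)) (f₁ i)) (f₂ i)))
             (solve 4 (λ a b c x → :1 :* a :* b :* (c :* c :* c) :* x := (:1 :* a :* b :* x) :* (c :* c :* c)) refl _ _ _ _)) ⟩
      ∏ K (λ i → ∏ 3 (λ r → N₃.d c (i ℕ.* 3 ℕ.+ r)) * (N₃.d c i * N₃.d c i * N₃.d c i))
        ≈⟨ ∏-* K _ _ ⟩
      ∏ K (λ i → ∏ 3 (λ r → N₃.d c (i ℕ.* 3 ℕ.+ r))) * ∏ K (λ i → N₃.d c i * N₃.d c i * N₃.d c i)
        ≈⟨ *-cong (sym (∏-blocks 3 K (N₃.d c))) (trans (∏-* K _ _) (*-congʳ (∏-* K _ _))) ⟩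
      ∏ (K ℕ.* 3) (N₃.d c) * (∏ K (N₃.d c) * ∏ K (N₃.d c) * ∏ K (N₃.d c))
        ≈⟨ *-congʳ (trans (reflexive (≡.cong (λ z → ∏ z (N₃.d c)) K*3)) (∏-stable (K ℕ.+ K) (λ i p → N₃.d≥K c i p))) ⟩
      ∏ K (N₃.d c) * (∏ K (N₃.d c) * ∏ K (N₃.d c) * ∏ K (N₃.d c)) ∎

  -- Gauss's formula makes each θ a quotient of a product with c = 1 by one with c = -1, and
  -- `normProduct` is applied to numerators and denominators.
  thetaNorm : N₀.theta * N₁.theta * N₂.theta * N₉.theta ≈ N₃.theta * (N₃.theta * N₃.theta * N₃.theta)
  thetaNorm = Unit-cancelˡ (Unit-* (Unit-* (Unit-* (Unit-∏ K (N₀.e-unit 1#)) (Unit-∏ K (N₁.e-unit 1#))) (Unit-∏ K (N₂.e-unit 1#))) (Unit-∏ K (N₉.e-unit 1#))) (begin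
    E₀ * E₁ * E₂ * E₉ * (N₀.theta * N₁.theta * N₂.theta * N₉.theta)
      ≈⟨ solve 8 (λ a b c d x y z w → a :* b :* c :* d :* (x :* y :* z :* w) := (x :* a) :* (y :* b) :* (z :* c) :* (w :* d)) refl
           E₀ E₁ E₂ E₉ N₀.theta N₁.theta N₂.theta N₉.theta ⟩
    (N₀.theta * E₀) * (N₁.theta * E₁) * (N₂.theta * E₂) * (N₉.theta * E₉)
      ≈⟨ *-cong (*-cong (*-cong N₀.gauss N₁.gauss) N₂.gauss) N₉.gauss ⟩
    ∏ K (N₀.d 1#) * ∏ K (N₁.d 1#) * ∏ K (N₂.d 1#) * ∏ K (N₉.d 1#)
      ≈⟨ normProduct 1# (solve 0 (:1 :* :1 :* :1 := :1) refl) ⟩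
    D₃ * (D₃ * D₃ * D₃)
      ≈⟨ *-cong (sym N₃.gauss) (*-cong (*-cong (sym N₃.gauss) (sym N₃.gauss)) (sym N₃.gauss)) ⟩
    (t * E₃) * ((t * E₃) * (t * E₃) * (t * E₃))
      ≈⟨ solve 2 (λ t e → (t :* e) :* ((t :* e) :* (t :* e) :* (t :* e)) := (e :* (e :* e :* e)) :* (t :* (t :* t :* t))) refl t E₃ ⟩
    (E₃ * (E₃ * E₃ * E₃)) * (t * (t * t * t))
      ≈⟨ *-congʳ E-norm ⟨
    E₀ * E₁ * E₂ * E₉ * (t * (t * t * t)) ∎)
    where
    E₀ = ∏ K (N₀.e 1#)
    E₁ = ∏ K (N₁.e 1#)
    E₂ = ∏ K (N₂.e 1#)
    E₃ = ∏ K (N₃.e 1#)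
    E₉ = ∏ K (N₉.e 1#)
    D₃ = ∏ K (N₃.d 1#)
    t = N₃.theta
    plus : ∀ x → 1# + 1# * x ≈ 1# - (- 1#) * x
    plus x = solve 1 (λ x → :1 :+ :1 :* x := :1 :- (:- :1) :* x) refl x
    plus₃ : E₃ ≈ ∏ K (N₃.d (- 1#))
    plus₃ = ∏-cong K (λ i → plus _)
    E-norm : E₀ * E₁ * E₂ * E₉ ≈ E₃ * (E₃ * E₃ * E₃)
    E-norm = begin
      E₀ * E₁ * E₂ * E₉
        ≈⟨ *-cong (*-cong (*-cong (∏-cong K (λ i → plus _)) (∏-cong K (λ i → plus _))) (∏-cong K (λ i → plus _))) (∏-cong K (λ i → plus _)) ⟩
      ∏ K (N₀.d (- 1#)) * ∏ K (N₁.d (- 1#)) * ∏ K (N₂.d (- 1#)) * ∏ K (N₉.d (- 1#))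
        ≈⟨ normProduct (- 1#) (solve 0 ((:- :1) :* (:- :1) :* (:- :1) := :- :1) refl) ⟩
      ∏ K (N₃.d (- 1#)) * (∏ K (N₃.d (- 1#)) * ∏ K (N₃.d (- 1#)) * ∏ K (N₃.d (- 1#)))
        ≈⟨ *-cong plus₃ (*-cong (*-cong plus₃ plus₃) plus₃) ⟨
      E₃ * (E₃ * E₃ * E₃) ∎

-- The ring of power series, its truncations, and the adjunction of ω.

module Z = RingKit ℤₚ.+-*-commutativeRing

Σ<-∑ : ∀ n f → Σ< n f ≡ Z.∑ n f
Σ<-∑ zero f = ≡.refl
Σ<-∑ (suc n) f = ≡.cong (ℤ._+ f n) (Σ<-∑ n f)

⊗-coeff : ∀ f g n → (f ⊗ g) n ≡ Z.∑ (suc n) (λ i → f i ℤ.* g (n ∸ i))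
⊗-coeff f g n = Σ<-∑ (suc n) _

zeroPS : PS
zeroPS _ = + 0

negPS : PS → PS
negPS f n = ℤ.- f n

infix 4 _≗_
_≗_ : PS → PS → Set
f ≗ g = ∀ n → f n ≡ g n

⊗-comm : ∀ f g → f ⊗ g ≗ g ⊗ f
⊗-comm f g n = begin
  (f ⊗ g) n                                              ≡⟨ ⊗-coeff f g n ⟩
  Z.∑ (suc n) (λ i → f i ℤ.* g (n ∸ i))                  ≡⟨ Z.∑-rev n _ ⟩
  Z.∑ (suc n) (λ i → f (n ∸ i) ℤ.* g (n ∸ (n ∸ i)))      ≡⟨ Z.∑-cong< (suc n) (λ i p → ≡.trans (ℤₚ.*-comm (f (n ∸ i)) _) (≡.cong (λ z → g z ℤ.* f (n ∸ i)) (ℕₚ.m∸[m∸n]≡n (ℕₚ.≤-pred p)))) ⟩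
  Z.∑ (suc n) (λ i → g i ℤ.* f (n ∸ i))                  ≡⟨ ⊗-coeff g f n ⟨
  (g ⊗ f) n                                              ∎
  where open ≡.≡-Reasoning

⊗-assoc : ∀ f g h → (f ⊗ g) ⊗ h ≗ f ⊗ (g ⊗ h)
⊗-assoc f g h n = begin
  ((f ⊗ g) ⊗ h) n
    ≡⟨ ⊗-coeff (f ⊗ g) h n ⟩
  Z.∑ (suc n) (λ i → (f ⊗ g) i ℤ.* h (n ∸ i))
    ≡⟨ Z.∑-cong (suc n) (λ i → ≡.trans (≡.cong (ℤ._* h (n ∸ i)) (⊗-coeff f g i)) (≡.sym (Z.∑-*ʳ (suc i) _ _))) ⟩
  Z.∑ (suc n) (λ i → Z.∑ (suc i) (λ j → f j ℤ.* g (i ∸ j) ℤ.* h (n ∸ i)))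
    ≡⟨ Z.∑-triangle (suc n) _ ⟩
  Z.∑ (suc n) (λ j → Z.∑ (suc n ∸ j) (λ b → f j ℤ.* g (j ℕ.+ b ∸ j) ℤ.* h (n ∸ (j ℕ.+ b))))
    ≡⟨ Z.∑-cong< (suc n) (λ j p → inner j (ℕₚ.≤-pred p)) ⟩
  Z.∑ (suc n) (λ j → f j ℤ.* (g ⊗ h) (n ∸ j))
    ≡⟨ ⊗-coeff f (g ⊗ h) n ⟨
  (f ⊗ (g ⊗ h)) n ∎
  where
  open ≡.≡-Reasoning
  inner : ∀ j → j ℕ.≤ n → Z.∑ (suc n ∸ j) (λ b → f j ℤ.* g (j ℕ.+ b ∸ j) ℤ.* h (n ∸ (j ℕ.+ b))) ≡ f j ℤ.* (g ⊗ h) (n ∸ j)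
  inner j j≤n = begin
    Z.∑ (suc n ∸ j) (λ b → f j ℤ.* g (j ℕ.+ b ∸ j) ℤ.* h (n ∸ (j ℕ.+ b)))
      ≡⟨ ≡.cong (λ z → Z.∑ z (λ b → f j ℤ.* g (j ℕ.+ b ∸ j) ℤ.* h (n ∸ (j ℕ.+ b)))) (ℕₚ.+-∸-assoc 1 j≤n) ⟩
    Z.∑ (suc (n ∸ j)) (λ b → f j ℤ.* g (j ℕ.+ b ∸ j) ℤ.* h (n ∸ (j ℕ.+ b)))
      ≡⟨ Z.∑-cong (suc (n ∸ j)) (λ b → ≡.trans (ℤₚ.*-assoc (f j) _ _) (≡.cong (f j ℤ.*_) (≡.cong₂ (λ y z → g y ℤ.* h z) (ℕₚ.m+n∸m≡n j b) (≡.sym (ℕₚ.∸-+-assoc n j b))))) ⟩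
    Z.∑ (suc (n ∸ j)) (λ b → f j ℤ.* (g b ℤ.* h (n ∸ j ∸ b)))
      ≡⟨ Z.∑-*ˡ (suc (n ∸ j)) (f j) _ ⟩
    f j ℤ.* Z.∑ (suc (n ∸ j)) (λ b → g b ℤ.* h (n ∸ j ∸ b))
      ≡⟨ ≡.cong (f j ℤ.*_) (⊗-coeff g h (n ∸ j)) ⟨
    f j ℤ.* (g ⊗ h) (n ∸ j) ∎

⊗-identityˡ : ∀ f → onePS ⊗ f ≗ f
⊗-identityˡ f n = begin
  (onePS ⊗ f) n                                                  ≡⟨ ⊗-coeff onePS f n ⟩
  Z.∑ (suc n) (λ i → onePS i ℤ.* f (n ∸ i))                      ≡⟨ Z.∑-head n _ ⟩
  + 1 ℤ.* f n ℤ.+ Z.∑ n (λ i → + 0 ℤ.* f (n ∸ suc i))            ≡⟨ ≡.cong₂ ℤ._+_ (ℤₚ.*-identityˡ (f n)) (Z.∑-zero< n (λ i _ → ℤₚ.*-zeroˡ (f (n ∸ suc i)))) ⟩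
  f n ℤ.+ + 0                                                    ≡⟨ ℤₚ.+-identityʳ (f n) ⟩
  f n                                                            ∎
  where open ≡.≡-Reasoning

⊗-distribˡ : ∀ f g h → f ⊗ (g ⊕ h) ≗ (f ⊗ g) ⊕ (f ⊗ h)
⊗-distribˡ f g h n = begin
  (f ⊗ (g ⊕ h)) n                                                           ≡⟨ ⊗-coeff f (g ⊕ h) n ⟩
  Z.∑ (suc n) (λ i → f i ℤ.* (g (n ∸ i) ℤ.+ h (n ∸ i)))                     ≡⟨ Z.∑-cong (suc n) (λ i → ℤₚ.*-distribˡ-+ (f i) _ _) ⟩
  Z.∑ (suc n) (λ i → f i ℤ.* g (n ∸ i) ℤ.+ f i ℤ.* h (n ∸ i))               ≡⟨ Z.∑-+ (suc n) _ _ ⟩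
  Z.∑ (suc n) (λ i → f i ℤ.* g (n ∸ i)) ℤ.+ Z.∑ (suc n) (λ i → f i ℤ.* h (n ∸ i))
    ≡⟨ ≡.cong₂ ℤ._+_ (⊗-coeff f g n) (⊗-coeff f h n) ⟨
  ((f ⊗ g) ⊕ (f ⊗ h)) n ∎
  where open ≡.≡-Reasoning

infix 4 _≈[_]_
-- Agreement on a set of indices. All indices give ℤ[[x]] and the indices below K its quotient by
-- x^K, on one carrier, so that the quotient map is the identity on representatives.
record _≈[_]_ (f : PS) (P : ℕ → Set) (g : PS) : Set where
  constructor below
  field at : ∀ i → P i → f i ≡ g i
open _≈[_]_ public

every : ∀ {P f g} → f ≗ g → f ≈[ P ] g
every h = below (λ i _ → h i)

-- Coefficient n of a product involves only indices at most n; hence the condition that P be closed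
-- downwards.
⊗-congᴾ : ∀ {P : ℕ → Set} → (∀ {i j} → i ℕ.≤ j → P j → P i) →
  ∀ {f f′ g g′} → f ≈[ P ] f′ → g ≈[ P ] g′ → f ⊗ g ≈[ P ] f′ ⊗ g′
⊗-congᴾ down {f} {f′} {g} {g′} p r = below λ n Pn → ≡.trans (⊗-coeff f g n) (≡.trans
  (Z.∑-cong< (suc n) (λ i i<n → ≡.cong₂ ℤ._*_ (at p i (down (ℕₚ.≤-pred i<n) Pn)) (at r (n ∸ i) (down (ℕₚ.m∸n≤m n i) Pn))))
  (≡.sym (⊗-coeff f′ g′ n)))

PSRingOn : (P : ℕ → Set) → (∀ {i j} → i ℕ.≤ j → P j → P i) → CommutativeRing 0ℓ 0ℓ
PSRingOn P down = record
  { Carrier = PS ; _≈_ = _≈[ P ]_ ; _+_ = _⊕_ ; _*_ = _⊗_ ; -_ = negPS ; 0# = zeroPS ; 1# = onePS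
  ; isCommutativeRing = record
    { isRing = record
      { +-isAbelianGroup = record
        { isGroup = record
          { isMonoid = record
            { isSemigroup = record
              { isMagma = record
                { isEquivalence = record { refl = every (λ _ → ≡.refl) ; sym = λ p → below λ i l → ≡.sym (at p i l) ; trans = λ p r → below λ i l → ≡.trans (at p i l) (at r i l) }
                ; ∙-cong = λ p r → below λ i l → ≡.cong₂ ℤ._+_ (at p i l) (at r i l) }
              ; assoc = λ f g h → every λ i → ℤₚ.+-assoc (f i) (g i) (h i) }
            ; identity = (λ f → every λ i → ℤₚ.+-identityˡ (f i)) , (λ f → every λ i → ℤₚ.+-identityʳ (f i)) }
          ; inverse = (λ f → every λ i → ℤₚ.+-inverseˡ (f i)) , (λ f → every λ i → ℤₚ.+-inverseʳ (f i))
          ; ⁻¹-cong = λ p → below λ i l → ≡.cong ℤ.-_ (at p i l) }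
        ; comm = λ f g → every λ i → ℤₚ.+-comm (f i) (g i) }
      ; *-cong = ⊗-congᴾ down
      ; *-assoc = λ f g h → every (⊗-assoc f g h)
      ; *-identity = (λ f → every (⊗-identityˡ f)) , (λ f → every λ i → ≡.trans (⊗-comm f onePS i) (⊗-identityˡ f i))
      ; distrib = (λ f g h → every (⊗-distribˡ f g h))
                , (λ f g h → every λ i → ≡.trans (⊗-comm (g ⊕ h) f i) (≡.trans (⊗-distribˡ f g h i) (≡.cong₂ ℤ._+_ (⊗-comm f g i) (⊗-comm f h i)))) }
    ; *-comm = λ f g → every (⊗-comm f g) } }

PSRing : ℕ → CommutativeRing 0ℓ 0ℓ
PSRing K = PSRingOn (ℕ._< K) ℕₚ.≤-<-trans

PS∞ : CommutativeRing 0ℓ 0ℓ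
PS∞ = PSRingOn (λ _ → ⊤) (λ _ _ → tt)

X : PS
X = mono (+ 1) 1

X⊗-zero : ∀ f → (X ⊗ f) 0 ≡ + 0
X⊗-zero f = ≡.refl

X⊗-suc : ∀ f n → (X ⊗ f) (suc n) ≡ f n
X⊗-suc f n = begin
  (X ⊗ f) (suc n)                                          ≡⟨ ⊗-coeff X f (suc n) ⟩
  Z.∑ (suc (suc n)) (λ i → X i ℤ.* f (suc n ∸ i))          ≡⟨ Z.∑-head (suc n) _ ⟩
  + 0 ℤ.+ Z.∑ (suc n) (λ i → X (suc i) ℤ.* f (n ∸ i))      ≡⟨ ℤₚ.+-identityˡ _ ⟩
  Z.∑ (suc n) (λ i → X (suc i) ℤ.* f (n ∸ i))              ≡⟨ Z.∑-cong (suc n) (λ { zero → ≡.refl ; (suc i) → ≡.refl }) ⟩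
  Z.∑ (suc n) (λ i → onePS i ℤ.* f (n ∸ i))                ≡⟨ ⊗-coeff onePS f n ⟨
  (onePS ⊗ f) n                                            ≡⟨ ⊗-identityˡ f n ⟩
  f n                                                      ∎
  where open ≡.≡-Reasoning

module PSK (K : ℕ) = RingKit (PSRing K)

X^-mono : ∀ K e n → (PSK._^_ K X e) n ≡ mono (+ 1) e n
X^-mono K zero zero = ≡.refl
X^-mono K zero (suc n) = ≡.refl
X^-mono K (suc e) zero = X⊗-zero (PSK._^_ K X e)
X^-mono K (suc e) (suc n) = ≡.trans (X⊗-suc (PSK._^_ K X e) n) (X^-mono K e n)

mono-< : ∀ c {e n} → n ℕ.< e → mono c e n ≡ + 0
mono-< c {suc e} {zero} _ = ≡.refl
mono-< c {suc e} {suc n} (s≤s p) = mono-< c {e} {n} p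

X-nil : ∀ K → CommutativeRing._≈_ (PSRing K) (PSK._^_ K X K) zeroPS
X-nil K = below λ i i<K → ≡.trans (X^-mono K K i) (mono-< (+ 1) i<K)

-- R[ω] with ω² = −1 − ω; the pair (a , b) is a + bω
module Eisenstein (R : CommutativeRing 0ℓ 0ℓ) where
  open RingKit R
  C : Set
  C = Carrier × Carrier
  infix 4 _≈ᵉ_
  record _≈ᵉ_ (x y : C) : Set where
    constructor _,_
    field
      re : proj₁ x ≈ proj₁ y
      im : proj₂ x ≈ proj₂ y
  open _≈ᵉ_ public
  _+ᵉ_ _*ᵉ_ : C → C → C
  x +ᵉ y = proj₁ x + proj₁ y , proj₂ x + proj₂ y
  x *ᵉ y = proj₁ x * proj₁ y - proj₂ x * proj₂ y , proj₁ x * proj₂ y + proj₂ x * proj₁ y - proj₂ x * proj₂ y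
  -ᵉ_ : C → C
  -ᵉ x = - proj₁ x , - proj₂ x

  Eis : CommutativeRing 0ℓ 0ℓ
  Eis = record
    { Carrier = C ; _≈_ = _≈ᵉ_ ; _+_ = _+ᵉ_ ; _*_ = _*ᵉ_ ; -_ = -ᵉ_ ; 0# = 0# , 0# ; 1# = 1# , 0#
    ; isCommutativeRing = record
      { isRing = record
        { +-isAbelianGroup = record
          { isGroup = record
            { isMonoid = record
              { isSemigroup = record
                { isMagma = record
                  { isEquivalence = record { refl = refl , refl ; sym = λ (p , r) → sym p , sym r ; trans = λ (p , r) (p′ , r′) → trans p p′ , trans r r′ }
                  ; ∙-cong = λ (p , r) (p′ , r′) → +-cong p p′ , +-cong r r′ }
                ; assoc = λ _ _ _ → +-assoc _ _ _ , +-assoc _ _ _ }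
              ; identity = (λ _ → +-identityˡ _ , +-identityˡ _) , (λ _ → +-identityʳ _ , +-identityʳ _) }
            ; inverse = (λ _ → -‿inverseˡ _ , -‿inverseˡ _) , (λ _ → -‿inverseʳ _ , -‿inverseʳ _)
            ; ⁻¹-cong = λ (p , r) → -‿cong p , -‿cong r }
          ; comm = λ _ _ → +-comm _ _ , +-comm _ _ }
        ; *-cong = λ (p , r) (p′ , r′) → +-cong (*-cong p p′) (-‿cong (*-cong r r′)) , +-cong (+-cong (*-cong p r′) (*-cong r p′)) (-‿cong (*-cong r r′))
        ; *-assoc = λ (a , b) (c , d) (e , f) →
            solve 6 (λ a b c d e f → (a :* c :- b :* d) :* e :- (a :* d :+ b :* c :- b :* d) :* f
                := a :* (c :* e :- d :* f) :- b :* (c :* f :+ d :* e :- d :* f)) refl a b c d e f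
          , solve 6 (λ a b c d e f → (a :* c :- b :* d) :* f :+ (a :* d :+ b :* c :- b :* d) :* e :- (a :* d :+ b :* c :- b :* d) :* f
                := a :* (c :* f :+ d :* e :- d :* f) :+ b :* (c :* e :- d :* f) :- b :* (c :* f :+ d :* e :- d :* f)) refl a b c d e f
        ; *-identity = (λ (a , b) → solve 2 (λ a b → :1 :* a :- con (+ 0) :* b := a) refl a b , solve 2 (λ a b → :1 :* b :+ con (+ 0) :* a :- con (+ 0) :* b := b) refl a b)
                     , (λ (a , b) → solve 2 (λ a b → a :* :1 :- b :* con (+ 0) := a) refl a b , solve 2 (λ a b → a :* con (+ 0) :+ b :* :1 :- b :* con (+ 0) := b) refl a b)
        ; distrib = (λ (a , b) (c , d) (e , f) →
              solve 6 (λ a b c d e f → a :* (c :+ e) :- b :* (d :+ f) := (a :* c :- b :* d) :+ (a :* e :- b :* f)) refl a b c d e f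
            , solve 6 (λ a b c d e f → a :* (d :+ f) :+ b :* (c :+ e) :- b :* (d :+ f) := (a :* d :+ b :* c :- b :* d) :+ (a :* f :+ b :* e :- b :* f)) refl a b c d e f)
          , (λ (a , b) (c , d) (e , f) →
              solve 6 (λ a b c d e f → (c :+ e) :* a :- (d :+ f) :* b := (c :* a :- d :* b) :+ (e :* a :- f :* b)) refl a b c d e f
            , solve 6 (λ a b c d e f → (c :+ e) :* b :+ (d :+ f) :* a :- (d :+ f) :* b := (c :* b :+ d :* a :- d :* b) :+ (e :* b :+ f :* a :- f :* b)) refl a b c d e f) }
      ; *-comm = λ (a , b) (c , d) →
            solve 4 (λ a b c d → a :* c :- b :* d := c :* a :- d :* b) refl a b c d
          , solve 4 (λ a b c d → a :* d :+ b :* c :- b :* d := c :* b :+ d :* a :- d :* b) refl a b c d } }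

  ι : Carrier → C
  ι a = a , 0#

  ω : C
  ω = 0# , 1#

-- Transport along ring homomorphisms; the splitting of θ modulo 3 and the norm identity.

module Hom (R S : CommutativeRing 0ℓ 0ℓ) (h : CommutativeRing.Carrier R → CommutativeRing.Carrier S)
  (h-cong : ∀ {x y} → CommutativeRing._≈_ R x y → CommutativeRing._≈_ S (h x) (h y))
  (h-+ : ∀ x y → CommutativeRing._≈_ S (h (CommutativeRing._+_ R x y)) (CommutativeRing._+_ S (h x) (h y)))
  (h-* : ∀ x y → CommutativeRing._≈_ S (h (CommutativeRing._*_ R x y)) (CommutativeRing._*_ S (h x) (h y)))
  (h-0 : CommutativeRing._≈_ S (h (CommutativeRing.0# R)) (CommutativeRing.0# S))
  (h-1 : CommutativeRing._≈_ S (h (CommutativeRing.1# R)) (CommutativeRing.1# S)) where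
  private
    module A = RingKit R
    module B = RingKit S

  h-neg : ∀ x → h (A.- x) B.≈ B.- h x
  h-neg x = B.begin
    h (A.- x)                                  B.≈⟨ B.solve 2 (λ a b → a B.:= (b B.:+ a) B.:+ (B.:- b)) B.refl (h (A.- x)) (h x) ⟩
    (h x B.+ h (A.- x)) B.+ B.- h x            B.≈⟨ B.+-congʳ (B.trans (B.sym (h-+ x (A.- x))) (B.trans (h-cong (A.-‿inverseʳ x)) h-0)) ⟩
    B.0# B.+ B.- h x                           B.≈⟨ B.+-identityˡ _ ⟩
    B.- h x                                    B.∎

  h-^ : ∀ x n → h (x A.^ n) B.≈ h x B.^ n
  h-^ x zero = h-1
  h-^ x (suc n) = B.trans (h-* x _) (B.*-congˡ (h-^ x n))

  h-∑ : ∀ n f → h (A.∑ n f) B.≈ B.∑ n (λ i → h (f i))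
  h-∑ zero f = h-0
  h-∑ (suc n) f = B.trans (h-+ _ _) (B.+-congʳ (h-∑ n f))

  h-sgn : ∀ n → h ((A.- A.1#) A.^ n) B.≈ (B.- B.1#) B.^ n
  h-sgn n = B.trans (h-^ _ n) (B.^-congˡ n (B.trans (h-neg A.1#) (B.-‿cong h-1)))

module Thetas (R : CommutativeRing 0ℓ 0ℓ) where
  open RingKit R

  ∑-blocks : ∀ b n f → ∑ (n ℕ.* b) f ≈ ∑ n (λ i → ∑ b (λ r → f (i ℕ.* b ℕ.+ r)))
  ∑-blocks b zero f = refl
  ∑-blocks b (suc n) f = begin
    ∑ (b ℕ.+ n ℕ.* b) f                                 ≡⟨ ≡.cong (λ z → ∑ z f) (ℕₚ.+-comm b (n ℕ.* b)) ⟩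
    ∑ (n ℕ.* b ℕ.+ b) f                                 ≈⟨ ∑-split (n ℕ.* b) b f ⟩
    ∑ (n ℕ.* b) f + ∑ b (λ r → f (n ℕ.* b ℕ.+ r))       ≈⟨ +-congʳ (∑-blocks b n f) ⟩
    ∑ (suc n) (λ i → ∑ b (λ r → f (i ℕ.* b ℕ.+ r)))     ∎

  thetaTerm bTerm : Carrier → ℕ → Carrier
  thetaTerm z r = (- 1#) ^ suc r * z ^ (suc r ℕ.* suc r)
  bTerm z j = (- 1#) ^ suc j * z ^ (suc j ℕ.* (3 ℕ.* suc j ℕ.+ 2)) + (- 1#) ^ suc j * z ^ (suc j ℕ.* (3 ℕ.* j ℕ.+ 1))

  thetaAt bAt : ℕ → Carrier → Carrier
  thetaAt K z = 1# + (1# + 1#) * ∑ K (thetaTerm z)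
  bAt K z = 1# + ∑ K (bTerm z)

  thetaAt-cong : ∀ K {z z′} → z ≈ z′ → thetaAt K z ≈ thetaAt K z′
  thetaAt-cong K p = +-congˡ (*-congˡ (∑-cong K (λ r → *-congˡ (^-congˡ (suc r ℕ.* suc r) p))))

  bAt-cong : ∀ K {z z′} → z ≈ z′ → bAt K z ≈ bAt K z′
  bAt-cong K p = +-congˡ (∑-cong K (λ j → +-cong (*-congˡ (^-congˡ (suc j ℕ.* (3 ℕ.* suc j ℕ.+ 2)) p)) (*-congˡ (^-congˡ (suc j ℕ.* (3 ℕ.* j ℕ.+ 1)) p))))

  module Split (q : Carrier) (k : ℕ) (q-nil : q ^ suc k ≈ 0#) where
    open Nilpotent R q k q-nil using (K; q^≥K)

    ∑-extend : ∀ n f → (∀ i → K ℕ.≤ i → f i ≈ 0#) → ∑ (K ℕ.+ n) f ≈ ∑ K f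
    ∑-extend n f h = trans (∑-split K n f) (trans (+-congˡ (∑-zero< n (λ i _ → h _ (ℕₚ.m≤m+n K i)))) (+-identityʳ _))

    thetaTerm-nil : ∀ r → K ℕ.≤ r → thetaTerm q r ≈ 0#
    thetaTerm-nil r p = trans (*-congˡ (q^≥K _ (ℕₚ.≤-trans (ℕₚ.≤-trans p (ℕₚ.n≤1+n r)) (ℕₚ.m≤m+n (suc r) (r ℕ.* suc r))))) (zeroʳ _)

    private
      s : ℕ → Carrier
      s n = (- 1#) ^ n

      sgn3 : ∀ i → s (i ℕ.* 3) ≈ s i
      sgn3 zero = refl
      sgn3 (suc i) = trans (solve 1 (λ x → :- :1 :* (:- :1 :* (:- :1 :* x)) := :- :1 :* x) refl (s (i ℕ.* 3))) (*-congˡ (sgn3 i))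

      sgn3+ : ∀ i r → s (suc (i ℕ.* 3 ℕ.+ r)) ≈ s i * s (suc r)
      sgn3+ i r = trans (reflexive (≡.cong s (≡.sym (ℕₚ.+-suc (i ℕ.* 3) r)))) (trans (^-homo-* (- 1#) (i ℕ.* 3) (suc r)) (*-congʳ (sgn3 i)))

      -- Up to sign, the terms of θ with index ≡ 1, 2, 0 modulo 3. Since (3i+1)² = 1 + 3i(3i+2) and
      -- (3j+2)² = 1 + 3(j+1)(3j+1), the first two are q times the terms m = i and m = -(j+1) of
      -- B(q³).
      α β γ : ℕ → Carrier
      α i = s i * q ^ (suc (i ℕ.* 3 ℕ.+ 0) ℕ.* suc (i ℕ.* 3 ℕ.+ 0))
      β j = s (suc j) * (q * (q ^ 3) ^ (suc j ℕ.* (3 ℕ.* j ℕ.+ 1)))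
      γ j = thetaTerm (q ^ 9) j

      powers : ∀ m n c → suc (m ℕ.* n) ≡ c → q * (q ^ m) ^ n ≈ q ^ c
      powers m n c e = trans (*-congˡ (^-assocʳ q m n)) (reflexive (≡.cong (q ^_) e))

      t₀ : ∀ i → thetaTerm q (i ℕ.* 3 ℕ.+ 0) ≈ - α i
      t₀ i = trans (*-congʳ (sgn3+ i 0)) (solve 2 (λ s x → s :* (:- :1 :* :1) :* x := :- (s :* x)) refl _ _)

      t₁ : ∀ i → thetaTerm q (i ℕ.* 3 ℕ.+ 1) ≈ - β i
      t₁ i = trans (*-cong (sgn3+ i 1) (sym (powers 3 (suc i ℕ.* (3 ℕ.* i ℕ.+ 1)) _
          (ℕsolve 1 (λ i → κ 1 ⊞ κ 3 ⊠ ((κ 1 ⊞ i) ⊠ (κ 3 ⊠ i ⊞ κ 1)) ≔ (κ 1 ⊞ (i ⊠ κ 3 ⊞ κ 1)) ⊠ (κ 1 ⊞ (i ⊠ κ 3 ⊞ κ 1))) ≡.refl i))))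
        (solve 2 (λ s x → s :* (:- :1 :* (:- :1 :* :1)) :* x := :- ((:- :1 :* s) :* x)) refl _ _)

      t₂ : ∀ i → thetaTerm q (i ℕ.* 3 ℕ.+ 2) ≈ γ i
      t₂ i = *-cong (trans (sgn3+ i 2) (solve 1 (λ s → s :* (:- :1 :* (:- :1 :* (:- :1 :* :1))) := :- :1 :* s) refl (s i)))
        (trans (reflexive (≡.cong (q ^_) (ℕsolve 1 (λ i → (κ 1 ⊞ (i ⊠ κ 3 ⊞ κ 2)) ⊠ (κ 1 ⊞ (i ⊠ κ 3 ⊞ κ 2)) ≔ κ 9 ⊠ ((κ 1 ⊞ i) ⊠ (κ 1 ⊞ i))) ≡.refl i))) (sym (^-assocʳ q 9 (suc i ℕ.* suc i))))

      -- α 0 = q is the term m = 0 of qB(q³). The term α K, added to shift the index, is zero.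
      α-sum : ∑ K α ≈ q + ∑ K (α ∘ suc)
      α-sum = begin
        ∑ K α                  ≈⟨ +-identityʳ _ ⟨
        ∑ K α + 0#             ≈⟨ +-congˡ (trans (*-congˡ (q^≥K _ (ℕₚ.≤-trans (ℕₚ.≤-trans (ℕₚ.≤-trans (ℕₚ.m≤m*n K 3) (ℕₚ.m≤m+n (K ℕ.* 3) 0)) (ℕₚ.n≤1+n _)) (ℕₚ.m≤m+n (suc (K ℕ.* 3 ℕ.+ 0)) _)))) (zeroʳ _)) ⟨
        ∑ (suc K) α            ≈⟨ ∑-head K α ⟩
        α 0 + ∑ K (α ∘ suc)    ≈⟨ +-congʳ (solve 1 (λ q → :1 :* (q :* :1) := q) refl q) ⟩
        q + ∑ K (α ∘ suc)      ∎

    thetaSplit : thetaAt K q ≈ thetaAt K (q ^ 9) - (1# + 1#) * (q * bAt K (q ^ 3))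
    thetaSplit = begin
      1# + (1# + 1#) * ∑ K (thetaTerm q)
        ≈⟨ +-congˡ (*-congˡ (trans (reflexive (≡.cong (λ z → ∑ z (thetaTerm q)) K*3)) (∑-extend (K ℕ.+ K) _ thetaTerm-nil))) ⟨
      1# + (1# + 1#) * ∑ (K ℕ.* 3) (thetaTerm q)
        ≈⟨ +-congˡ (*-congˡ (trans (∑-blocks 3 K _) (∑-cong K (λ i → +-cong (+-cong (trans (+-identityˡ _) (t₀ i)) (t₁ i)) (t₂ i))))) ⟩
      1# + (1# + 1#) * ∑ K (λ i → - α i + - β i + γ i)
        ≈⟨ +-congˡ (*-congˡ (trans (∑-+ K _ _) (+-congʳ (trans (∑-+ K _ _) (+-cong (trans (∑-neg K _) (-‿cong α-sum)) (∑-neg K _)))))) ⟩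
      1# + (1# + 1#) * (- (q + ∑ K (α ∘ suc)) + - ∑ K β + ∑ K γ)
        ≈⟨ solve 4 (λ q a b g → :1 :+ :2 :* (:- (q :+ a) :+ :- b :+ g) := (:1 :+ :2 :* g) :- :2 :* (q :+ (a :+ b))) refl q _ _ _ ⟩
      thetaAt K (q ^ 9) - (1# + 1#) * (q + (∑ K (α ∘ suc) + ∑ K β))
        ≈⟨ +-congˡ (-‿cong (*-congˡ (begin
             q + (∑ K (α ∘ suc) + ∑ K β)          ≈⟨ +-cong (sym (*-identityʳ q)) (sym (∑-+ K _ _)) ⟩
             q * 1# + ∑ K (λ j → α (suc j) + β j) ≈⟨ +-congˡ (trans (∑-cong K (λ j → sym (bt j))) (∑-*ˡ K q _)) ⟩
             q * 1# + q * ∑ K (bTerm (q ^ 3))     ≈⟨ distribˡ q _ _ ⟨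
             q * bAt K (q ^ 3)                    ∎))) ⟩
      thetaAt K (q ^ 9) - (1# + 1#) * (q * bAt K (q ^ 3)) ∎
      where
      K*3 : K ℕ.* 3 ≡ K ℕ.+ (K ℕ.+ K)
      K*3 = ℕsolve 1 (λ k → k ⊠ κ 3 ≔ k ⊞ (k ⊞ k)) ≡.refl K
      bt : ∀ j → q * bTerm (q ^ 3) j ≈ α (suc j) + β j
      bt j = trans (solve 4 (λ q s x y → q :* (s :* x :+ s :* y) := s :* (q :* x) :+ s :* (q :* y)) refl q (s (suc j)) _ _)
        (+-congʳ (*-congˡ (powers 3 (suc j ℕ.* (3 ℕ.* suc j ℕ.+ 2)) _
          (ℕsolve 1 (λ j → κ 1 ⊞ κ 3 ⊠ ((κ 1 ⊞ j) ⊠ (κ 3 ⊠ (κ 1 ⊞ j) ⊞ κ 2)) ≔ (κ 1 ⊞ ((κ 1 ⊞ j) ⊠ κ 3 ⊞ κ 0)) ⊠ (κ 1 ⊞ ((κ 1 ⊞ j) ⊠ κ 3 ⊞ κ 0))) ≡.refl j))))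

module NormIdentity (R : CommutativeRing 0ℓ 0ℓ) (q ω : CommutativeRing.Carrier R) (k : ℕ)
  (q-nil : CommutativeRing._≈_ R (RingKit._^_ R q (suc k)) (CommutativeRing.0# R))
  (ω²+ω+1 : CommutativeRing._≈_ R (RingKit._+_ R (RingKit._+_ R (RingKit._*_ R ω ω) ω) (CommutativeRing.1# R)) (CommutativeRing.0# R)) where
  open RingKit R
  open Thetas R
  private
    K = suc k
    module TN = ThetaNorm R q ω k q-nil ω²+ω+1
    a b t : Carrier
    a = thetaAt K (q ^ 9)
    b = - ((1# + 1#) * (q * bAt K (q ^ 3)))
    t = thetaAt K (q ^ 3)

    ω³ : ω ^ 3 ≈ 1#
    ω³ = trans (solve 1 (λ w → w :* (w :* (w :* :1)) := :1 :+ (w :* w :+ w :+ :1) :* (w :- :1)) refl ω)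
      (trans (+-congˡ (trans (*-congʳ ω²+ω+1) (zeroˡ _))) (+-identityʳ 1#))

    -- A cube root of unity c disappears from (cq)⁹ and (cq)³ and survives only in the explicit
    -- factor q of the second part.
    scaled : ∀ c → c ^ 3 ≈ 1# → thetaAt K (c * q) ≈ a + c * b
    scaled c c³ = begin
      thetaAt K (c * q)
        ≈⟨ Split.thetaSplit (c * q) k (TN.scaled-nil c) ⟩
      thetaAt K ((c * q) ^ 9) - (1# + 1#) * (c * q * bAt K ((c * q) ^ 3))
        ≈⟨ +-cong (thetaAt-cong K (unscale 9 c⁹)) (-‿cong (*-congˡ (*-congˡ (bAt-cong K (unscale 3 c³))))) ⟩
      a - (1# + 1#) * (c * q * bAt K (q ^ 3))
        ≈⟨ +-congˡ (solve 3 (λ c q b → :- (:2 :* (c :* q :* b)) := c :* (:- (:2 :* (q :* b)))) refl c q _) ⟩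
      a + c * b ∎
      where
      c⁹ : c ^ 9 ≈ 1#
      c⁹ = trans (sym (^-assocʳ c 3 3)) (trans (^-congˡ 3 c³) (solve 0 (:1 :* (:1 :* (:1 :* :1)) := :1) refl))
      unscale : ∀ n → c ^ n ≈ 1# → (c * q) ^ n ≈ q ^ n
      unscale n p = trans (^-distrib-* c q n) (trans (*-congʳ p) (*-identityˡ _))

  -- The conjugates of θ(q) are a + b, a + ωb and a + ω²b, with product a³ + b³. The extra factor a
  -- is the θ(q⁹) of `thetaNorm`.
  normIdentity : (a * a * a + b * b * b) * a ≈ t * (t * t * t)
  normIdentity = begin
    (a * a * a + b * b * b) * a
      ≈⟨ *-congʳ (begin
           a * a * a + b * b * b
             ≈⟨ trans (+-congˡ (trans (*-congʳ ω²+ω+1) (zeroˡ _))) (+-identityʳ _) ⟨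
           (a * a * a + b * b * b) + (ω * ω + ω + 1#) * (a * a * b + ω * a * b * b + (ω - 1#) * b * b * b)
             ≈⟨ solve 3 (λ w a b → (a :* a :* a :+ b :* b :* b) :+ (w :* w :+ w :+ :1) :* (a :* a :* b :+ w :* a :* b :* b :+ (w :- :1) :* b :* b :* b)
                  := (a :+ b) :* (a :+ w :* b) :* (a :+ w :* w :* b)) refl ω a b ⟩
           (a + b) * (a + ω * b) * (a + ω * ω * b)
             ≈⟨ *-cong (*-cong (sym (Split.thetaSplit q k q-nil)) (sym (scaled ω ω³)))
                  (sym (scaled (ω * ω) (trans (^-distrib-* ω ω 3) (trans (*-cong ω³ ω³) (*-identityʳ 1#))))) ⟩
           thetaAt K q * thetaAt K (ω * q) * thetaAt K (ω * ω * q) ∎) ⟩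
    thetaAt K q * thetaAt K (ω * q) * thetaAt K (ω * ω * q) * a
      ≈⟨ TN.thetaNorm ⟩
    t * (t * t * t) ∎

module HomTheta (R S : CommutativeRing 0ℓ 0ℓ) (h : CommutativeRing.Carrier R → CommutativeRing.Carrier S)
  (h-cong : ∀ {x y} → CommutativeRing._≈_ R x y → CommutativeRing._≈_ S (h x) (h y))
  (h-+ : ∀ x y → CommutativeRing._≈_ S (h (CommutativeRing._+_ R x y)) (CommutativeRing._+_ S (h x) (h y)))
  (h-* : ∀ x y → CommutativeRing._≈_ S (h (CommutativeRing._*_ R x y)) (CommutativeRing._*_ S (h x) (h y)))
  (h-0 : CommutativeRing._≈_ S (h (CommutativeRing.0# R)) (CommutativeRing.0# S))
  (h-1 : CommutativeRing._≈_ S (h (CommutativeRing.1# R)) (CommutativeRing.1# S)) where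
  open Hom R S h h-cong h-+ h-* h-0 h-1 public
  private
    module A = Thetas R
    module B = Thetas S
  open RingKit S

  h-term : ∀ n z e → h (RingKit._*_ R (RingKit._^_ R (RingKit.-_ R (RingKit.1# R)) n) (RingKit._^_ R z e)) ≈ (- 1#) ^ n * h z ^ e
  h-term n z e = trans (h-* _ _) (*-cong (h-sgn n) (h-^ z e))

  h-theta : ∀ K z → h (A.thetaAt K z) ≈ B.thetaAt K (h z)
  h-theta K z = trans (h-+ _ _) (+-cong h-1 (trans (h-* _ _) (*-cong (trans (h-+ _ _) (+-cong h-1 h-1))
    (trans (h-∑ K _) (∑-cong K (λ r → h-term (suc r) z (suc r ℕ.* suc r)))))))

  h-b : ∀ K z → h (A.bAt K z) ≈ B.bAt K (h z)
  h-b K z = trans (h-+ _ _) (+-cong h-1 (trans (h-∑ K _) (∑-cong K (λ j → trans (h-+ _ _)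
    (+-cong (h-term (suc j) z (suc j ℕ.* (3 ℕ.* suc j ℕ.+ 2))) (h-term (suc j) z (suc j ℕ.* (3 ℕ.* j ℕ.+ 1))))))))

-- Identities over an extension S ∋ ω of R between elements of R hold in R.
module NormDescent (R S : CommutativeRing 0ℓ 0ℓ) (h : CommutativeRing.Carrier R → CommutativeRing.Carrier S)
  (h-cong : ∀ {x y} → CommutativeRing._≈_ R x y → CommutativeRing._≈_ S (h x) (h y))
  (h-injective : ∀ {x y} → CommutativeRing._≈_ S (h x) (h y) → CommutativeRing._≈_ R x y)
  (h-+ : ∀ x y → CommutativeRing._≈_ S (h (CommutativeRing._+_ R x y)) (CommutativeRing._+_ S (h x) (h y)))
  (h-* : ∀ x y → CommutativeRing._≈_ S (h (CommutativeRing._*_ R x y)) (CommutativeRing._*_ S (h x) (h y)))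
  (h-0 : CommutativeRing._≈_ S (h (CommutativeRing.0# R)) (CommutativeRing.0# S))
  (h-1 : CommutativeRing._≈_ S (h (CommutativeRing.1# R)) (CommutativeRing.1# S))
  (ω : CommutativeRing.Carrier S)
  (ω²+ω+1 : CommutativeRing._≈_ S (RingKit._+_ S (RingKit._+_ S (RingKit._*_ S ω ω) ω) (CommutativeRing.1# S)) (CommutativeRing.0# S)) where
  private
    module A = RingKit R
    module TA = Thetas R
    module TB = Thetas S
  open RingKit S
  open HomTheta R S h h-cong h-+ h-* h-0 h-1 public

  module _ (q : A.Carrier) (k : ℕ) (q-nil : q A.^ suc k A.≈ A.0#)
    (a b t : A.Carrier) (a≈ : a A.≈ TA.thetaAt (suc k) (q A.^ 9))
    (b≈ : b A.≈ A.- ((A.1# A.+ A.1#) A.* (q A.* TA.bAt (suc k) (q A.^ 3))))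
    (t≈ : t A.≈ TA.thetaAt (suc k) (q A.^ 3)) where
    private
      K = suc k
      ha : h a ≈ TB.thetaAt K (h q ^ 9)
      ha = trans (h-cong a≈) (trans (h-theta K (q A.^ 9)) (TB.thetaAt-cong K (h-^ q 9)))
      ht : h t ≈ TB.thetaAt K (h q ^ 3)
      ht = trans (h-cong t≈) (trans (h-theta K (q A.^ 3)) (TB.thetaAt-cong K (h-^ q 3)))
      hb : h b ≈ - ((1# + 1#) * (h q * TB.bAt K (h q ^ 3)))
      hb = trans (h-cong b≈) (trans (h-neg _) (-‿cong (trans (h-* _ _) (*-cong (trans (h-+ _ _) (+-cong h-1 h-1)) (trans (h-* _ _) (*-congˡ
        (trans (h-b K (q A.^ 3)) (TB.bAt-cong K (h-^ q 3)))))))))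
      triple : ∀ {x y} → h x ≈ y → h (x A.* x A.* x) ≈ y * y * y
      triple p = trans (h-* _ _) (*-cong (trans (h-* _ _) (*-cong p p)) p)

    normDescended : (a A.* a A.* a A.+ b A.* b A.* b) A.* a A.≈ t A.* (t A.* t A.* t)
    normDescended = h-injective (trans (trans (h-* _ _) (*-cong (trans (h-+ _ _) (+-cong (triple ha) (triple hb))) ha))
      (trans (NormIdentity.normIdentity S (h q) ω k (trans (sym (h-^ q K)) (trans (h-cong q-nil) h-0)) ω²+ω+1)
      (sym (trans (h-* _ _) (*-cong ht (triple ht))))))

module Descent (R : CommutativeRing 0ℓ 0ℓ) where
  open RingKit R
  open Eisenstein R public
  module E = RingKit Eis

  ι* : ∀ x y → ι (x * y) E.≈ ι x E.* ι y
  ι* x y = solve 2 (λ a b → a :* b := a :* b :- con (+ 0) :* con (+ 0)) refl x y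
         , solve 2 (λ a b → con (+ 0) := a :* con (+ 0) :+ con (+ 0) :* b :- con (+ 0) :* con (+ 0)) refl x y

  ι+ : ∀ x y → ι (x + y) E.≈ ι x E.+ ι y
  ι+ x y = refl , sym (+-identityʳ 0#)

  ω-relation : ω E.* ω E.+ ω E.+ E.1# E.≈ E.0#
  ω-relation = solve 0 (((con (+ 0) :* con (+ 0) :- :1 :* :1) :+ con (+ 0)) :+ :1 := con (+ 0)) refl
             , solve 0 (((con (+ 0) :* :1 :+ :1 :* con (+ 0) :- :1 :* :1) :+ :1) :+ con (+ 0) := con (+ 0)) refl

  module ND = NormDescent R Eis ι (λ p → p , refl) re ι+ ι* (refl , refl) (refl , refl) ω ω-relation

  ω¹ : ∀ y → ω E.* ι y E.≈ (0# , y)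
  ω¹ y = solve 1 (λ y → con (+ 0) :* y :- :1 :* con (+ 0) := con (+ 0)) refl y
       , solve 1 (λ y → con (+ 0) :* con (+ 0) :+ :1 :* y :- :1 :* con (+ 0) := y) refl y

  ω² : ∀ y → ω E.* (ω E.* ι y) E.≈ (- y , - y)
  ω² y = E.trans (E.*-congˡ (ω¹ y))
    ( solve 1 (λ y → con (+ 0) :* con (+ 0) :- :1 :* y := :- y) refl y
    , solve 1 (λ y → con (+ 0) :* y :+ :1 :* con (+ 0) :- :1 :* y := :- y) refl y )

-- A ring R∞ that embeds into the product of its quotients R k by q^{k+1}
record Tower : Set₁ where
  field
    R∞ : CommutativeRing 0ℓ 0ℓ
    Rₖ : ℕ → CommutativeRing 0ℓ 0ℓ
  module L = RingKit R∞
  module F (k : ℕ) = RingKit (Rₖ k)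
  field
    π : ∀ k → L.Carrier → F.Carrier k
    π-cong : ∀ k {x y} → x L.≈ y → F._≈_ k (π k x) (π k y)
    π-injective : ∀ {x y} → (∀ k → F._≈_ k (π k x) (π k y)) → x L.≈ y
    π-+ : ∀ k x y → F._≈_ k (π k (x L.+ y)) (F._+_ k (π k x) (π k y))
    π-* : ∀ k x y → F._≈_ k (π k (x L.* y)) (F._*_ k (π k x) (π k y))
    π-0 : ∀ k → F._≈_ k (π k L.0#) (F.0# k)
    π-1 : ∀ k → F._≈_ k (π k L.1#) (F.1# k)
    q : L.Carrier
    q-nil : ∀ k → F._≈_ k (F._^_ k (π k q) (suc k)) (F.0# k)
    -- The substitution x ↦ x³, so that θ(x³) and θ(x⁹) become `v θ` and `v (v θ)`.
    v : L.Carrier → L.Carrier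
    v-cong : ∀ {x y} → x L.≈ y → v x L.≈ v y
    v-congₖ : ∀ k {x y} → F._≈_ k (π k x) (π k y) → F._≈_ k (π k (v x)) (π k (v y))
    v-+ : ∀ x y → v (x L.+ y) L.≈ v x L.+ v y
    v-* : ∀ x y → v (x L.* y) L.≈ v x L.* v y
    v-0 : v L.0# L.≈ L.0#
    v-1 : v L.1# L.≈ L.1#
    v-q : v q L.≈ q L.^ 3
    θ B : L.Carrier
    θ≈ : ∀ k → F._≈_ k (π k θ) (Thetas.thetaAt (Rₖ k) (suc k) (π k q))
    B≈ : ∀ k → F._≈_ k (π k B) (Thetas.bAt (Rₖ k) (suc k) (π k q))

module TowerIdentities (T : Tower) where
  open Tower T
  module Hπ (k : ℕ) = HomTheta R∞ (Rₖ k) (π k) (π-cong k) (π-+ k) (π-* k) (π-0 k) (π-1 k)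
  module Hv = HomTheta R∞ R∞ v v-cong v-+ v-* v-0 v-1
  module TL = Thetas R∞

  module At (k : ℕ) where
    open RingKit (Rₖ k)
    open Thetas (Rₖ k)
    K = suc k
    p : L.Carrier → Carrier
    p = π k
    x : Carrier
    x = π k q

    -- θ(q^m) ↦ θ(q^{3m}) under v, computed on a polynomial lift
    vθ : ∀ {y z w} → p y ≈ thetaAt K (p z) → v z L.≈ w → p (v y) ≈ thetaAt K (p w)
    vθ {y} {z} {w} e vz = begin
      p (v y)                         ≈⟨ v-congₖ k (trans e (sym (Hπ.h-theta k K z))) ⟩
      p (v (TL.thetaAt K z))          ≈⟨ π-cong k (Hv.h-theta K z) ⟩
      p (TL.thetaAt K (v z))          ≈⟨ Hπ.h-theta k K (v z) ⟩
      thetaAt K (p (v z))             ≈⟨ thetaAt-cong K (π-cong k vz) ⟩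
      thetaAt K (p w)                 ∎

    vb : ∀ {y z w} → p y ≈ bAt K (p z) → v z L.≈ w → p (v y) ≈ bAt K (p w)
    vb {y} {z} {w} e vz = begin
      p (v y)                         ≈⟨ v-congₖ k (trans e (sym (Hπ.h-b k K z))) ⟩
      p (v (TL.bAt K z))              ≈⟨ π-cong k (Hv.h-b K z) ⟩
      p (TL.bAt K (v z))              ≈⟨ Hπ.h-b k K (v z) ⟩
      bAt K (p (v z))                 ≈⟨ bAt-cong K (π-cong k vz) ⟩
      bAt K (p w)                     ∎

    v9 : v (q L.^ 3) L.≈ q L.^ 9
    v9 = L.trans (Hv.h-^ q 3) (L.trans (L.^-congˡ 3 v-q) (L.^-assocʳ q 3 3))

    θ₃ : p (v θ) ≈ thetaAt K (x ^ 3)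
    θ₃ = trans (vθ (θ≈ k) v-q) (thetaAt-cong K (Hπ.h-^ k q 3))

    B₃ : p (v B) ≈ bAt K (x ^ 3)
    B₃ = trans (vb (B≈ k) v-q) (bAt-cong K (Hπ.h-^ k q 3))

    θ₉ : p (v (v θ)) ≈ thetaAt K (x ^ 9)
    θ₉ = trans (vθ (vθ (θ≈ k) v-q) v9) (thetaAt-cong K (Hπ.h-^ k q 9))

    two : p (L.1# L.+ L.1#) ≈ 1# + 1#
    two = trans (π-+ k _ _) (+-cong (π-1 k) (π-1 k))

    b : L.Carrier
    b = L.- ((L.1# L.+ L.1#) L.* (q L.* v B))

    b≈ : p b ≈ - ((1# + 1#) * (x * bAt K (x ^ 3)))
    b≈ = trans (Hπ.h-neg k _) (-‿cong (trans (π-* k _ _) (*-cong two (trans (π-* k _ _) (*-congˡ B₃)))))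

    split : p θ ≈ p (v (v θ) L.- (L.1# L.+ L.1#) L.* (q L.* v B))
    split = trans (θ≈ k) (trans (Thetas.Split.thetaSplit (Rₖ k) x k (q-nil k)) (sym (trans (π-+ k _ _) (+-cong θ₉ b≈))))

    module De = Descent (Rₖ k)

    triple : ∀ y → p (y L.* y L.* y) ≈ p y * p y * p y
    triple y = trans (π-* k _ _) (*-congʳ (π-* k _ _))

    norm : let a = v (v θ) in let t = v θ in
      p ((a L.* a L.* a L.+ b L.* b L.* b) L.* a) ≈ p (t L.* (t L.* t L.* t))
    norm = trans (trans (π-* k _ _) (*-congʳ (trans (π-+ k _ _) (+-cong (triple _) (triple _)))))
      (trans (De.ND.normDescended x k (q-nil k) _ _ _ θ₉ b≈ θ₃) (sym (trans (π-* k _ _) (*-congˡ (triple _)))))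

  θ-split : θ L.≈ v (v θ) L.- (L.1# L.+ L.1#) L.* (q L.* v B)
  θ-split = π-injective At.split

  θ-norm : let a = v (v θ) in let b = L.- ((L.1# L.+ L.1#) L.* (q L.* v B)) in let t = v θ in
    (a L.* a L.* a L.+ b L.* b L.* b) L.* a L.≈ t L.* (t L.* t L.* t)
  θ-norm = π-injective At.norm

-- Enumeration of overpartitions as lists of parts.

canonical-head : ∀ p b b′ l → canonical ((p , b) ∷ l) ≡ canonical ((p , b′) ∷ l)
canonical-head p b b′ [] = ≡.refl
canonical-head p b b′ (x ∷ l) = ≡.refl

module ListSums (R : CommutativeRing 0ℓ 0ℓ) where
  open RingKit R

  sumL : {A : Set} → List A → (A → Carrier) → Carrier
  sumL [] f = 0#
  sumL (x ∷ xs) f = f x + sumL xs f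

  sumL-cong : {A : Set} (xs : List A) {f g : A → Carrier} → (∀ x → f x ≈ g x) → sumL xs f ≈ sumL xs g
  sumL-cong [] h = refl
  sumL-cong (x ∷ xs) h = +-cong (h x) (sumL-cong xs h)

  sumL-++ : {A : Set} (xs ys : List A) (f : A → Carrier) → sumL (xs ++ ys) f ≈ sumL xs f + sumL ys f
  sumL-++ [] ys f = sym (+-identityˡ _)
  sumL-++ (x ∷ xs) ys f = trans (+-congˡ (sumL-++ xs ys f)) (sym (+-assoc _ _ _))

  sumL-map : {A B : Set} (g : A → B) (xs : List A) (f : B → Carrier) → sumL (map g xs) f ≈ sumL xs (f ∘ g)
  sumL-map g [] f = refl
  sumL-map g (x ∷ xs) f = +-congˡ (sumL-map g xs f)

  sumL-concatMap : {A B : Set} (g : A → List B) (xs : List A) (f : B → Carrier) →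
    sumL (concatMap g xs) f ≈ sumL xs (λ x → sumL (g x) f)
  sumL-concatMap g [] f = refl
  sumL-concatMap g (x ∷ xs) f = trans (sumL-++ (g x) (concatMap g xs) f) (+-congˡ (sumL-concatMap g xs f))

  sumL-*ˡ : {A : Set} (xs : List A) (c : Carrier) (f : A → Carrier) → sumL xs (λ x → c * f x) ≈ c * sumL xs f
  sumL-*ˡ [] c f = sym (zeroʳ c)
  sumL-*ˡ (x ∷ xs) c f = trans (+-congˡ (sumL-*ˡ xs c f)) (sym (distribˡ c _ _))

  sumL-0 : {A : Set} (xs : List A) {f : A → Carrier} → (∀ x → f x ≈ 0#) → sumL xs f ≈ 0#
  sumL-0 [] h = refl
  sumL-0 (x ∷ xs) h = trans (+-cong (h x) (sumL-0 xs h)) (+-identityʳ 0#)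

  sumL-applyUpTo : {A : Set} (g : ℕ → A) (n : ℕ) (f : A → Carrier) → sumL (applyUpTo g n) f ≈ ∑ n (f ∘ g)
  sumL-applyUpTo g zero f = refl
  sumL-applyUpTo g (suc n) f = trans (+-congˡ (sumL-applyUpTo (g ∘ suc) n f)) (sym (∑-head n _))

  sumL-alphabet : ∀ n (f : ℕ × Bool → Carrier) → sumL (alphabet n) f ≈ ∑ n (λ i → f (suc i , true) + f (suc i , false))
  sumL-alphabet n f = begin
    sumL (alphabet n) f
      ≈⟨ sumL-concatMap (λ p → (suc p , true) ∷ (suc p , false) ∷ []) (upTo n) f ⟩
    sumL (upTo n) (λ p → f (suc p , true) + (f (suc p , false) + 0#))
      ≈⟨ sumL-applyUpTo (λ i → i) n _ ⟩
    ∑ n (λ p → f (suc p , true) + (f (suc p , false) + 0#))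
      ≈⟨ ∑-cong n (λ i → +-congˡ (+-identityʳ _)) ⟩
    ∑ n (λ i → f (suc i , true) + f (suc i , false)) ∎

  sumL-allLists : {A : Set} (xs : List A) (m : ℕ) (f : List A → Carrier) →
    sumL (allLists xs (suc m)) f ≈ f [] + sumL xs (λ x → sumL (allLists xs m) (λ l → f (x ∷ l)))
  sumL-allLists xs m f = +-congˡ (trans (sumL-concatMap (λ x → map (x ∷_) (allLists xs m)) xs f)
    (sumL-cong xs (λ x → sumL-map (x ∷_) (allLists xs m) f)))

  [_]_ : Bool → Carrier → Carrier
  [ b ] c = if b then c else 0#

  []-∧ : ∀ b b′ c → [ b ∧ b′ ] c ≈ [ b ] ([ b′ ] c)
  []-∧ true b′ c = refl
  []-∧ false b′ c = refl

  []-cong : ∀ b {c c′} → c ≈ c′ → [ b ] c ≈ [ b ] c′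
  []-cong true p = p
  []-cong false p = refl

  []-* : ∀ b c c′ → [ b ] (c * c′) ≈ c * [ b ] c′
  []-* true c c′ = refl
  []-* false c c′ = sym (zeroʳ c)

  sumL-[] : {A : Set} (xs : List A) (b : Bool) (f : A → Carrier) → sumL xs (λ x → [ b ] f x) ≈ [ b ] sumL xs f
  sumL-[] xs true f = refl
  sumL-[] xs false f = sumL-0 xs (λ _ → refl)

  ∑-[]≤ : ∀ n r (f : ℕ → Carrier) → r ℕ.< n → ∑ n (λ i → [ suc i ≤ᵇ suc r ] f i) ≈ ∑ (suc r) f
  ∑-[]≤ n r f r<n = begin
    ∑ n g                                                  ≡⟨ ≡.cong (λ z → ∑ z g) (ℕₚ.m+[n∸m]≡n r<n) ⟨
    ∑ (suc r ℕ.+ (n ∸ suc r)) g                            ≈⟨ ∑-split (suc r) (n ∸ suc r) g ⟩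
    ∑ (suc r) g + ∑ (n ∸ suc r) (λ i → g (suc r ℕ.+ i))    ≈⟨ +-cong (∑-cong< (suc r) (λ i p → lo i (ℕₚ.≤-pred p))) (∑-zero< (n ∸ suc r) (λ i _ → hi i)) ⟩
    ∑ (suc r) f + 0#                                       ≈⟨ +-identityʳ _ ⟩
    ∑ (suc r) f                                            ∎
    where
    g : ℕ → Carrier
    g i = [ suc i ≤ᵇ suc r ] f i
    lo : ∀ i → i ℕ.≤ r → g i ≈ f i
    lo i p with suc i ≤ᵇ suc r | ℕₚ.≤⇒≤ᵇ (s≤s p)
    ... | true | _ = refl
    hi : ∀ i → g (suc r ℕ.+ i) ≈ 0#
    hi i with suc (suc r ℕ.+ i) ≤ᵇ suc r | ℕₚ.≤ᵇ⇒≤ (suc (suc r ℕ.+ i)) (suc r)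
    ... | false | _ = refl
    ... | true | p with p _
    ...   | s≤s r+i<r = ⊥-elim′ (ℕₚ.<-irrefl ≡.refl (ℕₚ.≤-trans (s≤s (ℕₚ.m≤m+n r i)) r+i<r))
      where open import Data.Empty using () renaming (⊥-elim to ⊥-elim′)

module OverpartitionSeries (R : CommutativeRing 0ℓ 0ℓ) (q u ū : CommutativeRing.Carrier R) (k : ℕ)
  (q-nil : CommutativeRing._≈_ R (RingKit._^_ R q (suc k)) (CommutativeRing.0# R))
  (uū : CommutativeRing._≈_ R (CommutativeRing._*_ R u ū) (CommutativeRing.1# R)) where
  open Nilpotent R q k q-nil
  open RankSeries u ū uū using (W; V; W-sum; rankSeries)
  open ListSums R

  weight : OverPart → Carrier
  weight [] = 1#
  weight ((p , _) ∷ l) = u * q ^ p * weight l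

  valid : OverPart → Bool
  valid l = allPositive l ∧ canonical l

  -- the lists of at most m parts from 1 … n that may follow a part p
  gf : ℕ → ℕ → ℕ → Carrier
  gf n m p = sumL (allLists (alphabet n) m) (λ l → [ allPositive l ∧ canonical ((p , true) ∷ l) ] weight l)

  -- One step of the enumeration. After a part r + 1 the next part i + 1 is at most r + 1 without
  -- overline (first sum) and smaller than r + 1 with overline (second sum). One factor q is left
  -- out, so that every further part visibly costs a q.
  Λ : ℕ → (ℕ → Carrier) → Carrier
  Λ r f = ∑ (suc r) (λ i → u * q ^ i * f i) + ∑ r (λ i → u * q ^ i * f i)

  Λ-cong : ∀ r {f g} → (∀ i → i ℕ.≤ r → f i ≈ g i) → Λ r f ≈ Λ r g
  Λ-cong r h = +-cong (∑-cong< (suc r) (λ i p → *-congˡ (h i (ℕₚ.≤-pred p)))) (∑-cong< r (λ i p → *-congˡ (h i (ℕₚ.<⇒≤ p))))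

  Λ-linear : ∀ r f c g → Λ r (λ i → f i + c * g i) ≈ Λ r f + c * Λ r g
  Λ-linear r f c g = begin
    Λ r (λ i → f i + c * g i)
      ≈⟨ +-cong (part (suc r)) (part r) ⟩
    (∑ (suc r) F + c * ∑ (suc r) G) + (∑ r F + c * ∑ r G)
      ≈⟨ solve 5 (λ a b x y c → (a :+ c :* b) :+ (x :+ c :* y) := (a :+ x) :+ c :* (b :+ y)) refl _ _ _ _ c ⟩
    Λ r f + c * Λ r g ∎
    where
    F G : ℕ → Carrier
    F i = u * q ^ i * f i
    G i = u * q ^ i * g i
    part : ∀ n → ∑ n (λ i → u * q ^ i * (f i + c * g i)) ≈ ∑ n F + c * ∑ n G
    part n = begin
      ∑ n (λ i → u * q ^ i * (f i + c * g i))  ≈⟨ ∑-cong n (λ i → solve 4 (λ a f c g → a :* (f :+ c :* g) := a :* f :+ c :* (a :* g)) refl (u * q ^ i) (f i) c (g i)) ⟩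
      ∑ n (λ i → F i + c * G i)                ≈⟨ trans (∑-+ n F _) (+-congˡ (∑-*ˡ n c G)) ⟩
      ∑ n F + c * ∑ n G                        ∎

  q*Λ : ∀ r f → q * Λ r f ≈ ∑ (suc r) (λ i → u * q ^ suc i * f i) + ∑ r (λ i → u * q ^ suc i * f i)
  q*Λ r f = trans (distribˡ q _ _) (+-cong (part (suc r)) (part r))
    where
    part : ∀ n → q * ∑ n (λ i → u * q ^ i * f i) ≈ ∑ n (λ i → u * q ^ suc i * f i)
    part n = trans (sym (∑-*ˡ n q _)) (∑-cong n (λ i → solve 4 (λ q u x f → q :* (u :* x :* f) := u :* (q :* x) :* f) refl q u (q ^ i) (f i)))

  gf-suc : ∀ n m r → r ℕ.< n → gf n (suc m) (suc r) ≈ 1# + q * Λ r (λ i → gf n m (suc i))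
  gf-suc n m r r<n = begin
    gf n (suc m) (suc r)
      ≈⟨ sumL-allLists (alphabet n) m _ ⟩
    1# + sumL (alphabet n) (λ x → sumL (allLists (alphabet n) m) (λ l → [ allPositive (x ∷ l) ∧ canonical ((suc r , true) ∷ x ∷ l) ] weight (x ∷ l)))
      ≈⟨ +-congˡ (sumL-alphabet n _) ⟩
    1# + ∑ n (λ i → S i true + S i false)
      ≈⟨ +-congˡ (∑-cong n (λ i → +-cong (S-value i true) (S-value i false))) ⟩
    1# + ∑ n (λ i → [ c i true ] h i + [ c i false ] h i)
      ≈⟨ +-congˡ (trans (∑-+ n _ _) (+-comm _ _)) ⟩
    1# + (∑ n (λ i → [ c i false ] h i) + ∑ n (λ i → [ c i true ] h i))
      ≈⟨ +-congˡ (+-cong (trans (∑-cong n (λ i → []-and-true (suc i ≤ᵇ suc r) (not (i ≡ᵇ r)) (h i))) (∑-[]≤ n r h r<n)) distinct) ⟩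
    1# + (∑ (suc r) h + ∑ r h)
      ≈⟨ +-congˡ (q*Λ r _) ⟨
    1# + q * Λ r (λ i → gf n m (suc i)) ∎
    where
    h : ℕ → Carrier
    h i = u * q ^ suc i * gf n m (suc i)
    c : ℕ → Bool → Bool
    c i b = (suc i ≤ᵇ suc r) ∧ (not (i ≡ᵇ r) ∨ not b)
    S : ℕ → Bool → Carrier
    S i b = sumL (allLists (alphabet n) m) (λ l → [ allPositive l ∧ ((suc i ≤ᵇ suc r) ∧ (not (i ≡ᵇ r) ∨ not b) ∧ canonical ((suc i , b) ∷ l)) ] (u * q ^ suc i * weight l))
    S-value : ∀ i b → S i b ≈ [ c i b ] h i
    S-value i b = begin
      S i b
        ≈⟨ sumL-cong (allLists (alphabet n) m) (λ l → begin
             [ allPositive l ∧ ((suc i ≤ᵇ suc r) ∧ (not (i ≡ᵇ r) ∨ not b) ∧ canonical ((suc i , b) ∷ l)) ] (u * q ^ suc i * weight l)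
               ≡⟨ ≡.cong (λ z → [ z ] (u * q ^ suc i * weight l)) (shuffle (allPositive l) (suc i ≤ᵇ suc r) (not (i ≡ᵇ r) ∨ not b) _ _ (canonical-head (suc i) b true l)) ⟩
             [ c i b ∧ (allPositive l ∧ canonical ((suc i , true) ∷ l)) ] (u * q ^ suc i * weight l)
               ≈⟨ []-∧ (c i b) _ _ ⟩
             [ c i b ] ([ allPositive l ∧ canonical ((suc i , true) ∷ l) ] (u * q ^ suc i * weight l))
               ≈⟨ []-cong (c i b) ([]-* (allPositive l ∧ canonical ((suc i , true) ∷ l)) _ _) ⟩
             [ c i b ] (u * q ^ suc i * [ allPositive l ∧ canonical ((suc i , true) ∷ l) ] weight l) ∎) ⟩
      sumL (allLists (alphabet n) m) (λ l → [ c i b ] (u * q ^ suc i * [ allPositive l ∧ canonical ((suc i , true) ∷ l) ] weight l))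
        ≈⟨ sumL-[] (allLists (alphabet n) m) (c i b) _ ⟩
      [ c i b ] sumL (allLists (alphabet n) m) (λ l → u * q ^ suc i * [ allPositive l ∧ canonical ((suc i , true) ∷ l) ] weight l)
        ≈⟨ []-cong (c i b) (sumL-*ˡ (allLists (alphabet n) m) _ _) ⟩
      [ c i b ] h i ∎
      where
      shuffle : ∀ a x y z z′ → z ≡ z′ → a ∧ (x ∧ y ∧ z) ≡ (x ∧ y) ∧ (a ∧ z′)
      shuffle a true true z _ ≡.refl = ≡.refl
      shuffle a true false z _ ≡.refl = Boolₚ.∧-zeroʳ a
      shuffle a false y z _ ≡.refl = Boolₚ.∧-zeroʳ a
    []-and-true : ∀ x y e → [ x ∧ (y ∨ true) ] e ≈ [ x ] e
    []-and-true true true e = refl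
    []-and-true true false e = refl
    []-and-true false y e = refl
    distinct : ∑ n (λ i → [ c i true ] h i) ≈ ∑ r h
    distinct = begin
      ∑ n (λ i → [ c i true ] h i)
        ≈⟨ ∑-cong n (λ i → []-∧ (suc i ≤ᵇ suc r) _ _) ⟩
      ∑ n (λ i → [ suc i ≤ᵇ suc r ] ([ not (i ≡ᵇ r) ∨ false ] h i))
        ≈⟨ ∑-[]≤ n r _ r<n ⟩
      ∑ r (λ i → [ not (i ≡ᵇ r) ∨ false ] h i) + [ not (r ≡ᵇ r) ∨ false ] h r
        ≈⟨ +-cong (∑-cong< r (λ i p → reflexive (≡.cong (λ z → [ not z ∨ false ] h i) (≡ᵇ-< p)))) (reflexive (≡.cong (λ z → [ not z ∨ false ] h r) (≡ᵇ-refl r))) ⟩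
      ∑ r h + 0#
        ≈⟨ +-identityʳ _ ⟩
      ∑ r h ∎
      where
      ≡ᵇ-refl : ∀ r → (r ≡ᵇ r) ≡ true
      ≡ᵇ-refl zero = ≡.refl
      ≡ᵇ-refl (suc r) = ≡ᵇ-refl r
      ≡ᵇ-< : ∀ {i r} → i ℕ.< r → (i ≡ᵇ r) ≡ false
      ≡ᵇ-< {zero} {suc r} _ = ≡.refl
      ≡ᵇ-< {suc i} {suc r} (s≤s p) = ≡ᵇ-< p

  -- `V` is the fixed point of the recursion that `gf` obeys in its bound on the number of parts.
  V-rec : ∀ r → V r ≈ 1# + q * Λ r V
  V-rec r = begin
    V r
      ≈⟨ solve 2 (λ v x → v := v :* (:1 :- x) :+ x :* v) refl (V r) (u * q ^ suc r) ⟩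
    W r * I u r * d u r + u * q ^ suc r * V r
      ≈⟨ +-congʳ (trans (trans (*-assoc _ _ _) (*-congˡ (trans (*-comm _ _) (d*I u r)))) (trans (*-identityʳ _) (W-sum r))) ⟩
    (1# + ∑ r (λ l → (1# + 1#) * H l)) + H r
      ≈⟨ +-congʳ (+-congˡ (∑-*ˡ r _ H)) ⟩
    (1# + (1# + 1#) * ∑ r H) + H r
      ≈⟨ solve 2 (λ s h → (:1 :+ :2 :* s) :+ h := :1 :+ ((s :+ h) :+ s)) refl (∑ r H) (H r) ⟩
    1# + (∑ (suc r) H + ∑ r H)
      ≈⟨ +-congˡ (q*Λ r V) ⟨
    1# + q * Λ r V ∎
    where
    H : ℕ → Carrier
    H l = u * q ^ suc l * V l

  -- Cofactor of q^(m+1) in the discrepancy between m parts at most and any number of parts: the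
  -- lists left out have more than m parts.
  error : ℕ → ℕ → Carrier
  error zero r = - Λ r V
  error (suc m) r = Λ r (error m)

  gf-V : ∀ n m r → r ℕ.< n → gf n m (suc r) ≈ V r + q ^ suc m * error m r
  gf-V n zero r _ = begin
    1# + 0#                                 ≈⟨ solve 2 (λ q l → :1 :+ con (+ 0) := (:1 :+ q :* l) :+ (q :* :1) :* (:- l)) refl q (Λ r V) ⟩
    (1# + q * Λ r V) + q ^ 1 * - Λ r V      ≈⟨ +-congʳ (V-rec r) ⟨
    V r + q ^ 1 * error 0 r                 ∎
  gf-V n (suc m) r r<n = begin
    gf n (suc m) (suc r)
      ≈⟨ gf-suc n m r r<n ⟩
    1# + q * Λ r (λ i → gf n m (suc i))
      ≈⟨ +-congˡ (*-congˡ (trans (Λ-cong r (λ i i≤r → gf-V n m i (ℕₚ.≤-<-trans i≤r r<n))) (Λ-linear r V (q ^ suc m) (error m)))) ⟩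
    1# + q * (Λ r V + q ^ suc m * Λ r (error m))
      ≈⟨ solve 4 (λ q l x e → :1 :+ q :* (l :+ x :* e) := (:1 :+ q :* l) :+ (q :* x) :* e) refl q _ _ _ ⟩
    (1# + q * Λ r V) + q ^ suc (suc m) * error (suc m) r
      ≈⟨ +-congʳ (V-rec r) ⟨
    V r + q ^ suc (suc m) * error (suc m) r ∎

  headPart : OverPart → ℕ
  headPart [] = 0
  headPart ((p , _) ∷ _) = p

  -- The first part contributes at least one q, and the bound of m = n - 1 further parts an error
  -- divisible by qⁿ; their product is zero because q^(n+1) = 0. The same power removes the largest
  -- part n + 1 from `rankSeries`.
  overpartitions-rankSeries : ∀ m → k ≡ suc m →
    sumL (candidates (suc m)) (λ l → [ valid l ] (ū ^ headPart l * weight l)) ≈ rankSeries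
  overpartitions-rankSeries m k≡ = begin
    sumL (candidates n) (λ l → [ valid l ] (ū ^ headPart l * weight l))
      ≈⟨ sumL-allLists (alphabet n) m _ ⟩
    1# * 1# + sumL (alphabet n) (λ x → sumL (allLists (alphabet n) m) (λ l → [ valid (x ∷ l) ] (ū ^ proj₁ x * weight (x ∷ l))))
      ≈⟨ +-cong (*-identityʳ 1#) (trans (sumL-alphabet n _) (∑-cong< n (λ i i<n → trans (+-cong (block i true) (block i false)) (value i i<n)))) ⟩
    1# + ∑ n term
      ≈⟨ +-congˡ (trans (sym (+-identityʳ _)) (+-congˡ (sym last))) ⟩
    1# + ∑ (suc n) term
      ≡⟨ ≡.cong (λ z → 1# + ∑ (suc z) term) (≡.sym k≡) ⟩
    rankSeries ∎
    where
    n = suc m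
    term : ℕ → Carrier
    term l = (1# + 1#) * (ū ^ suc l * (u * q ^ suc l * V l))
    block : ∀ i b → sumL (allLists (alphabet n) m) (λ l → [ valid ((suc i , b) ∷ l) ] (ū ^ suc i * weight ((suc i , b) ∷ l)))
      ≈ ū ^ suc i * (u * q ^ suc i) * gf n m (suc i)
    block i b = trans (sumL-cong (allLists (alphabet n) m) (λ l → begin
        [ allPositive l ∧ canonical ((suc i , b) ∷ l) ] (ū ^ suc i * (u * q ^ suc i * weight l))
          ≈⟨ trans (reflexive (≡.cong (λ z → [ allPositive l ∧ z ] (ū ^ suc i * (u * q ^ suc i * weight l))) (canonical-head (suc i) b true l)))
               ([]-cong (allPositive l ∧ canonical ((suc i , true) ∷ l)) (sym (*-assoc _ _ _))) ⟩
        [ allPositive l ∧ canonical ((suc i , true) ∷ l) ] (ū ^ suc i * (u * q ^ suc i) * weight l)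
          ≈⟨ []-* (allPositive l ∧ canonical ((suc i , true) ∷ l)) _ _ ⟩
        ū ^ suc i * (u * q ^ suc i) * [ allPositive l ∧ canonical ((suc i , true) ∷ l) ] weight l ∎))
      (sumL-*ˡ (allLists (alphabet n) m) _ _)
    value : ∀ i → i ℕ.< n → ū ^ suc i * (u * q ^ suc i) * gf n m (suc i) + ū ^ suc i * (u * q ^ suc i) * gf n m (suc i) ≈ term i
    value i i<n = begin
      ū ^ suc i * (u * q ^ suc i) * gf n m (suc i) + ū ^ suc i * (u * q ^ suc i) * gf n m (suc i)
        ≈⟨ +-cong (*-congˡ (gf-V n m i i<n)) (*-congˡ (gf-V n m i i<n)) ⟩
      A * (V i + q ^ n * error m i) + A * (V i + q ^ n * error m i)
        ≈⟨ solve 7 (λ w u q x v y e → (w :* (u :* (q :* x)) :* (v :+ y :* e)) :+ (w :* (u :* (q :* x)) :* (v :+ y :* e))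
              := :2 :* (w :* (u :* (q :* x) :* v)) :+ (q :* y) :* (:2 :* w :* u :* x :* e)) refl (ū ^ suc i) u q (q ^ i) (V i) (q ^ n) (error m i) ⟩
      term i + q ^ suc n * _
        ≈⟨ +-congˡ (trans (*-congʳ (q^≥K (suc n) (ℕₚ.≤-reflexive (≡.cong suc k≡)))) (zeroˡ _)) ⟩
      term i + 0#
        ≈⟨ +-identityʳ _ ⟩
      term i ∎
      where A = ū ^ suc i * (u * q ^ suc i)
    last : term n ≈ 0#
    last = trans (*-congˡ (trans (*-congˡ (trans (*-congʳ (trans (*-congˡ (q^≥K (suc n) (ℕₚ.≤-reflexive (≡.cong suc k≡)))) (zeroʳ u))) (zeroˡ _))) (zeroʳ _))) (zeroʳ _)

-- The rank series at a primitive cube root of unity lies in R.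
module RankDescent (R S : CommutativeRing 0ℓ 0ℓ) (h : CommutativeRing.Carrier R → CommutativeRing.Carrier S)
  (h-cong : ∀ {x y} → CommutativeRing._≈_ R x y → CommutativeRing._≈_ S (h x) (h y))
  (h-+ : ∀ x y → CommutativeRing._≈_ S (h (CommutativeRing._+_ R x y)) (CommutativeRing._+_ S (h x) (h y)))
  (h-* : ∀ x y → CommutativeRing._≈_ S (h (CommutativeRing._*_ R x y)) (CommutativeRing._*_ S (h x) (h y)))
  (h-0 : CommutativeRing._≈_ S (h (CommutativeRing.0# R)) (CommutativeRing.0# S))
  (h-1 : CommutativeRing._≈_ S (h (CommutativeRing.1# R)) (CommutativeRing.1# S))
  (ω : CommutativeRing.Carrier S)
  (ω²+ω+1 : CommutativeRing._≈_ S (RingKit._+_ S (RingKit._+_ S (RingKit._*_ S ω ω) ω) (CommutativeRing.1# S)) (CommutativeRing.0# S))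
  (q : CommutativeRing.Carrier R) (k : ℕ)
  (q-nil : CommutativeRing._≈_ R (RingKit._^_ R q (suc k)) (CommutativeRing.0# R)) where
  private
    module A = Nilpotent R q k q-nil
  open HomTheta R S h h-cong h-+ h-* h-0 h-1
  open RingKit S

  ω³ : ω * ω * ω ≈ 1#
  ω³ = trans (solve 1 (λ w → w :* w :* w := :1 :+ (w :* w :+ w :+ :1) :* (w :- :1)) refl ω)
    (trans (+-congˡ (trans (*-congʳ ω²+ω+1) (zeroˡ _))) (+-identityʳ 1#))

  hq-nil : h q ^ suc k ≈ 0#
  hq-nil = trans (sym (h-^ q (suc k))) (trans (h-cong q-nil) h-0)

  module N = Nilpotent S (h q) k hq-nil
  module Rank = N.RankSeries (ω * ω) ω ω³
  open A using (K)

  -- 1/(1 + y + y²) for y = q^(r+1), written as (1 - y)/(1 - y³) so that ω does not occur.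
  J : ℕ → A.Carrier
  J r = (A.1# A.- q A.^ suc r) A.* A.I A.1# (2 ℕ.+ 3 ℕ.* r)

  private
    y : ℕ → A.Carrier
    y r = q A.^ suc r

    y³ : ∀ r → q A.^ suc (2 ℕ.+ 3 ℕ.* r) A.≈ y r A.* y r A.* y r
    y³ r = A.trans (A.reflexive (≡.cong (q A.^_) (ℕsolve 1 (λ r → κ 3 ⊞ κ 3 ⊠ r ≔ (κ 1 ⊞ r) ⊞ (κ 1 ⊞ r) ⊞ (κ 1 ⊞ r)) ≡.refl r)))
      (A.trans (A.^-homo-* q (suc r ℕ.+ suc r) (suc r)) (A.*-congʳ (A.^-homo-* q (suc r) (suc r))))

  J-inverse : ∀ r → (A.1# A.+ y r A.+ y r A.* y r) A.* J r A.≈ A.1#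
  J-inverse r = A.begin
    (A.1# A.+ y r A.+ y r A.* y r) A.* J r
      A.≈⟨ A.solve 2 (λ y i → (A.:1 A.:+ y A.:+ y A.:* y) A.:* ((A.:1 A.:- y) A.:* i) A.:= (A.:1 A.:- A.:1 A.:* (y A.:* y A.:* y)) A.:* i) A.refl (y r) _ ⟩
    (A.1# A.- A.1# A.* (y r A.* y r A.* y r)) A.* A.I A.1# (2 ℕ.+ 3 ℕ.* r)
      A.≈⟨ A.*-congʳ (A.+-congˡ (A.-‿cong (A.*-congˡ (A.sym (y³ r))))) ⟩
    A.d A.1# (2 ℕ.+ 3 ℕ.* r) A.* A.I A.1# (2 ℕ.+ 3 ℕ.* r)
      A.≈⟨ A.d*I A.1# (2 ℕ.+ 3 ℕ.* r) ⟩
    A.1# A.∎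

  -- 2(2 - ω - ω²), the constant in the product of θ with the rank series.
  six : A.Carrier
  six = (A.1# A.+ A.1#) A.* (A.1# A.+ A.1# A.+ A.1#)

  -- F is formed inside R as T/θ, the inverse of θ being `AtOne.W K`. That the rank series over S is
  -- its image is `rankSeries-descends`.
  Tseries Fseries : A.Carrier
  Tseries = A.1# A.+ six A.* A.∑ K (λ r → A.sgn (suc r) A.* q A.^ (suc r ℕ.* suc (suc r)) A.* J r)
  Fseries = A.AtOne.W K A.* Tseries

  theta*Fseries : A.theta A.* Fseries A.≈ Tseries
  theta*Fseries = A.trans (A.sym (A.*-assoc _ _ _)) (A.trans (A.*-congʳ A.theta*W) (A.*-identityˡ _))

  h-J : ∀ r → h (J r) ≈ Rank.J r
  h-J r = Unit-cancelˡ (Rank.J r , Rank.D*J r) (begin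
    Rank.D r * h (J r)
      ≈⟨ *-congʳ (begin
           (1# - ω * ω * z) * (1# - ω * z)
             ≈⟨ solve 2 (λ w z → (:1 :- w :* w :* z) :* (:1 :- w :* z) := (:1 :+ z :+ z :* z) :+ (w :* w :+ w :+ :1) :* (:- z :+ (w :- :1) :* z :* z)) refl ω z ⟩
           (1# + z + z * z) + (ω * ω + ω + 1#) * _
             ≈⟨ trans (+-congˡ (trans (*-congʳ ω²+ω+1) (zeroˡ _))) (+-identityʳ _) ⟩
           1# + z + z * z
             ≈⟨ +-cong (+-cong h-1 (h-^ q (suc r))) (trans (h-* _ _) (*-cong (h-^ q (suc r)) (h-^ q (suc r)))) ⟨
           (h A.1# + h (y r)) + h (y r A.* y r)
             ≈⟨ trans (h-+ _ _) (+-congʳ (h-+ _ _)) ⟨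
           h (A.1# A.+ y r A.+ y r A.* y r) ∎) ⟩
    h (A.1# A.+ y r A.+ y r A.* y r) * h (J r)
      ≈⟨ trans (sym (h-* _ _)) (trans (h-cong (J-inverse r)) h-1) ⟩
    1#
      ≈⟨ Rank.D*J r ⟨
    Rank.D r * Rank.J r ∎)
    where z = h q ^ suc r

  h-T : h Tseries ≈ N.theta * Rank.rankSeries
  h-T = begin
    h Tseries
      ≈⟨ trans (h-+ _ _) (+-cong h-1 (trans (h-* _ _) (*-cong h-six (trans (h-∑ K _) (∑-cong K (λ r → trans (h-* _ _) (*-cong (h-term (suc r) q (suc r ℕ.* suc (suc r))) (h-J r)))))))) ⟩
    1# + ((1# + 1#) * (1# + 1# - (ω * ω + ω))) * ∑ K (λ r → N.sgn (suc r) * h q ^ (suc r ℕ.* suc (suc r)) * Rank.J r)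
      ≈⟨ N.RankTheta.theta*rankSeries (ω * ω) ω ω³ ⟨
    N.theta * Rank.rankSeries ∎
    where
    h-two : h (A.1# A.+ A.1#) ≈ 1# + 1#
    h-two = trans (h-+ _ _) (+-cong h-1 h-1)
    h-six : h six ≈ (1# + 1#) * (1# + 1# - (ω * ω + ω))
    h-six = begin
      h six
        ≈⟨ trans (h-* _ _) (*-cong h-two (trans (h-+ _ _) (+-cong h-two h-1))) ⟩
      (1# + 1#) * (1# + 1# + 1#)
        ≈⟨ trans (+-congˡ (trans (*-congʳ ω²+ω+1) (zeroˡ _))) (+-identityʳ _) ⟨
      (1# + 1#) * (1# + 1# + 1#) + (ω * ω + ω + 1#) * (- (1# + 1#))
        ≈⟨ solve 1 (λ w → :2 :* (:1 :+ :1 :+ :1) :+ (w :* w :+ w :+ :1) :* (:- :2) := :2 :* (:1 :+ :1 :- (w :* w :+ w))) refl ω ⟩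
      (1# + 1#) * (1# + 1# - (ω * ω + ω)) ∎

  rankSeries-descends : Rank.rankSeries ≈ h Fseries
  rankSeries-descends = sym (begin
    h Fseries                                        ≈⟨ h-* _ _ ⟩
    h (A.AtOne.W K) * h Tseries                      ≈⟨ *-congˡ h-T ⟩
    h (A.AtOne.W K) * (N.theta * Rank.rankSeries)    ≈⟨ *-assoc _ _ _ ⟨
    h (A.AtOne.W K) * N.theta * Rank.rankSeries      ≈⟨ *-congʳ (begin
         h (A.AtOne.W K) * N.theta                    ≈⟨ *-congˡ (sym (h-theta K q)) ⟩
         h (A.AtOne.W K) * h A.theta                  ≈⟨ trans (*-comm _ _) (sym (h-* _ _)) ⟩
         h (A.theta A.* A.AtOne.W K)                  ≈⟨ trans (h-cong A.theta*W) h-1 ⟩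
         1#                                           ∎) ⟩
    1# * Rank.rankSeries                             ≈⟨ *-identityˡ _ ⟩
    Rank.rankSeries                                  ∎)

  open OverpartitionSeries S (h q) (ω * ω) ω k hq-nil ω³ public using (weight; valid; headPart; overpartitions-rankSeries)

  weight-power : ∀ l → weight l ≈ ω ^ (2 ℕ.* length l) * h (q A.^ partsSum l)
  weight-power [] = sym (trans (*-identityˡ _) h-1)
  weight-power ((p , b) ∷ l) = begin
    ω * ω * h q ^ p * weight l
      ≈⟨ *-cong (*-congˡ (sym (h-^ q p))) (weight-power l) ⟩
    ω * ω * h (q A.^ p) * (ω ^ (2 ℕ.* length l) * h (q A.^ partsSum l))
      ≈⟨ solve 4 (λ w a b c → w :* w :* a :* (b :* c) := (w :* (w :* b)) :* (a :* c)) refl ω _ _ _ ⟩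
    ω * (ω * ω ^ (2 ℕ.* length l)) * (h (q A.^ p) * h (q A.^ partsSum l))
      ≈⟨ *-cong (reflexive (≡.cong (ω ^_) (ℕsolve 1 (λ n → κ 2 ⊞ κ 2 ⊠ n ≔ κ 2 ⊠ (κ 1 ⊞ n)) ≡.refl (length l))))
           (trans (sym (h-* _ _)) (h-cong (A.sym (A.^-homo-* q p (partsSum l))))) ⟩
    ω ^ (2 ℕ.* suc (length l)) * h (q A.^ (p ℕ.+ partsSum l)) ∎

  ω^3+ : ∀ n x → ω ^ (3 ℕ.+ n) * x ≈ ω ^ n * x
  ω^3+ n x = *-congʳ (trans (solve 2 (λ w p → w :* (w :* (w :* p)) := (w :* w :* w) :* p) refl ω (ω ^ n)) (trans (*-congʳ ω³) (*-identityˡ _)))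

  open ListSums S public using (sumL; sumL-cong; [_]_; []-cong)

  -- Every part has weight u = ω² = 1/ω, so the exponent of ω is the rank modulo 3.
  F-as-sum : ∀ m → k ≡ suc m →
    h Fseries ≈ sumL (candidates (suc m)) (λ l → [ valid l ] (ω ^ (headPart l ℕ.+ 2 ℕ.* length l) * h (q A.^ partsSum l)))
  F-as-sum m k≡ = trans (sym rankSeries-descends) (trans (sym (overpartitions-rankSeries m k≡))
    (sumL-cong (candidates (suc m)) (λ l → []-cong (valid l) (trans (*-congˡ (weight-power l))
      (trans (sym (*-assoc _ _ _)) (*-congʳ (sym (^-homo-* ω (headPart l) (2 ℕ.* length l)))))))))

-- ω ↦ −1, i.e. a + bω ↦ a − b, on the powers of ω
λω : ℕ → ℤ
λω 0 = + 1
λω 1 = -[1+ 0 ]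
λω 2 = + 0
λω (suc (suc (suc n))) = λω n

b2z : Bool → ℤ
b2z b = if b then + 1 else + 0

private
  3∣-shift : ∀ x → does (3 ∣? ∣ x ℤ.+ + 3 ∣) ≡ does (3 ∣? ∣ x ∣)
  3∣-shift x = does-⇔ (mk⇔ to from) (3 ∣? ∣ x ℤ.+ + 3 ∣) (3 ∣? ∣ x ∣)
    where
    3∣3 : + 3 ℤ∣.∣ + 3
    3∣3 = ℤ∣.∣-refl
    from : 3 ∣ ∣ x ∣ → 3 ∣ ∣ x ℤ.+ + 3 ∣
    from p = ℤ∣.∣⇒∣ᵤ {+ 3} {x ℤ.+ + 3} (ℤ∣.∣m∣n⇒∣m+n (ℤ∣.∣ᵤ⇒∣ {+ 3} {x} p) 3∣3)
    to : 3 ∣ ∣ x ℤ.+ + 3 ∣ → 3 ∣ ∣ x ∣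
    to p = ℤ∣.∣⇒∣ᵤ {+ 3} {x} (≡.subst (+ 3 ℤ∣.∣_) (ℤsolve 1 (λ x → (x ⊞ᶻ κᶻ (+ 3)) ⊟ᶻ κᶻ (+ 3) ≔ᶻ x) ≡.refl x)
      (ℤ∣.∣m∣n⇒∣m-n (ℤ∣.∣ᵤ⇒∣ {+ 3} {x ℤ.+ + 3} p) 3∣3))

  gap : ℤ → ℤ
  gap x = b2z (congMod x (+ 0) 3) ℤ.- b2z (congMod x (+ 1) 3)

  gap-shift : ∀ x y → x ≡ y ℤ.+ + 3 → gap x ≡ gap y
  gap-shift x y ≡.refl = ≡.cong₂ (λ a b → b2z a ℤ.- b2z b) (shift (+ 0)) (shift (+ 1))
    where
    shift : ∀ s → congMod (y ℤ.+ + 3) s 3 ≡ congMod y s 3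
    shift s = ≡.trans (≡.cong (λ z → does (3 ∣? ∣ z ∣)) (ℤsolve 2 (λ y s → (y ⊞ᶻ κᶻ (+ 3)) ⊟ᶻ s ≔ᶻ (y ⊟ᶻ s) ⊞ᶻ κᶻ (+ 3)) ≡.refl y s)) (3∣-shift (y ℤ.- s))

-- 1, ω, ω² = -1 - ω go to 1, -1, 0 under a + bω ↦ a - b, which is [rank ≡ 0] - [rank ≡ 1] since 2l
-- ≡ -l modulo 3. Both sides have period 3 in h and in l, which leaves nine values.
λω-rank : ∀ h l → λω (h ℕ.+ 2 ℕ.* l) ≡ gap (+ h ℤ.- + l)
λω-rank (suc (suc (suc h))) l = ≡.trans (λω-rank h l) (≡.sym (gap-shift (+ (3 ℕ.+ h) ℤ.- + l) (+ h ℤ.- + l)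
  (≡.trans (≡.cong (ℤ._- + l) (ℤₚ.pos-+ 3 h)) (ℤsolve 2 (λ h l → (κᶻ (+ 3) ⊞ᶻ h) ⊟ᶻ l ≔ᶻ (h ⊟ᶻ l) ⊞ᶻ κᶻ (+ 3)) ≡.refl (+ h) (+ l)))))
λω-rank h (suc (suc (suc l))) = ≡.trans (≡.cong λω (ℕsolve 2 (λ h l → h ⊞ κ 2 ⊠ (κ 3 ⊞ l) ≔ κ 6 ⊞ (h ⊞ κ 2 ⊠ l)) ≡.refl h l))
  (≡.trans (λω-rank h l) (gap-shift (+ h ℤ.- + l) (+ h ℤ.- + (3 ℕ.+ l))
    (≡.sym (≡.trans (≡.cong (λ z → + h ℤ.- z ℤ.+ + 3) (ℤₚ.pos-+ 3 l)) (ℤsolve 2 (λ h l → h ⊟ᶻ (κᶻ (+ 3) ⊞ᶻ l) ⊞ᶻ κᶻ (+ 3) ≔ᶻ h ⊟ᶻ l) ≡.refl (+ h) (+ l))))))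
λω-rank 0 0 = ≡.refl
λω-rank 0 1 = ≡.refl
λω-rank 0 2 = ≡.refl
λω-rank 1 0 = ≡.refl
λω-rank 1 1 = ≡.refl
λω-rank 1 2 = ≡.refl
λω-rank 2 0 = ≡.refl
λω-rank 2 1 = ≡.refl
λω-rank 2 2 = ≡.refl

module ZL = ListSums ℤₚ.+-*-commutativeRing

length-filter : {A : Set} (p : A → Bool) (xs : List A) → + length (filterᵇ p xs) ≡ ZL.sumL xs (λ x → b2z (p x))
length-filter p [] = ≡.refl
length-filter p (x ∷ xs) with p x
... | true = ≡.trans (ℤₚ.pos-+ 1 _) (≡.cong (λ z → + 1 ℤ.+ z) (length-filter p xs))
... | false = ≡.trans (length-filter p xs) (≡.sym (ℤₚ.+-identityˡ _))

sumL-minus : {A : Set} (xs : List A) (f g : A → ℤ) → ZL.sumL xs f ℤ.- ZL.sumL xs g ≡ ZL.sumL xs (λ x → f x ℤ.- g x)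
sumL-minus [] f g = ≡.refl
sumL-minus (x ∷ xs) f g = ≡.trans
  (ℤsolve 4 (λ a b c d → (a ⊞ᶻ b) ⊟ᶻ (c ⊞ᶻ d) ≔ᶻ (a ⊟ᶻ c) ⊞ᶻ (b ⊟ᶻ d)) ≡.refl (f x) (ZL.sumL xs f) (g x) (ZL.sumL xs g))
  (≡.cong (λ z → (f x ℤ.- g x) ℤ.+ z) (sumL-minus xs f g))

headOf : OverPart → ℕ
headOf [] = 0
headOf ((p , _) ∷ _) = p

∧-elimˡ : ∀ x {y} → x ∧ y ≡ true → x ≡ true
∧-elimˡ true _ = ≡.refl

∧-elimʳ : ∀ x {y} → x ∧ y ≡ true → y ≡ true
∧-elimʳ true e = e

-- The rank is defined through the maximum of the parts, whereas the enumeration follows the head of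
-- the list.
largest-head : ∀ l → canonical l ≡ true → largestPart l ≡ headOf l
largest-head [] _ = ≡.refl
largest-head ((p , b) ∷ []) _ = ℕₚ.⊔-identityʳ p
largest-head ((p , b) ∷ (p′ , b′) ∷ l) c = ≡.trans (≡.cong (p ⊔_) (largest-head ((p′ , b′) ∷ l) (∧-elimʳ (not (p′ ≡ᵇ p) ∨ not b′) (∧-elimʳ (p′ ≤ᵇ p) c))))
  (ℕₚ.m≥n⇒m⊔n≡m (ℕₚ.≤ᵇ⇒≤ p′ p (≡.subst Bool.T (≡.sym (∧-elimˡ (p′ ≤ᵇ p) c)) tt)))

≡ᵇ-sym : ∀ m n → (m ≡ᵇ n) ≡ (n ≡ᵇ m)
≡ᵇ-sym zero zero = ≡.refl
≡ᵇ-sym zero (suc n) = ≡.refl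
≡ᵇ-sym (suc m) zero = ≡.refl
≡ᵇ-sym (suc m) (suc n) = ≡ᵇ-sym m n

contribution : ℕ → OverPart → ℤ
contribution n l = if allPositive l ∧ canonical l then λω (headOf l ℕ.+ 2 ℕ.* length l) ℤ.* mono (+ 1) (partsSum l) n else + 0

Nbar-difference : ∀ m → + Nbar (+ 0) 3 (suc m) ℤ.- + Nbar (+ 1) 3 (suc m) ≡ ZL.sumL (candidates (suc m)) (contribution (suc m))
Nbar-difference m = ≡.trans (≡.cong₂ ℤ._-_ (length-filter (p (+ 0)) cs) (length-filter (p (+ 1)) cs))
  (≡.trans (sumL-minus cs (λ l → b2z (p (+ 0) l)) (λ l → b2z (p (+ 1) l))) (ZL.sumL-cong cs pointwise))
  where
  n = suc m
  cs = candidates n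
  p : ℤ → OverPart → Bool
  p s l = isOverpartitionOf n l ∧ congMod (rank l) s 3
  pointwise : ∀ l → b2z (p (+ 0) l) ℤ.- b2z (p (+ 1) l) ≡ contribution n l
  pointwise l rewrite ≡ᵇ-sym n (partsSum l) with partsSum l ≡ᵇ n | allPositive l | canonical l in c
  ... | true | true | true = ≡.trans (≡.cong (λ z → b2z (congMod (+ z ℤ.- + length l) (+ 0) 3) ℤ.- b2z (congMod (+ z ℤ.- + length l) (+ 1) 3)) (largest-head l c))
        (≡.trans (≡.sym (λω-rank (headOf l) (length l))) (≡.sym (ℤₚ.*-identityʳ _)))
  ... | true | true | false = ≡.refl
  ... | true | false | _ = ≡.refl
  ... | false | true | true = ≡.sym (ℤₚ.*-zeroʳ (λω (headOf l ℕ.+ 2 ℕ.* length l)))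
  ... | false | true | false = ≡.refl
  ... | false | false | _ = ≡.refl

module RankFunctional (R S : CommutativeRing 0ℓ 0ℓ) (h : CommutativeRing.Carrier R → CommutativeRing.Carrier S)
  (h-cong : ∀ {x y} → CommutativeRing._≈_ R x y → CommutativeRing._≈_ S (h x) (h y))
  (h-+ : ∀ x y → CommutativeRing._≈_ S (h (CommutativeRing._+_ R x y)) (CommutativeRing._+_ S (h x) (h y)))
  (h-* : ∀ x y → CommutativeRing._≈_ S (h (CommutativeRing._*_ R x y)) (CommutativeRing._*_ S (h x) (h y)))
  (h-0 : CommutativeRing._≈_ S (h (CommutativeRing.0# R)) (CommutativeRing.0# S))
  (h-1 : CommutativeRing._≈_ S (h (CommutativeRing.1# R)) (CommutativeRing.1# S))
  (ω : CommutativeRing.Carrier S)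
  (ω²+ω+1 : CommutativeRing._≈_ S (RingKit._+_ S (RingKit._+_ S (RingKit._*_ S ω ω) ω) (CommutativeRing.1# S)) (CommutativeRing.0# S))
  (q : CommutativeRing.Carrier R) (k : ℕ)
  (q-nil : CommutativeRing._≈_ R (RingKit._^_ R q (suc k)) (CommutativeRing.0# R))
  (ev : CommutativeRing.Carrier S → ℤ)
  (ev-cong : ∀ {x y} → CommutativeRing._≈_ S x y → ev x ≡ ev y)
  (ev-0 : ev (CommutativeRing.0# S) ≡ + 0)
  (ev-+ : ∀ x y → ev (CommutativeRing._+_ S x y) ≡ ev x ℤ.+ ev y)
  (e : CommutativeRing.Carrier R → ℤ)
  (ev-ω⁰ : ∀ y → ev (h y) ≡ e y)
  (ev-ω¹ : ∀ y → ev (CommutativeRing._*_ S ω (h y)) ≡ ℤ.- e y)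
  (ev-ω² : ∀ y → ev (CommutativeRing._*_ S ω (CommutativeRing._*_ S ω (h y))) ≡ + 0) where
  module RD = RankDescent R S h h-cong h-+ h-* h-0 h-1 ω ω²+ω+1 q k q-nil
  open RD public using (Fseries; Tseries; theta*Fseries; J)
  open RingKit S

  ev-sumL : {A : Set} (xs : List A) (f : A → Carrier) → ev (RD.sumL xs f) ≡ ZL.sumL xs (λ x → ev (f x))
  ev-sumL [] f = ev-0
  ev-sumL (x ∷ xs) f = ≡.trans (ev-+ (f x) (RD.sumL xs f)) (≡.cong (λ z → ev (f x) ℤ.+ z) (ev-sumL xs f))

  ev-ω : ∀ i y → ev (ω ^ i * h y) ≡ λω i ℤ.* e y
  ev-ω 0 y = ≡.trans (ev-cong (*-identityˡ _)) (≡.trans (ev-ω⁰ y) (≡.sym (ℤₚ.*-identityˡ (e y))))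
  ev-ω 1 y = ≡.trans (ev-cong (*-congʳ (*-identityʳ ω))) (≡.trans (ev-ω¹ y) (≡.sym (ℤₚ.-1*i≡-i (e y))))
  ev-ω 2 y = ≡.trans (ev-cong (trans (*-congʳ (*-congˡ (*-identityʳ ω))) (*-assoc ω ω (h y)))) (≡.trans (ev-ω² y) (≡.sym (ℤₚ.*-zeroˡ (e y))))
  ev-ω (suc (suc (suc i))) y = ≡.trans (ev-cong (RD.ω^3+ i (h y))) (ev-ω i y)

  -- F has no ω-part, so the functional returns its coefficient; applied to the sum over
  -- overpartitions it returns [rank ≡ 0] - [rank ≡ 1] term by term.
  Fseries-value : ∀ m → k ≡ suc m → (∀ s → e (RingKit._^_ R q s) ≡ mono (+ 1) s (suc m)) →
    e Fseries ≡ + Nbar (+ 0) 3 (suc m) ℤ.- + Nbar (+ 1) 3 (suc m)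
  Fseries-value m k≡ e-q = ≡.trans (≡.sym (ev-ω⁰ Fseries))
    (≡.trans (ev-cong (RD.F-as-sum m k≡))
    (≡.trans (ev-sumL (candidates (suc m)) _)
    (≡.trans (ZL.sumL-cong (candidates (suc m)) term) (≡.sym (Nbar-difference m)))))
    where
    head≡ : ∀ l → RD.headPart l ≡ headOf l
    head≡ [] = ≡.refl
    head≡ (x ∷ l) = ≡.refl
    term : ∀ l → ev (RD.[ RD.valid l ] (ω ^ (RD.headPart l ℕ.+ 2 ℕ.* length l) * h (RingKit._^_ R q (partsSum l)))) ≡ contribution (suc m) l
    term l with allPositive l ∧ canonical l
    ... | false = ev-0
    ... | true = ≡.trans (ev-ω (RD.headPart l ℕ.+ 2 ℕ.* length l) (RingKit._^_ R q (partsSum l)))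
          (≡.cong₂ (λ y z → λω (y ℕ.+ 2 ℕ.* length l) ℤ.* z) (head≡ l) (e-q (partsSum l)))

module RankCoefficients (k : ℕ) where
  K = suc k
  module De = Descent (PSRing K)
  open De using (C; _≈ᵉ_; _,_; ι; ω)
  private
    ev : C → ℤ
    ev x = proj₁ x k ℤ.- proj₂ x k

    rfl : ∀ {f} → CommutativeRing._≈_ (PSRing K) f f
    rfl = every (λ _ → ≡.refl)

    ev-cong : ∀ {x y} → x ≈ᵉ y → ev x ≡ ev y
    ev-cong p = ≡.cong₂ ℤ._-_ (at (De.re p) k ℕₚ.≤-refl) (at (De.im p) k ℕₚ.≤-refl)

    ev-+ : ∀ x y → ev (x De.+ᵉ y) ≡ ev x ℤ.+ ev y
    ev-+ x y = ℤsolve 4 (λ a b c d → (a ⊞ᶻ b) ⊟ᶻ (c ⊞ᶻ d) ≔ᶻ (a ⊟ᶻ c) ⊞ᶻ (b ⊟ᶻ d)) ≡.refl (proj₁ x k) (proj₁ y k) (proj₂ x k) (proj₂ y k)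

    ev-ω¹ : ∀ y → ev (ω De.*ᵉ ι y) ≡ ℤ.- y k
    ev-ω¹ y = ≡.trans (ev-cong (De.ω¹ y)) (ℤₚ.+-identityˡ (ℤ.- y k))

    ev-ω² : ∀ y → ev (ω De.*ᵉ (ω De.*ᵉ ι y)) ≡ + 0
    ev-ω² y = ≡.trans (ev-cong (De.ω² y)) (ℤₚ.+-inverseʳ (ℤ.- y k))

  module RF = RankFunctional (PSRing K) De.Eis ι (λ p → p , rfl) De.ι+ De.ι* (rfl , rfl) (rfl , rfl) ω De.ω-relation X k (X-nil K)
    ev ev-cong ≡.refl ev-+ (λ f → f k) (λ y → ℤₚ.+-identityʳ (y k)) ev-ω¹ ev-ω²

  Fseries-coeff : ∀ m → k ≡ suc m → RF.Fseries k ≡ + Nbar (+ 0) 3 (suc m) ℤ.- + Nbar (+ 1) 3 (suc m)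
  Fseries-coeff m ≡.refl = RF.Fseries-value m ≡.refl (λ s → X^-mono K s k)

-- n v for the parts of the Lambert series with v ≡ n + 1 and v ≡ n + 2 modulo 3, n = r + 1
e₁ e₂ : ℕ → ℕ → ℕ
e₁ r t = suc r ℕ.* suc (suc r ℕ.+ (t ℕ.* 3 ℕ.+ 0))
e₂ r t = suc r ℕ.* suc (suc r ℕ.+ (t ℕ.* 3 ℕ.+ 1))

-- Lambert expansion of T, product formulas, and the linear system for the sections of F.

module LambertExpansion (R : CommutativeRing 0ℓ 0ℓ) (q : CommutativeRing.Carrier R) (k : ℕ)
  (q-nil : CommutativeRing._≈_ R (RingKit._^_ R q (suc k)) (CommutativeRing.0# R)) where
  open Nilpotent R q k q-nil hiding (a)

  -- A geometric series in q^(3n), n = r + 1, multiplied by 1 - qⁿ: the terms q^(nv) with v - n ≡ 1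
  -- modulo 3 minus those with v - n ≡ 2, for v > n.
  expand : ∀ r → sgn (suc r) * q ^ (suc r ℕ.* suc (suc r)) * ((1# - q ^ suc r) * I 1# (2 ℕ.+ 3 ℕ.* r)) ≈
    ∑ K (λ t → sgn (suc r) * q ^ e₁ r t - sgn (suc r) * q ^ e₂ r t)
  expand r = begin
    s * q ^ a * ((1# - q ^ suc r) * ∑ K f)
      ≈⟨ sym (*-assoc (s * q ^ a) _ _) ⟩
    s * q ^ a * (1# - q ^ suc r) * ∑ K f
      ≈⟨ sym (∑-*ˡ K (s * q ^ a * (1# - q ^ suc r)) f) ⟩
    ∑ K (λ t → s * q ^ a * (1# - q ^ suc r) * f t)
      ≈⟨ ∑-cong K (λ t → trans (solve 4 (λ s a b f → s :* a :* (:1 :- b) :* f := s :* (a :* f) :- s :* (a :* b :* f)) refl s (q ^ a) (q ^ suc r) (f t))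
           (+-cong (*-congˡ (power₁ t)) (-‿cong (*-congˡ (power₂ t))))) ⟩
    ∑ K (λ t → s * q ^ e₁ r t - s * q ^ e₂ r t) ∎
    where
    s = sgn (suc r)
    a = suc r ℕ.* suc (suc r)
    c = suc (2 ℕ.+ 3 ℕ.* r)
    f : ℕ → Carrier
    f t = (1# * q ^ c) ^ t
    f≈ : ∀ t → f t ≈ q ^ (c ℕ.* t)
    f≈ t = trans (^-congˡ t (*-identityˡ (q ^ c))) (^-assocʳ q c t)
    power₁ : ∀ t → q ^ a * f t ≈ q ^ e₁ r t
    power₁ t = trans (*-congˡ (f≈ t)) (trans (sym (^-homo-* q a (c ℕ.* t))) (reflexive (≡.cong (q ^_)
      (ℕsolve 2 (λ r t → (κ 1 ⊞ r) ⊠ (κ 2 ⊞ r) ⊞ (κ 3 ⊞ κ 3 ⊠ r) ⊠ t ≔ (κ 1 ⊞ r) ⊠ (κ 1 ⊞ ((κ 1 ⊞ r) ⊞ (t ⊠ κ 3 ⊞ κ 0)))) ≡.refl r t))))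
    power₂ : ∀ t → q ^ a * q ^ suc r * f t ≈ q ^ e₂ r t
    power₂ t = trans (*-cong (sym (^-homo-* q a (suc r))) (f≈ t)) (trans (sym (^-homo-* q (a ℕ.+ suc r) (c ℕ.* t))) (reflexive (≡.cong (q ^_)
      (ℕsolve 2 (λ r t → ((κ 1 ⊞ r) ⊠ (κ 2 ⊞ r) ⊞ (κ 1 ⊞ r)) ⊞ (κ 3 ⊞ κ 3 ⊠ r) ⊠ t ≔ (κ 1 ⊞ r) ⊠ (κ 1 ⊞ ((κ 1 ⊞ r) ⊞ (t ⊠ κ 3 ⊞ κ 1)))) ≡.refl r t))))

module ThetaProducts (R : CommutativeRing 0ℓ 0ℓ) (q : CommutativeRing.Carrier R) (k : ℕ)
  (q-nil : CommutativeRing._≈_ R (RingKit._^_ R q (suc k)) (CommutativeRing.0# R)) where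
  open Nilpotent R q k q-nil
  open Products R q k q-nil
  open Thetas R

  theta-product : ∀ b → thetaAt K (q ^ suc b) * P (- 1#) (suc b) ≈ P 1# (suc b)
  theta-product b = begin
    thetaAt K (q ^ suc b) * P (- 1#) (suc b)
      ≈⟨ *-congˡ (∏-cong K (λ i → trans (+-congˡ (-‿cong (*-congˡ (sym (^-assocʳ q (suc b) (suc i)))))) (solve 1 (λ x → :1 :- (:- :1) :* x := :1 :+ :1 :* x) refl ((q ^ suc b) ^ suc i)))) ⟩
    thetaAt K (q ^ suc b) * ∏ K (N.e 1#)
      ≈⟨ N.gauss ⟩
    ∏ K (N.d 1#)
      ≈⟨ ∏-cong K (λ i → +-congˡ (-‿cong (*-congˡ (^-assocʳ q (suc b) (suc i))))) ⟩
    P 1# (suc b) ∎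
    where
    module N = Nilpotent R (q ^ suc b) k (trans (^-assocʳ q (suc b) K) (q^≥K _ (ℕₚ.m≤m+n K (b ℕ.* K))))

  b-product : bAt K q * P (- 1#) 1 ≈ P 1# 6 * P (- 1#) 3
  b-product = bSeries-product

module UniqueQuotient (R : CommutativeRing 0ℓ 0ℓ) where
  open RingKit R

  unique : ∀ {a a′ i f f′ t t′} → a * i ≈ 1# → a ≈ a′ → t ≈ t′ → a * f ≈ t → a′ * f′ ≈ t′ → f ≈ f′
  unique {i = i} ai a≈ t≈ af af′ = Unit-cancelˡ (i , ai) (trans af (trans t≈ (trans (sym af′) (*-congʳ (sym a≈)))))

  quotient : ∀ {a i f t} → a * i ≈ 1# → f * a ≈ t → f ≈ t * i
  quotient {a} {i} {f} {t} ai fa = sym (trans (*-congʳ (sym fa)) (trans (*-assoc f a i) (trans (*-congˡ ai) (*-identityʳ f))))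

-- A F₀ − 2yB F₂ = T₀, A F₁ − 2B F₀ = 0 and A F₂ − 2B F₁ = T₂ give (A³ − 8yB³) F₀ = A (A T₀ + 2yB T₂).
module Dissection (R : CommutativeRing 0ℓ 0ℓ) (y A B θ F₀ F₁ F₂ T₀ T₂ iθ iA : CommutativeRing.Carrier R)
  (θ-inverse : CommutativeRing._≈_ R (RingKit._*_ R θ iθ) (CommutativeRing.1# R))
  (A-inverse : CommutativeRing._≈_ R (RingKit._*_ R A iA) (CommutativeRing.1# R)) where
  open RingKit R
  private
    2# = 1# + 1#
    8# = 2# * 2# * 2#

  module _ (s₀ : A * F₀ - 2# * (B * (y * F₂)) ≈ T₀) (s₁ : A * F₁ - 2# * (B * F₀) ≈ 0#) (s₂ : A * F₂ - 2# * (B * F₁) ≈ T₂)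
    (cubic : A * T₀ + 2# * (B * (y * T₂)) ≈ θ * (θ * θ)) (norm : (A * A * A - 8# * (y * (B * B * B))) * A ≈ θ * (θ * θ * θ)) where

    θF₀ : θ * F₀ ≈ A * A
    θF₀ = Unit-cancelˡ (Unit-* (iθ , θ-inverse) (Unit-* (iθ , θ-inverse) (iθ , θ-inverse))) (begin
      θ * (θ * θ) * (θ * F₀)
        ≈⟨ solve 2 (λ t f → t :* (t :* t) :* (t :* f) := t :* (t :* t :* t) :* f) refl θ F₀ ⟩
      θ * (θ * θ * θ) * F₀
        ≈⟨ *-congʳ norm ⟨
      (A * A * A - 8# * (y * (B * B * B))) * A * F₀
        -- A²(A s₀ + 2yB s₂) + 4yAB² s₁ is the combination of the three equations in which F₁ and F₂
        -- cancel.
        ≈⟨ solve 6 (λ y a b f₀ f₁ f₂ → (a :* a :* a :- (:2 :* :2 :* :2) :* (y :* (b :* b :* b))) :* a :* f₀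
             := a :* a :* (a :* (a :* f₀ :- :2 :* (b :* (y :* f₂))) :+ :2 :* (b :* (y :* (a :* f₂ :- :2 :* (b :* f₁)))))
                :+ (:2 :* :2 :* (y :* (b :* b :* a))) :* (a :* f₁ :- :2 :* (b :* f₀))) refl y A B F₀ F₁ F₂ ⟩
      A * A * (A * (A * F₀ - 2# * (B * (y * F₂))) + 2# * (B * (y * (A * F₂ - 2# * (B * F₁))))) + 2# * 2# * (y * (B * B * A)) * (A * F₁ - 2# * (B * F₀))
        ≈⟨ +-cong (*-congˡ (+-cong (*-congˡ s₀) (*-congˡ (*-congˡ (*-congˡ s₂))))) (*-congˡ s₁) ⟩
      A * A * (A * T₀ + 2# * (B * (y * T₂))) + 2# * 2# * (y * (B * B * A)) * 0#
        ≈⟨ +-cong (*-congˡ cubic) (zeroʳ _) ⟩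
      A * A * (θ * (θ * θ)) + 0#
        ≈⟨ trans (+-identityʳ _) (*-comm _ _) ⟩
      θ * (θ * θ) * (A * A) ∎)

    AF₁ : A * F₁ ≈ 2# * (B * F₀)
    AF₁ = trans (solve 2 (λ x z → x := (x :- z) :+ z) refl (A * F₁) (2# * (B * F₀))) (trans (+-congʳ s₁) (+-identityˡ _))

    θF₁ : θ * F₁ ≈ 2# * (A * B)
    θF₁ = Unit-cancelˡ (iA , A-inverse) (begin
      A * (θ * F₁)              ≈⟨ solve 3 (λ a t f → a :* (t :* f) := t :* (a :* f)) refl A θ F₁ ⟩
      θ * (A * F₁)              ≈⟨ *-congˡ AF₁ ⟩
      θ * (2# * (B * F₀))       ≈⟨ solve 3 (λ t b f → t :* (:2 :* (b :* f)) := :2 :* (b :* (t :* f))) refl θ B F₀ ⟩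
      2# * (B * (θ * F₀))       ≈⟨ *-congˡ (*-congˡ θF₀) ⟩
      2# * (B * (A * A))        ≈⟨ solve 2 (λ a b → :2 :* (b :* (a :* a)) := a :* (:2 :* (a :* b))) refl A B ⟩
      A * (2# * (A * B))        ∎)

    AF₂ : A * F₂ ≈ T₂ + 2# * (B * F₁)
    AF₂ = trans (solve 2 (λ x z → x := (x :- z) :+ z) refl (A * F₂) (2# * (B * F₁))) (+-congʳ s₂)

    module _ (P Pm P₂ P₃ Pm₃ P₆ : Carrier) (θPm : θ * Pm ≈ P) (APm₃ : A * Pm₃ ≈ P₃) (BPm : B * Pm ≈ P₆ * Pm₃) (PPm : P * Pm ≈ P₂) where

      F₀-product : F₀ * (P * Pm₃ * Pm₃) ≈ P₃ * P₃ * Pm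
      F₀-product = begin
        F₀ * (P * Pm₃ * Pm₃)             ≈⟨ *-congˡ (*-congʳ (*-congʳ θPm)) ⟨
        F₀ * (θ * Pm * Pm₃ * Pm₃)        ≈⟨ solve 4 (λ f t p p₃ → f :* (t :* p :* p₃ :* p₃) := (t :* f) :* (p :* p₃ :* p₃)) refl F₀ θ Pm Pm₃ ⟩
        θ * F₀ * (Pm * Pm₃ * Pm₃)        ≈⟨ *-congʳ θF₀ ⟩
        A * A * (Pm * Pm₃ * Pm₃)         ≈⟨ solve 3 (λ a p p₃ → a :* a :* (p :* p₃ :* p₃) := (a :* p₃) :* (a :* p₃) :* p) refl A Pm Pm₃ ⟩
        A * Pm₃ * (A * Pm₃) * Pm         ≈⟨ *-congʳ (*-cong APm₃ APm₃) ⟩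
        P₃ * P₃ * Pm                     ∎

      F₁-product : F₁ * P ≈ 2# * (P₃ * P₆)
      F₁-product = begin
        F₁ * P                           ≈⟨ *-congˡ θPm ⟨
        F₁ * (θ * Pm)                    ≈⟨ solve 3 (λ f t p → f :* (t :* p) := (t :* f) :* p) refl F₁ θ Pm ⟩
        θ * F₁ * Pm                      ≈⟨ *-congʳ θF₁ ⟩
        2# * (A * B) * Pm                ≈⟨ solve 3 (λ a b p → :2 :* (a :* b) :* p := :2 :* (a :* (b :* p))) refl A B Pm ⟩
        2# * (A * (B * Pm))              ≈⟨ *-congˡ (*-congˡ BPm) ⟩
        2# * (A * (P₆ * Pm₃))            ≈⟨ solve 3 (λ a x y → :2 :* (a :* (x :* y)) := :2 :* ((a :* y) :* x)) refl A P₆ Pm₃ ⟩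
        2# * (A * Pm₃ * P₆)              ≈⟨ *-congˡ (*-congʳ APm₃) ⟩
        2# * (P₃ * P₆)                   ∎

      F₂-product : F₂ * (P₃ * P₂) ≈ 2# * 2# * (Pm₃ * Pm₃ * P₆ * P₆) * P₃ + T₂ * Pm₃ * P₂
      F₂-product = begin
        F₂ * (P₃ * P₂)
          ≈⟨ *-congˡ (*-congʳ APm₃) ⟨
        F₂ * (A * Pm₃ * P₂)
          ≈⟨ solve 4 (λ f a p p₂ → f :* (a :* p :* p₂) := (a :* f) :* p :* p₂) refl F₂ A Pm₃ P₂ ⟩
        A * F₂ * Pm₃ * P₂
          ≈⟨ *-congʳ (*-congʳ AF₂) ⟩
        (T₂ + 2# * (B * F₁)) * Pm₃ * P₂
          ≈⟨ solve 5 (λ t b f p p₂ → (t :+ :2 :* (b :* f)) :* p :* p₂ := :2 :* (b :* f) :* p :* p₂ :+ t :* p :* p₂) refl T₂ B F₁ Pm₃ P₂ ⟩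
        2# * (B * F₁) * Pm₃ * P₂ + T₂ * Pm₃ * P₂
          ≈⟨ +-congʳ (begin
               2# * (B * F₁) * Pm₃ * P₂              ≈⟨ *-congˡ PPm ⟨
               2# * (B * F₁) * Pm₃ * (P * Pm)        ≈⟨ solve 5 (λ b f p₃ p pm → :2 :* (b :* f) :* p₃ :* (p :* pm) := :2 :* (b :* pm) :* p₃ :* (f :* p)) refl B F₁ Pm₃ P Pm ⟩
               2# * (B * Pm) * Pm₃ * (F₁ * P)        ≈⟨ *-cong (*-congʳ (*-congˡ BPm)) F₁-product ⟩
               2# * (P₆ * Pm₃) * Pm₃ * (2# * (P₃ * P₆)) ≈⟨ solve 3 (λ p₆ m p₃ → :2 :* (p₆ :* m) :* m :* (:2 :* (p₃ :* p₆)) := :2 :* :2 :* (m :* m :* p₆ :* p₆) :* p₃) refl P₆ Pm₃ P₃ ⟩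
               2# * 2# * (Pm₃ * Pm₃ * P₆ * P₆) * P₃  ∎) ⟩
        2# * 2# * (Pm₃ * Pm₃ * P₆ * P₆) * P₃ + T₂ * Pm₃ * P₂ ∎

      F₂-quotient : ∀ {c S i₂ i₃} → T₂ ≈ - (c * S) → P₂ * i₂ ≈ 1# → P₃ * i₃ ≈ 1# →
        F₂ ≈ 2# * 2# * (Pm₃ * Pm₃ * P₆ * P₆) * i₂ - c * Pm₃ * i₃ * S
      F₂-quotient {c} {S} {i₂} {i₃} T≈ e₂ e₃ = Unit-cancelˡ (Unit-* (i₃ , e₃) (i₂ , e₂)) (begin
        P₃ * P₂ * F₂
          ≈⟨ trans (*-comm _ F₂) F₂-product ⟩
        2# * 2# * Y * P₃ + T₂ * Pm₃ * P₂
          ≈⟨ +-cong (trans (*-congˡ (sym (trans (*-congˡ e₂) (*-identityʳ P₃)))) refl) (trans (*-congʳ (*-congʳ T≈)) (*-congˡ (sym (trans (*-congˡ e₃) (*-identityʳ P₂))))) ⟩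
        2# * 2# * Y * (P₃ * (P₂ * i₂)) + - (c * S) * Pm₃ * (P₂ * (P₃ * i₃))
          ≈⟨ solve 8 (λ y c s m p₂ p₃ i₂ i₃ → :2 :* :2 :* y :* (p₃ :* (p₂ :* i₂)) :+ :- (c :* s) :* m :* (p₂ :* (p₃ :* i₃)) := p₃ :* p₂ :* (:2 :* :2 :* y :* i₂ :- c :* m :* i₃ :* s)) refl Y c S Pm₃ P₂ P₃ i₂ i₃ ⟩
        P₃ * P₂ * (2# * 2# * Y * i₂ - c * Pm₃ * i₃ * S) ∎)
        where Y = Pm₃ * Pm₃ * P₆ * P₆

module NormAfterV (T : Tower) where
  open Tower T
  open TowerIdentities T using (θ-norm; module Hv)
  open RingKit R∞
  private
    2# = 1# + 1#
    A = v θ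

  v-2 : v 2# ≈ 2#
  v-2 = trans (v-+ 1# 1#) (+-cong v-1 v-1)

  -- `θ-norm` only involves series in x³. Here it is recognised as the image under x ↦ x³ of the
  -- identity that is wanted.
  norm : v ((A * A * A - 2# * 2# * 2# * (q * (B * B * B))) * A) ≈ v (θ * (θ * θ * θ))
  norm = begin
    v ((A * A * A - 2# * 2# * 2# * (q * (B * B * B))) * A)
      ≈⟨ trans (v-* _ A) (*-congʳ (trans (v-+ _ _) (+-cong (triple A) (trans (Hv.h-neg _) (-‿cong (trans (v-* _ _) (*-cong (trans (triple 2#) (*-cong (*-cong v-2 v-2) v-2)) (trans (v-* q _) (*-cong v-q (triple B)))))))))) ⟩
    (a * a * a - 2# * 2# * 2# * (q ^ 3 * (v B * v B * v B))) * a
      ≈⟨ solve 3 (λ a q b → (a :* a :* a :- :2 :* :2 :* :2 :* ((q :* (q :* (q :* :1))) :* (b :* b :* b))) :* a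
           := (a :* a :* a :+ (:- (:2 :* (q :* b))) :* (:- (:2 :* (q :* b))) :* (:- (:2 :* (q :* b)))) :* a) refl a q (v B) ⟩
    (a * a * a + (- (2# * (q * v B))) * (- (2# * (q * v B))) * (- (2# * (q * v B)))) * a
      ≈⟨ θ-norm ⟩
    A * (A * A * A)
      ≈⟨ trans (v-* θ _) (*-congˡ (triple θ)) ⟨
    v (θ * (θ * θ * θ)) ∎
    where
    a = v A
    triple : ∀ x → v (x * x * x) ≈ v x * v x * v x
    triple x = trans (v-* _ x) (*-congʳ (v-* x x))

module SplitProducts (R : CommutativeRing 0ℓ 0ℓ) where
  open RingKit R

  minus : ∀ {t a b q f s} → t ≈ a - (1# + 1#) * (q * b) → t * f ≈ s → s ≈ a * f - (1# + 1#) * (b * (q * f))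
  minus {t} {a} {b} {q} {f} e p = trans (sym p) (trans (*-congʳ e) (solve 4 (λ a b q f → (a :- :2 :* (q :* b)) :* f := a :* f :- :2 :* (b :* (q :* f))) refl a b q f))

  plus : ∀ {t a b q f} → t ≈ a + (1# + 1#) * (q * b) → t * f ≈ a * f + (1# + 1#) * (b * (q * f))
  plus {t} {a} {b} {q} {f} e = trans (*-congʳ e) (solve 4 (λ a b q f → (a :+ :2 :* (q :* b)) :* f := a :* f :+ :2 :* (b :* (q :* f))) refl a b q f)

  divide : ∀ {a i} t → a * i ≈ 1# → a * (i * t) ≈ t
  divide {a} {i} t e = trans (sym (*-assoc a i t)) (trans (*-congʳ e) (*-identityˡ t))

  replace : ∀ {t t′ p p′ r r′} → t ≈ t′ → p ≈ p′ → r ≈ r′ → t′ * p′ ≈ r′ → t * p ≈ r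
  replace a b c e = trans (*-cong a b) (trans e (sym c))

open import Data.Integer using (_+_; _*_; _-_; -_; _≟_)
open import Relation.Binary.PropositionalEquality using (refl; sym; trans; cong; cong₂)
open Data.Integer.Solver.+-*-Solver using (solve; _:+_; _:*_; _:-_; :-_; _:=_; con)

-- Residues modulo 3

-- Residues as a finite type with computing operations, so that every congruence fact is settled by
-- running through all residues.
F3 : Set
F3 = Fin 3

s3 : F3 → F3
s3 0F = 1F
s3 1F = 2F
s3 2F = 0F

infixl 6 _+₃_
infixl 7 _*₃_
_+₃_ _*₃_ : F3 → F3 → F3
0F +₃ y = y
1F +₃ y = s3 y
2F +₃ y = s3 (s3 y)
0F *₃ y = 0F
1F *₃ y = y
2F *₃ y = y +₃ y

-₃_ : F3 → F3
-₃ x = 2F *₃ x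

_≟₃_ : (x y : F3) → _
_≟₃_ = Finₚ._≟_

m3 : ℕ → F3
m3 zero = 0F
m3 (suc n) = s3 (m3 n)

r3 : ℤ → F3
r3 (+ n) = m3 n
r3 -[1+ n ] = -₃ m3 (suc n)

r3-suc : ∀ x → r3 (x + + 1) ≡ s3 (r3 x)
r3-suc (+ n) = cong m3 (ℕₚ.+-comm n 1)
r3-suc -[1+ zero ] = refl
r3-suc -[1+ suc n ] = from-yes (Finₚ.all? λ a → (-₃ s3 a) ≟₃ s3 (-₃ s3 (s3 a))) (m3 n)

r3-+⁺ : ∀ x n → r3 (x + + n) ≡ m3 n +₃ r3 x
r3-+⁺ x zero = cong r3 (ℤₚ.+-identityʳ x)
r3-+⁺ x (suc n) = trans (cong r3 (solve 2 (λ x n → x :+ (con (+ 1) :+ n) := (x :+ n) :+ con (+ 1)) refl x (+ n)))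
  (trans (r3-suc (x + + n)) (trans (cong s3 (r3-+⁺ x n)) (from-yes (Finₚ.all? λ a → Finₚ.all? λ b → s3 (a +₃ b) ≟₃ (s3 a +₃ b)) (m3 n) (r3 x))))

r3-neg : ∀ x → r3 (- x) ≡ -₃ r3 x
r3-neg (+ zero) = refl
r3-neg (+ suc n) = refl
r3-neg -[1+ n ] = from-yes (Finₚ.all? λ a → a ≟₃ (-₃ (-₃ a))) (m3 (suc n))

r3-+ : ∀ x y → r3 (x + y) ≡ r3 x +₃ r3 y
r3-+ x (+ n) = trans (r3-+⁺ x n) (from-yes (Finₚ.all? λ a → Finₚ.all? λ b → (a +₃ b) ≟₃ (b +₃ a)) (m3 n) (r3 x))
r3-+ x -[1+ n ] = trans (trans (solve₀ (r3 z) (m3 (suc n))) (cong (_+₃ (-₃ m3 (suc n))) (trans (sym (r3-+⁺ z (suc n))) (cong r3 (solve 2 (λ x n → (x :+ (:- n)) :+ n := x) refl x (+ suc n)))))) refl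
  where
  z = x + -[1+ n ]
  solve₀ : ∀ a b → a ≡ (b +₃ a) +₃ (-₃ b)
  solve₀ = from-yes (Finₚ.all? λ a → Finₚ.all? λ b → a ≟₃ ((b +₃ a) +₃ (-₃ b)))

r3-*⁺ : ∀ x n → r3 (x * + n) ≡ r3 x *₃ m3 n
r3-*⁺ x zero = trans (cong r3 (ℤₚ.*-zeroʳ x)) (from-yes (Finₚ.all? λ a → 0F ≟₃ (a *₃ 0F)) (r3 x))
r3-*⁺ x (suc n) = trans (cong r3 (solve 2 (λ x n → x :* (con (+ 1) :+ n) := x :+ x :* n) refl x (+ n)))
  (trans (r3-+ x (x * + n)) (trans (cong (r3 x +₃_) (r3-*⁺ x n)) (from-yes (Finₚ.all? λ a → Finₚ.all? λ b → (a +₃ a *₃ b) ≟₃ (a *₃ s3 b)) (r3 x) (m3 n))))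

r3-* : ∀ x y → r3 (x * y) ≡ r3 x *₃ r3 y
r3-* x (+ n) = r3-*⁺ x n
r3-* x -[1+ n ] = trans (cong r3 (sym (ℤₚ.neg-distribʳ-* x (+ suc n)))) (trans (r3-neg (x * + suc n))
  (trans (cong -₃_ (r3-*⁺ x (suc n))) (from-yes (Finₚ.all? λ a → Finₚ.all? λ b → (-₃ (a *₃ b)) ≟₃ (a *₃ (-₃ b))) (r3 x) (m3 (suc n)))))

r3-minus : ∀ x y → r3 (x - y) ≡ r3 x +₃ (-₃ r3 y)
r3-minus x y = trans (r3-+ x (- y)) (cong (r3 x +₃_) (r3-neg y))

-- χ is the nontrivial character modulo 3; ε is the sign by which the twisted theta series differs
-- from θ.
χ₃ ε₃ : F3 → ℤ
χ₃ 0F = + 0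
χ₃ 1F = + 1
χ₃ 2F = -[1+ 0 ]
ε₃ 0F = + 1
ε₃ 1F = -[1+ 0 ]
ε₃ 2F = -[1+ 0 ]

ψ₃ : F3 → F3 → ℤ
ψ₃ 0F b = χ₃ b
ψ₃ a@1F b = χ₃ a
ψ₃ a@2F b = χ₃ a

-- ψ a b is the invariant of the form [2a , 2k , −b] of determinant −(k² + 2ab) ≡ 0 (mod 3)
ψ : ℤ → ℤ → ℤ
ψ a b = ψ₃ (r3 a) (r3 b)

χ : ℤ → ℤ
χ x = χ₃ (r3 x)

ε : ℤ → ℤ
ε x = ε₃ (r3 x)

-- Finite sums over ℤ

sg : ℕ → ℤ
sg zero = + 1
sg (suc n) = - sg n

E : ℤ → ℤ → ℤ
E x y = if does (x ≟ y) then + 1 else + 0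

-- The equation in the bracket may be used to rewrite the weight in front of it. Congruences modulo
-- 3 enter the sums below in this way.
E-cong : ∀ {x y f g} → (x ≡ y → f ≡ g) → f * E x y ≡ g * E x y
E-cong {x} {y} {f} {g} h with x ≟ y
... | yes p = cong (_* + 1) (h p)
... | no _ = trans (ℤₚ.*-zeroʳ f) (sym (ℤₚ.*-zeroʳ g))

E-zero : ∀ {x y} → x ≢ y → E x y ≡ + 0
E-zero {x} {y} h with x ≟ y
... | yes p = ⊥-elim (h p)
... | no _ = refl

E-refl : ∀ x → E x x ≡ + 1
E-refl x with x ≟ x
... | yes _ = refl
... | no h = ⊥-elim (h refl)

Σ⁺ : ℕ → (ℤ → ℤ) → ℤ
Σ⁺ R f = Z.∑ R (λ i → f (+ suc i))

Σ⁺-cong : ∀ R {f g} → (∀ x → f x ≡ g x) → Σ⁺ R f ≡ Σ⁺ R g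
Σ⁺-cong R h = Z.∑-cong R (λ i → h (+ suc i))

Σ⁺-cong⁺ : ∀ R {f g} → (∀ i → i ℕ.< R → f (+ suc i) ≡ g (+ suc i)) → Σ⁺ R f ≡ Σ⁺ R g
Σ⁺-cong⁺ R h = Z.∑-cong< R h

Σ⁺-+ : ∀ R f g → Σ⁺ R (λ x → f x + g x) ≡ Σ⁺ R f + Σ⁺ R g
Σ⁺-+ R f g = Z.∑-+ R _ _

Σ⁺-* : ∀ R c f → Σ⁺ R (λ x → c * f x) ≡ c * Σ⁺ R f
Σ⁺-* R c f = Z.∑-*ˡ R c _

Σ⁺-neg : ∀ R f → Σ⁺ R (λ x → - f x) ≡ - Σ⁺ R f
Σ⁺-neg R f = Z.∑-neg R _

Σ⁺-swap : ∀ R R′ (f : ℤ → ℤ → ℤ) → Σ⁺ R (λ x → Σ⁺ R′ (f x)) ≡ Σ⁺ R′ (λ y → Σ⁺ R (λ x → f x y))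
Σ⁺-swap R R′ f = Z.∑-swap R R′ (λ i j → f (+ suc i) (+ suc j))

Σ⁺-zero : ∀ R {f} → (∀ i → i ℕ.< R → f (+ suc i) ≡ + 0) → Σ⁺ R f ≡ + 0
Σ⁺-zero R h = Z.∑-zero< R h

Σ⁺-extend : ∀ R n f → (∀ i → R ℕ.≤ i → f (+ suc i) ≡ + 0) → Σ⁺ (R ℕ.+ n) f ≡ Σ⁺ R f
Σ⁺-extend R n f h = trans (Z.∑-split R n _) (trans (cong (λ z → Σ⁺ R f + z) (Z.∑-zero< n (λ i _ → h _ (ℕₚ.m≤m+n R i)))) (ℤₚ.+-identityʳ _))

Σ± : ℕ → ℤ → (ℤ → ℤ) → ℤ
Σ± R c f = f c + (Σ⁺ R (λ m → f (c + m)) + Σ⁺ R (λ m → f (c - m)))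

ΣZ : ℕ → (ℤ → ℤ) → ℤ
ΣZ R = Σ± R (+ 0)

Σ±-cong : ∀ R c {f g} → (∀ x → f x ≡ g x) → Σ± R c f ≡ Σ± R c g
Σ±-cong R c {f} {g} h = cong₂ _+_ (h c) (cong₂ _+_
  (Σ⁺-cong R {λ m → f (c + m)} {λ m → g (c + m)} (λ m → h (c + m)))
  (Σ⁺-cong R {λ m → f (c - m)} {λ m → g (c - m)} (λ m → h (c - m))))

ΣZ-cong : ∀ R {f g} → (∀ x → f x ≡ g x) → ΣZ R f ≡ ΣZ R g
ΣZ-cong R = Σ±-cong R (+ 0)

ΣZ-+ : ∀ R f g → ΣZ R (λ x → f x + g x) ≡ ΣZ R f + ΣZ R g
ΣZ-+ R f g = trans (cong (λ z → (f (+ 0) + g (+ 0)) + z) (cong₂ _+_ (Σ⁺-+ R f⁺ g⁺) (Σ⁺-+ R f⁻ g⁻)))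
  (solve 6 (λ a b c d e h → (a :+ b) :+ ((c :+ d) :+ (e :+ h)) := (a :+ (c :+ e)) :+ (b :+ (d :+ h))) refl (f (+ 0)) (g (+ 0)) (Σ⁺ R f⁺) (Σ⁺ R g⁺) (Σ⁺ R f⁻) (Σ⁺ R g⁻))
  where
  f⁺ f⁻ g⁺ g⁻ : ℤ → ℤ
  f⁺ m = f (+ 0 + m)
  f⁻ m = f (+ 0 - m)
  g⁺ m = g (+ 0 + m)
  g⁻ m = g (+ 0 - m)

ΣZ-* : ∀ R c f → ΣZ R (λ x → c * f x) ≡ c * ΣZ R f
ΣZ-* R c f = trans (cong (λ z → c * f (+ 0) + z) (cong₂ _+_ (Σ⁺-* R c f⁺) (Σ⁺-* R c f⁻)))
  (solve 4 (λ c a b d → c :* a :+ (c :* b :+ c :* d) := c :* (a :+ (b :+ d))) refl c (f (+ 0)) (Σ⁺ R f⁺) (Σ⁺ R f⁻))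
  where
  f⁺ f⁻ : ℤ → ℤ
  f⁺ m = f (+ 0 + m)
  f⁻ m = f (+ 0 - m)

ΣZ-Σ⁺ : ∀ R R′ (f : ℤ → ℤ → ℤ) → ΣZ R (λ x → Σ⁺ R′ (f x)) ≡ Σ⁺ R′ (λ y → ΣZ R (λ x → f x y))
ΣZ-Σ⁺ R R′ f = sym (trans (Σ⁺-+ R′ (f (+ 0)) (λ y → Σ⁺ R (λ m → f (+ 0 + m) y) + Σ⁺ R (λ m → f (+ 0 - m) y)))
  (cong (λ z → Σ⁺ R′ (f (+ 0)) + z) (trans (Σ⁺-+ R′ (λ y → Σ⁺ R (λ m → f (+ 0 + m) y)) (λ y → Σ⁺ R (λ m → f (+ 0 - m) y)))
    (cong₂ _+_ (Σ⁺-swap R′ R (λ y m → f (+ 0 + m) y)) (Σ⁺-swap R′ R (λ y m → f (+ 0 - m) y))))))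

ΣZ-swap : ∀ R R′ (f : ℤ → ℤ → ℤ) → ΣZ R (λ x → ΣZ R′ (f x)) ≡ ΣZ R′ (λ y → ΣZ R (λ x → f x y))
ΣZ-swap R R′ f = trans (ΣZ-+ R (λ x → f x (+ 0)) (λ x → Σ⁺ R′ (λ y → f x (+ 0 + y)) + Σ⁺ R′ (λ y → f x (+ 0 - y))))
  (cong (λ z → ΣZ R (λ x → f x (+ 0)) + z)
  (trans (ΣZ-+ R (λ x → Σ⁺ R′ (λ y → f x (+ 0 + y))) (λ x → Σ⁺ R′ (λ y → f x (+ 0 - y))))
    (cong₂ _+_ (ΣZ-Σ⁺ R R′ (λ x y → f x (+ 0 + y))) (ΣZ-Σ⁺ R R′ (λ x y → f x (+ 0 - y))))))

ΣZ-neg : ∀ R f → ΣZ R (λ x → f (- x)) ≡ ΣZ R f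
ΣZ-neg R f = cong (λ z → f (+ 0) + z) (ℤₚ.+-comm (Σ⁺ R (λ m → f (- (+ 0 + m)))) (Σ⁺ R (λ m → f (- (+ 0 - m)))))

ΣZ-zero : ∀ R {f} → (∀ x → f x ≡ + 0) → ΣZ R f ≡ + 0
ΣZ-zero R {f} h = trans (ΣZ-cong R {g = λ _ → + 0} h) (cong (λ z → + 0 + z) (cong₂ _+_ (Σ⁺-zero R {λ _ → + 0} (λ _ _ → refl)) (Σ⁺-zero R {λ _ → + 0} (λ _ _ → refl))))

Supported : ℕ → (ℤ → ℤ) → Set
Supported N f = ∀ x → N ℕ.< ∣ x ∣ → f x ≡ + 0

ΣZ-extend : ∀ N n f → Supported N f → ΣZ (N ℕ.+ n) f ≡ ΣZ N f
ΣZ-extend N n f h = cong (λ z → f (+ 0) + z) (cong₂ _+_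
  (Σ⁺-extend N n (λ m → f (+ 0 + m)) (λ i p → h (+ suc i) (s≤s p)))
  (Σ⁺-extend N n (λ m → f (+ 0 - m)) (λ i p → h -[1+ i ] (s≤s p))))

Σ±-suc : ∀ R c f → f (c + + suc (suc R)) ≡ + 0 → f (c - + suc R) ≡ + 0 → Σ± (suc R) (c + + 1) f ≡ Σ± (suc R) c f
Σ±-suc R c f h₁ h₂ = begin
  f (c + + 1) + (Σ⁺ (suc R) (λ m → f (c + + 1 + m)) + Σ⁺ (suc R) (λ m → f (c + + 1 - m)))
    ≡⟨ cong₂ (λ y z → f (c + + 1) + (y + z)) up down ⟩
  f (c + + 1) + (Z.∑ R (λ i → f (c + + suc (suc i))) + (f c + (Z.∑ (suc R) (λ i → f (c - + suc i)))))
    ≡⟨ solve 4 (λ a b c d → a :+ (b :+ (c :+ d)) := c :+ ((a :+ b) :+ d)) refl (f (c + + 1)) (Z.∑ R (λ i → f (c + + suc (suc i)))) (f c) (Z.∑ (suc R) (λ i → f (c - + suc i))) ⟩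
  f c + ((f (c + + 1) + Z.∑ R (λ i → f (c + + suc (suc i)))) + Σ⁺ (suc R) (λ m → f (c - m)))
    ≡⟨ cong (λ z → f c + (z + Σ⁺ (suc R) (λ m → f (c - m)))) (sym (Z.∑-head R (λ i → f (c + + suc i)))) ⟩
  Σ± (suc R) c f ∎
  where
  open ≡.≡-Reasoning
  up : Σ⁺ (suc R) (λ m → f (c + + 1 + m)) ≡ Z.∑ R (λ i → f (c + + suc (suc i)))
  up = trans (Z.∑-cong (suc R) (λ i → cong f (ℤₚ.+-assoc c (+ 1) (+ suc i))))
    (trans (cong (λ z → Z.∑ R (λ i → f (c + + suc (suc i))) + z) h₁) (ℤₚ.+-identityʳ _))
  down : Σ⁺ (suc R) (λ m → f (c + + 1 - m)) ≡ f c + Z.∑ (suc R) (λ i → f (c - + suc i))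
  down = trans (Z.∑-head R _) (cong₂ _+_ (cong f (solve 1 (λ c → c :+ con (+ 1) :- con (+ 1) := c) refl c))
    (trans (Z.∑-cong R (λ i → cong f (solve 2 (λ c i → c :+ con (+ 1) :- (con (+ 1) :+ i) := c :- i) refl c (+ suc i))))
           (sym (trans (cong (λ z → Z.∑ R (λ i → f (c - + suc i)) + z) h₂) (ℤₚ.+-identityʳ _)))))

far : ∀ (c : ℤ) N n → ∣ c ∣ ℕ.≤ N → N ℕ.+ N ℕ.< n → N ℕ.< ∣ c + + n ∣ × N ℕ.< ∣ c - + n ∣
far c N n c≤N 2N<n = bound (c + + n) (- c) (trans (ℤₚ.+-comm (- c) (c + + n)) (solve 2 (λ c n → (c :+ n) :+ (:- c) := n) refl c (+ n))) (ℕₚ.≤-reflexive (ℤₚ.∣-i∣≡∣i∣ c))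
                   , ≡.subst (N ℕ.<_) (trans (sym (ℤₚ.∣-i∣≡∣i∣ (- c + + n))) (cong ∣_∣ (solve 2 (λ c n → :- ((:- c) :+ n) := c :- n) refl c (+ n))))
                       (bound (- c + + n) c (solve 2 (λ c n → c :+ ((:- c) :+ n) := n) refl c (+ n)) ℕₚ.≤-refl)
  where
  bound : ∀ x d → d + x ≡ + n → ∣ d ∣ ℕ.≤ ∣ c ∣ → N ℕ.< ∣ x ∣
  bound x d e d≤ = ℕₚ.+-cancelˡ-< N N ∣ x ∣ (ℕₚ.<-≤-trans 2N<n (ℕₚ.≤-trans (ℕₚ.≤-reflexive (sym (cong ∣_∣ e)))
    (ℕₚ.≤-trans (ℤₚ.∣i+j∣≤∣i∣+∣j∣ d x) (ℕₚ.+-monoˡ-≤ ∣ x ∣ (ℕₚ.≤-trans d≤ c≤N)))))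

-- The centre is moved one unit at a time, each move exchanging two end terms. The radius 2N + 1
-- keeps these outside the support as long as the centre stays within N.
ΣZ-split : ∀ N c f → Supported N f → ∣ c ∣ ℕ.≤ N → ΣZ N f ≡ Σ± (suc (N ℕ.+ N)) c f
ΣZ-split N c f h c≤N = trans (sym start) (go c c≤N)
  where
  R = N ℕ.+ N
  start : ΣZ (suc R) f ≡ ΣZ N f
  start = trans (cong (λ z → ΣZ z f) (sym (ℕₚ.+-suc N N))) (ΣZ-extend N (suc N) f h)
  step : ∀ c → ∣ c ∣ ℕ.≤ N → Σ± (suc R) (c + + 1) f ≡ Σ± (suc R) c f
  step c p = Σ±-suc R c f (h _ (proj₁ (far c N (suc (suc R)) p (s≤s (ℕₚ.n≤1+n R))))) (h _ (proj₂ (far c N (suc R) p ℕₚ.≤-refl)))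
  go : ∀ c → ∣ c ∣ ℕ.≤ N → ΣZ (suc R) f ≡ Σ± (suc R) c f
  go (+ zero) p = refl
  go (+ suc n) p = trans (go (+ n) (ℕₚ.<⇒≤ p)) (trans (sym (step (+ n) (ℕₚ.<⇒≤ p))) (cong (λ z → Σ± (suc R) z f) (ℤₚ.+-comm (+ n) (+ 1))))
  go -[1+ zero ] p = step -[1+ zero ] p
  go -[1+ suc n ] p = trans (go -[1+ n ] (ℕₚ.<⇒≤ p)) (step -[1+ suc n ] p)

ΣZ-shift : ∀ N n c f → Supported N f → ∣ c ∣ ℕ.≤ n → ΣZ N f ≡ ΣZ (suc ((N ℕ.+ n) ℕ.+ (N ℕ.+ n))) (λ x → f (c + x))
ΣZ-shift N n c f h p = trans (sym (ΣZ-extend N n f h))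
  (trans (ΣZ-split (N ℕ.+ n) c f (λ x q → h x (ℕₚ.≤-<-trans (ℕₚ.m≤m+n N n) q)) (ℕₚ.≤-trans p (ℕₚ.m≤n+m n N)))
  (cong₂ _+_ (cong f (sym (ℤₚ.+-identityʳ c))) (cong₂ _+_
    (Z.∑-cong R (λ i → refl)) (Z.∑-cong R (λ i → refl)))))
  where R = suc ((N ℕ.+ n) ℕ.+ (N ℕ.+ n))

sq : ∀ k → k * k ≡ + (∣ k ∣ ℕ.* ∣ k ∣)
sq (+ n) = sym (ℤₚ.pos-* n n)
sq -[1+ n ] = refl

sq+-≢ : ∀ {N} k n → N ℕ.< n → k * k + + n ≢ + N
sq+-≢ {N} k n N<n e = ℕₚ.<-irrefl refl (ℕₚ.<-≤-trans N<n (ℕₚ.≤-trans (ℕₚ.m≤n+m n (∣ k ∣ ℕ.* ∣ k ∣)) (ℕₚ.≤-reflexive (ℤₚ.+-injective (trans (trans (ℤₚ.pos-+ (∣ k ∣ ℕ.* ∣ k ∣) n) (cong (_+ + n) (sym (sq k)))) e)))))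

sq≢ : ∀ {N} k n → N ℕ.< ∣ k ∣ → k * k + + n ≢ + N
sq≢ {N} k n N<k e = ℕₚ.<-irrefl refl (ℕₚ.<-≤-trans N<k (ℕₚ.≤-trans k≤k² (ℕₚ.≤-trans (ℕₚ.m≤m+n (∣ k ∣ ℕ.* ∣ k ∣) n) (ℕₚ.≤-reflexive (ℤₚ.+-injective (trans (trans (ℤₚ.pos-+ (∣ k ∣ ℕ.* ∣ k ∣) n) (cong (_+ + n) (sym (sq k)))) e))))))
  where
  k≤k² : ∣ k ∣ ℕ.≤ ∣ k ∣ ℕ.* ∣ k ∣
  k≤k² with ∣ k ∣
  ... | zero = z≤n
  ... | suc n = ℕₚ.m≤m+n (suc n) (n ℕ.* suc n)

+2* : ∀ m n → + (2 ℕ.* m ℕ.* n) ≡ + 2 * + m * + n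
+2* m n = trans (ℤₚ.pos-* (2 ℕ.* m) n) (cong (_* + n) (ℤₚ.pos-* 2 m))

∣-∣≤ : ∀ i j {N} → i ℕ.< N → j ℕ.< N → ∣ + suc j - + suc i ∣ ℕ.≤ N
∣-∣≤ i j {N} i<N j<N = ℕₚ.≤-trans (ℕₚ.≤-reflexive (cong ∣_∣ (ℤₚ.m-n≡m⊖n (suc j) (suc i))))
  (ℕₚ.≤-trans (ℤₚ.∣m⊝n∣≤m⊔n (suc j) (suc i)) (ℕₚ.⊔-lub j<N i<N))

x+x≡0 : ∀ x → x ≡ - x → x ≡ + 0
x+x≡0 (+ zero) _ = refl

Σ⁺-antisym : ∀ R (f : ℤ → ℤ → ℤ) → (∀ x y → f x y ≡ - f y x) → Σ⁺ R (λ x → Σ⁺ R (f x)) ≡ + 0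
Σ⁺-antisym R f h = x+x≡0 _ (begin
  Σ⁺ R (λ x → Σ⁺ R (f x))                   ≡⟨ Σ⁺-cong R (λ x → trans (Σ⁺-cong R (h x)) (Σ⁺-neg R (λ y → f y x))) ⟩
  Σ⁺ R (λ x → - Σ⁺ R (λ y → f y x))         ≡⟨ Σ⁺-neg R (λ x → Σ⁺ R (λ y → f y x)) ⟩
  - Σ⁺ R (λ x → Σ⁺ R (λ y → f y x))         ≡⟨ cong -_ (Σ⁺-swap R R (λ x y → f y x)) ⟩
  - Σ⁺ R (λ y → Σ⁺ R (f y))                 ∎)
  where open ≡.≡-Reasoning

-- Liouville-style splitting of sums over k² + 2ab = N with 3 | N.

module Forms (N : ℕ) (N≡0 : r3 (+ N) ≡ 0F) where

  private
    -- The facts about ψ used below, as finite checks. Their premises are the residues of the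
    -- quadratic equations modulo 3, and 3 | N is what makes these residues zero.
    f₁ : ∀ k a b → k *₃ k +₃ 2F *₃ a *₃ b ≡ 0F → ψ₃ a b ≡ ψ₃ b a
    f₁ = from-yes (Finₚ.all? λ k → Finₚ.all? λ a → Finₚ.all? λ b → ((k *₃ k +₃ 2F *₃ a *₃ b) ≟₃ 0F) →-dec (ψ₃ a b ≟ ψ₃ b a))
    f₂ : ∀ j b m → j *₃ j +₃ b *₃ b +₃ 2F *₃ b *₃ m ≡ 0F → ψ₃ (m +₃ (-₃ j)) b ≡ ψ₃ (m +₃ j) b
    f₂ = from-yes (Finₚ.all? λ j → Finₚ.all? λ b → Finₚ.all? λ m → ((j *₃ j +₃ b *₃ b +₃ 2F *₃ b *₃ m) ≟₃ 0F) →-dec (ψ₃ (m +₃ (-₃ j)) b ≟ ψ₃ (m +₃ j) b))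
    f₃ : ∀ t b m → (m +₃ t) *₃ (m +₃ t) +₃ b *₃ b +₃ 2F *₃ b *₃ m ≡ 0F → ψ₃ (-₃ t) b ≡ - ψ₃ (-₃ b) t
    f₃ = from-yes (Finₚ.all? λ t → Finₚ.all? λ b → Finₚ.all? λ m → (((m +₃ t) *₃ (m +₃ t) +₃ b *₃ b +₃ 2F *₃ b *₃ m) ≟₃ 0F) →-dec (ψ₃ (-₃ t) b ≟ - ψ₃ (-₃ b) t))
    f₄ : ∀ a b → a *₃ a +₃ b *₃ b ≡ 0F → ψ₃ a b ≡ + 0
    f₄ = from-yes (Finₚ.all? λ a → Finₚ.all? λ b → ((a *₃ a +₃ b *₃ b) ≟₃ 0F) →-dec (ψ₃ a b ≟ + 0))

    sq₃ : ∀ k → r3 (k * k) ≡ r3 k *₃ r3 k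
    sq₃ k = r3-* k k

    two₃ : ∀ a b → r3 (+ 2 * a * b) ≡ 2F *₃ r3 a *₃ r3 b
    two₃ a b = trans (r3-* (+ 2 * a) b) (cong (_*₃ r3 b) (r3-* (+ 2) a))

  ψ-sym : ∀ k a b → k * k + + 2 * a * b ≡ + N → ψ a b ≡ ψ b a
  ψ-sym k a b e = f₁ (r3 k) (r3 a) (r3 b) (trans (sym (trans (r3-+ (k * k) (+ 2 * a * b)) (cong₂ _+₃_ (sq₃ k) (two₃ a b)))) (trans (cong r3 e) N≡0))

  ψ-reflect : ∀ j b m → j * j + b * b + + 2 * b * m ≡ + N → ψ (m - j) b ≡ ψ (m + j) b
  ψ-reflect j b m e = trans (cong (λ z → ψ₃ z (r3 b)) (r3-minus m j)) (trans (f₂ (r3 j) (r3 b) (r3 m)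
    (trans (sym (trans (r3-+ (j * j + b * b) (+ 2 * b * m)) (cong₂ _+₃_ (trans (r3-+ (j * j) (b * b)) (cong₂ _+₃_ (sq₃ j) (sq₃ b))) (two₃ b m)))) (trans (cong r3 e) N≡0)))
    (cong (λ z → ψ₃ z (r3 b)) (sym (r3-+ m j))))

  ψ-odd : ∀ t b m → (m + t) * (m + t) + b * b + + 2 * b * m ≡ + N → ψ (- t) b ≡ - ψ (- b) t
  ψ-odd t b m e = trans (cong (λ z → ψ₃ z (r3 b)) (r3-neg t)) (trans (f₃ (r3 t) (r3 b) (r3 m)
    (trans (sym (trans (r3-+ ((m + t) * (m + t) + b * b) (+ 2 * b * m)) (cong₂ _+₃_ (trans (r3-+ ((m + t) * (m + t)) (b * b)) (cong₂ _+₃_ (trans (sq₃ (m + t)) (cong₂ _*₃_ (r3-+ m t) (r3-+ m t))) (sq₃ b))) (two₃ b m)))) (trans (cong r3 e) N≡0)))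
    (cong (λ z → - ψ₃ z (r3 t)) (sym (r3-neg b))))

  ψ-sumOfSquares : ∀ a b → a * a + b * b ≡ + N → ψ a b ≡ + 0
  ψ-sumOfSquares a b e = f₄ (r3 a) (r3 b) (trans (sym (trans (r3-+ (a * a) (b * b)) (cong₂ _+₃_ (sq₃ a) (sq₃ b)))) (trans (cong r3 e) N≡0))

  Σ₂ : (ℤ → ℤ → ℤ) → ℤ
  Σ₂ f = Σ⁺ N (λ x → Σ⁺ N (f x))

  Σ₂-cong : ∀ {f g} → (∀ x y → f x y ≡ g x y) → Σ₂ f ≡ Σ₂ g
  Σ₂-cong h = Σ⁺-cong N (λ x → Σ⁺-cong N (h x))

  Σ₂-cong⁺ : ∀ {f g} → (∀ i j → i ℕ.< N → j ℕ.< N → f (+ suc i) (+ suc j) ≡ g (+ suc i) (+ suc j)) → Σ₂ f ≡ Σ₂ g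
  Σ₂-cong⁺ h = Z.∑-cong< N (λ i p → Z.∑-cong< N (λ j r → h i j p r))

  Σ₂-+ : ∀ f g → Σ₂ (λ x y → f x y + g x y) ≡ Σ₂ f + Σ₂ g
  Σ₂-+ f g = trans (Σ⁺-cong N (λ x → Σ⁺-+ N (f x) (g x))) (Σ⁺-+ N (λ x → Σ⁺ N (f x)) (λ x → Σ⁺ N (g x)))

  private
    R = suc (N ℕ.+ N)
    N<R : ∀ f → (∀ i → N ℕ.≤ i → f (+ suc i) ≡ + 0) → Σ⁺ R f ≡ Σ⁺ N f
    N<R f h = trans (cong (λ z → Σ⁺ z f) (sym (ℕₚ.+-suc N N))) (Σ⁺-extend N (suc N) f h)

  -- P is a polynomial weight. `P-swap` serves the symmetry (k, a, b) ↦ (-k, b, a) of k² + 2ab, and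
  -- `P-odd` the antisymmetry of the terms with negative a.
  module Weighted (P : ℤ → ℤ → ℤ → ℤ) (P-swap : ∀ k a b → P k a b ≡ P (- k) b a)
    (P-odd : ∀ m t b → P (m + t + b) (- t) b ≡ P (m + b + t) (- b) t) where

    t : ℤ → ℤ → ℤ → ℤ
    t k a b = ψ a b * P k a b * E (k * k + + 2 * a * b) (+ N)

    -- The terms to the right of k = b - a, at distance m.
    x₁ : ℤ → ℤ → ℤ → ℤ
    x₁ a b m = t (b - a + m) a b

    S X₁ : ℤ
    S = Σ₂ (λ a b → ΣZ N (λ k → t k a b))
    X₁ = Σ₂ (λ a b → Σ⁺ N (x₁ a b))

    t-zero : ∀ k a b → k * k + + 2 * a * b ≢ + N → t k a b ≡ + 0
    t-zero k a b h = trans (cong (ψ a b * P k a b *_) (E-zero h)) (ℤₚ.*-zeroʳ (ψ a b * P k a b))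

    -- (b − a + m)² + 2ab = (m − a)² + b² + 2bm
    shape : ∀ a b m → (b - a + m) * (b - a + m) + + 2 * a * b ≡ (m - a) * (m - a) + (b * b + + 2 * b * m)
    shape = solve 3 (λ a b m → (b :- a :+ m) :* (b :- a :+ m) :+ con (+ 2) :* a :* b := (m :- a) :* (m :- a) :+ (b :* b :+ con (+ 2) :* b :* m)) refl

    bbm : ∀ i m → + suc i * + suc i + + 2 * + suc i * + m ≡ + (suc i ℕ.* suc i ℕ.+ 2 ℕ.* suc i ℕ.* m)
    bbm i m = sym (trans (ℤₚ.pos-+ (suc i ℕ.* suc i) _) (cong₂ _+_ (ℤₚ.pos-* (suc i) (suc i)) (+2* (suc i) m)))

    m<bbm : ∀ i m → m ℕ.< suc i ℕ.* suc i ℕ.+ 2 ℕ.* suc i ℕ.* m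
    m<bbm i m = ℕₚ.+-mono-≤ {1} {suc i ℕ.* suc i} (s≤s z≤n) (ℕₚ.m≤n*m m (2 ℕ.* suc i))

    x₁-far : ∀ i j m → N ℕ.≤ m → x₁ (+ suc i) (+ suc j) (+ suc m) ≡ + 0
    x₁-far i j m N≤m = t-zero _ (+ suc i) (+ suc j) (λ e → sq+-≢ (+ suc m - + suc i) _ (ℕₚ.≤-<-trans N≤m (ℕₚ.<-trans (ℕₚ.n<1+n m) (m<bbm j (suc m))))
      (trans (sym (trans (shape (+ suc i) (+ suc j) (+ suc m)) (cong (λ z → (+ suc m - + suc i) * (+ suc m - + suc i) + z) (bbm j (suc m))))) e))

    swapped : ∀ a b m → t (b - a - m) a b ≡ x₁ b a m
    swapped a b m = begin
      ψ a b * P k a b * E (k * k + + 2 * a * b) (+ N)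
        ≡⟨ E-cong (λ e → cong (_* P k a b) (ψ-sym k a b e)) ⟩
      ψ b a * P k a b * E (k * k + + 2 * a * b) (+ N)
        ≡⟨ cong₂ (λ y z → ψ b a * y * E z (+ N)) (trans (P-swap k a b) (cong (λ z → P z b a) (solve 3 (λ a b m → :- (b :- a :- m) := a :- b :+ m) refl a b m)))
             (solve 3 (λ a b m → (b :- a :- m) :* (b :- a :- m) :+ con (+ 2) :* a :* b := (a :- b :+ m) :* (a :- b :+ m) :+ con (+ 2) :* b :* a) refl a b m) ⟩
      x₁ b a m ∎
      where
      open ≡.≡-Reasoning
      k = b - a - m

    -- For k = b - a the form is a² + b², and 3 | a² + b² forces a ≡ b ≡ 0 modulo 3, where ψ
    -- vanishes.
    middle : ∀ a b → t (b - a) a b ≡ + 0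
    middle a b = trans (E-cong {f = ψ a b * P (b - a) a b} {g = + 0} (λ e → cong (_* P (b - a) a b) (ψ-sumOfSquares a b (trans
      (solve 2 (λ a b → a :* a :+ b :* b := (b :- a) :* (b :- a) :+ con (+ 2) :* a :* b) refl a b) e)))) refl

    t-supported : ∀ i j → Supported N (λ k → t k (+ suc i) (+ suc j))
    t-supported i j k N<k = t-zero k (+ suc i) (+ suc j) (λ e → sq≢ k (2 ℕ.* suc i ℕ.* suc j) N<k (trans (cong (λ z → k * k + z) (+2* (suc i) (suc j))) e))

    -- The sum over k is split at b - a. The middle term vanishes, and (k, a, b) ↦ (-k, b, a)
    -- carries the left half to the right half.
    S-X₁ : S ≡ X₁ + X₁
    S-X₁ = begin
      S
        ≡⟨ Σ₂-cong⁺ {λ a b → ΣZ N (λ k → t k a b)} {λ a b → Σ⁺ N (x₁ a b) + Σ⁺ N (x₁ b a)} inner ⟩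
      Σ₂ (λ a b → Σ⁺ N (x₁ a b) + Σ⁺ N (x₁ b a))
        ≡⟨ Σ₂-+ (λ a b → Σ⁺ N (x₁ a b)) (λ a b → Σ⁺ N (x₁ b a)) ⟩
      X₁ + Σ₂ (λ a b → Σ⁺ N (x₁ b a))
        ≡⟨ cong (λ z → X₁ + z) (Σ⁺-swap N N (λ a b → Σ⁺ N (x₁ b a))) ⟩
      X₁ + X₁ ∎
      where
      open ≡.≡-Reasoning
      inner : ∀ i j → i ℕ.< N → j ℕ.< N → ΣZ N (λ k → t k (+ suc i) (+ suc j)) ≡ Σ⁺ N (x₁ (+ suc i) (+ suc j)) + Σ⁺ N (x₁ (+ suc j) (+ suc i))
      inner i j i<N j<N = begin
        ΣZ N (λ k → t k a b)
          ≡⟨ ΣZ-split N (b - a) (λ k → t k a b) (t-supported i j) (∣-∣≤ i j i<N j<N) ⟩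
        t (b - a) a b + (Σ⁺ R (λ m → t (b - a + m) a b) + Σ⁺ R (λ m → t (b - a - m) a b))
          ≡⟨ cong₂ _+_ (middle a b) (cong₂ _+_ (N<R (x₁ a b) (λ m N≤m → x₁-far i j m N≤m))
               (trans (Σ⁺-cong R {λ m → t (b - a - m) a b} {x₁ b a} (swapped a b)) (N<R (x₁ b a) (λ m N≤m → x₁-far j i m N≤m)))) ⟩
        + 0 + (Σ⁺ N (x₁ a b) + Σ⁺ N (x₁ b a))
          ≡⟨ ℤₚ.+-identityˡ _ ⟩
        Σ⁺ N (x₁ a b) + Σ⁺ N (x₁ b a) ∎
        where
        a = + suc i
        b = + suc j

    -- The terms of X₁ in the variables b, m and j = m - a, where k = j + b and k² + 2ab = j² + b² +
    -- 2bm. Now j runs over all integers, so a is no longer restricted to be positive.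
    h : ℤ → ℤ → ℤ → ℤ
    h b m j = ψ (m - j) b * P (j + b) (m - j) b * E (j * j + b * b + + 2 * b * m) (+ N)

    H Zᵈ : ℤ
    H = Σ₂ (λ b m → ΣZ N (h b m))
    Zᵈ = Σ₂ (λ b m → h b m m)

    h-zero : ∀ b m j → j * j + b * b + + 2 * b * m ≢ + N → h b m j ≡ + 0
    h-zero b m j n = trans (cong (ψ (m - j) b * P (j + b) (m - j) b *_) (E-zero n)) (ℤₚ.*-zeroʳ (ψ (m - j) b * P (j + b) (m - j) b))

    h-supported : ∀ i m → Supported N (h (+ suc i) (+ m))
    h-supported i m j N<j = h-zero (+ suc i) (+ m) j (λ e → sq≢ j (suc i ℕ.* suc i ℕ.+ 2 ℕ.* suc i ℕ.* m) N<j
      (trans (cong (λ z → j * j + z) (sym (bbm i m))) (trans (sym (ℤₚ.+-assoc (j * j) _ _)) e)))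

    h-x₁ : ∀ b m a → h b m (m - a) ≡ x₁ a b m
    h-x₁ b m a = cong₂ (λ y z → y * E z (+ N))
      (cong₂ (λ y z → ψ y b * z) m-[m-a] (cong₂ (λ y z → P y z b) (solve 3 (λ b m a → m :- a :+ b := b :- a :+ m) refl b m a) m-[m-a]))
      (solve 3 (λ b m a → (m :- a) :* (m :- a) :+ b :* b :+ con (+ 2) :* b :* m := (b :- a :+ m) :* (b :- a :+ m) :+ con (+ 2) :* a :* b) refl b m a)
      where
      m-[m-a] : m - (m - a) ≡ a
      m-[m-a] = solve 2 (λ m a → m :- (m :- a) := a) refl m a

    x₁-far′ : ∀ i j m → N ℕ.≤ i → x₁ (+ suc i) (+ suc j) m ≡ + 0
    x₁-far′ i j m N≤i = t-zero k (+ suc i) (+ suc j) (λ e → sq+-≢ k (2 ℕ.* suc i ℕ.* suc j) (ℕₚ.≤-<-trans N≤i (ℕₚ.<-≤-trans (ℕₚ.n<1+n i) (ℕₚ.≤-trans (ℕₚ.m≤n*m (suc i) 2) (ℕₚ.m≤m*n (2 ℕ.* suc i) (suc j)))))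
      (trans (cong (λ z → k * k + z) (+2* (suc i) (suc j))) e))
      where k = + suc j - + suc i + m

    -- The terms with a = -s < 0.
    y : ℤ → ℤ → ℤ → ℤ
    y m s b = ψ (- s) b * P (m + s + b) (- s) b * E ((m + s) * (m + s) + b * b + + 2 * b * m) (+ N)

    h-y : ∀ b m s → h b m (m + s) ≡ y m s b
    h-y b m s = cong₂ (λ u v → ψ u b * P (m + s + b) v b * E ((m + s) * (m + s) + b * b + + 2 * b * m) (+ N)) e e
      where
      e : m - (m + s) ≡ - s
      e = solve 2 (λ m s → m :- (m :+ s) := :- s) refl m s

    -- The form (m + s)² + b² + 2bm is symmetric in s and b, while ψ(-s, b) changes sign when they
    -- are exchanged.
    y-antisym : ∀ m s b → y m s b ≡ - y m b s
    y-antisym m s b = begin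
      ψ (- s) b * P (m + s + b) (- s) b * E q (+ N)
        ≡⟨ E-cong (λ e → cong (_* P (m + s + b) (- s) b) (ψ-odd s b m e)) ⟩
      - ψ (- b) s * P (m + s + b) (- s) b * E q (+ N)
        ≡⟨ cong₂ (λ u v → - ψ (- b) s * u * E v (+ N)) (P-odd m s b)
             (solve 3 (λ m s b → (m :+ s) :* (m :+ s) :+ b :* b :+ con (+ 2) :* b :* m := (m :+ b) :* (m :+ b) :+ s :* s :+ con (+ 2) :* s :* m) refl m s b) ⟩
      - ψ (- b) s * P (m + b + s) (- b) s * E q′ (+ N)
        ≡⟨ solve 3 (λ u v w → (:- u) :* v :* w := :- (u :* v :* w)) refl (ψ (- b) s) (P (m + b + s) (- b) s) (E q′ (+ N)) ⟩
      - y m b s ∎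
      where
      open ≡.≡-Reasoning
      q = (m + s) * (m + s) + b * b + + 2 * b * m
      q′ = (m + b) * (m + b) + s * s + + 2 * s * m

    y-far : ∀ j m i → N ℕ.≤ i → h (+ suc j) (+ m) (+ m + + suc i) ≡ + 0
    y-far j m i N≤i = h-supported j m (+ m + + suc i) (ℕₚ.≤-<-trans N≤i (ℕₚ.<-≤-trans (ℕₚ.n<1+n i) (ℕₚ.m≤n+m (suc i) m)))

    -- Splitting the sum over j at m sorts the terms by the sign of a = m - j: positive a give X₁, a
    -- = 0 gives Zᵈ, and negative a cancel in pairs.
    H-X₁ : H ≡ Zᵈ + X₁
    H-X₁ = begin
      H
        ≡⟨ Σ₂-cong⁺ {λ b m → ΣZ N (h b m)} {λ b m → h b m m + (Σ⁺ N (λ s → y m s b) + Σ⁺ N (λ a → x₁ a b m))} inner ⟩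
      Σ₂ (λ b m → h b m m + (Σ⁺ N (λ s → y m s b) + Σ⁺ N (λ a → x₁ a b m)))
        ≡⟨ trans (Σ₂-+ (λ b m → h b m m) (λ b m → Σ⁺ N (λ s → y m s b) + Σ⁺ N (λ a → x₁ a b m)))
                 (cong (λ z → Zᵈ + z) (Σ₂-+ (λ b m → Σ⁺ N (λ s → y m s b)) (λ b m → Σ⁺ N (λ a → x₁ a b m)))) ⟩
      Zᵈ + (Σ₂ (λ b m → Σ⁺ N (λ s → y m s b)) + Σ₂ (λ b m → Σ⁺ N (λ a → x₁ a b m)))
        ≡⟨ cong₂ (λ u v → Zᵈ + (u + v)) y-sum x-sum ⟩
      Zᵈ + (+ 0 + X₁)
        ≡⟨ cong (λ z → Zᵈ + z) (ℤₚ.+-identityˡ X₁) ⟩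
      Zᵈ + X₁ ∎
      where
      open ≡.≡-Reasoning
      inner : ∀ j m → j ℕ.< N → m ℕ.< N → ΣZ N (h (+ suc j) (+ suc m)) ≡
        h (+ suc j) (+ suc m) (+ suc m) + (Σ⁺ N (λ s → y (+ suc m) s (+ suc j)) + Σ⁺ N (λ a → x₁ a (+ suc j) (+ suc m)))
      inner j m′ _ m<N = trans (ΣZ-split N m (h b m) (h-supported j (suc m′)) m<N)
        (cong (λ z → h b m m + z) (cong₂ _+_
          (trans (N<R (λ s → h b m (m + s)) (λ i N≤i → y-far j (suc m′) i N≤i)) (Σ⁺-cong N {λ s → h b m (m + s)} {λ s → y m s b} (h-y b m)))
          (trans (Σ⁺-cong R {λ a → h b m (m - a)} {λ a → x₁ a b m} (h-x₁ b m)) (N<R (λ a → x₁ a b m) (λ i N≤i → x₁-far′ i j m N≤i)))))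
        where
        b = + suc j
        m = + suc m′
      y-sum : Σ₂ (λ b m → Σ⁺ N (λ s → y m s b)) ≡ + 0
      y-sum = trans (Σ⁺-swap N N (λ b m → Σ⁺ N (λ s → y m s b))) (trans (Σ⁺-cong N {λ m → Σ⁺ N (λ b → Σ⁺ N (λ s → y m s b))} {λ _ → + 0}
        (λ m → Σ⁺-antisym N (λ b s → y m s b) (λ b s → y-antisym m s b))) (Σ⁺-zero N {λ _ → + 0} (λ _ _ → refl)))
      x-sum : Σ₂ (λ b m → Σ⁺ N (λ a → x₁ a b m)) ≡ X₁
      x-sum = trans (Σ⁺-cong N {λ b → Σ⁺ N (λ m → Σ⁺ N (λ a → x₁ a b m))} {λ b → Σ⁺ N (λ a → Σ⁺ N (λ m → x₁ a b m))} (λ b → Σ⁺-swap N N (λ m a → x₁ a b m)))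
        (Σ⁺-swap N N (λ b a → Σ⁺ N (x₁ a b)))

-- Σ_{b+c=w, b,c>0} χ(b) c, for w = n + 1
moment : ℕ → ℤ
moment n = Z.∑ n (λ i → χ (+ suc i) * + (n ∸ i))

private
  χ-sum : ∀ t → Z.∑ (t ℕ.* 3) (λ i → χ (+ suc i)) ≡ + 0
  χ-sum zero = refl
  χ-sum (suc t) = trans (cong₂ (λ x y → x + y + χ (+ suc (suc (suc (t ℕ.* 3))))) (cong₂ _+_ (χ-sum t) (cong χ₃ (cong s3 (m3-3 t)))) (cong χ₃ (cong s3 (cong s3 (m3-3 t)))))
    (trans (cong (λ z → + 0 + + 1 + -[1+ 0 ] + χ₃ z) (cong s3 (cong s3 (cong s3 (m3-3 t))))) refl)
    where
    m3-3 : ∀ t → m3 (t ℕ.* 3) ≡ 0F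
    m3-3 zero = refl
    m3-3 (suc t) = cong s3 (cong s3 (cong s3 (m3-3 t)))

  m3-3 : ∀ t → m3 (t ℕ.* 3) ≡ 0F
  m3-3 zero = refl
  m3-3 (suc t) = cong s3 (cong s3 (cong s3 (m3-3 t)))

  moment-suc : ∀ n → moment (suc n) ≡ moment n + Z.∑ (suc n) (λ i → χ (+ suc i))
  moment-suc n = begin
    Z.∑ n (λ i → χ (+ suc i) * + (suc n ∸ i)) + χ (+ suc n) * + (suc n ∸ n)
      ≡⟨ cong₂ _+_ (trans (Z.∑-cong< n (λ i i<n → trans (cong (λ z → χ (+ suc i) * + z) (ℕₚ.+-∸-assoc 1 (ℕₚ.<⇒≤ i<n)))
             (solve 2 (λ c x → c :* (con (+ 1) :+ x) := c :* x :+ c) refl (χ (+ suc i)) (+ (n ∸ i))))) (Z.∑-+ n _ _))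
           (trans (cong (λ z → χ (+ suc n) * + z) (ℕₚ.m+n∸n≡m 1 n)) (ℤₚ.*-identityʳ _)) ⟩
    (moment n + Z.∑ n (λ i → χ (+ suc i))) + χ (+ suc n)
      ≡⟨ ℤₚ.+-assoc (moment n) _ _ ⟩
    moment n + Z.∑ (suc n) (λ i → χ (+ suc i)) ∎
    where open ≡.≡-Reasoning

-- Raising n by one adds the partial sum of χ, and these partial sums run through 1, 0, 0
-- periodically. So three steps add 1, and the moment is w/3 when 3 | w.
moment-value : ∀ t → moment (2 ℕ.+ t ℕ.* 3) ≡ + suc t
moment-value zero = refl
moment-value (suc t) = begin
  moment (2 ℕ.+ suc t ℕ.* 3)
    ≡⟨ trans (moment-suc (4 ℕ.+ t ℕ.* 3)) (cong (_+ c₅) (trans (moment-suc (3 ℕ.+ t ℕ.* 3)) (cong (_+ c₄) (trans (moment-suc (2 ℕ.+ t ℕ.* 3)) (cong (_+ c₃) (moment-value t)))))) ⟩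
  + suc t + c₃ + c₄ + c₅
    ≡⟨ cong₂ (λ y z → + suc t + y + z + c₅) (χ-sum (suc t)) (trans (cong (λ z → z + χ (+ suc (3 ℕ.+ t ℕ.* 3))) (χ-sum (suc t))) (cong (λ z → + 0 + χ₃ z) (cong s3 (m3-3 (suc t))))) ⟩
  + suc t + + 0 + + 1 + c₅
    ≡⟨ cong (λ z → + suc t + + 0 + + 1 + z) (trans (cong₂ (λ y z → y + χ₃ z) (trans (cong₂ (λ y z → y + χ₃ z) (χ-sum (suc t)) (cong s3 (m3-3 (suc t)))) refl) (cong s3 (cong s3 (m3-3 (suc t))))) refl) ⟩
  + suc t + + 0 + + 1 + + 0
    ≡⟨ solve 1 (λ t → t :+ con (+ 0) :+ con (+ 1) :+ con (+ 0) := con (+ 1) :+ t) refl (+ suc t) ⟩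
  + suc (suc t) ∎
  where
  open ≡.≡-Reasoning
  c : ℕ → ℤ
  c n = Z.∑ n (λ i → χ (+ suc i))
  c₃ = c (3 ℕ.+ t ℕ.* 3)
  c₄ = c (4 ℕ.+ t ℕ.* 3)
  c₅ = c (5 ℕ.+ t ℕ.* 3)

3∣-root : ∀ n → m3 n *₃ m3 n ≡ 0F → ∃ λ t → n ≡ t ℕ.* 3
3∣-root 0 _ = 0 , refl
3∣-root 1 ()
3∣-root 2 ()
3∣-root (suc (suc (suc n))) e with 3∣-root n (trans (cong₂ _*₃_ (sym (per (m3 n))) (sym (per (m3 n)))) e)
  where
  per : ∀ a → s3 (s3 (s3 a)) ≡ a
  per = from-yes (Finₚ.all? λ a → s3 (s3 (s3 a)) ≟₃ a)
... | t , refl = suc t , refl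

-- Evaluation with the weights 1 and (k - b)(k + a).

module Values (M : ℕ) where
  N : ℕ
  N = M ℕ.* 3

  N≡0 : r3 (+ N) ≡ 0F
  N≡0 = m3-3 M

  open Forms N N≡0

  -- The symmetrisation P₂(k) + P₂(-k) = 2(k² - ab) equals 3k² - N on k² + 2ab = N, the factor in
  -- the recursion.
  P₁ P₂ : ℤ → ℤ → ℤ → ℤ
  P₁ _ _ _ = + 1
  P₂ k a b = (k - b) * (k + a)

  module W₁ = Weighted P₁ (λ _ _ _ → refl) (λ _ _ _ → refl)
  module W₂ = Weighted P₂ (λ k a b → solve 3 (λ k a b → (k :- b) :* (k :+ a) := ((:- k) :- a) :* ((:- k) :+ b)) refl k a b)
    (λ m t b → solve 3 (λ m t b → (m :+ t :+ b :- b) :* (m :+ t :+ b :+ (:- t)) := (m :+ b :+ t :- t) :* (m :+ b :+ t :+ (:- b))) refl m t b)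

  private
    f₅ : ∀ b m → (m +₃ b) *₃ (m +₃ b) ≡ 0F → ψ₃ 0F b ≡ - ψ₃ 0F m
    f₅ = from-yes (Finₚ.all? λ b → Finₚ.all? λ m → (((m +₃ b) *₃ (m +₃ b)) ≟₃ 0F) →-dec (ψ₃ 0F b ≟ - ψ₃ 0F m))

    m-m : ∀ m → m - m ≡ + 0
    m-m m = ℤₚ.+-inverseʳ m

    squareShape : ∀ b m → m * m + b * b + + 2 * b * m ≡ (m + b) * (m + b)
    squareShape = solve 2 (λ b m → m :* m :+ b :* b :+ con (+ 2) :* b :* m := (m :+ b) :* (m :+ b)) refl

  -- On the diagonal (m + b)² = N, so b ≡ -m modulo 3 and χ(b) = -χ(m): the double sum is
  -- antisymmetric.
  Z₁-zero : W₁.Zᵈ ≡ + 0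
  Z₁-zero = trans (Σ₂-cong {λ b m → W₁.h b m m} {z} (λ b m → cong₂ (λ u v → ψ u b * + 1 * E v (+ N)) (m-m m) (squareShape b m)))
    (Σ⁺-antisym N z antisym)
    where
    z : ℤ → ℤ → ℤ
    z b m = ψ (+ 0) b * + 1 * E ((m + b) * (m + b)) (+ N)
    antisym : ∀ b m → z b m ≡ - z m b
    antisym b m = trans (E-cong {(m + b) * (m + b)} {+ N} {f = ψ (+ 0) b * + 1} {g = - ψ (+ 0) m * + 1} (λ e → cong (_* + 1) (f₅ (r3 b) (r3 m)
        (trans (cong₂ _*₃_ (sym (r3-+ m b)) (sym (r3-+ m b))) (trans (sym (r3-* (m + b) (m + b))) (trans (cong r3 e) N≡0))))))
      (trans (cong (λ w → - ψ (+ 0) m * + 1 * E (w * w) (+ N)) (ℤₚ.+-comm m b))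
        (solve 2 (λ p e → (:- p) :* con (+ 1) :* e := :- (p :* con (+ 1) :* e)) refl (ψ (+ 0) m) (E ((b + m) * (b + m)) (+ N))))

  S₁≡2H₁ : W₁.S ≡ W₁.H + W₁.H
  S₁≡2H₁ = trans W₁.S-X₁ (cong₂ _+_ (sym H≡) (sym H≡))
    where
    H≡ : W₁.H ≡ W₁.X₁
    H≡ = trans W₁.H-X₁ (trans (cong (_+ W₁.X₁) Z₁-zero) (ℤₚ.+-identityˡ _))

  -- In the variables b, m, j the weight becomes j(b + m), which is odd in j, while ψ is even in j
  -- by `ψ-reflect`.
  H₂-zero : W₂.H ≡ + 0
  H₂-zero = trans (Σ₂-cong {λ b m → ΣZ N (W₂.h b m)} {λ _ _ → + 0} inner) (Σ⁺-zero N {λ _ → Σ⁺ N (λ _ → + 0)} (λ _ _ → Σ⁺-zero N {λ _ → + 0} (λ _ _ → refl)))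
    where
    odd : ∀ b m j → W₂.h b m j ≡ - W₂.h b m (- j)
    odd b m j = trans (E-cong {f = ψ (m - j) b * P₂ (j + b) (m - j) b} {g = - (ψ (m - - j) b * P₂ (- j + b) (m - - j) b)} (λ e →
        trans (cong (_* P₂ (j + b) (m - j) b) (trans (ψ-reflect j b m e) (cong (λ z → ψ (m + z) b) (sym (ℤₚ.neg-involutive j)))))
          (solve 4 (λ p j b m → p :* ((j :+ b :- b) :* (j :+ b :+ (m :- j))) := :- (p :* (((:- j) :+ b :- b) :* ((:- j) :+ b :+ (m :- (:- j)))))) refl (ψ (m - - j) b) j b m)))
      (trans (cong (λ z → - (ψ (m - - j) b * P₂ (- j + b) (m - - j) b) * E (z + b * b + + 2 * b * m) (+ N)) (solve 1 (λ j → j :* j := (:- j) :* (:- j)) refl j))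
        (sym (ℤₚ.neg-distribˡ-* (ψ (m - - j) b * P₂ (- j + b) (m - - j) b) _)))
    inner : ∀ b m → ΣZ N (W₂.h b m) ≡ + 0
    inner b m = x+x≡0 _ (trans (ΣZ-cong N (odd b m)) (trans (ΣZ-cong N (λ j → sym (ℤₚ.-1*i≡-i (W₂.h b m (- j)))))
      (trans (ΣZ-* N -[1+ 0 ] (λ j → W₂.h b m (- j))) (trans (ℤₚ.-1*i≡-i _) (cong -_ (ΣZ-neg N (W₂.h b m)))))))

  squares : ℤ
  squares = Σ⁺ N (λ w → E (w * w) (+ N))

  -- Collect the terms with m + b = w. For w² = N they give w Σ χ(b) m = w · w/3 = M.
  Z₂-value : W₂.Zᵈ ≡ + M * squares
  Z₂-value = begin
    W₂.Zᵈ
      ≡⟨ Σ₂-cong {λ b m → W₂.h b m m} {λ b m → χ b * (m * (m + b)) * E ((m + b) * (m + b)) (+ N)} (λ b m → cong₂ _*_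
           (cong₂ (λ u v → ψ u b * v) (m-m m) (solve 2 (λ b m → (m :+ b :- b) :* (m :+ b :+ (m :- m)) := m :* (m :+ b)) refl b m)) (cong (λ v → E v (+ N)) (squareShape b m))) ⟩
    Z.∑ N (λ i → Z.∑ N (λ j → F i j))
      ≡⟨ Z.∑-cong< N (λ i i<N → trans (cong (λ z → Z.∑ z (F i)) (sym (ℕₚ.m∸n+n≡m (ℕₚ.<⇒≤ i<N)))) (trans (Z.∑-split (N ∸ i) i (F i)) (trans (cong (λ z → Z.∑ (N ∸ i) (F i) + z) (Z.∑-zero< i (λ j _ → outside i j i<N))) (ℤₚ.+-identityʳ _)))) ⟩
    Z.∑ N (λ i → Z.∑ (N ∸ i) (λ j → F i j))
      ≡⟨ Z.∑-cong N (λ i → Z.∑-cong (N ∸ i) (λ j → cong (F i) (sym (ℕₚ.m+n∸m≡n i j)))) ⟩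
    Z.∑ N (λ i → Z.∑ (N ∸ i) (λ j → F i (i ℕ.+ j ∸ i)))
      ≡⟨ Z.∑-triangle N (λ n i → F i (n ∸ i)) ⟨
    Z.∑ N (λ n → Z.∑ (suc n) (λ i → F i (n ∸ i)))
      ≡⟨ Z.∑-cong N row ⟩
    Z.∑ N (λ n → + M * E (w n * w n) (+ N))
      ≡⟨ Z.∑-*ˡ N (+ M) _ ⟩
    + M * Z.∑ N (λ n → E (w n * w n) (+ N))
      ≡⟨ cong (+ M *_) shift ⟩
    + M * squares ∎
    where
    open ≡.≡-Reasoning
    w : ℕ → ℤ
    w n = + suc (suc n)
    F : ℕ → ℕ → ℤ
    F i j = χ (+ suc i) * (+ suc j * (+ suc j + + suc i)) * E ((+ suc j + + suc i) * (+ suc j + + suc i)) (+ N)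
    big : ∀ x → N ℕ.< x → E (+ x * + x) (+ N) ≡ + 0
    big x N<x = E-zero (λ e → sq≢ (+ x) 0 N<x (trans (ℤₚ.+-identityʳ (+ x * + x)) e))
    outside : ∀ i j → i ℕ.< N → F i (N ∸ i ℕ.+ j) ≡ + 0
    outside i j i<N = trans (cong (λ z → χ (+ suc i) * (+ suc m * (+ suc m + + suc i)) * z) (big (suc m ℕ.+ suc i) (s≤s (ℕₚ.≤-trans (ℕₚ.≤-reflexive (sym (ℕₚ.m∸n+n≡m (ℕₚ.<⇒≤ i<N))))
        (ℕₚ.+-mono-≤ (ℕₚ.m≤m+n (N ∸ i) j) (ℕₚ.n≤1+n i)))))) (ℤₚ.*-zeroʳ (χ (+ suc i) * (+ suc m * (+ suc m + + suc i))))
      where m = N ∸ i ℕ.+ j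
    value : ∀ n → w n * w n ≡ + N → moment (suc n) * w n ≡ + M
    value n e with 3∣-root (suc (suc n)) (trans (sym (r3-* (w n) (w n))) (trans (cong r3 e) N≡0))
    ... | suc t , refl = ℤₚ.*-cancelʳ-≡ (moment (2 ℕ.+ t ℕ.* 3) * w (suc (t ℕ.* 3))) (+ M) (+ 3) (trans (cong (λ z → z * w (suc (t ℕ.* 3)) * + 3) (moment-value t))
        (trans (solve 2 (λ a b → a :* b :* con (+ 3) := (a :* con (+ 3)) :* b) refl (+ suc t) (w (suc (t ℕ.* 3))))
        (trans (cong (_* w (suc (t ℕ.* 3))) (sym (ℤₚ.pos-* (suc t) 3))) (trans e (ℤₚ.pos-* M 3)))))
    row : ∀ n → Z.∑ (suc n) (λ i → F i (n ∸ i)) ≡ + M * E (w n * w n) (+ N)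
    row n = begin
      Z.∑ (suc n) (λ i → F i (n ∸ i))
        ≡⟨ Z.∑-cong< (suc n) (λ i p → cong₂ (λ x y → χ (+ suc i) * (x * y) * E (y * y) (+ N)) (cong +_ (sym (ℕₚ.+-∸-assoc 1 (ℕₚ.≤-pred p))))
             (cong +_ (trans (ℕₚ.+-suc (suc (n ∸ i)) i) (cong (λ z → suc (suc z)) (ℕₚ.m∸n+n≡m (ℕₚ.≤-pred p)))))) ⟩
      Z.∑ (suc n) (λ i → χ (+ suc i) * (+ (suc n ∸ i) * w n) * E (w n * w n) (+ N))
        ≡⟨ trans (Z.∑-cong (suc n) (λ i → cong (_* E (w n * w n) (+ N)) (sym (ℤₚ.*-assoc (χ (+ suc i)) _ _)))) (trans (Z.∑-*ʳ (suc n) _ _) (cong (_* E (w n * w n) (+ N)) (Z.∑-*ʳ (suc n) (w n) _))) ⟩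
      moment (suc n) * w n * E (w n * w n) (+ N)
        ≡⟨ E-cong (value n) ⟩
      + M * E (w n * w n) (+ N) ∎
    -- The row n belongs to w = n + 2, so w = 1 does not occur among the rows; it does not satisfy
    -- w² = 3M either.
    shift : Z.∑ N (λ n → E (w n * w n) (+ N)) ≡ squares
    shift = sym (trans (sym (Σ⁺-extend N 1 (λ w → E (w * w) (+ N)) (λ i N≤i → big (suc i) (s≤s N≤i))))
      (trans (cong (λ z → Σ⁺ z (λ w → E (w * w) (+ N))) (ℕₚ.+-comm N 1)) (trans (Z.∑-head N (λ i → E (+ suc i * + suc i) (+ N))) (trans (cong (_+ Z.∑ N (λ n → E (w n * w n) (+ N))) (E-zero {+ 1 * + 1} {+ N} (one M))) (ℤₚ.+-identityˡ _)))))
      where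
      one : ∀ M → + 1 * + 1 ≢ + (M ℕ.* 3)
      one zero ()
      one (suc M) ()

  S₂-value : W₂.S ≡ - (+ 2 * (+ M * squares))
  S₂-value = trans W₂.S-X₁ (trans (cong (λ z → z + z) X₁≡) (solve 1 (λ z → (:- z) :+ (:- z) := :- (con (+ 2) :* z)) refl (+ M * squares)))
    where
    X₁≡ : W₂.X₁ ≡ - (+ M * squares)
    X₁≡ = trans (solve 2 (λ x z → x := (z :+ x) :+ (:- z)) refl W₂.X₁ W₂.Zᵈ) (trans (cong (_+ - W₂.Zᵈ) (trans (sym W₂.H-X₁) H₂-zero)) (trans (ℤₚ.+-identityˡ _) (cong -_ Z₂-value)))

-- Parity, and the signed sum over k² + nv = N with n < v.

odd : ℕ → Bool
odd zero = false
odd (suc n) = not (odd n)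

odd-+ : ∀ m n → odd (m ℕ.+ n) ≡ odd m xor odd n
odd-+ zero n = refl
odd-+ (suc m) n = trans (cong not (odd-+ m n)) (xor-not (odd m) (odd n))
  where
  xor-not : ∀ a b → not (a xor b) ≡ not a xor b
  xor-not true true = refl
  xor-not true false = refl
  xor-not false b = refl

odd-* : ∀ m n → odd (m ℕ.* n) ≡ odd m ∧ odd n
odd-* zero n = refl
odd-* (suc m) n = trans (odd-+ n (m ℕ.* n)) (trans (cong (odd n xor_) (odd-* m n)) (table (odd n) (odd m)))
  where
  table : ∀ a b → a xor (b ∧ a) ≡ not b ∧ a
  table true true = refl
  table true false = refl
  table false true = refl
  table false false = refl

signB evenB : Bool → ℤ
signB b = if b then -[1+ 0 ] else + 1
evenB b = if b then + 0 else + 1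

sg-odd : ∀ n → sg n ≡ signB (odd n)
sg-odd zero = refl
sg-odd (suc n) = trans (cong -_ (sg-odd n)) (flip (odd n))
  where
  flip : ∀ b → - signB b ≡ signB (not b)
  flip true = refl
  flip false = refl

even : ℕ → ℤ
even n = evenB (odd n)

lt : ℕ → ℕ → ℤ
lt m n = if m <ᵇ n then + 1 else + 0

lt-yes : ∀ {m n} → m ℕ.< n → lt m n ≡ + 1
lt-yes {m} {n} p with m <ᵇ n | ℕₚ.<⇒<ᵇ p
... | true | _ = refl

lt-no : ∀ {m n} → n ℕ.≤ m → lt m n ≡ + 0
lt-no {m} {n} p with m <ᵇ n | ℕₚ.<ᵇ⇒< m n
... | false | _ = refl
... | true | h = ⊥-elim (ℕₚ.<-irrefl refl (ℕₚ.<-≤-trans (h _) p))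

∑-even : ∀ R (g : ℕ → ℤ) → Z.∑ (R ℕ.+ R) (λ i → even (suc i) * g (suc i)) ≡ Z.∑ R (λ i → g (suc i ℕ.+ suc i))
∑-even zero g = refl
∑-even (suc R) g = begin
  Z.∑ (suc R ℕ.+ suc R) f
    ≡⟨ cong (λ z → Z.∑ z f) (cong suc (ℕₚ.+-suc R R)) ⟩
  Z.∑ (R ℕ.+ R) f + even (suc (R ℕ.+ R)) * g (suc (R ℕ.+ R)) + even (suc (suc (R ℕ.+ R))) * g (suc (suc (R ℕ.+ R)))
    ≡⟨ cong₂ (λ x y → Z.∑ (R ℕ.+ R) f + evenB (not x) * g (suc (R ℕ.+ R)) + evenB (not (not y)) * g (suc (suc (R ℕ.+ R)))) dbl dbl ⟩
  Z.∑ (R ℕ.+ R) f + + 0 * g (suc (R ℕ.+ R)) + + 1 * g (suc (suc (R ℕ.+ R)))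
    ≡⟨ solve 3 (λ a b c → a :+ con (+ 0) :* b :+ con (+ 1) :* c := a :+ c) refl (Z.∑ (R ℕ.+ R) f) (g (suc (R ℕ.+ R))) (g (suc (suc (R ℕ.+ R)))) ⟩
  Z.∑ (R ℕ.+ R) f + g (suc (suc (R ℕ.+ R)))
    ≡⟨ cong₂ _+_ (∑-even R g) (cong g (sym (cong suc (ℕₚ.+-suc R R)))) ⟩
  Z.∑ R (λ i → g (suc i ℕ.+ suc i)) + g (suc R ℕ.+ suc R) ∎
  where
  open ≡.≡-Reasoning
  f : ℕ → ℤ
  f i = even (suc i) * g (suc i)
  dbl : odd (R ℕ.+ R) ≡ false
  dbl = trans (odd-+ R R) (self (odd R))
    where
    self : ∀ b → b xor b ≡ false
    self true = refl
    self false = refl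

module PairSums (M : ℕ) where
  open Values M public
  open Forms N N≡0

  private
    -- With n = 2a, v = b here, and n = b + 2m, v = b in `f₇`, the value of ψ is ε(k) χ(v - n). Both
    -- kinds of sums thereby become partial sums of one function `Q` that is antisymmetric in n and
    -- v.
    f₆ : ∀ k a b → k *₃ k +₃ 2F *₃ a *₃ b ≡ 0F → ε₃ k * χ₃ (b +₃ (-₃ (2F *₃ a))) ≡ ψ₃ a b
    f₆ = from-yes (Finₚ.all? λ k → Finₚ.all? λ a → Finₚ.all? λ b → ((k *₃ k +₃ 2F *₃ a *₃ b) ≟₃ 0F) →-dec (ε₃ k * χ₃ (b +₃ (-₃ (2F *₃ a))) ≟ ψ₃ a b))
    f₇ : ∀ j b m → j *₃ j +₃ b *₃ b +₃ 2F *₃ b *₃ m ≡ 0F → ε₃ j * χ₃ (2F *₃ (2F *₃ m)) ≡ ψ₃ (m +₃ (-₃ j)) b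
    f₇ = from-yes (Finₚ.all? λ j → Finₚ.all? λ b → Finₚ.all? λ m → ((j *₃ j +₃ b *₃ b +₃ 2F *₃ b *₃ m) ≟₃ 0F) →-dec (ε₃ j * χ₃ (2F *₃ (2F *₃ m)) ≟ ψ₃ (m +₃ (-₃ j)) b))

    χ-odd : ∀ x y → χ (x - y) ≡ - χ (y - x)
    χ-odd x y = trans (cong χ₃ (r3-minus x y)) (trans (neg (r3 x) (r3 y)) (cong (λ z → - χ₃ z) (sym (r3-minus y x))))
      where
      neg : ∀ a b → χ₃ (a +₃ (-₃ b)) ≡ - χ₃ (b +₃ (-₃ a))
      neg = from-yes (Finₚ.all? λ a → Finₚ.all? λ b → χ₃ (a +₃ (-₃ b)) ≟ - χ₃ (b +₃ (-₃ a)))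

  Q : ℤ → ℤ → ℤ
  Q n v = ΣZ N (λ k → ε k * χ (v - n) * E (k * k + n * v) (+ N))

  Q-antisym : ∀ n v → Q n v ≡ - Q v n
  Q-antisym n v = trans (ΣZ-cong N (λ k → trans (cong₂ (λ x y → ε k * x * E (k * k + y) (+ N)) (χ-odd v n) (ℤₚ.*-comm n v))
      (solve 3 (λ a b c → a :* (:- b) :* c := con -[1+ 0 ] :* (a :* b :* c)) refl (ε k) (χ (n - v)) (E (k * k + v * n) (+ N)))))
    (trans (ΣZ-* N -[1+ 0 ] (λ k → ε k * χ (n - v) * E (k * k + v * n) (+ N))) (ℤₚ.-1*i≡-i (Q v n)))

  Q-far : ∀ n j → N ℕ.≤ n → Q (+ suc n) (+ suc j) ≡ + 0
  Q-far n j N≤n = ΣZ-zero N (λ k → trans (cong (ε k * χ (+ suc j - + suc n) *_) (E-zero {k * k + + suc n * + suc j} (λ e → sq+-≢ k (suc n ℕ.* suc j) (ℕₚ.≤-<-trans N≤n (ℕₚ.<-≤-trans (ℕₚ.n<1+n n) (ℕₚ.m≤m*n (suc n) (suc j))))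
    (trans (cong (λ z → k * k + z) (ℤₚ.pos-* (suc n) (suc j))) e)))) (ℤₚ.*-zeroʳ (ε k * χ (+ suc j - + suc n))))

  S₁-Q : W₁.S ≡ Σ₂ (λ n v → even (∣ n ∣) * Q n v)
  S₁-Q = begin
    W₁.S
      ≡⟨ Σ₂-cong {λ a b → ΣZ N (λ k → W₁.t k a b)} {λ a b → Q (a + a) b} (λ a b → ΣZ-cong N (term a b)) ⟩
    Σ₂ (λ a b → Q (a + a) b)
      ≡⟨ Σ⁺-swap N N (λ a b → Q (a + a) b) ⟩
    Σ⁺ N (λ b → Σ⁺ N (λ a → Q (a + a) b))
      ≡⟨ Σ⁺-cong⁺ N {λ b → Σ⁺ N (λ a → Q (a + a) b)} {λ b → Σ⁺ N (λ n → even (∣ n ∣) * Q n b)} (λ j _ →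
           trans (sym (∑-even N (λ n → Q (+ n) (+ suc j)))) (Σ⁺-extend N N (λ n → even (∣ n ∣) * Q n (+ suc j)) (λ i N≤i → trans (cong (even (suc i) *_) (Q-far i j N≤i)) (ℤₚ.*-zeroʳ (even (suc i)))))) ⟩
    Σ⁺ N (λ b → Σ⁺ N (λ n → even (∣ n ∣) * Q n b))
      ≡⟨ Σ⁺-swap N N (λ b n → even (∣ n ∣) * Q n b) ⟩
    Σ₂ (λ n v → even (∣ n ∣) * Q n v) ∎
    where
    open ≡.≡-Reasoning
    term : ∀ a b k → W₁.t k a b ≡ ε k * χ (b - (a + a)) * E (k * k + (a + a) * b) (+ N)
    term a b k = trans (E-cong {k * k + + 2 * a * b} {+ N} {ψ a b * + 1} {ε k * χ (b - (a + a))} (λ e →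
        trans (ℤₚ.*-identityʳ (ψ a b)) (trans (sym (f₆ (r3 k) (r3 a) (r3 b) (trans (sym (trans (r3-+ (k * k) (+ 2 * a * b)) (cong₂ _+₃_ (r3-* k k) (trans (r3-* (+ 2 * a) b) (cong (_*₃ r3 b) (r3-* (+ 2) a)))))) (trans (cong r3 e) N≡0))))
          (cong (λ z → ε k * χ₃ z) (sym (trans (r3-minus b (a + a)) (cong (λ z → r3 b +₃ (-₃ z)) (trans (r3-+ a a) refl))))))))
      (cong (λ z → ε k * χ (b - (a + a)) * E (k * k + z) (+ N)) (solve 2 (λ a b → con (+ 2) :* a :* b := (a :+ a) :* b) refl a b))

  -- The substitution n = b + 2m, v = b reaches exactly the pairs n > v of equal parity.
  H₁-Q : W₁.H ≡ Σ₂ (λ n v → lt (∣ v ∣) (∣ n ∣) * even ((∣ n ∣) ℕ.+ (∣ v ∣)) * Q n v)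
  H₁-Q = begin
    W₁.H
      ≡⟨ Σ₂-cong {λ b m → ΣZ N (W₁.h b m)} {λ b m → Q (b + (m + m)) b} (λ b m → ΣZ-cong N (term b m)) ⟩
    Σ⁺ N (λ b → Σ⁺ N (λ m → Q (b + (m + m)) b))
      ≡⟨ Σ⁺-cong⁺ N {λ b → Σ⁺ N (λ m → Q (b + (m + m)) b)} {λ b → Σ⁺ N (λ n → c n b * Q n b)} (λ j _ → inner j) ⟩
    Σ⁺ N (λ b → Σ⁺ N (λ n → c n b * Q n b))
      ≡⟨ Σ⁺-swap N N (λ b n → c n b * Q n b) ⟩
    Σ₂ (λ n v → c n v * Q n v) ∎
    where
    open ≡.≡-Reasoning
    c : ℤ → ℤ → ℤ
    c n v = lt (∣ v ∣) (∣ n ∣) * even ((∣ n ∣) ℕ.+ (∣ v ∣))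
    term : ∀ b m j → W₁.h b m j ≡ ε j * χ (b - (b + (m + m))) * E (j * j + (b + (m + m)) * b) (+ N)
    term b m j = trans (E-cong {j * j + b * b + + 2 * b * m} {+ N} {ψ (m - j) b * + 1} {ε j * χ (b - (b + (m + m)))} (λ e →
        trans (ℤₚ.*-identityʳ (ψ (m - j) b)) (trans (cong (λ z → ψ₃ z (r3 b)) (r3-minus m j)) (trans (sym (f₇ (r3 j) (r3 b) (r3 m)
            (trans (sym (trans (r3-+ (j * j + b * b) (+ 2 * b * m)) (cong₂ _+₃_ (trans (r3-+ (j * j) (b * b)) (cong₂ _+₃_ (r3-* j j) (r3-* b b))) (trans (r3-* (+ 2 * b) m) (cong (_*₃ r3 m) (r3-* (+ 2) b)))))) (trans (cong r3 e) N≡0))))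
          (cong (λ z → ε j * χ₃ z) (sym (trans (cong r3 (solve 2 (λ b m → b :- (b :+ (m :+ m)) := :- (con (+ 2) :* m)) refl b m)) (trans (r3-neg (+ 2 * m)) (cong -₃_ (r3-* (+ 2) m))))))))))
      (cong (λ z → ε j * χ (b - (b + (m + m))) * E z (+ N)) (solve 3 (λ j b m → j :* j :+ b :* b :+ con (+ 2) :* b :* m := j :* j :+ (b :+ (m :+ m)) :* b) refl j b m))
    inner : ∀ j → Σ⁺ N (λ m → Q (+ suc j + (m + m)) (+ suc j)) ≡ Σ⁺ N (λ n → c n (+ suc j) * Q n (+ suc j))
    inner j = sym (begin
      Z.∑ N F
        ≡⟨ Σ⁺-extend N (suc j ℕ.+ N) (λ n → c n (+ suc j) * Q n (+ suc j)) (λ i N≤i → trans (cong (c (+ suc i) (+ suc j) *_) (Q-far i j N≤i)) (ℤₚ.*-zeroʳ (c (+ suc i) (+ suc j)))) ⟨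
      Z.∑ (N ℕ.+ (suc j ℕ.+ N)) F
        ≡⟨ cong (λ z → Z.∑ z F) (trans (sym (ℕₚ.+-assoc N (suc j) N)) (trans (cong (ℕ._+ N) (ℕₚ.+-comm N (suc j))) (ℕₚ.+-assoc (suc j) N N))) ⟩
      Z.∑ (suc j ℕ.+ (N ℕ.+ N)) F
        ≡⟨ Z.∑-split (suc j) (N ℕ.+ N) F ⟩
      Z.∑ (suc j) F + Z.∑ (N ℕ.+ N) (λ i → F (suc j ℕ.+ i))
        ≡⟨ cong₂ _+_ (Z.∑-zero< (suc j) (λ i p → trans (cong (λ z → z * even (suc i ℕ.+ suc j) * Q (+ suc i) (+ suc j)) (lt-no {suc j} {suc i} p)) refl))
             (Z.∑-cong (N ℕ.+ N) above) ⟩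
      + 0 + Z.∑ (N ℕ.+ N) (λ i → even (suc i) * G (suc i))
        ≡⟨ trans (ℤₚ.+-identityˡ _) (∑-even N G) ⟩
      Z.∑ N (λ i → G (suc i ℕ.+ suc i)) ∎)
      where
      F G : ℕ → ℤ
      F i = c (+ suc i) (+ suc j) * Q (+ suc i) (+ suc j)
      G t = Q (+ suc j + + t) (+ suc j)
      above : ∀ i → F (suc j ℕ.+ i) ≡ even (suc i) * G (suc i)
      above i = cong₂ _*_ (trans (cong₂ _*_ (lt-yes {suc j} {suc (suc j ℕ.+ i)} (s≤s (ℕₚ.m≤m+n (suc j) i))) (cong evenB parity)) (ℤₚ.*-identityˡ (even (suc i))))
        (cong (λ z → Q (+ z) (+ suc j)) (sym (ℕₚ.+-suc (suc j) i)))
        where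
        parity : odd (suc (suc j ℕ.+ i) ℕ.+ suc j) ≡ odd (suc i)
        parity = trans (odd-+ (suc (suc j ℕ.+ i)) (suc j)) (trans (cong (λ z → not z xor odd (suc j)) (odd-+ (suc j) i)) (table (odd (suc j)) (odd i)))
          where
          table : ∀ a b → not (a xor b) xor a ≡ not b
          table true true = refl
          table true false = refl
          table false true = refl
          table false false = refl

  δ : ℕ → ℕ → ℤ
  δ n v = sg (n ℕ.* v ℕ.+ n)

  private
    -- A combination of the three weights in question that is symmetric: for n < v both `f n v` and
    -- `f v n` are - `even v`. Its sum against the antisymmetric `Q` is therefore zero.
    f : ℕ → ℕ → ℤ
    f n v = lt n v * δ n v - even n - lt n v * even (n ℕ.+ v)

    parity-table : ∀ a b → signB ((a ∧ b) xor a) - evenB a - evenB (a xor b) ≡ - evenB b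
    parity-table true true = refl
    parity-table true false = refl
    parity-table false true = refl
    parity-table false false = refl

    f-less : ∀ {n v} → n ℕ.< v → f n v ≡ f v n
    f-less {n} {v} p = begin
      lt n v * δ n v - even n - lt n v * even (n ℕ.+ v)
        ≡⟨ cong (λ z → z * δ n v - even n - z * even (n ℕ.+ v)) (lt-yes p) ⟩
      + 1 * δ n v - even n - + 1 * even (n ℕ.+ v)
        ≡⟨ cong₂ (λ x y → x - even n - y) (trans (ℤₚ.*-identityˡ (δ n v)) (trans (sg-odd (n ℕ.* v ℕ.+ n)) (cong signB (trans (odd-+ (n ℕ.* v) n) (cong (_xor odd n) (odd-* n v)))))) (trans (ℤₚ.*-identityˡ (even (n ℕ.+ v))) (cong evenB (odd-+ n v))) ⟩
      signB ((odd n ∧ odd v) xor odd n) - evenB (odd n) - evenB (odd n xor odd v)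
        ≡⟨ parity-table (odd n) (odd v) ⟩
      - even v
        ≡⟨ solve 3 (λ x d y → :- x := con (+ 0) :* d :- x :- con (+ 0) :* y) refl (even v) (δ v n) (even (v ℕ.+ n)) ⟩
      + 0 * δ v n - even v - + 0 * even (v ℕ.+ n)
        ≡⟨ cong (λ z → z * δ v n - even v - z * even (v ℕ.+ n)) (sym (lt-no (ℕₚ.<⇒≤ p))) ⟩
      f v n ∎
      where open ≡.≡-Reasoning

    f-sym : ∀ n v → f n v ≡ f v n
    f-sym n v with ℕₚ.<-cmp n v
    ... | tri< p _ _ = f-less p
    ... | tri≈ _ refl _ = refl
    ... | tri> _ _ p = sym (f-less p)

  -- Symmetry of `f` makes the left side S₁ plus the sum over n < v of equal parity. The latter is
  -- -H₁ because `Q` is antisymmetric, and S₁ = 2H₁.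
  pairSum : Σ₂ (λ n v → lt (∣ n ∣) (∣ v ∣) * δ (∣ n ∣) (∣ v ∣) * Q n v) ≡ W₁.H
  pairSum = begin
    T
      ≡⟨ solve 3 (λ t s h → t := (t :- s :- h) :+ (s :+ h)) refl T S′ H′ ⟩
    (T - S′ - H′) + (S′ + H′)
      ≡⟨ cong₂ _+_ balance (cong₂ _+_ (sym S₁-Q) H′≡) ⟩
    + 0 + (W₁.S + - W₁.H)
      ≡⟨ trans (ℤₚ.+-identityˡ _) (trans (cong (_+ - W₁.H) S₁≡2H₁) (solve 1 (λ h → (h :+ h) :+ (:- h) := h) refl W₁.H)) ⟩
    W₁.H ∎
    where
    open ≡.≡-Reasoning
    t s h : ℤ → ℤ → ℤ
    t n v = lt (∣ n ∣) (∣ v ∣) * δ (∣ n ∣) (∣ v ∣) * Q n v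
    s n v = even (∣ n ∣) * Q n v
    h n v = lt (∣ n ∣) (∣ v ∣) * even ((∣ n ∣) ℕ.+ (∣ v ∣)) * Q n v
    T = Σ₂ t
    S′ = Σ₂ s
    H′ = Σ₂ h
    H′≡ : H′ ≡ - W₁.H
    H′≡ = begin
      H′
        ≡⟨ Σ⁺-swap N N h ⟩
      Σ₂ (λ n v → h v n)
        ≡⟨ Σ₂-cong {λ n v → h v n} {λ n v → - h′ n v} (λ n v → trans (cong₂ (λ x y → lt (∣ v ∣) (∣ n ∣) * even x * y) (ℕₚ.+-comm (∣ v ∣) (∣ n ∣)) (Q-antisym v n)) (sym (ℤₚ.neg-distribʳ-* (lt (∣ v ∣) (∣ n ∣) * even ((∣ n ∣) ℕ.+ (∣ v ∣))) (Q n v)))) ⟩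
      Σ₂ (λ n v → - h′ n v)
        ≡⟨ trans (Σ⁺-cong N {λ n → Σ⁺ N (λ v → - h′ n v)} {λ n → - Σ⁺ N (h′ n)} (λ n → Σ⁺-neg N (h′ n))) (Σ⁺-neg N (λ n → Σ⁺ N (h′ n))) ⟩
      - Σ₂ h′
        ≡⟨ cong -_ (sym H₁-Q) ⟩
      - W₁.H ∎
      where
      h′ : ℤ → ℤ → ℤ
      h′ n v = lt (∣ v ∣) (∣ n ∣) * even ((∣ n ∣) ℕ.+ (∣ v ∣)) * Q n v
    balance : T - S′ - H′ ≡ + 0
    balance = begin
      T - S′ - H′
        ≡⟨ solve 3 (λ t s h → t :- s :- h := t :+ con -[1+ 0 ] :* (s :+ h)) refl T S′ H′ ⟩
      T + -[1+ 0 ] * (S′ + H′)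
        ≡⟨ cong (λ z → T + z) (trans (cong (-[1+ 0 ] *_) (sym (Σ₂-+ s h))) (sym (trans (Σ⁺-cong N {λ n → Σ⁺ N (λ v → -[1+ 0 ] * (s n v + h n v))} {λ n → -[1+ 0 ] * Σ⁺ N (λ v → s n v + h n v)} (λ n → Σ⁺-* N -[1+ 0 ] (λ v → s n v + h n v))) (Σ⁺-* N -[1+ 0 ] (λ n → Σ⁺ N (λ v → s n v + h n v)))))) ⟩
      T + Σ₂ (λ n v → -[1+ 0 ] * (s n v + h n v))
        ≡⟨ Σ₂-+ t (λ n v → -[1+ 0 ] * (s n v + h n v)) ⟨
      Σ₂ (λ n v → t n v + -[1+ 0 ] * (s n v + h n v))
        ≡⟨ Σ₂-cong {λ n v → t n v + -[1+ 0 ] * (s n v + h n v)} {λ n v → f (∣ n ∣) (∣ v ∣) * Q n v} (λ n v →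
             solve 5 (λ l d e e′ q → l :* d :* q :+ con -[1+ 0 ] :* (e :* q :+ l :* e′ :* q) := (l :* d :- e :- l :* e′) :* q) refl (lt (∣ n ∣) (∣ v ∣)) (δ (∣ n ∣) (∣ v ∣)) (even (∣ n ∣)) (even ((∣ n ∣) ℕ.+ (∣ v ∣))) (Q n v)) ⟩
      Σ₂ (λ n v → f (∣ n ∣) (∣ v ∣) * Q n v)
        ≡⟨ Σ⁺-antisym N (λ n v → f (∣ n ∣) (∣ v ∣) * Q n v) (λ n v → trans (cong₂ _*_ (f-sym (∣ n ∣) (∣ v ∣)) (Q-antisym n v)) (sym (ℤₚ.neg-distribʳ-* (f (∣ v ∣) (∣ n ∣)) (Q v n)))) ⟩
      + 0 ∎

-- Lambert-type divisor sums and their sums over x - k².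

E-iff : ∀ {x y x′ y′} → (x ≡ y → x′ ≡ y′) → (x′ ≡ y′ → x ≡ y) → E x y ≡ E x′ y′
E-iff {x} {y} {x′} {y′} f g with x ≟ y | x′ ≟ y′
... | yes p | yes p′ = refl
... | yes p | no p′ = ⊥-elim (p′ (f p))
... | no p | yes p′ = ⊥-elim (p (g p′))
... | no p | no p′ = refl

E-move : ∀ k x n → E x (n - k) ≡ E (k + x) n
E-move k x n = E-iff (λ e → trans (cong (λ z → k + z) e) (solve 2 (λ k n → k :+ (n :- k) := n) refl k n))
  (λ e → trans (solve 2 (λ k x → x := (k :+ x) :- k) refl k x) (cong (λ z → z - k) e))

ΣZ-radius : ∀ {R R′} f → Supported R f → R ℕ.≤ R′ → ΣZ R′ f ≡ ΣZ R f
ΣZ-radius {R} {R′} f h p = trans (cong (λ z → ΣZ z f) (sym (ℕₚ.m+[n∸m]≡n p))) (ΣZ-extend R (R′ ∸ R) f h)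

Σ⁺-radius : ∀ {R R′} f → (∀ i → R ℕ.≤ i → f (+ suc i) ≡ + 0) → R ℕ.≤ R′ → Σ⁺ R′ f ≡ Σ⁺ R f
Σ⁺-radius {R} {R′} f h p = trans (cong (λ z → Σ⁺ z f) (sym (ℕₚ.m+[n∸m]≡n p))) (Σ⁺-extend R (R′ ∸ R) f h)

shifted-supported : ∀ {R} n c {f} → Supported R f → ∣ c ∣ ℕ.≤ n → Supported (R ℕ.+ n) (λ x → f (c + x))
shifted-supported {R} n c {f} h c≤n x p = h (c + x) (ℕₚ.+-cancelʳ-< n R ∣ c + x ∣ (ℕₚ.<-≤-trans p
  (ℕₚ.≤-trans (ℕₚ.≤-reflexive (cong ∣_∣ (solve 2 (λ c x → x := (c :+ x) :- c) refl c x)))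
  (ℕₚ.≤-trans (ℤₚ.∣i-j∣≤∣i∣+∣j∣ (c + x) c) (ℕₚ.+-monoʳ-≤ ∣ c + x ∣ c≤n)))))

ΣZ-translate : ∀ R n c f → Supported R f → ∣ c ∣ ℕ.≤ n → ΣZ R f ≡ ΣZ (R ℕ.+ n) (λ x → f (c + x))
ΣZ-translate R n c f h c≤n = trans (ΣZ-shift R n c f h c≤n)
  (ΣZ-radius (λ x → f (c + x)) (shifted-supported n c h c≤n) (ℕₚ.≤-trans (ℕₚ.m≤m+n (R ℕ.+ n) (R ℕ.+ n)) (ℕₚ.n≤1+n _)))

pairs : ℕ → ℕ → (ℤ → ℤ → ℤ) → ℤ → ℤ
pairs d R c x = Σ⁺ R (λ a → Σ⁺ R (λ b → c a b * E (+ d * a * b) x))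

-- The coefficient of q^x in 1 + e Σ c(a,b) q^(dab). For d > 0 it vanishes at negative x, so that it
-- can be summed at N - k² over every k in the symmetric range.
lambert : ℕ → ℤ → (ℤ → ℤ → ℤ) → ℤ → ℤ
lambert d e c x = E (+ 0) x + e * pairs d ∣ x ∣ c x

private
  d*a*b : ∀ d i j → + d * + suc i * + suc j ≡ + (d ℕ.* suc i ℕ.* suc j)
  d*a*b d i j = trans (cong (_* + suc j) (sym (ℤₚ.pos-* d (suc i)))) (sym (ℤₚ.pos-* (d ℕ.* suc i) (suc j)))

  large₁ : ∀ d i j {m} → m ℕ.≤ i → m ℕ.< suc d ℕ.* suc i ℕ.* suc j
  large₁ d i j p = ℕₚ.<-≤-trans (s≤s p) (ℕₚ.≤-trans (ℕₚ.m≤n*m (suc i) (suc d)) (ℕₚ.m≤m*n (suc d ℕ.* suc i) (suc j)))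

  large₂ : ∀ d i j {m} → m ℕ.≤ j → m ℕ.< suc d ℕ.* suc i ℕ.* suc j
  large₂ d i j p = ℕₚ.<-≤-trans (s≤s p) (ℕₚ.m≤n*m (suc j) (suc d ℕ.* suc i))

pairs-radius : ∀ d c x R → x ℤ.≤ + R → pairs (suc d) R c x ≡ pairs (suc d) ∣ x ∣ c x
pairs-radius d c (+ m) R (ℤ.+≤+ m≤R) = trans
  (Z.∑-cong R (λ i → Σ⁺-radius (λ b → c (+ suc i) b * E (+ suc d * + suc i * b) (+ m))
    (λ j p → zero′ i j (λ e → ℕₚ.<-irrefl (sym e) (large₂ d i j p))) m≤R))
  (Σ⁺-radius (λ a → Σ⁺ m (λ b → c a b * E (+ suc d * a * b) (+ m)))
    (λ i p → Z.∑-zero< m (λ j _ → zero′ i j (λ e → ℕₚ.<-irrefl (sym e) (large₁ d i j p)))) m≤R)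
  where
  zero′ : ∀ i j → (suc d ℕ.* suc i ℕ.* suc j ≢ m) → c (+ suc i) (+ suc j) * E (+ suc d * + suc i * + suc j) (+ m) ≡ + 0
  zero′ i j h = trans (cong (c (+ suc i) (+ suc j) *_) (E-zero (λ e → h (ℤₚ.+-injective (trans (sym (d*a*b (suc d) i j)) e))))) (ℤₚ.*-zeroʳ (c (+ suc i) (+ suc j)))
pairs-radius d c -[1+ m ] R _ = trans (vanish R) (sym (vanish (suc m)))
  where
  vanish : ∀ R → pairs (suc d) R c -[1+ m ] ≡ + 0
  vanish R = Z.∑-zero< R (λ i _ → Z.∑-zero< R (λ j _ → trans (cong (c (+ suc i) (+ suc j) *_) (E-zero (neg i j))) (ℤₚ.*-zeroʳ (c (+ suc i) (+ suc j)))))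
    where
    neg : ∀ i j → + suc d * + suc i * + suc j ≢ -[1+ m ]
    neg i j e with trans (sym (d*a*b (suc d) i j)) e
    ... | ()

lambert-neg : ∀ d e c m → lambert (suc d) e c -[1+ m ] ≡ + 0
lambert-neg d e c m = trans (cong (λ z → + 0 + e * z) (sym (pairs-radius d c -[1+ m ] 0 ℤ.-≤+))) (trans (ℤₚ.+-identityˡ _) (ℤₚ.*-zeroʳ e))

N-k²≤N : ∀ N k → + N - k * k ℤ.≤ + N
N-k²≤N N k = ≡.subst (λ z → + N - z ℤ.≤ + N) (sym (sq k)) (ℤₚ.i-j≤i (+ N) (+ (∣ k ∣ ℕ.* ∣ k ∣)))

ΣZ-lambert : ∀ N d e c (f : ℤ → ℤ) → ΣZ N (λ k → f k * lambert (suc d) e c (+ N - k * k)) ≡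
  ΣZ N (λ k → f k * E (k * k) (+ N)) + e * Σ⁺ N (λ a → Σ⁺ N (λ b → ΣZ N (λ k → f k * c a b * E (k * k + + suc d * a * b) (+ N))))
ΣZ-lambert N d e c f = begin
  ΣZ N (λ k → f k * lambert (suc d) e c (+ N - k * k))
    ≡⟨ ΣZ-cong N (λ k → trans (cong₂ (λ x y → f k * (x + e * y)) (trans (E-move (k * k) (+ 0) (+ N)) (cong (λ z → E z (+ N)) (ℤₚ.+-identityʳ (k * k))))
         (sym (pairs-radius d c (+ N - k * k) N (N-k²≤N N k))))
         (solve 4 (λ f u e v → f :* (u :+ e :* v) := f :* u :+ e :* (f :* v)) refl (f k) (E (k * k) (+ N)) e (pairs (suc d) N c (+ N - k * k)))) ⟩
  ΣZ N (λ k → f k * E (k * k) (+ N) + e * (f k * pairs (suc d) N c (+ N - k * k)))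
    ≡⟨ trans (ΣZ-+ N (λ k → f k * E (k * k) (+ N)) (λ k → e * (f k * pairs (suc d) N c (+ N - k * k)))) (cong (λ z → ΣZ N (λ k → f k * E (k * k) (+ N)) + z) (ΣZ-* N e (λ k → f k * pairs (suc d) N c (+ N - k * k)))) ⟩
  ΣZ N (λ k → f k * E (k * k) (+ N)) + e * ΣZ N (λ k → f k * pairs (suc d) N c (+ N - k * k))
    ≡⟨ cong (λ z → ΣZ N (λ k → f k * E (k * k) (+ N)) + e * z) (trans (ΣZ-cong N inner) (trans (ΣZ-Σ⁺ N N (λ k a → Σ⁺ N (λ b → t k a b)))
         (Σ⁺-cong N {λ a → ΣZ N (λ k → Σ⁺ N (λ b → t k a b))} {λ a → Σ⁺ N (λ b → ΣZ N (λ k → t k a b))} (λ a → ΣZ-Σ⁺ N N (λ k b → t k a b))))) ⟩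
  ΣZ N (λ k → f k * E (k * k) (+ N)) + e * Σ⁺ N (λ a → Σ⁺ N (λ b → ΣZ N (λ k → t k a b))) ∎
  where
  open ≡.≡-Reasoning
  t : ℤ → ℤ → ℤ → ℤ
  t k a b = f k * c a b * E (k * k + + suc d * a * b) (+ N)
  inner : ∀ k → f k * pairs (suc d) N c (+ N - k * k) ≡ Σ⁺ N (λ a → Σ⁺ N (λ b → t k a b))
  inner k = trans (sym (Σ⁺-* N (f k) (λ a → Σ⁺ N (λ b → c a b * E (+ suc d * a * b) (+ N - k * k)))))
    (Σ⁺-cong N {λ a → f k * Σ⁺ N (λ b → c a b * E (+ suc d * a * b) (+ N - k * k))} {λ a → Σ⁺ N (λ b → t k a b)} (λ a →
      trans (sym (Σ⁺-* N (f k) (λ b → c a b * E (+ suc d * a * b) (+ N - k * k))))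
        (Σ⁺-cong N {λ b → f k * (c a b * E (+ suc d * a * b) (+ N - k * k))} {λ b → t k a b} (λ b →
          trans (sym (ℤₚ.*-assoc (f k) (c a b) _)) (cong (f k * c a b *_) (E-move (k * k) (+ suc d * a * b) (+ N)))))))

-- Half the number of representations by the hexagonal form, as a divisor sum
ℓ : ℤ → ℤ
ℓ = lambert 2 (+ 3) ψ

module DivisorSide (M : ℕ) where
  open Values M public
  open Forms N N≡0

  3∣k : ∀ k → k * k ≡ + N → r3 k ≡ 0F
  3∣k k e = root (r3 k) (trans (sym (r3-* k k)) (trans (cong r3 e) N≡0))
    where
    root : ∀ a → a *₃ a ≡ 0F → a ≡ 0F
    root = from-yes (Finₚ.all? λ a → ((a *₃ a) ≟₃ 0F) →-dec (a ≟₃ 0F))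

  squaresZ : ℤ
  squaresZ = ΣZ N (λ k → E (k * k) (+ N))

  ℓ-sum : ΣZ N (λ k → ℓ (+ N - k * k)) ≡ squaresZ + + 3 * W₁.S
  ℓ-sum = trans (ΣZ-cong N (λ k → sym (ℤₚ.*-identityˡ (ℓ (+ N - k * k))))) (trans (ΣZ-lambert N 1 (+ 3) ψ (λ _ → + 1))
    (cong₂ (λ x y → x + + 3 * y) (ΣZ-cong N (λ k → ℤₚ.*-identityˡ (E (k * k) (+ N))))
      (Σ₂-cong {λ a b → ΣZ N (λ k → + 1 * ψ a b * E (k * k + + 2 * a * b) (+ N))} {λ a b → ΣZ N (λ k → W₁.t k a b)} (λ a b →
        ΣZ-cong N (λ k → cong (_* E (k * k + + 2 * a * b) (+ N)) (ℤₚ.*-comm (+ 1) (ψ a b)))))))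

  -- On k² = N the factor is 2N = 6M, for each of the two signs of k, which gives 12M `squares`. On
  -- k² + 2ab = N it is P₂(k) + P₂(-k), which gives 3 · 2 S₂ = -12M `squares`.
  ℓ-recursion : M ≢ 0 → ΣZ N (λ k → (+ 3 * (k * k) - + N) * ℓ (+ N - k * k)) ≡ + 0
  ℓ-recursion M≢0 = begin
    ΣZ N (λ k → c k * ℓ (+ N - k * k))
      ≡⟨ ΣZ-lambert N 1 (+ 3) ψ c ⟩
    ΣZ N (λ k → c k * E (k * k) (+ N)) + + 3 * Σ₂ (λ a b → ΣZ N (λ k → c k * ψ a b * E (k * k + + 2 * a * b) (+ N)))
      ≡⟨ cong₂ (λ x y → x + + 3 * y) first second ⟩
    + 2 * (+ M * + 3) * (squares + squares) + + 3 * (+ 2 * W₂.S)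
      ≡⟨ cong (λ z → + 2 * (+ M * + 3) * (squares + squares) + + 3 * (+ 2 * z)) S₂-value ⟩
    + 2 * (+ M * + 3) * (squares + squares) + + 3 * (+ 2 * - (+ 2 * (+ M * squares)))
      ≡⟨ solve 2 (λ m s → con (+ 2) :* (m :* con (+ 3)) :* (s :+ s) :+ con (+ 3) :* (con (+ 2) :* (:- (con (+ 2) :* (m :* s)))) := con (+ 0)) refl (+ M) squares ⟩
    + 0 ∎
    where
    open ≡.≡-Reasoning
    c : ℤ → ℤ
    c k = + 3 * (k * k) - + N
    first : ΣZ N (λ k → c k * E (k * k) (+ N)) ≡ + 2 * (+ M * + 3) * (squares + squares)
    first = trans (ΣZ-cong N (λ k → E-cong {k * k} {+ N} {c k} {+ 2 * (+ M * + 3)} (λ e →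
        trans (cong (λ z → + 3 * z - + N) e) (trans (solve 1 (λ n → con (+ 3) :* n :- n := con (+ 2) :* n) refl (+ N)) (cong (+ 2 *_) (ℤₚ.pos-* M 3))))))
      (trans (ΣZ-* N (+ 2 * (+ M * + 3)) (λ k → E (k * k) (+ N))) (cong (+ 2 * (+ M * + 3) *_)
        (trans (cong₂ _+_ (E-zero {+ 0} {+ N} (nonzero M M≢0)) (cong (λ z → squares + z) (Σ⁺-cong N {λ w → E ((+ 0 - w) * (+ 0 - w)) (+ N)} {λ w → E (w * w) (+ N)} (λ w →
           cong (λ z → E z (+ N)) (solve 1 (λ w → (con (+ 0) :- w) :* (con (+ 0) :- w) := w :* w) refl w))))) (ℤₚ.+-identityˡ (squares + squares)))))
      where
      nonzero : ∀ M → M ≢ 0 → + 0 ≢ + (M ℕ.* 3)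
      nonzero zero h _ = h refl
      nonzero (suc M) h ()
    second : Σ₂ (λ a b → ΣZ N (λ k → c k * ψ a b * E (k * k + + 2 * a * b) (+ N))) ≡ + 2 * W₂.S
    second = trans (Σ₂-cong {λ a b → ΣZ N (λ k → c k * ψ a b * E (k * k + + 2 * a * b) (+ N))} {λ a b → + 2 * ΣZ N (λ k → W₂.t k a b)} inner)
      (trans (Σ⁺-cong N {λ a → Σ⁺ N (λ b → + 2 * ΣZ N (λ k → W₂.t k a b))} {λ a → + 2 * Σ⁺ N (λ b → ΣZ N (λ k → W₂.t k a b))} (λ a → Σ⁺-* N (+ 2) (λ b → ΣZ N (λ k → W₂.t k a b))))
        (Σ⁺-* N (+ 2) (λ a → Σ⁺ N (λ b → ΣZ N (λ k → W₂.t k a b)))))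
      where
      inner : ∀ a b → ΣZ N (λ k → c k * ψ a b * E (k * k + + 2 * a * b) (+ N)) ≡ + 2 * ΣZ N (λ k → W₂.t k a b)
      inner a b = trans (ΣZ-cong N (λ k → trans (E-cong {k * k + + 2 * a * b} {+ N} {c k * ψ a b} {ψ a b * P₂ k a b + ψ a b * P₂ (- k) a b} (λ e →
              trans (cong (λ n → (+ 3 * (k * k) - n) * ψ a b) (sym e))
                (solve 4 (λ k a b p → (con (+ 3) :* (k :* k) :- (k :* k :+ con (+ 2) :* a :* b)) :* p := p :* ((k :- b) :* (k :+ a)) :+ p :* (((:- k) :- b) :* ((:- k) :+ a))) refl k a b (ψ a b))))
            (trans (ℤₚ.*-distribʳ-+ (E (k * k + + 2 * a * b) (+ N)) (ψ a b * P₂ k a b) (ψ a b * P₂ (- k) a b))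
              (cong (λ z → W₂.t k a b + ψ a b * P₂ (- k) a b * E (z + + 2 * a * b) (+ N)) (solve 1 (λ k → k :* k := (:- k) :* (:- k)) refl k)))))
        (trans (ΣZ-+ N (λ k → W₂.t k a b) (λ k → W₂.t (- k) a b)) (trans (cong (λ z → ΣZ N (λ k → W₂.t k a b) + z) (ΣZ-neg N (λ k → W₂.t k a b)))
          (solve 1 (λ x → x :+ x := con (+ 2) :* x) refl (ΣZ N (λ k → W₂.t k a b)))))

-- The hexagonal form and sums of three squares.

hexForm : ℤ → ℤ → ℤ → ℤ
hexForm k y z = (k - y - z - y) * (k - y - z - y) + (y - z) * (y - z) + (z - (k - y - z)) * (z - (k - y - z))

hex : ℕ → ℤ → ℤ → ℤ
hex R k m = ΣZ R (λ y → ΣZ R (λ z → E (hexForm k y z) m))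

-- N - k² with 3 | N is never in the class 1. The radius is |x| + 1 because for k = 1 the variables
-- are bounded by x + k².
hexClass : F3 → ℤ → ℤ
hexClass 0F x = hex (suc ∣ x ∣) (+ 0) x
hexClass 1F x = + 0
hexClass 2F x = hex (suc ∣ x ∣) (+ 1) x

-- for x ≡ 0 (resp. 2) modulo 3, the number of y, z with hexForm k y z ≡ x, for any k ≡ 0 (resp. ±1)
hexagonal : ℤ → ℤ
hexagonal x = hexClass (r3 x) x

private
  -- With x = k - y - z the form is (x - y)² + (y - z)² + (z - x)², and 3(x² + y² + z²) = (x + y +
  -- z)² plus this.
  3q : ∀ k y z → hexForm k y z + k * k ≡ + 3 * ((k - y - z) * (k - y - z) + y * y + z * z)
  3q = solve 3 (λ k y z → ((k :- y :- z :- y) :* (k :- y :- z :- y) :+ (y :- z) :* (y :- z) :+ (z :- (k :- y :- z)) :* (z :- (k :- y :- z))) :+ k :* k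
    := con (+ 3) :* ((k :- y :- z) :* (k :- y :- z) :+ y :* y :+ z :* z)) refl

  square : ℤ → ℕ
  square k = ∣ k ∣ ℕ.* ∣ k ∣

  sum₃ : ∀ a b c → a * a + b * b + c * c ≡ + (square a ℕ.+ square b ℕ.+ square c)
  sum₃ a b c = cong₂ _+_ (cong₂ _+_ (sq a) (sq b)) (sq c)

  hexForm≢neg : ∀ k y z n → hexForm k y z ≢ -[1+ n ]
  hexForm≢neg k y z n e with trans (sym (sum₃ (k - y - z - y) (y - z) (z - (k - y - z)))) e
  ... | ()

  y-bound : ∀ k y z {B m} → m + k * k ≡ + B → B ℕ.< ∣ y ∣ → hexForm k y z ≢ m
  y-bound k y z {B} {m} b B<y e = sq≢ y n B<y (trans (cong (λ w → y * y + w) n≡)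
      (trans (solve 2 (λ y w → y :* y :+ (con (+ 3) :* w :- y :* y) := con (+ 3) :* w) refl y (x * x + y * y + z * z)) (trans (sym (3q k y z)) (trans (cong (_+ k * k) e) b))))
    where
    x = k - y - z
    p = square x ℕ.+ square y ℕ.+ square z
    n = p ℕ.+ p ℕ.+ (square x ℕ.+ square z)
    n≡ : + n ≡ + 3 * (x * x + y * y + z * z) - y * y
    n≡ = trans (cong₂ (λ u v → u + u + v) (sym (sum₃ x y z)) (sym (cong₂ _+_ (sq x) (sq z))))
      (solve 3 (λ x y z → (x :+ y :+ z) :+ (x :+ y :+ z) :+ (x :+ z) := con (+ 3) :* (x :+ y :+ z) :- y) refl (x * x) (y * y) (z * z))

  hexForm-swap : ∀ k y z → hexForm k y z ≡ hexForm k z y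
  hexForm-swap = solve 3 (λ k y z → ((k :- y :- z :- y) :* (k :- y :- z :- y) :+ (y :- z) :* (y :- z) :+ (z :- (k :- y :- z)) :* (z :- (k :- y :- z)))
    := ((k :- z :- y :- z) :* (k :- z :- y :- z) :+ (z :- y) :* (z :- y) :+ (y :- (k :- z :- y)) :* (y :- (k :- z :- y)))) refl

  z-bound : ∀ k y z {B m} → m + k * k ≡ + B → B ℕ.< ∣ z ∣ → hexForm k y z ≢ m
  z-bound k y z b B<z e = y-bound k z y b B<z (trans (sym (hexForm-swap k y z)) e)

hex-neg : ∀ R k n → hex R k -[1+ n ] ≡ + 0
hex-neg R k n = ΣZ-zero R (λ y → ΣZ-zero R (λ z → E-zero {hexForm k y z} (hexForm≢neg k y z n)))

hexagonal-neg : ∀ n → hexagonal -[1+ n ] ≡ + 0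
hexagonal-neg n with r3 -[1+ n ]
... | 0F = hex-neg (suc (suc n)) (+ 0) n
... | 1F = refl
... | 2F = hex-neg (suc (suc n)) (+ 1) n

hex-radius : ∀ {R B k m} → m + k * k ≡ + B → B ℕ.≤ R → hex R k m ≡ hex B k m
hex-radius {R} {B} {k} {m} b B≤R = trans (ΣZ-cong R (λ y → ΣZ-radius (λ z → E (hexForm k y z) m) (λ z p → E-zero {hexForm k y z} {m} (z-bound k y z b p)) B≤R))
  (ΣZ-radius (λ y → ΣZ B (λ z → E (hexForm k y z) m)) (λ y p → ΣZ-zero B (λ z → E-zero {hexForm k y z} {m} (y-bound k y z b p))) B≤R)

hex-reflect : ∀ R k m → hex R (- k) m ≡ hex R k m
hex-reflect R k m = trans (sym (ΣZ-neg R (λ y → ΣZ R (λ z → E (hexForm (- k) y z) m))))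
  (ΣZ-cong R (λ y → trans (sym (ΣZ-neg R (λ z → E (hexForm (- k) (- y) z) m))) (ΣZ-cong R (λ z → cong (λ w → E w m) (reflect k y z)))))
  where
  reflect : ∀ k y z → hexForm (- k) (- y) (- z) ≡ hexForm k y z
  reflect = solve 3 (λ k y z → (((:- k) :- (:- y) :- (:- z) :- (:- y)) :* ((:- k) :- (:- y) :- (:- z) :- (:- y)) :+ ((:- y) :- (:- z)) :* ((:- y) :- (:- z)) :+ ((:- z) :- ((:- k) :- (:- y) :- (:- z))) :* ((:- z) :- ((:- k) :- (:- y) :- (:- z))))
    := ((k :- y :- z :- y) :* (k :- y :- z :- y) :+ (y :- z) :* (y :- z) :+ (z :- (k :- y :- z)) :* (z :- (k :- y :- z)))) refl

-- Translating x, y and z by t preserves all differences and changes k by 3t.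
hex-translate : ∀ {B m} k r t n → m + k * k ≡ + B → k ≡ + 3 * t + r → ∣ t ∣ ℕ.≤ n → hex B k m ≡ hex (B ℕ.+ n) r m
hex-translate {B} {m} k r t n b k≡ t≤n = begin
  hex B k m
    ≡⟨ ΣZ-cong B (λ y → ΣZ-translate B n t (λ z → E (hexForm k y z) m) (λ z p → E-zero {hexForm k y z} {m} (z-bound k y z b p)) t≤n) ⟩
  ΣZ B (λ y → ΣZ (B ℕ.+ n) (λ z → E (hexForm k y (t + z)) m))
    ≡⟨ ΣZ-translate B n t (λ y → ΣZ (B ℕ.+ n) (λ z → E (hexForm k y (t + z)) m)) (λ y p → ΣZ-zero (B ℕ.+ n) (λ z → E-zero {hexForm k y (t + z)} {m} (y-bound k y (t + z) b p))) t≤n ⟩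
  ΣZ (B ℕ.+ n) (λ y → ΣZ (B ℕ.+ n) (λ z → E (hexForm k (t + y) (t + z)) m))
    ≡⟨ ΣZ-cong (B ℕ.+ n) (λ y → ΣZ-cong (B ℕ.+ n) (λ z → cong (λ w → E w m) (trans (cong (λ k → hexForm k (t + y) (t + z)) k≡) (shift t r y z)))) ⟩
  hex (B ℕ.+ n) r m ∎
  where
  open ≡.≡-Reasoning
  shift : ∀ t r y z → hexForm (+ 3 * t + r) (t + y) (t + z) ≡ hexForm r y z
  shift = solve 4 (λ t k y z → (((con (+ 3) :* t :+ k) :- (t :+ y) :- (t :+ z) :- (t :+ y)) :* ((con (+ 3) :* t :+ k) :- (t :+ y) :- (t :+ z) :- (t :+ y)) :+ ((t :+ y) :- (t :+ z)) :* ((t :+ y) :- (t :+ z)) :+ ((t :+ z) :- ((con (+ 3) :* t :+ k) :- (t :+ y) :- (t :+ z))) :* ((t :+ z) :- ((con (+ 3) :* t :+ k) :- (t :+ y) :- (t :+ z))))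
    := ((k :- y :- z :- y) :* (k :- y :- z :- y) :+ (y :- z) :* (y :- z) :+ (z :- (k :- y :- z)) :* (z :- (k :- y :- z)))) refl

balanced : F3 → ℤ
balanced 0F = + 0
balanced 1F = + 1
balanced 2F = -[1+ 0 ]

mod3 : ∀ k → ∃ λ t → k ≡ + 3 * t + balanced (r3 k)
mod3 (+ n) = nat n
  where
  nat : ∀ n → ∃ λ t → + n ≡ + 3 * t + balanced (m3 n)
  nat zero = + 0 , refl
  nat (suc n) with nat n
  ... | t , e with m3 n
  ... | 0F = t , trans (cong (λ z → + 1 + z) e) (solve 1 (λ t → con (+ 1) :+ (con (+ 3) :* t :+ con (+ 0)) := con (+ 3) :* t :+ con (+ 1)) refl t)
  ... | 1F = t + + 1 , trans (cong (λ z → + 1 + z) e) (solve 1 (λ t → con (+ 1) :+ (con (+ 3) :* t :+ con (+ 1)) := con (+ 3) :* (t :+ con (+ 1)) :+ con -[1+ 0 ]) refl t)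
  ... | 2F = t , trans (cong (λ z → + 1 + z) e) (solve 1 (λ t → con (+ 1) :+ (con (+ 3) :* t :+ con -[1+ 0 ]) := con (+ 3) :* t :+ con (+ 0)) refl t)
mod3 -[1+ n ] with mod3 (+ suc n)
... | t , e = - t , trans (cong -_ e) (trans (solve 2 (λ t b → :- (con (+ 3) :* t :+ b) := con (+ 3) :* (:- t) :+ (:- b)) refl t (balanced (m3 (suc n))))
    (cong (λ z → + 3 * (- t) + z) (neg (m3 (suc n)))))
  where
  neg : ∀ a → - balanced a ≡ balanced (-₃ a)
  neg 0F = refl
  neg 1F = refl
  neg 2F = refl

-- N - k² ≡ -k² determines k modulo 3 up to sign. Translation leaves only k = 0, 1, -1, and
-- reflection identifies the last two.
hex-hexagonal : ∀ N k → r3 (+ N) ≡ 0F → hex N k (+ N - k * k) ≡ hexagonal (+ N - k * k)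
hex-hexagonal N k N≡0 with + N - k * k in e
... | -[1+ n ] = trans (hex-neg N k n) (sym (hexagonal-neg n))
... | + m = trans (hex-translate k (balanced (r3 k)) (proj₁ (mod3 k)) (∣ proj₁ (mod3 k) ∣ ℕ.+ suc m) b (proj₂ (mod3 k)) (ℕₚ.m≤m+n _ _))
    (trans (class (r3 k)) (sym (cong (λ c → hexClass c (+ m)) residue)))
  where
  b : + m + k * k ≡ + N
  b = trans (cong (_+ k * k) (sym e)) (solve 2 (λ n k → (n :- k) :+ k := n) refl (+ N) (k * k))
  residue : r3 (+ m) ≡ -₃ (r3 k *₃ r3 k)
  residue = trans (cong r3 (sym e)) (trans (r3-minus (+ N) (k * k)) (cong₂ (λ u v → u +₃ (-₃ v)) N≡0 (r3-* k k)))
  R = N ℕ.+ (∣ proj₁ (mod3 k) ∣ ℕ.+ suc m)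
  m≤R : suc m ℕ.≤ R
  m≤R = ℕₚ.≤-trans (ℕₚ.m≤n+m (suc m) ∣ proj₁ (mod3 k) ∣) (ℕₚ.m≤n+m _ N)
  class : ∀ a → hex R (balanced a) (+ m) ≡ hexClass (-₃ (a *₃ a)) (+ m)
  class 0F = trans (hex-radius {R} {m} {+ 0} {+ m} (ℤₚ.+-identityʳ (+ m)) (ℕₚ.<⇒≤ m≤R)) (sym (hex-radius {suc m} {m} {+ 0} {+ m} (ℤₚ.+-identityʳ (+ m)) (ℕₚ.n≤1+n m)))
  class 1F = hex-radius {R} {suc m} {+ 1} {+ m} (ℤₚ.+-comm (+ m) (+ 1)) m≤R
  class 2F = trans (hex-reflect R (+ 1) (+ m)) (class 1F)

module ThreeSquares (M : ℕ) where
  private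
    N = M ℕ.* 3
    +N : + N ≡ + 3 * + M
    +N = trans (ℤₚ.pos-* M 3) (ℤₚ.*-comm (+ M) (+ 3))
    M≤N : M ℕ.≤ N
    M≤N = ℕₚ.m≤m*n M 3

  Σ₃ : (ℤ → ℤ → ℤ → ℤ) → ℤ
  Σ₃ c = ΣZ N (λ y → ΣZ N (λ z → ΣZ N (λ x → c x y z * E (x * x + y * y + z * z) (+ M))))

  -- Substituting x = k - y - z turns x² + y² + z² = M into hexForm k y z = 3M - k².
  byTrace : ∀ c (c′ : ℤ → ℤ) → (∀ x y z → x * x + y * y + z * z ≡ + M → c x y z ≡ c′ (x + y + z)) →
    Σ₃ c ≡ ΣZ N (λ k → c′ k * hex N k (+ N - k * k))
  byTrace c c′ h = begin
    Σ₃ c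
      ≡⟨ ΣZ-cong N (λ y → ΣZ-cong N (λ z → trans (ΣZ-cong N (λ x → E-cong (h x y z))) (inner y z))) ⟩
    ΣZ N (λ y → ΣZ N (λ z → ΣZ N (λ k → F k y z)))
      ≡⟨ ΣZ-cong N (λ y → ΣZ-swap N N (λ z k → F k y z)) ⟩
    ΣZ N (λ y → ΣZ N (λ k → ΣZ N (λ z → F k y z)))
      ≡⟨ ΣZ-swap N N (λ y k → ΣZ N (λ z → F k y z)) ⟩
    ΣZ N (λ k → ΣZ N (λ y → ΣZ N (λ z → F k y z)))
      ≡⟨ ΣZ-cong N (λ k → trans (ΣZ-cong N (λ y → ΣZ-* N (c′ k) (λ z → E (hexForm k y z) (+ N - k * k)))) (ΣZ-* N (c′ k) (λ y → ΣZ N (λ z → E (hexForm k y z) (+ N - k * k))))) ⟩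
    ΣZ N (λ k → c′ k * hex N k (+ N - k * k)) ∎
    where
    open ≡.≡-Reasoning
    F : ℤ → ℤ → ℤ → ℤ
    F k y z = c′ k * E (hexForm k y z) (+ N - k * k)
    G : ℤ → ℤ → ℤ → ℤ
    G y z x = c′ (x + y + z) * E (x * x + y * y + z * z) (+ M)
    G-F : ∀ y z k → G y z (- (y + z) + k) ≡ F k y z
    G-F y z k = cong₂ (λ u v → c′ u * v) (solve 3 (λ y z k → (:- (y :+ z)) :+ k :+ y :+ z := k) refl y z k)
      (trans (cong (λ x → E (x * x + y * y + z * z) (+ M)) (solve 3 (λ y z k → (:- (y :+ z)) :+ k := k :- y :- z) refl y z k))
        (E-iff (λ e → trans (solve 2 (λ h k → h := (h :+ k) :- k) refl (hexForm k y z) (k * k)) (cong (_- k * k) (trans (3q k y z) (trans (cong (+ 3 *_) e) (sym +N)))))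
               (λ e → ℤₚ.*-cancelˡ-≡ (+ 3) _ _ (trans (sym (3q k y z)) (trans (cong (_+ k * k) e) (trans (solve 2 (λ n k → (n :- k) :+ k := n) refl (+ N) (k * k)) +N))))))
    supportˣ : ∀ y z → Supported N (G y z)
    supportˣ y z x p = trans (cong (c′ (x + y + z) *_) (E-zero {x * x + y * y + z * z} (λ e → sq≢ x (square y ℕ.+ square z) (ℕₚ.≤-<-trans M≤N p)
      (trans (cong (λ w → x * x + w) (sym (cong₂ _+_ (sq y) (sq z)))) (trans (sym (ℤₚ.+-assoc (x * x) (y * y) (z * z))) e))))) (ℤₚ.*-zeroʳ (c′ (x + y + z)))
    supportᵏ : ∀ y z → Supported N (λ k → F k y z)
    supportᵏ y z k p = trans (cong (c′ k *_) (E-zero {hexForm k y z} (λ e → sq≢ k (square (k - y - z - y) ℕ.+ square (y - z) ℕ.+ square (z - (k - y - z))) p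
      (trans (cong (λ w → k * k + w) (sym (sum₃ (k - y - z - y) (y - z) (z - (k - y - z))))) (trans (cong (λ w → k * k + w) e) (solve 2 (λ n k → k :+ (n :- k) := n) refl (+ N) (k * k))))))) (ℤₚ.*-zeroʳ (c′ k))
    inner : ∀ y z → ΣZ N (G y z) ≡ ΣZ N (λ k → F k y z)
    inner y z = trans (ΣZ-translate N n (- (y + z)) (G y z) (supportˣ y z) ℕₚ.≤-refl)
      (trans (ΣZ-cong (N ℕ.+ n) (G-F y z)) (ΣZ-radius (λ k → F k y z) (supportᵏ y z) (ℕₚ.m≤m+n N n)))
      where n = ∣ - (y + z) ∣

  ΣZ-odd : ∀ R f → (∀ x → f x ≡ - f (- x)) → ΣZ R f ≡ + 0
  ΣZ-odd R f h = x+x≡0 _ (trans (ΣZ-cong R (λ x → trans (h x) (sym (ℤₚ.-1*i≡-i (f (- x)))))) (trans (ΣZ-* R -[1+ 0 ] (λ x → f (- x))) (trans (ℤₚ.-1*i≡-i _) (cong -_ (ΣZ-neg R f)))))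

  -- each of the monomials xy, yz, zx is odd in one of the variables
  mixed-zero : Σ₃ (λ x y z → + 6 * (x * y + y * z + z * x)) ≡ + 0
  mixed-zero = begin
    Σ₃ (λ x y z → + 6 * (x * y + y * z + z * x))
      ≡⟨ ΣZ-cong N (λ y → ΣZ-cong N {λ z → ΣZ N (λ x → + 6 * (x * y + y * z + z * x) * e x y z)} {λ z → ΣZ N (λ x → + 6 * (y * z) * e x y z)} (λ z → trans (ΣZ-cong N (split y z)) (trans (ΣZ-+ N (λ x → x * (+ 6 * (y + z)) * e x y z) (λ x → + 6 * (y * z) * e x y z))
           (trans (cong (_+ ΣZ N (λ x → + 6 * (y * z) * e x y z)) (ΣZ-odd N (λ x → x * (+ 6 * (y + z)) * e x y z) (x-odd y z))) (ℤₚ.+-identityˡ (ΣZ N (λ x → + 6 * (y * z) * e x y z))))))) ⟩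
    ΣZ N (λ y → ΣZ N (λ z → ΣZ N (λ x → + 6 * (y * z) * e x y z)))
      ≡⟨ ΣZ-zero N (λ y → ΣZ-odd N (λ z → ΣZ N (λ x → + 6 * (y * z) * e x y z)) (λ z → trans (ΣZ-cong N (z-odd y z)) (trans (ΣZ-* N -[1+ 0 ] (λ x → + 6 * (y * - z) * e x y (- z))) (ℤₚ.-1*i≡-i _)))) ⟩
    + 0 ∎
    where
    open ≡.≡-Reasoning
    e : ℤ → ℤ → ℤ → ℤ
    e x y z = E (x * x + y * y + z * z) (+ M)
    neg² : ∀ x → x * x ≡ - x * - x
    neg² = solve 1 (λ x → x :* x := (:- x) :* (:- x)) refl
    split : ∀ y z x → + 6 * (x * y + y * z + z * x) * e x y z ≡ x * (+ 6 * (y + z)) * e x y z + + 6 * (y * z) * e x y z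
    split y z x = solve 4 (λ x y z e → con (+ 6) :* (x :* y :+ y :* z :+ z :* x) :* e := x :* (con (+ 6) :* (y :+ z)) :* e :+ con (+ 6) :* (y :* z) :* e) refl x y z (e x y z)
    x-odd : ∀ y z x → x * (+ 6 * (y + z)) * e x y z ≡ - (- x * (+ 6 * (y + z)) * e (- x) y z)
    x-odd y z x = trans (cong (λ w → x * (+ 6 * (y + z)) * E (w + y * y + z * z) (+ M)) (neg² x))
      (solve 3 (λ x c e → x :* c :* e := :- ((:- x) :* c :* e)) refl x (+ 6 * (y + z)) (e (- x) y z))
    z-odd : ∀ y z x → + 6 * (y * z) * e x y z ≡ -[1+ 0 ] * (+ 6 * (y * - z) * e x y (- z))
    z-odd y z x = trans (cong (λ w → + 6 * (y * z) * E (x * x + y * y + w) (+ M)) (neg² z))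
      (solve 3 (λ y z e → con (+ 6) :* (y :* z) :* e := con -[1+ 0 ] :* (con (+ 6) :* (y :* (:- z)) :* e)) refl y z (e x y (- z)))

  hexagonal-count : r3 (+ N) ≡ 0F → Σ₃ (λ _ _ _ → + 1) ≡ ΣZ N (λ k → hexagonal (+ N - k * k))
  hexagonal-count N≡0 = trans (byTrace (λ _ _ _ → + 1) (λ _ → + 1) (λ _ _ _ _ → refl))
    (ΣZ-cong N (λ k → trans (ℤₚ.*-identityˡ (hex N k (+ N - k * k))) (hex-hexagonal N k N≡0)))

  -- 6(xy + yz + zx) = 3k² - 3M for k = x + y + z, so the recursion says that the mixed products sum
  -- to zero.
  hexagonal-recursion : r3 (+ N) ≡ 0F → ΣZ N (λ k → (+ 3 * (k * k) - + N) * hexagonal (+ N - k * k)) ≡ + 0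
  hexagonal-recursion N≡0 = trans (ΣZ-cong N (λ k → cong ((+ 3 * (k * k) - + N) *_) (sym (hex-hexagonal N k N≡0))))
    (trans (sym (byTrace (λ x y z → + 6 * (x * y + y * z + z * x)) (λ k → + 3 * (k * k) - + N) (λ x y z e → trans
      (solve 3 (λ x y z → con (+ 6) :* (x :* y :+ y :* z :+ z :* x) := con (+ 3) :* ((x :+ y :+ z) :* (x :+ y :+ z)) :- con (+ 3) :* (x :* x :+ y :* y :+ z :* z)) refl x y z)
      (cong (λ w → + 3 * ((x + y + z) * (x + y + z)) - w) (trans (cong (+ 3 *_) e) (sym +N)))))) mixed-zero)

minus-cases : ∀ N p → (∃ λ q → q ℕ.+ p ≡ N × + N - + p ≡ + q) ⊎ (∃ λ q → + N - + p ≡ -[1+ q ])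
minus-cases N p with ℕₚ.≤-total p N
... | inj₁ p≤N = inj₁ (N ∸ p , ℕₚ.m∸n+n≡m p≤N , trans (ℤₚ.m-n≡m⊖n N p) (ℤₚ.⊖-≥ p≤N))
... | inj₂ N≤p with + N - + p in e
... | -[1+ q ] = inj₂ (q , refl)
... | + q = inj₁ (q , ℤₚ.+-injective (trans (cong (_+ + p) (sym e)) (solve 2 (λ n p → (n :- p) :+ p := n) refl (+ N) (+ p))) , refl)

halve : ∀ m → (∃ λ n → m ≡ n ℕ.+ n) ⊎ (∃ λ n → m ≡ suc (n ℕ.+ n))
halve zero = inj₁ (0 , refl)
halve (suc m) with halve m
... | inj₁ (n , refl) = inj₂ (n , refl)
... | inj₂ (n , refl) = inj₁ (suc n , cong suc (sym (ℕₚ.+-suc n n)))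

2w≢odd : ∀ w n → + 2 * w ≢ + suc (n ℕ.+ n)
2w≢odd w n e = absurd ∣ w - + n ∣ (trans (sym (ℤₚ.abs-* (+ 2) (w - + n))) (cong ∣_∣ (trans (solve 2 (λ w n → con (+ 2) :* (w :- n) := con (+ 2) :* w :- (n :+ n)) refl w (+ n))
    (trans (cong (_- (+ n + + n)) e) (solve 1 (λ n → con (+ 1) :+ (n :+ n) :- (n :+ n) := con (+ 1)) refl (+ n))))))
  where
  absurd : ∀ x → 2 ℕ.* x ≢ 1
  absurd zero ()
  absurd (suc x) e with trans (sym (ℕₚ.+-suc x (x ℕ.+ 0))) (ℕₚ.suc-injective e)
  ... | ()

third : ∀ m → m3 m ≡ 0F → ∃ λ t → m ≡ t ℕ.* 3
third m e = 3∣-root m (cong₂ _*₃_ e e)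

private
  N-k² : ∀ N k {p} → k * k ≡ + p → (∃ λ q → q ℕ.+ p ≡ N × + N - k * k ≡ + q) ⊎ (∃ λ q → + N - k * k ≡ -[1+ q ])
  N-k² N k {p} e with minus-cases N p
  ... | inj₁ (q , a , b) = inj₁ (q , a , trans (cong (λ z → + N - z) e) b)
  ... | inj₂ (q , b) = inj₂ (q , trans (cong (λ z → + N - z) e) b)

  residue≢1 : ∀ N k → r3 (+ N) ≡ 0F → r3 (+ N - k * k) ≢ 1F
  residue≢1 N k N≡0 = table (r3 k) ∘′ trans (sym (trans (r3-minus (+ N) (k * k)) (cong₂ (λ u v → u +₃ (-₃ v)) N≡0 (r3-* k k))))
    where
    table : ∀ a → 0F +₃ (-₃ (a *₃ a)) ≢ 1F
    table 0F ()
    table 1F ()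
    table 2F ()

  cancel : ∀ c x → c ≢ + 0 → c * x ≡ + 0 → x ≡ + 0
  cancel c x h e with ℤₚ.i*j≡0⇒i≡0∨j≡0 c e
  ... | inj₁ p = ⊥-elim (h p)
  ... | inj₂ p = p

-- The recursion determines g at m ≡ 0 (mod 3) from N = m and k = 0, and at m ≡ 2 (mod 3) from N = m + 1 and k = ±1.
recursion-unique : (g : ℤ → ℤ) → (∀ n → g -[1+ n ] ≡ + 0) → (∀ n → g (+ suc (n ℕ.+ n)) ≡ + 0) → g (+ 0) ≡ + 0 → g (+ 2) ≡ + 0 →
  (∀ M → M ≢ 0 → ΣZ (M ℕ.* 3) (λ k → (+ 3 * (k * k) - + (M ℕ.* 3)) * g (+ (M ℕ.* 3) - k * k)) ≡ + 0) →
  ∀ m → m3 m ≢ 1F → g (+ m) ≡ + 0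
recursion-unique g g-neg g-odd g0 g2 rec = <-rec (λ m → m3 m ≢ 1F → g (+ m) ≡ + 0) step
  where
  step : ∀ m → (∀ {m′} → m′ ℕ.< m → m3 m′ ≢ 1F → g (+ m′) ≡ + 0) → m3 m ≢ 1F → g (+ m) ≡ + 0
  step m ih m≢1 with halve m
  ... | inj₂ (n , refl) = g-odd n
  ... | inj₁ (n , m≡2n) with m3 m in mod
  ... | 1F = ⊥-elim (m≢1 refl)
  ... | 0F with third m mod
  ...   | zero , refl = g0
  ...   | suc t , refl = cancel (- + N) (g (+ N)) (λ ()) (begin
      - + N * g (+ N)
        ≡⟨ cong₂ (λ x y → x * g y) (sym (ℤₚ.+-identityˡ (- + N))) (sym (ℤₚ.+-identityʳ (+ N))) ⟩
      f (+ 0)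
        ≡⟨ trans (cong (λ z → f (+ 0) + z) (cong₂ _+_ (Z.∑-zero< N (λ i _ → small (+ suc i) i refl)) (Z.∑-zero< N (λ i _ → small -[1+ i ] i refl)))) (ℤₚ.+-identityʳ (f (+ 0))) ⟨
      ΣZ N f
        ≡⟨ rec (suc t) (λ ()) ⟩
      + 0 ∎)
    where
    open ≡.≡-Reasoning
    N = suc t ℕ.* 3
    f : ℤ → ℤ
    f k = (+ 3 * (k * k) - + N) * g (+ N - k * k)
    small : ∀ k i → k * k ≡ + (suc i ℕ.* suc i) → f k ≡ + 0
    small k i e with N-k² N k e
    ... | inj₂ (q , b) = trans (cong (λ z → (+ 3 * (k * k) - + N) * z) (trans (cong g b) (g-neg q))) (ℤₚ.*-zeroʳ (+ 3 * (k * k) - + N))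
    ... | inj₁ (q , a , b) = trans (cong (λ z → (+ 3 * (k * k) - + N) * z) (trans (cong g b) (ih (≡.subst (q ℕ.<_) a (ℕₚ.m<m+n q (s≤s z≤n)))
      (λ r → residue≢1 N k mod (trans (cong r3 b) r))))) (ℤₚ.*-zeroʳ (+ 3 * (k * k) - + N))
  step m ih m≢1 | inj₁ (n , m≡2n) | 2F with third (suc m) (cong s3 mod)
  ...   | suc zero , refl = g2
  ...   | suc (suc t) , e = cancel (+ 2 * (+ 3 - + N)) (g (+ m)) nonzero (begin
      + 2 * (+ 3 - + N) * g (+ m)
        ≡⟨ solve 2 (λ a x → con (+ 2) :* a :* x := con (+ 0) :+ (a :* x :+ a :* x)) refl (+ 3 - + N) (g (+ m)) ⟩
      + 0 + ((+ 3 - + N) * g (+ m) + (+ 3 - + N) * g (+ m))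
        ≡⟨ cong₂ (λ x y → x + (y + y)) (sym f0) (sym f1) ⟩
      f (+ 0) + (f (+ 1) + f -[1+ 0 ])
        ≡⟨ cong (λ z → f (+ 0) + z) (cong₂ _+_ (sym (head (λ i → f (+ suc i)) (λ i → small (+ suc (suc i)) i refl))) (sym (head (λ i → f -[1+ i ]) (λ i → small -[1+ suc i ] i refl)))) ⟩
      ΣZ N f
        ≡⟨ rec (suc (suc t)) (λ ()) ⟩
      + 0 ∎)
    where
    open ≡.≡-Reasoning
    N′ = suc (suc (suc t ℕ.* 3))
    N = suc N′
    m≡N′ : m ≡ N′
    m≡N′ = ℕₚ.suc-injective e
    N≡0 : r3 (+ N) ≡ 0F
    N≡0 = trans (cong m3 (sym e)) (cong s3 mod)
    -- The factor would vanish at N = 3, that is m = 2, which is why the value at 2 is a hypothesis.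
    nonzero : + 2 * (+ 3 - + N) ≢ + 0
    nonzero ()
    f : ℤ → ℤ
    f k = (+ 3 * (k * k) - + N) * g (+ N - k * k)
    -- The term k = 0 involves the larger argument m + 1, out of reach of the induction. Here m is
    -- even, so m + 1 is odd and g vanishes there.
    f0 : f (+ 0) ≡ + 0
    f0 = trans (cong (λ z → (+ 3 * + 0 - + N) * z) (trans (cong g (trans (ℤₚ.+-identityʳ (+ N)) (cong +_ (trans (sym e) (cong suc m≡2n))))) (g-odd n))) (ℤₚ.*-zeroʳ (+ 3 * + 0 - + N))
    f1 : f (+ 1) ≡ (+ 3 - + N) * g (+ m)
    f1 = cong (λ z → (+ 3 - + N) * g z) (cong +_ (sym m≡N′))
    small : ∀ k i → k * k ≡ + (suc (suc i) ℕ.* suc (suc i)) → f k ≡ + 0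
    small k i e′ with N-k² N k e′
    ... | inj₂ (q , b) = trans (cong (λ z → (+ 3 * (k * k) - + N) * z) (trans (cong g b) (g-neg q))) (ℤₚ.*-zeroʳ (+ 3 * (k * k) - + N))
    ... | inj₁ (q , a , b) = trans (cong (λ z → (+ 3 * (k * k) - + N) * z) (trans (cong g b) (ih q<m
      (λ r → residue≢1 N k N≡0 (trans (cong r3 b) r))))) (ℤₚ.*-zeroʳ (+ 3 * (k * k) - + N))
      where
      q<m : q ℕ.< m
      q<m = ℕₚ.≤-pred (≡.subst (suc (suc q) ℕ.≤_) (trans a (sym e)) (≡.subst (ℕ._≤ q ℕ.+ suc (suc i) ℕ.* suc (suc i)) (ℕₚ.+-comm q 2) (ℕₚ.+-monoʳ-≤ q (s≤s (s≤s z≤n)))))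
    head : ∀ (h : ℕ → ℤ) → (∀ i → h (suc i) ≡ + 0) → Z.∑ N h ≡ h 0
    head h z = trans (Z.∑-head N′ h) (trans (cong (λ w → h 0 + w) (Z.∑-zero< N′ (λ i _ → z i))) (ℤₚ.+-identityʳ (h 0)))

-- The three differences add up to zero, so the sum of their squares is even.
hex-odd : ∀ R k n → hex R k (+ suc (n ℕ.+ n)) ≡ + 0
hex-odd R k n = ΣZ-zero R (λ y → ΣZ-zero R (λ z → E-zero {hexForm k y z} (λ e → 2w≢odd (h k y z) n (trans (sym (double k y z)) e))))
  where
  h : ℤ → ℤ → ℤ → ℤ
  h k y z = (k - y - z) * (k - y - z) + y * y + z * z - (k - y - z) * y - y * z - z * (k - y - z)
  double : ∀ k y z → hexForm k y z ≡ + 2 * h k y z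
  double = solve 3 (λ k y z → ((k :- y :- z :- y) :* (k :- y :- z :- y) :+ (y :- z) :* (y :- z) :+ (z :- (k :- y :- z)) :* (z :- (k :- y :- z)))
    := con (+ 2) :* ((k :- y :- z) :* (k :- y :- z) :+ y :* y :+ z :* z :- (k :- y :- z) :* y :- y :* z :- z :* (k :- y :- z))) refl

hexagonal-odd : ∀ n → hexagonal (+ suc (n ℕ.+ n)) ≡ + 0
hexagonal-odd n with m3 (suc (n ℕ.+ n))
... | 0F = hex-odd (suc (suc (n ℕ.+ n))) (+ 0) n
... | 1F = refl
... | 2F = hex-odd (suc (suc (n ℕ.+ n))) (+ 1) n

ℓ-odd : ∀ n → ℓ (+ suc (n ℕ.+ n)) ≡ + 0
ℓ-odd n = trans (cong (λ z → + 0 + + 3 * z) (Z.∑-zero< x (λ i _ → Z.∑-zero< x (λ j _ →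
  trans (cong (ψ (+ suc i) (+ suc j) *_) (E-zero {+ 2 * + suc i * + suc j} (λ e → 2w≢odd (+ suc i * + suc j) n (trans (sym (ℤₚ.*-assoc (+ 2) (+ suc i) (+ suc j))) e)))) (ℤₚ.*-zeroʳ (ψ (+ suc i) (+ suc j))))))) refl
  where x = suc (n ℕ.+ n)

hexagonal≡ℓ : ∀ x → r3 x ≢ 1F → hexagonal x ≡ ℓ x
hexagonal≡ℓ -[1+ n ] _ = trans (hexagonal-neg n) (sym (lambert-neg 1 (+ 3) ψ n))
hexagonal≡ℓ (+ m) m≢1 = ℤₚ.i-j≡0⇒i≡j (hexagonal (+ m)) (ℓ (+ m)) (recursion-unique (λ x → hexagonal x - ℓ x)
  (λ n → cong₂ _-_ (hexagonal-neg n) (lambert-neg 1 (+ 3) ψ n)) (λ n → cong₂ _-_ (hexagonal-odd n) (ℓ-odd n)) refl refl rec m m≢1)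
  where
  rec : ∀ M → M ≢ 0 → ΣZ (M ℕ.* 3) (λ k → (+ 3 * (k * k) - + (M ℕ.* 3)) * (hexagonal (+ (M ℕ.* 3) - k * k) - ℓ (+ (M ℕ.* 3) - k * k))) ≡ + 0
  rec M M≢0 = trans (ΣZ-cong N (λ k → solve 3 (λ c x y → c :* (x :- y) := c :* x :+ con -[1+ 0 ] :* (c :* y)) refl (c k) (hexagonal (+ N - k * k)) (ℓ (+ N - k * k))))
    (trans (ΣZ-+ N (λ k → c k * hexagonal (+ N - k * k)) (λ k → -[1+ 0 ] * (c k * ℓ (+ N - k * k))))
      (cong₂ _+_ (hexagonal-recursion N≡0) (trans (ΣZ-* N -[1+ 0 ] (λ k → c k * ℓ (+ N - k * k))) (cong (-[1+ 0 ] *_) (ℓ-recursion M≢0)))))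
    where
    open DivisorSide M
    open ThreeSquares M
    c : ℤ → ℤ
    c k = + 3 * (k * k) - + N

-- Both sides are Σ_k of a function at 3M - k²: the hexagonal count on the left, the divisor sum on
-- the right.
threeSquares : ∀ M → ThreeSquares.Σ₃ M (λ _ _ _ → + 1) ≡ DivisorSide.squaresZ M + + 3 * DivisorSide.W₁.S M
threeSquares M = trans (hexagonal-count N≡0) (trans (ΣZ-cong N (λ k → hexagonal≡ℓ (+ N - k * k) (residue≢1 N k N≡0))) ℓ-sum)
  where
  open DivisorSide M
  open ThreeSquares M

-- Coefficients of products with theta series: θ³ and the twisted product with T.

ext : PS → ℤ → ℤ
ext h (+ m) = h m
ext h -[1+ _ ] = + 0

thetaSeries : (ℤ → ℤ) → PS
thetaSeries f n = ΣZ n (λ k → f k * E (k * k) (+ n))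

∑-pick : ∀ R p (a : ℕ → ℤ) → Z.∑ R (λ i → E (+ p) (+ i) * a i) ≡ lt p R * a p
∑-pick zero p a = refl
∑-pick (suc R) p a with ℕₚ.<-cmp p R
... | tri< p<R p≢R _ = trans (cong₂ _+_ (trans (∑-pick R p a) (cong (_* a p) (lt-yes p<R))) (cong (_* a R) (E-zero {+ p} {+ R} (λ e → p≢R (ℤₚ.+-injective e)))))
    (trans (ℤₚ.+-identityʳ (+ 1 * a p)) (cong (_* a p) (sym (lt-yes {p} {suc R} (ℕₚ.m<n⇒m<1+n p<R)))))
... | tri≈ _ refl _ = trans (cong₂ _+_ (trans (∑-pick R R a) (cong (_* a R) (lt-no {R} {R} ℕₚ.≤-refl))) (cong (_* a R) (E-refl (+ R))))
    (trans (ℤₚ.+-identityˡ (+ 1 * a R)) (cong (_* a R) (sym (lt-yes {R} {suc R} ℕₚ.≤-refl))))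
... | tri> _ p≢R R<p = trans (cong₂ _+_ (trans (∑-pick R p a) (cong (_* a p) (lt-no (ℕₚ.<⇒≤ R<p)))) (cong (_* a R) (E-zero {+ p} {+ R} (λ e → p≢R (ℤₚ.+-injective e)))))
    (cong (_* a p) (sym (lt-no {p} {suc R} R<p)))

ext-minus : ∀ h M p → lt p (suc M) * h (M ∸ p) ≡ ext h (+ M - + p)
ext-minus h M p with ℕₚ.≤-total p M
... | inj₁ p≤M = trans (cong (_* h (M ∸ p)) (lt-yes {p} {suc M} (s≤s p≤M))) (trans (ℤₚ.*-identityˡ (h (M ∸ p))) (cong (ext h) (sym (trans (ℤₚ.m-n≡m⊖n M p) (ℤₚ.⊖-≥ p≤M)))))
... | inj₂ M≤p with ℕₚ.m≤n⇒m<n∨m≡n M≤p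
...   | inj₂ refl = trans (cong (_* h (M ∸ M)) (lt-yes {M} {suc M} ℕₚ.≤-refl)) (trans (ℤₚ.*-identityˡ (h (M ∸ M))) (cong (ext h) (sym (trans (ℤₚ.m-n≡m⊖n M M) (ℤₚ.⊖-≥ (ℕₚ.≤-refl {M}))))))
...   | inj₁ M<p = trans (cong (_* h (M ∸ p)) (lt-no {p} {suc M} M<p)) (sym (trans (cong (ext h) (trans (ℤₚ.m-n≡m⊖n M p) (ℤₚ.⊖-< M<p))) (negative (ℕₚ.m<n⇒0<n∸m M<p))))
  where
  negative : ∀ {d} → 0 ℕ.< d → ext h (- + d) ≡ + 0
  negative {suc d} _ = refl

ext-square : ∀ h z k → z ℤ.< k * k → ext h (z - k * k) ≡ + 0
ext-square h z k p with z - k * k | ≡.subst (z - k * k ℤ.<_) (ℤₚ.+-inverseʳ (k * k)) (ℤₚ.+-monoˡ-< (- (k * k)) p)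
... | -[1+ _ ] | _ = refl
... | + _ | ℤ.+<+ ()

conv : ∀ f h M → (thetaSeries f ⊗ h) M ≡ ΣZ M (λ k → f k * ext h (+ M - k * k))
conv f h M = begin
  (thetaSeries f ⊗ h) M
    ≡⟨ ⊗-coeff (thetaSeries f) h M ⟩
  Z.∑ (suc M) (λ i → thetaSeries f i * h (M ∸ i))
    ≡⟨ Z.∑-cong< (suc M) (λ i i≤M → trans (cong (_* h (M ∸ i)) (sym (ΣZ-radius (λ k → f k * E (k * k) (+ i)) (supported i) (ℕₚ.≤-pred i≤M))))
         (trans (ℤₚ.*-comm (ΣZ M (λ k → f k * E (k * k) (+ i))) (h (M ∸ i))) (sym (ΣZ-* M (h (M ∸ i)) (λ k → f k * E (k * k) (+ i)))))) ⟩
  Z.∑ (suc M) (λ i → ΣZ M (λ k → t k i))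
    ≡⟨ sym (∑-ΣZ (suc M)) ⟩
  ΣZ M (λ k → Z.∑ (suc M) (t k))
    ≡⟨ ΣZ-cong M inner ⟩
  ΣZ M (λ k → f k * ext h (+ M - k * k)) ∎
  where
  open ≡.≡-Reasoning
  t : ℤ → ℕ → ℤ
  t k i = h (M ∸ i) * (f k * E (k * k) (+ i))
  supported : ∀ i → Supported i (λ k → f k * E (k * k) (+ i))
  supported i k p = trans (cong (f k *_) (E-zero (λ e → sq≢ k 0 p (trans (ℤₚ.+-identityʳ (k * k)) e)))) (ℤₚ.*-zeroʳ (f k))
  ∑-ΣZ : ∀ R → ΣZ M (λ k → Z.∑ R (t k)) ≡ Z.∑ R (λ i → ΣZ M (λ k → t k i))
  ∑-ΣZ zero = ΣZ-zero M {λ _ → + 0} (λ _ → refl)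
  ∑-ΣZ (suc R) = trans (ΣZ-+ M (λ k → Z.∑ R (t k)) (λ k → t k R)) (cong (_+ ΣZ M (λ k → t k R)) (∑-ΣZ R))
  inner : ∀ k → Z.∑ (suc M) (t k) ≡ f k * ext h (+ M - k * k)
  inner k = trans (Z.∑-cong (suc M) (λ i → trans (cong (λ z → h (M ∸ i) * (f k * E z (+ i))) (sq k)) (solve 3 (λ a b c → a :* (b :* c) := b :* (c :* a)) refl (h (M ∸ i)) (f k) (E (+ ((∣ k ∣) ℕ.* (∣ k ∣))) (+ i)))))
    (trans (Z.∑-*ˡ (suc M) (f k) (λ i → E (+ ((∣ k ∣) ℕ.* (∣ k ∣))) (+ i) * h (M ∸ i)))
    (cong (f k *_) (trans (∑-pick (suc M) ((∣ k ∣) ℕ.* (∣ k ∣)) (λ i → h (M ∸ i))) (trans (ext-minus h M ((∣ k ∣) ℕ.* (∣ k ∣))) (cong (λ z → ext h (+ M - z)) (sym (sq k)))))))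

conv-ext : ∀ R f h z → z ℤ.≤ + R → ext (thetaSeries f ⊗ h) z ≡ ΣZ R (λ k → f k * ext h (z - k * k))
conv-ext R f h (+ M) (ℤ.+≤+ M≤R) = trans (conv f h M) (sym (ΣZ-radius (λ k → f k * ext h (+ M - k * k)) (λ k p →
  trans (cong (f k *_) (ext-square h (+ M) k (ℤₚ.<-≤-trans (ℤ.+<+ p) (ℤₚ.≤-trans (ℤ.+≤+ (k≤k² (∣ k ∣))) (ℤₚ.≤-reflexive (sym (sq k))))))) (ℤₚ.*-zeroʳ (f k))) M≤R))
  where
  k≤k² : ∀ n → n ℕ.≤ n ℕ.* n
  k≤k² zero = z≤n
  k≤k² (suc n) = ℕₚ.m≤m+n (suc n) (n ℕ.* suc n)
conv-ext R f h -[1+ n ] _ = sym (ΣZ-zero R (λ k → trans (cong (f k *_) (ext-square h -[1+ n ] k (ℤₚ.<-≤-trans ℤ.-<+ (ℤₚ.≤-reflexive (sym (sq k)))))) (ℤₚ.*-zeroʳ (f k))))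

ext-one : ∀ z → ext onePS z ≡ E (+ 0) z
ext-one (+ zero) = refl
ext-one (+ suc n) = refl
ext-one -[1+ n ] = refl

ext-cong : ∀ {f g} z → (∀ n → f n ≡ g n) → ext f z ≡ ext g z
ext-cong (+ n) h = h n
ext-cong -[1+ n ] h = refl

theta-ext : ∀ R f z → z ℤ.≤ + R → ext (thetaSeries f) z ≡ ΣZ R (λ k → f k * E (k * k) z)
theta-ext R f z p = trans (ext-cong z (λ n → sym (trans (⊗-comm (thetaSeries f) onePS n) (⊗-identityˡ (thetaSeries f) n))))
  (trans (conv-ext R f onePS z p) (ΣZ-cong R (λ k → cong (f k *_) (trans (ext-one (z - k * k)) (trans (E-move (k * k) (+ 0) z) (cong (λ w → E w z) (ℤₚ.+-identityʳ (k * k))))))))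

minus-square≤ : ∀ z k {R} → z ℤ.≤ + R → z - k * k ℤ.≤ + R
minus-square≤ z k p = ℤₚ.≤-trans (≡.subst (λ w → z - w ℤ.≤ z) (sym (sq k)) (ℤₚ.i-j≤i z (+ ((∣ k ∣) ℕ.* (∣ k ∣))))) p

sg-+ : ∀ m n → sg (m ℕ.+ n) ≡ sg m * sg n
sg-+ zero n = sym (ℤₚ.*-identityˡ (sg n))
sg-+ (suc m) n = trans (cong -_ (sg-+ m n)) (ℤₚ.neg-distribˡ-* (sg m) (sg n))

sg-square : ∀ n → sg (n ℕ.* n) ≡ sg n
sg-square n = trans (sg-odd (n ℕ.* n)) (trans (cong signB (trans (odd-* n n) (idem (odd n)))) (sym (sg-odd n)))
  where
  idem : ∀ b → b ∧ b ≡ b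
  idem true = refl
  idem false = refl

sg² : ∀ n → sg n * sg n ≡ + 1
sg² zero = refl
sg² (suc n) = trans (solve 1 (λ x → (:- x) :* (:- x) := x :* x) refl (sg n)) (sg² n)

sgᶻ twisted : ℤ → ℤ
sgᶻ k = sg (∣ k ∣)
twisted k = ε k * sg (∣ k ∣)

θ θ̃ : PS
θ = thetaSeries sgᶻ
θ̃ = thetaSeries twisted

-- Expanding 1/(1 + xⁿ + x²ⁿ) = (1 - xⁿ)/(1 - x³ⁿ) writes T as 1 + 6 Σ (-1)ⁿ χ(v - n) x^(nv) over 0
-- < n < v.
rankWeight : ℤ → ℤ → ℤ
rankWeight n v = lt (∣ n ∣) (∣ v ∣) * sg (∣ n ∣) * χ (v - n)

T : PS
T m = lambert 1 (+ 6) rankWeight (+ m)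

ext-T : ∀ z → ext T z ≡ lambert 1 (+ 6) rankWeight z
ext-T (+ m) = refl
ext-T -[1+ m ] = sym (lambert-neg 0 (+ 6) rankWeight m)

module CubeIdentity (M : ℕ) where
  open PairSums M
  open DivisorSide M using (squaresZ; 3∣k)
  open Forms N N≡0

  -- (-1)^(x+y+z) depends only on x² + y² + z² = M, so the signs of θ³ factor out of the count of
  -- three squares.
  cube : (θ ⊗ (θ ⊗ θ)) M ≡ sg M * (squaresZ + + 3 * W₁.S)
  cube = begin
    (θ ⊗ (θ ⊗ θ)) M
      ≡⟨ conv-ext N sgᶻ (θ ⊗ θ) (+ M) (ℤ.+≤+ (ℕₚ.m≤m*n M 3)) ⟩
    ΣZ N (λ y → sgᶻ y * ext (θ ⊗ θ) (+ M - y * y))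
      ≡⟨ ΣZ-cong N (λ y → cong (sgᶻ y *_) (trans (conv-ext N sgᶻ θ (+ M - y * y) (bound y))
           (ΣZ-cong N (λ z → cong (sgᶻ z *_) (theta-ext N sgᶻ (+ M - y * y - z * z) (minus-square≤ (+ M - y * y) z (bound y))))))) ⟩
    ΣZ N (λ y → sgᶻ y * ΣZ N (λ z → sgᶻ z * ΣZ N (λ x → sgᶻ x * E (x * x) (+ M - y * y - z * z))))
      ≡⟨ ΣZ-cong N (λ y → trans (sym (ΣZ-* N (sgᶻ y) (λ z → sgᶻ z * ΣZ N (λ x → sgᶻ x * E (x * x) (+ M - y * y - z * z)))))
           (trans (ΣZ-cong N (λ z → trans (sym (ℤₚ.*-assoc (sgᶻ y) (sgᶻ z) (ΣZ N (λ x → sgᶻ x * E (x * x) (+ M - y * y - z * z)))))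
             (trans (sym (ΣZ-* N (sgᶻ y * sgᶻ z) (λ x → sgᶻ x * E (x * x) (+ M - y * y - z * z))))
             (trans (ΣZ-cong N (λ x → term y z x)) (ΣZ-* N (sg M) (λ x → + 1 * E (x * x + y * y + z * z) (+ M)))))))
           (ΣZ-* N (sg M) (λ z → ΣZ N (λ x → + 1 * E (x * x + y * y + z * z) (+ M)))))) ⟩
    ΣZ N (λ y → sg M * ΣZ N (λ z → ΣZ N (λ x → + 1 * E (x * x + y * y + z * z) (+ M))))
      ≡⟨ ΣZ-* N (sg M) (λ y → ΣZ N (λ z → ΣZ N (λ x → + 1 * E (x * x + y * y + z * z) (+ M)))) ⟩
    sg M * ThreeSquares.Σ₃ M (λ _ _ _ → + 1)
      ≡⟨ cong (sg M *_) (threeSquares M) ⟩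
    sg M * (squaresZ + + 3 * W₁.S) ∎
    where
    open ≡.≡-Reasoning
    bound : ∀ y → + M - y * y ℤ.≤ + N
    bound y = minus-square≤ (+ M) y (ℤ.+≤+ (ℕₚ.m≤m*n M 3))
    sign : ∀ y z x → x * x + y * y + z * z ≡ + M → sgᶻ y * sgᶻ z * sgᶻ x ≡ sg M
    sign y z x e = sym (trans (cong sg (ℤₚ.+-injective (trans (sym e) (cong₂ _+_ (cong₂ _+_ (sq x) (sq y)) (sq z)))))
      (trans (sg-+ ((∣ x ∣) ℕ.* (∣ x ∣) ℕ.+ (∣ y ∣) ℕ.* (∣ y ∣)) ((∣ z ∣) ℕ.* (∣ z ∣))) (trans (cong₂ _*_ (trans (sg-+ ((∣ x ∣) ℕ.* (∣ x ∣)) ((∣ y ∣) ℕ.* (∣ y ∣))) (cong₂ _*_ (sg-square (∣ x ∣)) (sg-square (∣ y ∣)))) (sg-square (∣ z ∣)))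
        (solve 3 (λ x y z → x :* y :* z := y :* z :* x) refl (sgᶻ x) (sgᶻ y) (sgᶻ z)))))
    term : ∀ y z x → sgᶻ y * sgᶻ z * (sgᶻ x * E (x * x) (+ M - y * y - z * z)) ≡ sg M * (+ 1 * E (x * x + y * y + z * z) (+ M))
    term y z x = trans (sym (ℤₚ.*-assoc (sgᶻ y * sgᶻ z) (sgᶻ x) (E (x * x) (+ M - y * y - z * z))))
      (trans (cong (sgᶻ y * sgᶻ z * sgᶻ x *_) (trans (E-move (z * z) (x * x) (+ M - y * y)) (trans (E-move (y * y) (z * z + x * x) (+ M))
        (cong (λ w → E w (+ M)) (solve 3 (λ x y z → y :+ (z :+ x) := x :+ y :+ z) refl (x * x) (y * y) (z * z))))))
      (trans (E-cong (sign y z x)) (cong (sg M *_) (sym (ℤₚ.*-identityˡ (E (x * x + y * y + z * z) (+ M)))))))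

  sg-N : sg N ≡ sg M
  sg-N = trans (sg-odd N) (trans (cong signB (trans (odd-* M 3) (∧-true (odd M)))) (sym (sg-odd M)))
    where
    ∧-true : ∀ b → b ∧ true ≡ b
    ∧-true true = refl
    ∧-true false = refl

  -- On k² + nv = 3M the sign (-1)^(k+n) is (-1)^M times (-1)^(nv+n), the latter being `δ`. On k² =
  -- 3M one has 3 | k, so ε(k) = 1.
  twistedSum : (θ̃ ⊗ T) N ≡ sg M * (squaresZ + + 6 * W₁.H)
  twistedSum = begin
    (θ̃ ⊗ T) N
      ≡⟨ conv twisted T N ⟩
    ΣZ N (λ k → twisted k * ext T (+ N - k * k))
      ≡⟨ ΣZ-cong N (λ k → cong (twisted k *_) (ext-T (+ N - k * k))) ⟩
    ΣZ N (λ k → twisted k * lambert 1 (+ 6) rankWeight (+ N - k * k))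
      ≡⟨ ΣZ-lambert N 0 (+ 6) rankWeight twisted ⟩
    ΣZ N (λ k → twisted k * E (k * k) (+ N)) + + 6 * Σ₂ (λ a b → ΣZ N (λ k → twisted k * rankWeight a b * E (k * k + + 1 * a * b) (+ N)))
      ≡⟨ cong₂ (λ x y → x + + 6 * y) (trans (ΣZ-cong N (λ k → E-cong (squareTerm k))) (ΣZ-* N (sg M) (λ k → E (k * k) (+ N))))
           (trans (Σ₂-cong⁺ {λ a b → ΣZ N (λ k → twisted k * rankWeight a b * E (k * k + + 1 * a * b) (+ N))} {λ a b → sg M * p a b} (λ i j _ _ → pair i j))
             (trans (Σ⁺-cong N {λ a → Σ⁺ N (λ b → sg M * p a b)} {λ a → sg M * Σ⁺ N (p a)} (λ a → Σ⁺-* N (sg M) (p a))) (trans (Σ⁺-* N (sg M) (λ a → Σ⁺ N (p a))) (cong (sg M *_) pairSum)))) ⟩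
    sg M * squaresZ + + 6 * (sg M * W₁.H)
      ≡⟨ solve 3 (λ s q h → s :* q :+ con (+ 6) :* (s :* h) := s :* (q :+ con (+ 6) :* h)) refl (sg M) squaresZ W₁.H ⟩
    sg M * (squaresZ + + 6 * W₁.H) ∎
    where
    open ≡.≡-Reasoning
    p : ℤ → ℤ → ℤ
    p n v = lt (∣ n ∣) (∣ v ∣) * δ (∣ n ∣) (∣ v ∣) * Q n v
    squareTerm : ∀ k → k * k ≡ + N → twisted k ≡ sg M
    squareTerm k e = trans (cong₂ _*_ (cong ε₃ (3∣k k e)) (trans (sym (sg-square (∣ k ∣))) (trans (cong sg (ℤₚ.+-injective (trans (sym (sq k)) e))) sg-N))) (ℤₚ.*-identityˡ (sg M))
    pair : ∀ i j → ΣZ N (λ k → twisted k * rankWeight (+ suc i) (+ suc j) * E (k * k + + 1 * + suc i * + suc j) (+ N)) ≡ sg M * p (+ suc i) (+ suc j)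
    pair i j = trans (ΣZ-cong N term) (trans (ΣZ-* N (sg M * (l * δ (suc i) (suc j))) q) (ℤₚ.*-assoc (sg M) (l * δ (suc i) (suc j)) (Q (+ suc i) (+ suc j))))
      where
      n = + suc i
      v = + suc j
      l = lt (suc i) (suc j)
      q : ℤ → ℤ
      q k = ε k * χ (v - n) * E (k * k + n * v) (+ N)
      sign : ∀ k → k * k + n * v ≡ + N → sgᶻ k * sg (suc i) ≡ sg M * δ (suc i) (suc j)
      sign k e = sym (begin
        sg M * sg (suc i ℕ.* suc j ℕ.+ suc i)
          ≡⟨ cong₂ _*_ (trans (sym sg-N) (trans (cong sg (sym (ℤₚ.+-injective (trans (cong₂ _+_ (sym (sq k)) refl) e)))) (trans (sg-+ ((∣ k ∣) ℕ.* (∣ k ∣)) (suc i ℕ.* suc j)) (cong (_* sg (suc i ℕ.* suc j)) (sg-square (∣ k ∣)))))) (sg-+ (suc i ℕ.* suc j) (suc i)) ⟩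
        sgᶻ k * sg (suc i ℕ.* suc j) * (sg (suc i ℕ.* suc j) * sg (suc i))
          ≡⟨ solve 3 (λ a b c → a :* b :* (b :* c) := (b :* b) :* (a :* c)) refl (sgᶻ k) (sg (suc i ℕ.* suc j)) (sg (suc i)) ⟩
        sg (suc i ℕ.* suc j) * sg (suc i ℕ.* suc j) * (sgᶻ k * sg (suc i))
          ≡⟨ trans (cong (_* (sgᶻ k * sg (suc i))) (sg² (suc i ℕ.* suc j))) (ℤₚ.*-identityˡ _) ⟩
        sgᶻ k * sg (suc i) ∎)
      term : ∀ k → twisted k * rankWeight n v * E (k * k + + 1 * n * v) (+ N) ≡ sg M * (l * δ (suc i) (suc j)) * q k
      term k = trans (cong (λ w → twisted k * rankWeight n v * E (k * k + w * v) (+ N)) (ℤₚ.*-identityˡ n))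
        (trans (E-cong {k * k + n * v} {+ N} {twisted k * rankWeight n v} {sg M * (l * δ (suc i) (suc j)) * (ε k * χ (v - n))} (λ e → trans
            (solve 5 (λ a b c d f → (a :* b) :* (c :* d :* f) := (b :* d) :* (c :* (a :* f))) refl (ε k) (sgᶻ k) l (sg (suc i)) (χ (v - n)))
            (trans (cong (_* (l * (ε k * χ (v - n)))) (sign k e))
            (solve 4 (λ s d l x → (s :* d) :* (l :* x) := s :* (l :* d) :* x) refl (sg M) (δ (suc i) (suc j)) l (ε k * χ (v - n))))))
        (ℤₚ.*-assoc (sg M * (l * δ (suc i) (suc j))) (ε k * χ (v - n)) (E (k * k + n * v) (+ N))))

  twisted-cube : (θ̃ ⊗ T) N ≡ (θ ⊗ (θ ⊗ θ)) M
  twisted-cube = trans twistedSum (trans (cong (λ z → sg M * (squaresZ + z)) (trans (solve 1 (λ h → con (+ 6) :* h := con (+ 3) :* (h :+ h)) refl W₁.H) (cong (+ 3 *_) (sym S₁≡2H₁)))) (sym cube))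

-- f(x³)
v3 : PS → PS
v3 f 0 = f 0
v3 f 1 = + 0
v3 f 2 = + 0
v3 f (suc (suc (suc n))) = v3 (f ∘ suc) n

U : ℕ → PS → PS
U d f n = f (n ℕ.* 3 ℕ.+ d)

v3-cong : ∀ {f g} → f ≗ g → v3 f ≗ v3 g
v3-cong h 0 = h 0
v3-cong h 1 = refl
v3-cong h 2 = refl
v3-cong h (suc (suc (suc n))) = v3-cong (h ∘ suc) n

v3-cong< : ∀ K {f g} → (∀ i → i ℕ.< K → f i ≡ g i) → ∀ i → i ℕ.< K → v3 f i ≡ v3 g i
v3-cong< K h 0 p = h 0 p
v3-cong< K h 1 p = refl
v3-cong< K h 2 p = refl
v3-cong< (suc (suc (suc K))) h (suc (suc (suc i))) (s≤s (s≤s (s≤s p))) =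
  v3-cong< K (λ j j<K → h (suc j) (s≤s (ℕₚ.≤-trans j<K (ℕₚ.≤-trans (ℕₚ.n≤1+n K) (ℕₚ.n≤1+n (suc K)))))) i p

v3-⊕ : ∀ f g → v3 (f ⊕ g) ≗ v3 f ⊕ v3 g
v3-⊕ f g 0 = refl
v3-⊕ f g 1 = refl
v3-⊕ f g 2 = refl
v3-⊕ f g (suc (suc (suc n))) = v3-⊕ (f ∘ suc) (g ∘ suc) n

v3-zero : v3 zeroPS ≗ zeroPS
v3-zero 0 = refl
v3-zero 1 = refl
v3-zero 2 = refl
v3-zero (suc (suc (suc n))) = v3-zero n

v3-one : v3 onePS ≗ onePS
v3-one 0 = refl
v3-one 1 = refl
v3-one 2 = refl
v3-one (suc (suc (suc n))) = v3-zero n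

v3-X : ∀ K → v3 X ≗ PSK._^_ K X 3
v3-X K 0 = sym (X^-mono K 3 0)
v3-X K 1 = sym (X^-mono K 3 1)
v3-X K 2 = sym (X^-mono K 3 2)
v3-X K (suc (suc (suc n))) = trans (shifted n) (trans (mono-one n) (sym (X^-mono K 3 (suc (suc (suc n))))))
  where
  mono-one : onePS ≗ mono (+ 1) 0
  mono-one zero = refl
  mono-one (suc n) = refl
  shifted : v3 (X ∘ suc) ≗ onePS
  shifted n = trans (v3-cong (λ { zero → refl ; (suc _) → refl }) n) (v3-one n)

U-v3 : ∀ f → U 0 (v3 f) ≗ f
U-v3 f zero = refl
U-v3 f (suc n) = U-v3 (f ∘ suc) n

-- Multiplication by a series in x³ acts on each section separately, which makes the dissection of θ
-- F = T a linear system.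
v3⊗ : ∀ d f g → d ℕ.< 3 → U d (v3 f ⊗ g) ≗ f ⊗ U d g
v3⊗ d f g d<3 n = trans (⊗-coeff (v3 f) g (n ℕ.* 3 ℕ.+ d)) (trans (rows n f) (sym (⊗-coeff f (U d g) n)))
  where
  step : ∀ d → d ℕ.< 3 → ∀ f → Z.∑ (suc d) (λ i → v3 f i ℤ.* g (d ∸ i)) ≡ f 0 ℤ.* g d
  step 0 _ f = ℤₚ.+-identityˡ _
  step 1 _ f = trans (ℤₚ.+-identityʳ _) (ℤₚ.+-identityˡ _)
  step 2 _ f = trans (ℤₚ.+-identityʳ _) (trans (ℤₚ.+-identityʳ _) (ℤₚ.+-identityˡ _))
  step (suc (suc (suc _))) (s≤s (s≤s (s≤s ()))) f
  rows : ∀ n f → Z.∑ (suc (n ℕ.* 3 ℕ.+ d)) (λ i → v3 f i ℤ.* g (n ℕ.* 3 ℕ.+ d ∸ i)) ≡ Z.∑ (suc n) (λ i → f i ℤ.* U d g (n ∸ i))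
  rows zero f = trans (step d d<3 f) (sym (ℤₚ.+-identityˡ _))
  rows (suc n) f = begin
    Z.∑ (suc (suc (suc (suc m)))) t
      ≡⟨ trans (Z.∑-head (suc (suc (suc m))) t) (cong (λ z → t 0 ℤ.+ z) (trans (Z.∑-head (suc (suc m)) (t ∘ suc)) (trans (ℤₚ.+-identityˡ _) (trans (Z.∑-head (suc m) (t ∘ suc ∘ suc)) (ℤₚ.+-identityˡ _))))) ⟩
    t 0 ℤ.+ Z.∑ (suc m) (λ i → v3 (f ∘ suc) i ℤ.* g (m ∸ i))
      ≡⟨ cong (λ z → t 0 ℤ.+ z) (rows n (f ∘ suc)) ⟩
    f 0 ℤ.* U d g (suc n) ℤ.+ Z.∑ (suc n) (λ i → f (suc i) ℤ.* U d g (n ∸ i))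
      ≡⟨ Z.∑-head (suc n) (λ i → f i ℤ.* U d g (suc n ∸ i)) ⟨
    Z.∑ (suc (suc n)) (λ i → f i ℤ.* U d g (suc n ∸ i)) ∎
    where
    open ≡.≡-Reasoning
    m = n ℕ.* 3 ℕ.+ d
    t : ℕ → ℤ
    t i = v3 f i ℤ.* g (suc n ℕ.* 3 ℕ.+ d ∸ i)

-- Multiplication by x carries the section 2 into the section 0 at the price of a factor y; the
-- other two sections just move up.
U-X₀ : ∀ f → U 0 (X ⊗ f) ≗ X ⊗ U 2 f
U-X₀ f zero = refl
U-X₀ f (suc n) = trans (X⊗-suc f (suc (suc (n ℕ.* 3 ℕ.+ 0)))) (trans (cong f (trans (cong (λ z → suc (suc z)) (ℕₚ.+-identityʳ (n ℕ.* 3))) (ℕₚ.+-comm 2 (n ℕ.* 3)))) (sym (X⊗-suc (U 2 f) n)))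

U-X₁ : ∀ f → U 1 (X ⊗ f) ≗ U 0 f
U-X₁ f n = trans (cong (X ⊗ f) (ℕₚ.+-suc (n ℕ.* 3) 0)) (X⊗-suc f (n ℕ.* 3 ℕ.+ 0))

U-X₂ : ∀ f → U 2 (X ⊗ f) ≗ U 1 f
U-X₂ f n = trans (cong (X ⊗ f) (ℕₚ.+-suc (n ℕ.* 3) 1)) (X⊗-suc f (n ℕ.* 3 ℕ.+ 1))

three-cases : ∀ {P : ℕ → Set} → (∀ n → P (n ℕ.* 3 ℕ.+ 0)) → (∀ n → P (n ℕ.* 3 ℕ.+ 1)) → (∀ n → P (n ℕ.* 3 ℕ.+ 2)) → ∀ n → P n
three-cases a b c 0 = a 0
three-cases a b c 1 = b 0
three-cases a b c 2 = c 0
three-cases {P} a b c (suc (suc (suc n))) = three-cases {λ n → P (suc (suc (suc n)))} (a ∘ suc) (b ∘ suc) (c ∘ suc) n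

v3-off : ∀ f n → v3 f (n ℕ.* 3 ℕ.+ 1) ≡ + 0 × v3 f (n ℕ.* 3 ℕ.+ 2) ≡ + 0
v3-off f zero = refl , refl
v3-off f (suc n) = v3-off (f ∘ suc) n

⊗-zeroʳ : ∀ f {g} → g ≗ zeroPS → f ⊗ g ≗ zeroPS
⊗-zeroʳ f {g} h n = trans (⊗-coeff f g n) (Z.∑-zero< (suc n) (λ i _ → trans (cong (f i ℤ.*_) (h (n ∸ i))) (ℤₚ.*-zeroʳ (f i))))

v3-⊗ : ∀ f g → v3 (f ⊗ g) ≗ v3 f ⊗ v3 g
v3-⊗ f g = three-cases
  (λ n → trans (U-v3 (f ⊗ g) n) (sym (trans (v3⊗ 0 f (v3 g) (s≤s z≤n) n) (⊗-cong-r n))))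
  (λ n → trans (proj₁ (v3-off (f ⊗ g) n)) (sym (trans (v3⊗ 1 f (v3 g) (s≤s (s≤s z≤n)) n) (⊗-zeroʳ f (λ i → proj₁ (v3-off g i)) n))))
  (λ n → trans (proj₂ (v3-off (f ⊗ g) n)) (sym (trans (v3⊗ 2 f (v3 g) (s≤s (s≤s (s≤s z≤n))) n) (⊗-zeroʳ f (λ i → proj₂ (v3-off g i)) n))))
  where
  ⊗-cong-r : f ⊗ U 0 (v3 g) ≗ f ⊗ g
  ⊗-cong-r n = trans (⊗-coeff f (U 0 (v3 g)) n) (trans (Z.∑-cong (suc n) (λ i → cong (f i ℤ.*_) (U-v3 g (n ∸ i)))) (sym (⊗-coeff f g n)))

-- Coefficients of θ, B and T, and their truncations.

coeff-∑ : ∀ K R (f : ℕ → PS) n → PSK.∑ K R f n ≡ Z.∑ R (λ i → f i n)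
coeff-∑ K zero f n = refl
coeff-∑ K (suc R) f n = cong (_+ f R n) (coeff-∑ K R f n)

scalar-⊗ : ∀ {f} c g → f ≗ constPS c → ∀ n → (f ⊗ g) n ≡ c * g n
scalar-⊗ {f} c g h n = trans (⊗-coeff f g n) (trans (Z.∑-head n (λ i → f i * g (n ∸ i)))
  (trans (cong₂ _+_ (cong (_* g n) (h 0)) (Z.∑-zero< n (λ i _ → cong (_* g (n ∸ suc i)) (h (suc i))))) (ℤₚ.+-identityʳ (c * g n))))

minusOne^ : ∀ K s → PSK._^_ K (negPS onePS) s ≗ constPS (sg s)
minusOne^ K zero n = refl
minusOne^ K (suc s) n = trans (scalar-⊗ {negPS onePS} -[1+ 0 ] (PSK._^_ K (negPS onePS) s) (λ { zero → refl ; (suc _) → refl }) n)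
  (trans (cong (-[1+ 0 ] *_) (minusOne^ K s n)) (trans (ℤₚ.-1*i≡-i (constPS (sg s) n)) (neg n)))
  where
  neg : ∀ n → - constPS (sg s) n ≡ constPS (- sg s) n
  neg zero = refl
  neg (suc n) = refl

mono-E : ∀ e n → mono (+ 1) e n ≡ E (+ e) (+ n)
mono-E zero zero = refl
mono-E zero (suc n) = refl
mono-E (suc e) zero = refl
mono-E (suc e) (suc n) = mono-E e n

coeff-term : ∀ K s e n → (PSK._^_ K (negPS onePS) s ⊗ PSK._^_ K X e) n ≡ sg s * E (+ e) (+ n)
coeff-term K s e n = trans (scalar-⊗ {PSK._^_ K (negPS onePS) s} (sg s) (PSK._^_ K X e) (minusOne^ K s) n) (cong (sg s *_) (trans (X^-mono K e n) (mono-E e n)))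

onePS-E : ∀ n → onePS n ≡ E (+ 0) (+ n)
onePS-E zero = refl
onePS-E (suc n) = refl

thetaAt-coeff : ∀ K R n → Thetas.thetaAt (PSRing K) R X n ≡ onePS n + + 2 * Z.∑ R (λ r → sg (suc r) * E (+ (suc r ℕ.* suc r)) (+ n))
thetaAt-coeff K R n = cong (λ z → onePS n + z) (trans (scalar-⊗ {onePS ⊕ onePS} (+ 2) (PSK.∑ K R (Thetas.thetaTerm (PSRing K) X)) (λ { zero → refl ; (suc _) → refl }) n)
  (cong (+ 2 *_) (trans (coeff-∑ K R (Thetas.thetaTerm (PSRing K) X) n) (Z.∑-cong R (λ r → coeff-term K (suc r) (suc r ℕ.* suc r) n)))))

bCoeff : ℕ → ℕ → ℤ
bCoeff n j = sg (suc j) * E (+ (suc j ℕ.* (3 ℕ.* suc j ℕ.+ 2))) (+ n) + sg (suc j) * E (+ (suc j ℕ.* (3 ℕ.* j ℕ.+ 1))) (+ n)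

bAt-coeff : ∀ K R n → Thetas.bAt (PSRing K) R X n ≡ onePS n + Z.∑ R (bCoeff n)
bAt-coeff K R n = cong (λ z → onePS n + z) (trans (coeff-∑ K R (Thetas.bTerm (PSRing K) X) n)
  (Z.∑-cong R (λ j → cong₂ _+_ (coeff-term K (suc j) (suc j ℕ.* (3 ℕ.* suc j ℕ.+ 2)) n) (coeff-term K (suc j) (suc j ℕ.* (3 ℕ.* j ℕ.+ 1)) n))))

E-large : ∀ {e n} → n ℕ.< e → E (+ e) (+ n) ≡ + 0
E-large {e} {n} p = E-zero {+ e} {+ n} (λ q → ℕₚ.<-irrefl (sym (ℤₚ.+-injective q)) p)

-- n + 1 terms suffice for coefficient n: both exponents of the j-th term are at least j + 1.
B : PS
B n = onePS n + Z.∑ (suc n) (bCoeff n)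

∑-radius : ∀ {R R′} (f : ℕ → ℤ) → (∀ i → R ℕ.≤ i → f i ≡ + 0) → R ℕ.≤ R′ → Z.∑ R′ f ≡ Z.∑ R f
∑-radius {R} {R′} f h p = trans (cong (λ z → Z.∑ z f) (sym (ℕₚ.m+[n∸m]≡n p))) (trans (Z.∑-split R (R′ ∸ R) f)
  (trans (cong (λ z → Z.∑ R f + z) (Z.∑-zero< (R′ ∸ R) (λ i _ → h (R ℕ.+ i) (ℕₚ.m≤m+n R i)))) (ℤₚ.+-identityʳ (Z.∑ R f))))

B-truncated : ∀ k → CommutativeRing._≈_ (PSRing (suc k)) B (Thetas.bAt (PSRing (suc k)) (suc k) X)
B-truncated k = below (λ n n<K → sym (trans (bAt-coeff (suc k) (suc k) n) (cong (λ z → onePS n + z) (∑-radius (bCoeff n) (vanish n) n<K))))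
  where
  vanish : ∀ n j → suc n ℕ.≤ j → bCoeff n j ≡ + 0
  vanish n j p = trans (cong₂ (λ x y → sg (suc j) * x + sg (suc j) * y)
    (E-large (ℕₚ.<-≤-trans (ℕₚ.m<n⇒m<1+n p) (≡.subst (λ z → suc j ℕ.≤ suc j ℕ.* z) (ℕₚ.+-comm 2 (3 ℕ.* suc j)) (ℕₚ.m≤m*n (suc j) (2 ℕ.+ 3 ℕ.* suc j)))))
    (E-large (ℕₚ.<-≤-trans (ℕₚ.m<n⇒m<1+n p) (≡.subst (λ z → suc j ℕ.≤ suc j ℕ.* z) (ℕₚ.+-comm 1 (3 ℕ.* j)) (ℕₚ.m≤m*n (suc j) (1 ℕ.+ 3 ℕ.* j))))))
    (cong₂ _+_ (ℤₚ.*-zeroʳ (sg (suc j))) (ℤₚ.*-zeroʳ (sg (suc j))))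

θ-truncated : ∀ k → CommutativeRing._≈_ (PSRing (suc k)) θ (Thetas.thetaAt (PSRing (suc k)) (suc k) X)
θ-truncated k = below λ n n<K → sym (trans (thetaAt-coeff (suc k) (suc k) n) (sym (begin
  θ n
    ≡⟨ ΣZ-radius (f n) (supported n) (ℕₚ.<⇒≤ n<K) ⟨
  f n (+ 0) + (Σ⁺ (suc k) (λ m → f n (+ 0 + m)) + Σ⁺ (suc k) (λ m → f n (+ 0 - m)))
    ≡⟨ cong₂ _+_ (trans (ℤₚ.*-identityˡ (E (+ 0) (+ n))) (sym (onePS-E n))) (trans (cong₂ _+_ (Z.∑-cong (suc k) (λ r → cong (λ z → sg (suc r) * E z (+ n)) (sym (ℤₚ.pos-* (suc r) (suc r))))) refl)
         (solve 1 (λ x → x :+ x := con (+ 2) :* x) refl (Z.∑ (suc k) (λ r → sg (suc r) * E (+ (suc r ℕ.* suc r)) (+ n))))) ⟩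
  onePS n + + 2 * Z.∑ (suc k) (λ r → sg (suc r) * E (+ (suc r ℕ.* suc r)) (+ n)) ∎)))
  where
  open ≡.≡-Reasoning
  f : ℕ → ℤ → ℤ
  f n k = sgᶻ k * E (k * k) (+ n)
  supported : ∀ n → Supported n (f n)
  supported n k p = trans (cong (sgᶻ k *_) (E-zero (λ e → sq≢ k 0 p (trans (ℤₚ.+-identityʳ (k * k)) e)))) (ℤₚ.*-zeroʳ (sgᶻ k))

-- The projections are the identity on carriers; only the equality becomes coarser.
powerSeries : Tower
powerSeries = record
  { R∞ = PS∞ ; Rₖ = λ k → PSRing (suc k) ; π = λ _ f → f
  ; π-cong = λ k p → below (λ i _ → at p i tt)
  ; π-injective = λ h → below (λ i _ → at (h i) i ℕₚ.≤-refl)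
  ; π-+ = λ k x y → every (λ _ → refl) ; π-* = λ k x y → every (λ _ → refl)
  ; π-0 = λ k → every (λ _ → refl) ; π-1 = λ k → every (λ _ → refl)
  ; q = X ; q-nil = λ k → X-nil (suc k)
  ; v = v3 ; v-cong = λ p → every (v3-cong (λ i → at p i tt))
  ; v-congₖ = λ k p → below (v3-cong< (suc k) (at p))
  ; v-+ = λ f g → every (v3-⊕ f g) ; v-* = λ f g → every (v3-⊗ f g)
  ; v-0 = every v3-zero ; v-1 = every v3-one ; v-q = every (v3-X 0)
  ; θ = θ ; B = B ; θ≈ = θ-truncated ; B≈ = B-truncated }

τ : ℕ → ℕ → ℕ → ℤ
τ m r t = sg (suc r) * E (+ e₁ r t) (+ m) - sg (suc r) * E (+ e₂ r t) (+ m)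

raw : ℕ → PS
raw K m = onePS m + + 6 * Z.∑ K (λ r → Z.∑ K (τ m r))

Tseries-coeff : ∀ k n → n ℕ.< suc k → RankCoefficients.RF.Tseries k n ≡ raw (suc k) n
Tseries-coeff k n n<K = cong (λ z → onePS n + z) (trans (scalar-⊗ {(onePS ⊕ onePS) ⊗ (onePS ⊕ onePS ⊕ onePS)} (+ 6) S six n)
  (cong (+ 6 *_) (trans (coeff-∑ K K term n) (Z.∑-cong K (λ r → trans (at (expansion r) n n<K)
    (trans (coeff-∑ K K (expanded r) n) (Z.∑-cong K (λ t → cong₂ _-_ (coeff-term K (suc r) (e₁ r t) n) (coeff-term K (suc r) (e₂ r t) n)))))))))
  where
  K = suc k
  expanded : ℕ → ℕ → PS
  expanded r t = (PSK._^_ K (negPS onePS) (suc r) ⊗ PSK._^_ K X (e₁ r t)) ⊕ negPS (PSK._^_ K (negPS onePS) (suc r) ⊗ PSK._^_ K X (e₂ r t))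
  term : ℕ → PS
  term r = PSK._^_ K (negPS onePS) (suc r) ⊗ PSK._^_ K X (suc r ℕ.* suc (suc r)) ⊗ RankCoefficients.RF.J k r
  expansion : ∀ r → term r ≈[ ℕ._< K ] PSK.∑ K K (expanded r)
  expansion r = LambertExpansion.expand (PSRing K) X k (X-nil K) r
  S : PS
  S = PSK.∑ K K term
  six : (onePS ⊕ onePS) ⊗ (onePS ⊕ onePS ⊕ onePS) ≗ constPS (+ 6)
  six n = trans (scalar-⊗ {onePS ⊕ onePS} (+ 2) (onePS ⊕ onePS ⊕ onePS) (λ { zero → refl ; (suc _) → refl }) n) (value n)
    where
    value : ∀ n → + 2 * (onePS ⊕ onePS ⊕ onePS) n ≡ constPS (+ 6) n
    value zero = refl
    value (suc n) = refl

m3-+ : ∀ m n → m3 (m ℕ.+ n) ≡ m3 m +₃ m3 n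
m3-+ m n = trans (cong r3 (ℤₚ.pos-+ m n)) (r3-+ (+ m) (+ n))

m3-* : ∀ m n → m3 (m ℕ.* n) ≡ m3 m *₃ m3 n
m3-* m n = trans (cong r3 (ℤₚ.pos-* m n)) (r3-* (+ m) (+ n))

m3-block : ∀ t r → m3 (t ℕ.* 3 ℕ.+ r) ≡ m3 r
m3-block zero r = refl
m3-block (suc t) r = trans (from-yes (Finₚ.all? λ a → s3 (s3 (s3 a)) ≟₃ a) (m3 (t ℕ.* 3 ℕ.+ r))) (m3-block t r)

-- Write v = n + 1 + w and w = 3t + r. Then χ(v - n) = χ(1 + r) is 1, -1, 0 for r = 0, 1, 2, so each
-- block of three consists of the `e₁` term, the `e₂` term with opposite sign, and nothing.
raw-T : ∀ K m → m ℕ.≤ K → raw K m ≡ T m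
raw-T K m m≤K = cong₂ (λ x y → x + + 6 * y) (onePS-E m) (sym (trans (sym (pairs-radius 0 rankWeight (+ m) K (ℤ.+≤+ m≤K))) (Z.∑-cong K row)))
  where
  open ≡.≡-Reasoning
  row : ∀ i → Σ⁺ K (λ v → rankWeight (+ suc i) v * E (+ 1 * + suc i * v) (+ m)) ≡ Z.∑ K (τ m i)
  row i = begin
    Z.∑ K f
      ≡⟨ ∑-radius f (λ j p → vanish j (ℕₚ.≤-trans m≤K p)) K≤ ⟨
    Z.∑ (suc i ℕ.+ K ℕ.* 3) f
      ≡⟨ Z.∑-split (suc i) (K ℕ.* 3) f ⟩
    Z.∑ (suc i) f + Z.∑ (K ℕ.* 3) (λ w → f (suc i ℕ.+ w))
      ≡⟨ cong₂ _+_ (Z.∑-zero< (suc i) (λ j p → cong (λ z → z * sg (suc i) * χ (+ suc j - + suc i) * E (+ 1 * + suc i * + suc j) (+ m)) (lt-no {suc i} {suc j} p)))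
           (trans (Thetas.∑-blocks ℤₚ.+-*-commutativeRing 3 K (λ w → f (suc i ℕ.+ w))) (Z.∑-cong K block)) ⟩
    + 0 + Z.∑ K (τ m i)
      ≡⟨ ℤₚ.+-identityˡ (Z.∑ K (τ m i)) ⟩
    Z.∑ K (τ m i) ∎
    where
    f : ℕ → ℤ
    f j = rankWeight (+ suc i) (+ suc j) * E (+ 1 * + suc i * + suc j) (+ m)
    E≡ : ∀ j → E (+ 1 * + suc i * + suc j) (+ m) ≡ E (+ (suc i ℕ.* suc j)) (+ m)
    E≡ j = cong (λ z → E z (+ m)) (trans (cong (_* + suc j) (ℤₚ.*-identityˡ (+ suc i))) (sym (ℤₚ.pos-* (suc i) (suc j))))
    K≤ : K ℕ.≤ suc i ℕ.+ K ℕ.* 3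
    K≤ = ℕₚ.≤-trans (ℕₚ.m≤m*n K 3) (ℕₚ.m≤n+m (K ℕ.* 3) (suc i))
    vanish : ∀ j → m ℕ.≤ j → f j ≡ + 0
    vanish j p = trans (cong (rankWeight (+ suc i) (+ suc j) *_) (trans (E≡ j) (E-large (ℕₚ.<-≤-trans (s≤s p) (ℕₚ.m≤n*m (suc j) (suc i)))))) (ℤₚ.*-zeroʳ (rankWeight (+ suc i) (+ suc j)))
    value : ∀ t r → f (suc i ℕ.+ (t ℕ.* 3 ℕ.+ r)) ≡ sg (suc i) * χ₃ (s3 (m3 r)) * E (+ (suc i ℕ.* suc (suc i ℕ.+ (t ℕ.* 3 ℕ.+ r)))) (+ m)
    value t r = cong₂ _*_ (cong₂ _*_ (trans (cong (_* sg (suc i)) (lt-yes {suc i} {suc (suc i ℕ.+ w)} (s≤s (ℕₚ.m≤m+n (suc i) w)))) (ℤₚ.*-identityˡ (sg (suc i))))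
        (trans (cong χ (solve 2 (λ i w → con (+ 1) :+ (i :+ w) :- i := con (+ 1) :+ w) refl (+ suc i) (+ w))) (cong (χ₃ ∘ s3) (m3-block t r)))) (E≡ (suc i ℕ.+ w))
      where w = t ℕ.* 3 ℕ.+ r
    block : ∀ t → Z.∑ 3 (λ r → f (suc i ℕ.+ (t ℕ.* 3 ℕ.+ r))) ≡ τ m i t
    block t = trans (cong₂ _+_ (cong₂ _+_ (cong (λ z → + 0 + z) (value t 0)) (value t 1)) (value t 2))
      (solve 4 (λ s a b c → con (+ 0) :+ s :* con (+ 1) :* a :+ s :* con -[1+ 0 ] :* b :+ s :* con (+ 0) :* c := s :* a :- s :* b) refl
        (sg (suc i)) (E (+ e₁ i t) (+ m)) (E (+ e₂ i t) (+ m)) (E (+ (suc i ℕ.* suc (suc i ℕ.+ (t ℕ.* 3 ℕ.+ 2)))) (+ m)))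

T-truncated : ∀ k → CommutativeRing._≈_ (PSRing (suc k)) T (RankCoefficients.RF.Tseries k)
T-truncated k = below (λ n n<K → sym (trans (Tseries-coeff k n n<K) (raw-T (suc k) n (ℕₚ.<⇒≤ n<K))))

res₁ : ∀ r t → m3 (e₁ r t) ≡ m3 (suc r) *₃ s3 (m3 (suc r) +₃ 0F)
res₁ r t = trans (m3-* (suc r) (suc (suc r ℕ.+ (t ℕ.* 3 ℕ.+ 0)))) (cong (λ z → m3 (suc r) *₃ s3 z) (trans (m3-+ (suc r) (t ℕ.* 3 ℕ.+ 0)) (cong (m3 (suc r) +₃_) (m3-block t 0))))

res₂ : ∀ r t → m3 (e₂ r t) ≡ m3 (suc r) *₃ s3 (m3 (suc r) +₃ 1F)
res₂ r t = trans (m3-* (suc r) (suc (suc r ℕ.+ (t ℕ.* 3 ℕ.+ 1)))) (cong (λ z → m3 (suc r) *₃ s3 z) (trans (m3-+ (suc r) (t ℕ.* 3 ℕ.+ 1)) (cong (m3 (suc r) +₃_) (m3-block t 1))))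

E-mod : ∀ e m → m3 e ≢ m3 m → E (+ e) (+ m) ≡ + 0
E-mod e m h = E-zero {+ e} {+ m} (λ p → h (cong m3 (ℤₚ.+-injective p)))

τ-zero : ∀ m r t → (∀ (a : F3) → a ≡ m3 (suc r) → a *₃ s3 (a +₃ 0F) ≢ m3 m × a *₃ s3 (a +₃ 1F) ≢ m3 m) → τ m r t ≡ + 0
τ-zero m r t h = trans (cong₂ (λ x y → sg (suc r) * x - sg (suc r) * y)
    (E-mod (e₁ r t) m (λ p → proj₁ (h _ refl) (trans (sym (res₁ r t)) p))) (E-mod (e₂ r t) m (λ p → proj₂ (h _ refl) (trans (sym (res₂ r t)) p))))
  (solve 1 (λ s → s :* con (+ 0) :- s :* con (+ 0) := con (+ 0)) refl (sg (suc r)))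

-- The exponents are n(n + 1) or n(n + 2) modulo 3, and neither is ever 1.
U₁-T : U 1 T ≗ zeroPS
U₁-T n = trans (sym (raw-T m m ℕₚ.≤-refl)) (trans (cong₂ (λ x y → x + + 6 * y) (one n) (Z.∑-zero< m (λ r _ → Z.∑-zero< m (λ t _ → τ-zero m r t (λ a _ → ≡.subst (λ z → _ ≢ z × _ ≢ z) (sym (m3-block n 1)) (table a)))))) refl)
  where
  m = n ℕ.* 3 ℕ.+ 1
  one : ∀ n → onePS (n ℕ.* 3 ℕ.+ 1) ≡ + 0
  one zero = refl
  one (suc n) = refl
  table : ∀ (a : F3) → a *₃ s3 (a +₃ 0F) ≢ 1F × a *₃ s3 (a +₃ 1F) ≢ 1F
  table 0F = (λ ()) , λ ()
  table 1F = (λ ()) , λ ()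
  table 2F = (λ ()) , λ ()

-- The section 2 of T and the bilateral sum.

bilat⁺ : ∀ z N {e d} → + 3 * z + + 1 ≡ + suc e → + N - (+ 3 * z * z + + 3 * z) ≡ + d →
  bilatTermCoeff z N ≡ (if does (suc e ∣? d) then signZ z else + 0)
bilat⁺ z N p q rewrite p | q = refl

bilat⁺-neg : ∀ z N {e d} → + 3 * z + + 1 ≡ + suc e → + N - (+ 3 * z * z + + 3 * z) ≡ -[1+ d ] → bilatTermCoeff z N ≡ + 0
bilat⁺-neg z N p q rewrite p | q = refl

bilat⁻ : ∀ z N {e d} → + 3 * z + + 1 ≡ -[1+ e ] → + N - (+ 3 * z * z + + 3 * z) ≡ + suc d →
  bilatTermCoeff z N ≡ (if does (suc e ∣? suc d) then - signZ z else + 0)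
bilat⁻ z N p q rewrite p | q = refl

bilat⁻-zero : ∀ z N {e} → + 3 * z + + 1 ≡ -[1+ e ] → + N - (+ 3 * z * z + + 3 * z) ≡ + 0 → bilatTermCoeff z N ≡ + 0
bilat⁻-zero z N p q rewrite p | q = refl

bilat⁻-neg : ∀ z N {e d} → + 3 * z + + 1 ≡ -[1+ e ] → + N - (+ 3 * z * z + + 3 * z) ≡ -[1+ d ] → bilatTermCoeff z N ≡ + 0
bilat⁻-neg z N p q rewrite p | q = refl

signZ-sg : ∀ z → signZ z ≡ sg ∣ z ∣
signZ-sg z = go ∣ z ∣
  where
  shift : ∀ n → does (2 ∣? suc (suc n)) ≡ does (2 ∣? n)
  shift n = does-⇔ (mk⇔ (λ p → ∣m+n∣m⇒∣n p (∣-refl {2})) (λ p → ∣m∣n⇒∣m+n (∣-refl {2}) p)) (2 ∣? suc (suc n)) (2 ∣? n)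
  go : ∀ n → (if does (2 ∣? n) then + 1 else - + 1) ≡ sg n
  go 0 = refl
  go 1 = refl
  go (suc (suc n)) = trans (cong (λ b → if b then + 1 else - + 1) (shift n)) (trans (go n) (sym (ℤₚ.neg-involutive (sg n))))

multiples : ∀ K c d → d ℕ.< K → Z.∑ K (λ t → E (+ (suc c ℕ.* t)) (+ d)) ≡ (if does (suc c ∣? d) then + 1 else + 0)
multiples K c d d<K = by (suc c ∣? d)
  where
  by : Dec (suc c ∣ d) → Z.∑ K (λ t → E (+ (suc c ℕ.* t)) (+ d)) ≡ (if does (suc c ∣? d) then + 1 else + 0)
  by (yes p@(divides k refl)) = trans (Z.∑-cong K (λ t → trans (E-iff {+ (suc c ℕ.* t)} {+ (k ℕ.* suc c)} {+ k} {+ t}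
        (λ e → cong +_ (sym (ℕₚ.*-cancelˡ-≡ t k (suc c) (trans (ℤₚ.+-injective e) (ℕₚ.*-comm k (suc c))))))
        (λ e → cong +_ (trans (cong (suc c ℕ.*_) (sym (ℤₚ.+-injective e))) (ℕₚ.*-comm (suc c) k)))) (sym (ℤₚ.*-identityʳ (E (+ k) (+ t))))))
      (trans (∑-pick K k (λ _ → + 1)) (trans (ℤₚ.*-identityʳ (lt k K)) (trans (lt-yes (ℕₚ.≤-<-trans (ℕₚ.m≤m*n k (suc c)) d<K)) (cong (λ b → if b then + 1 else + 0) (sym (dec-true (suc c ∣? d) p))))))
  by (no ∤) = trans (Z.∑-zero< K (λ t _ → E-zero {+ (suc c ℕ.* t)} {+ d} (λ e → ∤ (divides t (trans (sym (ℤₚ.+-injective e)) (ℕₚ.*-comm (suc c) t))))))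
    (cong (λ b → if b then + 1 else + 0) (sym (dec-false (suc c ∣? d) ∤)))

-- At negative indices the geometric series starts with k = 1, so the multiple 0 is excluded.
positiveMultiples : ∀ K c d → d ℕ.< K → Z.∑ K (λ t → E (+ (suc c ℕ.* suc t)) (+ suc d)) ≡ (if does (suc c ∣? suc d) then + 1 else + 0)
positiveMultiples K c d d<K = trans (sym (trans (Z.∑-head K (λ t → E (+ (suc c ℕ.* t)) (+ suc d)))
  (trans (cong (_+ Z.∑ K (λ t → E (+ (suc c ℕ.* suc t)) (+ suc d))) (E-zero {+ (suc c ℕ.* 0)} {+ suc d} (λ e → absurd (trans (sym (ℕₚ.*-zeroʳ c)) (ℤₚ.+-injective e))))) (ℤₚ.+-identityˡ _))))
  (multiples (suc K) c (suc d) (s≤s d<K))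
  where
  absurd : ∀ {d} → 0 ≢ suc d
  absurd ()

private
  if-* : ∀ (b : Bool) s → (if b then s else + 0) ≡ s * (if b then + 1 else + 0)
  if-* true s = sym (ℤₚ.*-identityʳ s)
  if-* false s = sym (ℤₚ.*-zeroʳ s)

  -- 3z² + 3z takes this same value at z = i and at z = -1 - i, so one exponent serves both halves
  -- of the bilateral sum.
  A₀ : ℕ → ℕ
  A₀ i = 3 ℕ.* i ℕ.* i ℕ.+ 3 ℕ.* i

  +A₀ : ∀ i → + A₀ i ≡ + 3 * + i * + i + + 3 * + i
  +A₀ i = cong₂ _+_ (trans (ℤₚ.pos-* (3 ℕ.* i) i) (cong (_* + i) (ℤₚ.pos-* 3 i))) (ℤₚ.pos-* 3 i)

  E-cut : ∀ x n → E (+ (x ℕ.* 3 ℕ.+ 2)) (+ (n ℕ.* 3 ℕ.+ 2)) ≡ E (+ x) (+ n)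
  E-cut x n = E-iff (λ e → cong +_ (ℕₚ.*-cancelʳ-≡ x n 3 (ℕₚ.+-cancelʳ-≡ 2 (x ℕ.* 3) (n ℕ.* 3) (ℤₚ.+-injective e)))) (λ e → cong (λ z → + (z ℕ.* 3 ℕ.+ 2)) (ℤₚ.+-injective e))

  E-shift : ∀ A x q n → q ℕ.+ A ≡ n → E (+ (A ℕ.+ x)) (+ n) ≡ E (+ x) (+ q)
  E-shift A x q n a = E-iff (λ e → cong +_ (ℕₚ.+-cancelˡ-≡ A x q (trans (ℤₚ.+-injective e) (trans (sym a) (ℕₚ.+-comm q A)))))
    (λ e → cong +_ (trans (cong (A ℕ.+_) (ℤₚ.+-injective e)) (trans (ℕₚ.+-comm A q) a)))

  below-A : ∀ A n {q} → + n - + A ≡ -[1+ q ] → n ℕ.< A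
  below-A A n {q} e with minus-cases n A
  ... | inj₁ (_ , _ , e′) with trans (sym e) e′
  ...   | ()
  below-A A n {q} e | inj₂ _ = ℕₚ.≰⇒> (λ A≤n → absurd (trans (sym e) (trans (ℤₚ.m-n≡m⊖n n A) (ℤₚ.⊖-≥ A≤n))))
    where
    absurd : ∀ {x} → -[1+ q ] ≢ + x
    absurd ()

  sg-3i : ∀ i → sg (i ℕ.* 3) ≡ sg i
  sg-3i zero = refl
  sg-3i (suc i) = trans (solve 1 (λ x → :- (:- (:- x)) := :- x) refl (sg (i ℕ.* 3))) (cong -_ (sg-3i i))

module BilateralTerms (n i : ℕ) where
  private
    K = suc n ℕ.* 3
    m = n ℕ.* 3 ℕ.+ 2
    n<K : n ℕ.< K
    n<K = s≤s (ℕₚ.≤-trans (ℕₚ.m≤m*n n 3) (ℕₚ.≤-trans (ℕₚ.n≤1+n _) (ℕₚ.n≤1+n _)))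
    q<K : ∀ {q} → q ℕ.+ A₀ i ≡ n → q ℕ.< K
    q<K {q} a = ℕₚ.≤-<-trans (≡.subst (q ℕ.≤_) a (ℕₚ.m≤m+n q (A₀ i))) n<K

    e≡ : + 3 * + i + + 1 ≡ + suc (3 ℕ.* i)
    e≡ = trans (cong (_+ + 1) (sym (ℤₚ.pos-* 3 i))) (ℤₚ.+-comm (+ (3 ℕ.* i)) (+ 1))
    exponent : ∀ t → E (+ e₁ (i ℕ.* 3 ℕ.+ 0) t) (+ m) ≡ E (+ (A₀ i ℕ.+ suc (3 ℕ.* i) ℕ.* t)) (+ n)
    exponent t = trans (cong (λ z → E (+ z) (+ m)) (ℕsolve 2 (λ i t → (κ 1 ⊞ (i ⊠ κ 3 ⊞ κ 0)) ⊠ (κ 1 ⊞ ((κ 1 ⊞ (i ⊠ κ 3 ⊞ κ 0)) ⊞ (t ⊠ κ 3 ⊞ κ 0)))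
      ≔ ((κ 3 ⊠ i ⊠ i ⊞ κ 3 ⊠ i) ⊞ (κ 1 ⊞ κ 3 ⊠ i) ⊠ t) ⊠ κ 3 ⊞ κ 2) refl i t)) (E-cut (A₀ i ℕ.+ suc (3 ℕ.* i) ℕ.* t) n)

  -- n = 3i + 1: (3i + 1)(3i + 2 + 3t) = 3(3i² + 3i + (3i + 1)t) + 2, and (-1)^(3i+1) = -(-1)^i.
  right : sg (suc (i ℕ.* 3)) * Z.∑ K (λ t → E (+ e₁ (i ℕ.* 3 ℕ.+ 0) t) (+ m)) ≡ - bilatTermCoeff (+ i) n
  right with minus-cases n (A₀ i)
  ... | inj₁ (q , a , b) = begin
    - sg (i ℕ.* 3) * Z.∑ K (λ t → E (+ e₁ (i ℕ.* 3 ℕ.+ 0) t) (+ m))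
      ≡⟨ cong₂ (λ x y → - x * y) (sg-3i i) (trans (Z.∑-cong K (λ t → trans (exponent t) (E-shift (A₀ i) (suc (3 ℕ.* i) ℕ.* t) q n a))) (multiples K (3 ℕ.* i) q (q<K a))) ⟩
    - sg i * (if does (suc (3 ℕ.* i) ∣? q) then + 1 else + 0)
      ≡⟨ sym (ℤₚ.neg-distribˡ-* (sg i) _) ⟩
    - (sg i * (if does (suc (3 ℕ.* i) ∣? q) then + 1 else + 0))
      ≡⟨ cong -_ (trans (cong (_* (if does (suc (3 ℕ.* i) ∣? q) then + 1 else + 0)) (sym (signZ-sg (+ i)))) (sym (if-* (does (suc (3 ℕ.* i) ∣? q)) (signZ (+ i))))) ⟩
    - (if does (suc (3 ℕ.* i) ∣? q) then signZ (+ i) else + 0)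
      ≡⟨ cong -_ (bilat⁺ (+ i) n e≡ (trans (cong (λ z → + n - z) (sym (+A₀ i))) b)) ⟨
    - bilatTermCoeff (+ i) n ∎
    where open ≡.≡-Reasoning
  ... | inj₂ (q , b) = trans (cong (sg (suc (i ℕ.* 3)) *_) (Z.∑-zero< K (λ t _ → trans (exponent t) (E-large (ℕₚ.<-≤-trans (below-A (A₀ i) n b) (ℕₚ.m≤m+n (A₀ i) _))))))
      (trans (ℤₚ.*-zeroʳ (sg (suc (i ℕ.* 3)))) (sym (cong -_ (bilat⁺-neg (+ i) n e≡ (trans (cong (λ z → + n - z) (sym (+A₀ i))) b)))))

  private
    z = -[1+ i ]
    c = suc (3 ℕ.* i)
    e≡′ : + 3 * z + + 1 ≡ -[1+ c ]
    e≡′ = trans (solve 1 (λ i → con (+ 3) :* (:- (con (+ 1) :+ i)) :+ con (+ 1) := :- (con (+ 2) :+ con (+ 3) :* i)) refl (+ i)) (cong (λ w → - (+ 2 + w)) (sym (ℤₚ.pos-* 3 i)))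
    A≡ : + A₀ i ≡ + 3 * z * z + + 3 * z
    A≡ = trans (+A₀ i) (solve 1 (λ i → con (+ 3) :* i :* i :+ con (+ 3) :* i := con (+ 3) :* (:- (con (+ 1) :+ i)) :* (:- (con (+ 1) :+ i)) :+ con (+ 3) :* (:- (con (+ 1) :+ i))) refl (+ i))
    exponent′ : ∀ t → E (+ e₂ (i ℕ.* 3 ℕ.+ 1) t) (+ m) ≡ E (+ (A₀ i ℕ.+ suc c ℕ.* suc t)) (+ n)
    exponent′ t = trans (cong (λ z → E (+ z) (+ m)) (ℕsolve 2 (λ i t → (κ 1 ⊞ (i ⊠ κ 3 ⊞ κ 1)) ⊠ (κ 1 ⊞ ((κ 1 ⊞ (i ⊠ κ 3 ⊞ κ 1)) ⊞ (t ⊠ κ 3 ⊞ κ 1)))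
      ≔ ((κ 3 ⊠ i ⊠ i ⊞ κ 3 ⊠ i) ⊞ (κ 2 ⊞ κ 3 ⊠ i) ⊠ (κ 1 ⊞ t)) ⊠ κ 3 ⊞ κ 2) refl i t)) (E-cut (A₀ i ℕ.+ suc c ℕ.* suc t) n)

  -- n = 3i + 2: (3i + 2)(3i + 4 + 3t) = 3(3i² + 3i + (3i + 2)(t + 1)) + 2. The index is z = -1 - i;
  -- expanding 1/(1 - q^(3z+1)) brings a minus sign, which turns (-1)^z into (-1)^i.
  left : sg (suc (suc (i ℕ.* 3))) * Z.∑ K (λ t → E (+ e₂ (i ℕ.* 3 ℕ.+ 1) t) (+ m)) ≡ bilatTermCoeff -[1+ i ] n
  left with minus-cases n (A₀ i)
  ... | inj₁ (suc q , a , b) = begin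
    - - sg (i ℕ.* 3) * Z.∑ K (λ t → E (+ e₂ (i ℕ.* 3 ℕ.+ 1) t) (+ m))
      ≡⟨ cong₂ (λ x y → - - x * y) (sg-3i i) (trans (Z.∑-cong K (λ t → trans (exponent′ t) (E-shift (A₀ i) (suc c ℕ.* suc t) (suc q) n a))) (positiveMultiples K c q (ℕₚ.<-trans (ℕₚ.n<1+n q) (q<K a)))) ⟩
    - - sg i * (if does (suc c ∣? suc q) then + 1 else + 0)
      ≡⟨ trans (cong (λ s → - s * (if does (suc c ∣? suc q) then + 1 else + 0)) (sym (signZ-sg z))) (sym (if-* (does (suc c ∣? suc q)) (- signZ z))) ⟩
    (if does (suc c ∣? suc q) then - signZ z else + 0)
      ≡⟨ bilat⁻ z n e≡′ (trans (cong (λ w → + n - w) (sym A≡)) b) ⟨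
    bilatTermCoeff z n ∎
    where open ≡.≡-Reasoning
  ... | inj₁ (zero , a , b) = trans (cong (sg (suc (suc (i ℕ.* 3))) *_) (Z.∑-zero< K (λ t _ → trans (exponent′ t) (trans (E-shift (A₀ i) (suc c ℕ.* suc t) 0 n a) (E-large {suc c ℕ.* suc t} {0} (s≤s z≤n))))))
      (trans (ℤₚ.*-zeroʳ (sg (suc (suc (i ℕ.* 3))))) (sym (bilat⁻-zero z n e≡′ (trans (cong (λ w → + n - w) (sym A≡)) b))))
  ... | inj₂ (q , b) = trans (cong (sg (suc (suc (i ℕ.* 3))) *_) (Z.∑-zero< K (λ t _ → trans (exponent′ t) (E-large (ℕₚ.<-≤-trans (below-A (A₀ i) n b) (ℕₚ.m≤m+n (A₀ i) _))))))
      (trans (ℤₚ.*-zeroʳ (sg (suc (suc (i ℕ.* 3))))) (sym (bilat⁻-neg z n e≡′ (trans (cong (λ w → + n - w) (sym A≡)) b))))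

-- n(n + 1) ≡ 2 only for n ≡ 1, and n(n + 2) ≡ 2 only for n ≡ 2 modulo 3. These two families are the
-- indices z = i and z = -1 - i of the bilateral sum; n ≡ 0 contributes nothing.
U₂-T : ∀ n → U 2 T n ≡ -[1+ 5 ] * bilatSum n
U₂-T n = begin
  T m
    ≡⟨ raw-T K m m≤K ⟨
  onePS m + + 6 * Z.∑ K g
    ≡⟨ cong₂ (λ x y → x + + 6 * y) (one n) (trans (Thetas.∑-blocks ℤₚ.+-*-commutativeRing 3 (suc n) g) (Z.∑-cong (suc n) block)) ⟩
  + 0 + + 6 * Z.∑ (suc n) (λ i → - bilatTermCoeff (+ i) n - bilatTermCoeff -[1+ i ] n)
    ≡⟨ cong (λ z → + 0 + + 6 * z) (trans (Z.∑-+ (suc n) (λ i → - bilatTermCoeff (+ i) n) (λ i → - bilatTermCoeff -[1+ i ] n)) (cong₂ _+_ (Z.∑-neg (suc n) (λ i → bilatTermCoeff (+ i) n)) (Z.∑-neg (suc n) (λ i → bilatTermCoeff -[1+ i ] n)))) ⟩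
  + 0 + + 6 * (- Z.∑ (suc n) (λ i → bilatTermCoeff (+ i) n) + - Z.∑ (suc n) (λ i → bilatTermCoeff -[1+ i ] n))
    ≡⟨ solve 2 (λ x y → con (+ 0) :+ con (+ 6) :* ((:- x) :+ (:- y)) := con -[1+ 5 ] :* (x :+ y)) refl (Z.∑ (suc n) (λ i → bilatTermCoeff (+ i) n)) (Z.∑ (suc n) (λ i → bilatTermCoeff -[1+ i ] n)) ⟩
  -[1+ 5 ] * (Z.∑ (suc n) (λ i → bilatTermCoeff (+ i) n) + Z.∑ (suc n) (λ i → bilatTermCoeff -[1+ i ] n))
    ≡⟨ cong (-[1+ 5 ] *_) (cong₂ _+_ (sym (Σ<-∑ (suc n) (λ i → bilatTermCoeff (+ i) n))) (sym (Σ<-∑ (suc n) (λ i → bilatTermCoeff -[1+ i ] n)))) ⟩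
  -[1+ 5 ] * bilatSum n ∎
  where
  open ≡.≡-Reasoning
  K = suc n ℕ.* 3
  m = n ℕ.* 3 ℕ.+ 2
  m≤K : m ℕ.≤ K
  m≤K = ℕₚ.≤-trans (ℕₚ.≤-reflexive (ℕₚ.+-comm (n ℕ.* 3) 2)) (ℕₚ.n≤1+n _)
  one : ∀ n → onePS (n ℕ.* 3 ℕ.+ 2) ≡ + 0
  one zero = refl
  one (suc n) = refl
  g : ℕ → ℤ
  g r = Z.∑ K (τ m r)
  mod : ∀ i r → m3 (suc (i ℕ.* 3 ℕ.+ r)) ≡ s3 (m3 r)
  mod i r = cong s3 (m3-block i r)
  split : ∀ r s (f h : ℕ → ℤ) → Z.∑ K (λ t → s * f t - s * h t) ≡ s * Z.∑ K f - s * Z.∑ K h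
  split r s f h = trans (Z.∑-+ K (λ t → s * f t) (λ t → - (s * h t))) (cong₂ _+_ (Z.∑-*ˡ K s f) (trans (Z.∑-neg K (λ t → s * h t)) (cong -_ (Z.∑-*ˡ K s h))))
  off₁ : ∀ r t → m3 (suc r) *₃ s3 (m3 (suc r) +₃ 0F) ≢ 2F → E (+ e₁ r t) (+ m) ≡ + 0
  off₁ r t h = E-mod (e₁ r t) m (λ p → h (trans (sym (res₁ r t)) (trans p (m3-block n 2))))
  off₂ : ∀ r t → m3 (suc r) *₃ s3 (m3 (suc r) +₃ 1F) ≢ 2F → E (+ e₂ r t) (+ m) ≡ + 0
  off₂ r t h = E-mod (e₂ r t) m (λ p → h (trans (sym (res₂ r t)) (trans p (m3-block n 2))))
  g₀ : ∀ i → g (i ℕ.* 3 ℕ.+ 0) ≡ - bilatTermCoeff (+ i) n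
  g₀ i = trans (split r (sg (suc r)) (λ t → E (+ e₁ r t) (+ m)) (λ t → E (+ e₂ r t) (+ m)))
    (trans (cong₂ (λ x y → sg (suc x) * Z.∑ K (λ t → E (+ e₁ r t) (+ m)) - sg (suc r) * y) (ℕₚ.+-identityʳ (i ℕ.* 3)) (Z.∑-zero< K (λ t _ → off₂ r t (λ p → absurd (trans (sym (cong (λ a → a *₃ s3 (a +₃ 1F)) (mod i 0))) p)))))
    (trans (cong₂ (λ x y → x - y) (BilateralTerms.right n i) (ℤₚ.*-zeroʳ (sg (suc r)))) (ℤₚ.+-identityʳ _)))
    where
    r = i ℕ.* 3 ℕ.+ 0
    absurd : 1F *₃ s3 (1F +₃ 1F) ≢ 2F
    absurd ()
  g₁ : ∀ i → g (i ℕ.* 3 ℕ.+ 1) ≡ - bilatTermCoeff -[1+ i ] n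
  g₁ i = trans (split r (sg (suc r)) (λ t → E (+ e₁ r t) (+ m)) (λ t → E (+ e₂ r t) (+ m)))
    (trans (cong₂ (λ x y → sg (suc r) * x - sg (suc y) * Z.∑ K (λ t → E (+ e₂ r t) (+ m))) (Z.∑-zero< K (λ t _ → off₁ r t (λ p → absurd (trans (sym (cong (λ a → a *₃ s3 (a +₃ 0F)) (mod i 1))) p)))) (ℕₚ.+-comm (i ℕ.* 3) 1))
    (trans (cong₂ (λ x y → x - y) (ℤₚ.*-zeroʳ (sg (suc r))) (BilateralTerms.left n i)) (ℤₚ.+-identityˡ _)))
    where
    r = i ℕ.* 3 ℕ.+ 1
    absurd : 2F *₃ s3 (2F +₃ 0F) ≢ 2F
    absurd ()
  g₂ : ∀ i → g (i ℕ.* 3 ℕ.+ 2) ≡ + 0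
  g₂ i = Z.∑-zero< K (λ t _ → trans (cong₂ (λ x y → sg (suc r) * x - sg (suc r) * y) (off₁ r t (λ p → absurd (trans (sym (cong (λ a → a *₃ s3 (a +₃ 0F)) (mod i 2))) p))) (off₂ r t (λ p → absurd (trans (sym (cong (λ a → a *₃ s3 (a +₃ 1F)) (mod i 2))) p))))
      (solve 1 (λ s → s :* con (+ 0) :- s :* con (+ 0) := con (+ 0)) refl (sg (suc r))))
    where
    r = i ℕ.* 3 ℕ.+ 2
    absurd : 0F ≢ 2F
    absurd ()
  block : ∀ i → Z.∑ 3 (λ r → g (i ℕ.* 3 ℕ.+ r)) ≡ - bilatTermCoeff (+ i) n - bilatTermCoeff -[1+ i ] n
  block i = trans (cong₂ _+_ (cong₂ _+_ (cong (λ z → + 0 + z) (g₀ i)) (g₁ i)) (g₂ i))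
    (solve 2 (λ x y → con (+ 0) :+ (:- x) :+ (:- y) :+ con (+ 0) := (:- x) :- y) refl (bilatTermCoeff (+ i) n) (bilatTermCoeff -[1+ i ] n))

-- Inverses, infinite products, and the assembly of the theorem.

infix 4 _≈∞_
_≈∞_ : PS → PS → Set
_≈∞_ = CommutativeRing._≈_ PS∞

exact : ∀ {f g} → f ≈∞ g → f ≗ g
exact p n = at p n tt

lim : ∀ {f g} → (∀ k → CommutativeRing._≈_ (PSRing (suc k)) f g) → f ≈∞ g
lim h = below (λ n _ → at (h n) n ℕₚ.≤-refl)

truncate : ∀ {f g} K → f ≈∞ g → CommutativeRing._≈_ (PSRing K) f g
truncate K p = below (λ n _ → at p n tt)

⊗-cong≗ : ∀ {f f′ g g′} → f ≗ f′ → g ≗ g′ → f ⊗ g ≗ f′ ⊗ g′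
⊗-cong≗ p r n = at (⊗-congᴾ {P = λ _ → Data.Unit.⊤} (λ _ _ → tt) (every p) (every r)) n tt

-- dot f i n = Σ_{j≤n} f(i+j) c_{n−j} for the coefficients c of invPS f; unification recovers it from the definition of invPS.
mutual
  dot : PS → ℕ → ℕ → ℤ
  dot = _

  invPS-suc : ∀ f n → invPS f (suc n) ≡ - dot f 1 n
  invPS-suc f n with 1
  ... | i = refl

dot-∑ : ∀ f i n → dot f i n ≡ Z.∑ (suc n) (λ j → f (i ℕ.+ j) * invPS f (n ∸ j))
dot-∑ f i zero = trans (ℤₚ.+-identityʳ (f i * + 1)) (trans (cong (λ z → f z * + 1) (sym (ℕₚ.+-identityʳ i))) (sym (ℤₚ.+-identityˡ (f (i ℕ.+ 0) * + 1))))
dot-∑ f i (suc n) = sym (trans (Z.∑-head (suc n) (λ j → f (i ℕ.+ j) * invPS f (suc n ∸ j)))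
  (cong₂ _+_ (cong (λ z → f z * invPS f (suc n)) (ℕₚ.+-identityʳ i)) (trans (Z.∑-cong (suc n) (λ j → cong (λ z → f z * invPS f (n ∸ j)) (ℕₚ.+-suc i j))) (sym (dot-∑ f (suc i) n)))))

invPS-inverse : ∀ f → f 0 ≡ + 1 → f ⊗ invPS f ≈∞ onePS
invPS-inverse f f0 = every coefficient
  where
  coefficient : f ⊗ invPS f ≗ onePS
  coefficient zero = trans (ℤₚ.+-identityˡ (f 0 * + 1)) (cong (_* + 1) f0)
  coefficient (suc n) = trans (⊗-coeff f (invPS f) (suc n)) (trans (Z.∑-head (suc n) (λ i → f i * invPS f (suc n ∸ i)))
    (trans (cong₂ _+_ (trans (cong₂ _*_ f0 (trans (invPS-suc f n) (cong -_ (dot-∑ f 1 n)))) (ℤₚ.*-identityˡ _)) refl)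
      (ℤₚ.+-inverseˡ (Z.∑ (suc n) (λ j → f (suc j) * invPS f (n ∸ j))))))

mono-scale : ∀ c e n → mono c e n ≡ c * mono (+ 1) e n
mono-scale c e n with n ≡ᵇ e
... | true = sym (ℤₚ.*-identityʳ c)
... | false = sym (ℤₚ.*-zeroʳ c)

prodUpTo-∏ : ∀ K n {F G} → (∀ i → F i ≗ G i) → prodUpTo n F ≗ PSK.∏ K n G
prodUpTo-∏ K zero h _ = refl
prodUpTo-∏ K (suc n) h = ⊗-cong≗ (prodUpTo-∏ K n h) (h n)

𝐏 : ℕ → PS → ℕ → PS
𝐏 k = Products.P (PSRing (suc k)) X k (X-nil (suc k))

-- For coefficient n the infinite product takes n + 1 factors, while `𝐏` takes k + 1 for all
-- coefficients at once; the additional ones are 1 modulo x^(n+1).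
poch-truncated : ∀ c c# b k → c# ≗ constPS c → CommutativeRing._≈_ (PSRing (suc k)) (poch c (suc b) (suc b)) (𝐏 k c# (suc b))
poch-truncated c c# b k h = below λ n n<K → trans (prodUpTo-∏ (suc n) (suc n) (factors (suc n)) n)
  (trans (sym (at (Products.P-extend (PSRing (suc n)) X n (X-nil (suc n)) c# b (k ∸ n)) n ℕₚ.≤-refl))
    (trans (cong (λ z → PSK.∏ (suc n) z (G (suc n)) n) (cong suc (ℕₚ.m+[n∸m]≡n (ℕₚ.≤-pred n<K))))
      (trans (sym (prodUpTo-∏ (suc n) (suc k) (factors (suc n)) n)) (prodUpTo-∏ (suc k) (suc k) (factors (suc k)) n))))
  where
  G : ℕ → ℕ → PS
  G K i = onePS ⊕ negPS (c# ⊗ PSK._^_ K X (suc b ℕ.* suc i))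
  factors : ∀ K i → onePS ⊖ mono c (suc b ℕ.+ suc b ℕ.* i) ≗ G K i
  factors K i n = cong (λ z → onePS n - z) (trans (mono-scale c (suc b ℕ.+ suc b ℕ.* i) n) (trans (cong (λ e → c * mono (+ 1) e n) (sym (ℕₚ.*-suc (suc b) i)))
    (sym (trans (scalar-⊗ {c#} c (PSK._^_ K X (suc b ℕ.* suc i)) h n) (cong (c *_) (X^-mono K (suc b ℕ.* suc i) n))))))

poch⁺ : ∀ b k → CommutativeRing._≈_ (PSRing (suc k)) (poch (+ 1) (suc b) (suc b)) (𝐏 k onePS (suc b))
poch⁺ b k = poch-truncated (+ 1) onePS b k (λ _ → refl)

poch⁻ : ∀ b k → CommutativeRing._≈_ (PSRing (suc k)) (poch -[1+ 0 ] (suc b) (suc b)) (𝐏 k (negPS onePS) (suc b))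
poch⁻ b k = poch-truncated -[1+ 0 ] (negPS onePS) b k (λ { zero → refl ; (suc _) → refl })

A F : PS
A = v3 θ
F = invPS θ ⊗ T

P Pm P₂ P₃ Pm₃ P₆ : PS
P = poch (+ 1) 1 1
Pm = poch -[1+ 0 ] 1 1
P₂ = poch (+ 1) 2 2
P₃ = poch (+ 1) 3 3
Pm₃ = poch -[1+ 0 ] 3 3
P₆ = poch (+ 1) 6 6

private
  X¹ : ∀ K → CommutativeRing._≈_ (PSRing K) X (PSK._^_ K X 1)
  X¹ K = every (λ n → sym (X^-mono K 1 n))

θPm : θ ⊗ Pm ≈∞ P
θPm = lim λ k → SplitProducts.replace (PSRing (suc k)) {θ} {Thetas.thetaAt (PSRing (suc k)) (suc k) (PSK._^_ (suc k) X 1)} {Pm} {𝐏 k (negPS onePS) 1} {P} {𝐏 k onePS 1} (CommutativeRing.trans (PSRing (suc k)) {θ} {Thetas.thetaAt (PSRing (suc k)) (suc k) X} {Thetas.thetaAt (PSRing (suc k)) (suc k) (PSK._^_ (suc k) X 1)} (θ-truncated k) (Thetas.thetaAt-cong (PSRing (suc k)) (suc k) {X} {PSK._^_ (suc k) X 1} (X¹ (suc k))))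
  (poch⁻ 0 k) (poch⁺ 0 k) (ThetaProducts.theta-product (PSRing (suc k)) X k (X-nil (suc k)) 0)

APm₃ : A ⊗ Pm₃ ≈∞ P₃
APm₃ = lim λ k → SplitProducts.replace (PSRing (suc k)) {A} {Thetas.thetaAt (PSRing (suc k)) (suc k) (PSK._^_ (suc k) X 3)} {Pm₃} {𝐏 k (negPS onePS) 3} {P₃} {𝐏 k onePS 3} (TowerIdentities.At.θ₃ powerSeries k) (poch⁻ 2 k) (poch⁺ 2 k) (ThetaProducts.theta-product (PSRing (suc k)) X k (X-nil (suc k)) 2)

BPm : B ⊗ Pm ≈∞ P₆ ⊗ Pm₃
BPm = lim λ k → SplitProducts.replace (PSRing (suc k)) {B} {Thetas.bAt (PSRing (suc k)) (suc k) X} {Pm} {𝐏 k (negPS onePS) 1} {P₆ ⊗ Pm₃} {𝐏 k onePS 6 ⊗ 𝐏 k (negPS onePS) 3} (B-truncated k) (poch⁻ 0 k) (CommutativeRing.*-cong (PSRing (suc k)) {P₆} {𝐏 k onePS 6} {Pm₃} {𝐏 k (negPS onePS) 3} (poch⁺ 5 k) (poch⁻ 2 k)) (ThetaProducts.b-product (PSRing (suc k)) X k (X-nil (suc k)))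

PPm : P ⊗ Pm ≈∞ P₂
PPm = lim λ k → SplitProducts.replace (PSRing (suc k)) {P} {𝐏 k onePS 1} {Pm} {𝐏 k (negPS onePS) 1} {P₂} {𝐏 k onePS 2} (poch⁺ 0 k) (poch⁻ 0 k) (poch⁺ 1 k) (Products.P-double (PSRing (suc k)) X k (X-nil (suc k)) 1)

θ-inverse : θ ⊗ invPS θ ≈∞ onePS
θ-inverse = invPS-inverse θ refl

θF : θ ⊗ F ≈∞ T
θF = SplitProducts.divide PS∞ {θ} {invPS θ} T θ-inverse

-- In the ring truncated just above x^(m+1), F and `Fseries` are both solutions of θ F = T, and θ is
-- a unit there.
F-rank : ∀ m → F (suc m) ≡ + Nbar (+ 0) 3 (suc m) - + Nbar (+ 1) 3 (suc m)
F-rank m = trans (at (UniqueQuotient.unique (PSRing K) {θ} {Thetas.thetaAt (PSRing K) K X} {invPS θ} {F} {RF.Fseries} {T} {RF.Tseries} (truncate K θ-inverse) (θ-truncated (suc m)) (T-truncated (suc m)) (truncate K θF) RF.theta*Fseries) (suc m) ℕₚ.≤-refl)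
  (RankCoefficients.Fseries-coeff (suc m) m refl)
  where
  K = suc (suc m)
  module RF = RankCoefficients.RF (suc m)

private
  two : onePS ⊕ onePS ≗ constPS (+ 2)
  two zero = refl
  two (suc n) = refl

  2⊗ : ∀ g n → ((onePS ⊕ onePS) ⊗ g) n ≡ + 2 * g n
  2⊗ g = scalar-⊗ {onePS ⊕ onePS} (+ 2) g two

section⁻ : ∀ d f {g} → d ℕ.< 3 → U d (X ⊗ f) ≗ g → U d ((v3 A ⊗ f) ⊕ negPS ((onePS ⊕ onePS) ⊗ (v3 B ⊗ (X ⊗ f)))) ≗ (A ⊗ U d f) ⊕ negPS ((onePS ⊕ onePS) ⊗ (B ⊗ g))
section⁻ d f {g} d<3 h n = cong₂ _-_ (v3⊗ d A f d<3 n) (trans (2⊗ (v3 B ⊗ (X ⊗ f)) (n ℕ.* 3 ℕ.+ d)) (trans (cong (+ 2 *_) (trans (v3⊗ d B (X ⊗ f) d<3 n) (⊗-cong≗ {B} {B} (λ _ → refl) h n))) (sym (2⊗ (B ⊗ g) n))))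

section⁺ : ∀ d f {g} → d ℕ.< 3 → U d (X ⊗ f) ≗ g → U d ((v3 A ⊗ f) ⊕ ((onePS ⊕ onePS) ⊗ (v3 B ⊗ (X ⊗ f)))) ≗ (A ⊗ U d f) ⊕ ((onePS ⊕ onePS) ⊗ (B ⊗ g))
section⁺ d f {g} d<3 h n = cong₂ _+_ (v3⊗ d A f d<3 n) (trans (2⊗ (v3 B ⊗ (X ⊗ f)) (n ℕ.* 3 ℕ.+ d)) (trans (cong (+ 2 *_) (trans (v3⊗ d B (X ⊗ f) d<3 n) (⊗-cong≗ {B} {B} (λ _ → refl) h n))) (sym (2⊗ (B ⊗ g) n))))

T-split : T ≈∞ (v3 A ⊗ F) ⊕ negPS ((onePS ⊕ onePS) ⊗ (v3 B ⊗ (X ⊗ F)))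
T-split = SplitProducts.minus PS∞ {θ} {v3 A} {v3 B} {X} {F} {T} (TowerIdentities.θ-split powerSeries) θF

system₀ : (A ⊗ U 0 F) ⊕ negPS ((onePS ⊕ onePS) ⊗ (B ⊗ (X ⊗ U 2 F))) ≈∞ U 0 T
system₀ = every (λ n → sym (trans (exact T-split (n ℕ.* 3 ℕ.+ 0)) (section⁻ 0 F (s≤s z≤n) (U-X₀ F) n)))

system₁ : (A ⊗ U 1 F) ⊕ negPS ((onePS ⊕ onePS) ⊗ (B ⊗ U 0 F)) ≈∞ zeroPS
system₁ = every (λ n → trans (sym (trans (exact T-split (n ℕ.* 3 ℕ.+ 1)) (section⁻ 1 F (s≤s (s≤s z≤n)) (U-X₁ F) n))) (U₁-T n))

system₂ : (A ⊗ U 2 F) ⊕ negPS ((onePS ⊕ onePS) ⊗ (B ⊗ U 1 F)) ≈∞ U 2 T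
system₂ = every (λ n → sym (trans (exact T-split (n ℕ.* 3 ℕ.+ 2)) (section⁻ 2 F (s≤s (s≤s (s≤s z≤n))) (U-X₂ F) n)))

private
  -- ε(k) depends only on whether 3 divides the exponent k², so the twist changes the sign of whole
  -- sections of θ.
  ε-square : ∀ k n → k * k ≡ + n → m3 n ≡ 0F → ε k ≡ + 1
  ε-square k n e h = from-yes (Finₚ.all? λ a → ((a *₃ a) ≟₃ 0F) →-dec (ε₃ a ≟ + 1)) (r3 k) (trans (sym (r3-* k k)) (trans (cong r3 e) h))

  ε-nonsquare : ∀ k n → k * k ≡ + n → m3 n ≢ 0F → ε k ≡ -[1+ 0 ]
  ε-nonsquare k n e h = from-yes (Finₚ.all? λ a → ¬? ((a *₃ a) ≟₃ 0F) →-dec (ε₃ a ≟ -[1+ 0 ])) (r3 k) (λ p → h (trans (cong r3 (sym e)) (trans (r3-* k k) p)))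

  θ̃-plus : ∀ n → m3 n ≡ 0F → θ̃ n ≡ θ n
  θ̃-plus n h = ΣZ-cong n (λ k → E-cong {k * k} {+ n} (λ e → trans (cong (_* sgᶻ k) (ε-square k n e h)) (ℤₚ.*-identityˡ (sgᶻ k))))

  θ̃-minus : ∀ n → m3 n ≢ 0F → θ̃ n ≡ - θ n
  θ̃-minus n h = trans (ΣZ-cong n (λ k → trans (E-cong {k * k} {+ n} (λ e → cong (_* sgᶻ k) (ε-nonsquare k n e h))) (ℤₚ.*-assoc -[1+ 0 ] (sgᶻ k) (E (k * k) (+ n)))))
    (trans (ΣZ-* n -[1+ 0 ] (λ k → sgᶻ k * E (k * k) (+ n))) (ℤₚ.-1*i≡-i (θ n)))

-- θ̃ arises from θ = A(x³) − 2x B(x³) by reversing the second sign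
θ̃-split : θ̃ ≈∞ v3 A ⊕ ((onePS ⊕ onePS) ⊗ (X ⊗ v3 B))
θ̃-split = every (three-cases
  (λ n → trans (θ̃-plus (n ℕ.* 3 ℕ.+ 0) (m3-block n 0)) (trans (split (n ℕ.* 3 ℕ.+ 0)) (cong₂ (λ x y → v3 A (n ℕ.* 3 ℕ.+ 0) + x) (trans (cong -_ (zero₀ n)) (sym (zero₀ n))) (zero₀ n))))
  (λ n → flip (n ℕ.* 3 ℕ.+ 1) (λ p → absurd₁ (trans (sym (m3-block n 1)) p)) (proj₁ (v3-off A n)))
  (λ n → flip (n ℕ.* 3 ℕ.+ 2) (λ p → absurd₂ (trans (sym (m3-block n 2)) p)) (proj₂ (v3-off A n))))
  where
  G = (onePS ⊕ onePS) ⊗ (X ⊗ v3 B)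
  split : ∀ m → θ m ≡ v3 A m - G m
  split m = exact (TowerIdentities.θ-split powerSeries) m
  zero₀ : ∀ n → G (n ℕ.* 3 ℕ.+ 0) ≡ + 0
  zero₀ n = trans (2⊗ (X ⊗ v3 B) (n ℕ.* 3 ℕ.+ 0)) (trans (cong (+ 2 *_) (trans (U-X₀ (v3 B) n) (⊗-zeroʳ X (λ i → proj₂ (v3-off B i)) n))) refl)
  flip : ∀ m → m3 m ≢ 0F → v3 A m ≡ + 0 → θ̃ m ≡ v3 A m + G m
  flip m h z = trans (θ̃-minus m h) (trans (cong -_ (split m)) (trans (cong (λ a → - (a - G m)) z) (trans (solve 1 (λ g → :- (con (+ 0) :- g) := con (+ 0) :+ g) refl (G m)) (cong (_+ G m) (sym z)))))
  absurd₁ : 1F ≢ 0F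
  absurd₁ ()
  absurd₂ : 2F ≢ 0F
  absurd₂ ()

-- `twisted-cube` gives the coefficients at x^(3M) of the twisted theta series times T; `θ̃-split`
-- identifies that section with the left side.
cubic : (A ⊗ U 0 T) ⊕ ((onePS ⊕ onePS) ⊗ (B ⊗ (X ⊗ U 2 T))) ≈∞ θ ⊗ (θ ⊗ θ)
cubic = every (λ n → trans (sym (section⁺ 0 T (s≤s z≤n) (U-X₀ T) n)) (trans (sym (exact (SplitProducts.plus PS∞ {θ̃} {v3 A} {v3 B} {X} {T} θ̃-split) (n ℕ.* 3 ℕ.+ 0)))
  (trans (cong (θ̃ ⊗ T) (ℕₚ.+-identityʳ (n ℕ.* 3))) (CubeIdentity.twisted-cube n))))

-- Taking every third coefficient undoes the substitution x ↦ x³.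
norm : ((A ⊗ A ⊗ A) ⊕ negPS ((onePS ⊕ onePS) ⊗ (onePS ⊕ onePS) ⊗ (onePS ⊕ onePS) ⊗ (X ⊗ (B ⊗ B ⊗ B)))) ⊗ A ≈∞ θ ⊗ (θ ⊗ θ ⊗ θ)
norm = every (λ n → trans (sym (U-v3 L n)) (trans (exact (NormAfterV.norm powerSeries) (n ℕ.* 3 ℕ.+ 0)) (U-v3 (θ ⊗ (θ ⊗ θ ⊗ θ)) n)))
  where
  L = ((A ⊗ A ⊗ A) ⊕ negPS ((onePS ⊕ onePS) ⊗ (onePS ⊕ onePS) ⊗ (onePS ⊕ onePS) ⊗ (X ⊗ (B ⊗ B ⊗ B)))) ⊗ A

open import Defs using (R)

private
  module Di = Dissection PS∞ X A B θ (U 0 F) (U 1 F) (U 2 F) (U 0 T) (U 2 T) (invPS θ) (invPS A) θ-inverse (invPS-inverse A refl)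

  F₀-quotient : U 0 F ≈∞ (P₃ ⊗ P₃ ⊗ Pm) ÷ (P ⊗ Pm₃ ⊗ Pm₃)
  F₀-quotient = UniqueQuotient.quotient PS∞ {P ⊗ Pm₃ ⊗ Pm₃} {invPS (P ⊗ Pm₃ ⊗ Pm₃)} {U 0 F} {P₃ ⊗ P₃ ⊗ Pm} (invPS-inverse (P ⊗ Pm₃ ⊗ Pm₃) refl)
    (Di.F₀-product system₀ system₁ system₂ cubic norm P Pm P₂ P₃ Pm₃ P₆ θPm APm₃ BPm PPm)

  F₁-quotient : U 1 F ≈∞ ((onePS ⊕ onePS) ⊗ (P₃ ⊗ P₆)) ÷ P
  F₁-quotient = UniqueQuotient.quotient PS∞ {P} {invPS P} {U 1 F} {(onePS ⊕ onePS) ⊗ (P₃ ⊗ P₆)} (invPS-inverse P refl)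
    (Di.F₁-product system₀ system₁ system₂ cubic norm P Pm P₂ P₃ Pm₃ P₆ θPm APm₃ BPm PPm)

  F₂-quotient : U 2 F ≈∞ (((onePS ⊕ onePS) ⊗ (onePS ⊕ onePS) ⊗ (Pm₃ ⊗ Pm₃ ⊗ P₆ ⊗ P₆)) ÷ P₂) ⊕ negPS (constPS (+ 6) ⊗ Pm₃ ÷ P₃ ⊗ bilatSum)
  F₂-quotient = Di.F₂-quotient system₀ system₁ system₂ cubic norm P Pm P₂ P₃ Pm₃ P₆ θPm APm₃ BPm PPm {constPS (+ 6)} {bilatSum} {invPS P₂} {invPS P₃}
    (every (λ n → trans (U₂-T n) (trans (sym (ℤₚ.neg-distribˡ-* (+ 6) (bilatSum n))) (cong -_ (sym (scalar-⊗ {constPS (+ 6)} (+ 6) bilatSum (λ _ → refl) n))))))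
    (invPS-inverse P₂ refl) (invPS-inverse P₃ refl)

  rank-section : ∀ d n {m} → n ℕ.* 3 ℕ.+ d ≡ suc m → R (+ 0) (+ 1) d n ≡ U d F n
  rank-section d n {m} e = trans (cong (λ z → + Nbar (+ 0) 3 z - + Nbar (+ 1) 3 z) (trans (cong (ℕ._+ d) (ℕₚ.*-comm 3 n)) e)) (trans (sym (F-rank m)) (cong F (sym e)))

theorem1p1 :
    (∀ (n : ℕ) → R (+ 0) (+ 1) 0 n
        ≡ (constPS -[1+ 0 ]
           ⊕ (poch (+ 1) 3 3 ⊗ poch (+ 1) 3 3 ⊗ poch -[1+ 0 ] 1 1)
             ÷ (poch (+ 1) 1 1 ⊗ poch -[1+ 0 ] 3 3 ⊗ poch -[1+ 0 ] 3 3)) n)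
    × (∀ (n : ℕ) → R (+ 0) (+ 1) 1 n
        ≡ ((+ 2) · (poch (+ 1) 3 3 ⊗ poch (+ 1) 6 6) ÷ poch (+ 1) 1 1) n)
    × (∀ (n : ℕ) → R (+ 0) (+ 1) 2 n
        ≡ ((+ 4) · (poch -[1+ 0 ] 3 3 ⊗ poch -[1+ 0 ] 3 3 ⊗ poch (+ 1) 6 6 ⊗ poch (+ 1) 6 6)
             ÷ poch (+ 1) 2 2
           ⊖ ((+ 6) · poch -[1+ 0 ] 3 3 ÷ poch (+ 1) 3 3) ⊗ bilatSum) n)
theorem1p1 = part₀ , part₁ , part₂
  where
  part₀ : ∀ n → R (+ 0) (+ 1) 0 n ≡ (constPS -[1+ 0 ] ⊕ (P₃ ⊗ P₃ ⊗ Pm) ÷ (P ⊗ Pm₃ ⊗ Pm₃)) n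
  -- F has constant term 1 while the empty overpartition is not counted; this is the -1 of the
  -- statement.
  part₀ zero = cong (λ z → -[1+ 0 ] + z) (exact F₀-quotient 0)
  part₀ (suc n) = trans (rank-section 0 (suc n) refl) (trans (exact F₀-quotient (suc n)) (sym (ℤₚ.+-identityˡ (((P₃ ⊗ P₃ ⊗ Pm) ÷ (P ⊗ Pm₃ ⊗ Pm₃)) (suc n)))))
  part₁ : ∀ n → R (+ 0) (+ 1) 1 n ≡ ((+ 2) · (P₃ ⊗ P₆) ÷ P) n
  part₁ n = trans (rank-section 1 n (ℕₚ.+-comm (n ℕ.* 3) 1)) (trans (exact F₁-quotient n) (⊗-cong≗ {g = invPS P} (2⊗ (P₃ ⊗ P₆)) (λ _ → refl) n))
  part₂ : ∀ n → R (+ 0) (+ 1) 2 n ≡ ((+ 4) · (Pm₃ ⊗ Pm₃ ⊗ P₆ ⊗ P₆) ÷ P₂ ⊖ ((+ 6) · Pm₃ ÷ P₃) ⊗ bilatSum) n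
  part₂ n = trans (rank-section 2 n (ℕₚ.+-comm (n ℕ.* 3) 2)) (trans (exact F₂-quotient n) (cong₂ _-_
    (⊗-cong≗ {g = invPS P₂} (scalar-⊗ {(onePS ⊕ onePS) ⊗ (onePS ⊕ onePS)} (+ 4) (Pm₃ ⊗ Pm₃ ⊗ P₆ ⊗ P₆) four) (λ _ → refl) n)
    (⊗-cong≗ {g = bilatSum} (⊗-cong≗ {g = invPS P₃} (scalar-⊗ {constPS (+ 6)} (+ 6) Pm₃ (λ _ → refl)) (λ _ → refl)) (λ _ → refl) n)))
    where
    four : (onePS ⊕ onePS) ⊗ (onePS ⊕ onePS) ≗ constPS (+ 4)
    four m = trans (2⊗ (onePS ⊕ onePS) m) (trans (cong (+ 2 *_) (two m)) (value m))
      where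
      value : ∀ m → + 2 * constPS (+ 2) m ≡ constPS (+ 4) m
      value zero = refl
      value (suc m) = refl
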